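{- Let $q$ be a power of the prime $p$ and $m\ge 1$. Let $\mathrm{U}_m(q)\le \mathrm{GL}_m(q^2)$ be the isometry group of a non-degenerate unitary (Hermitian) form on $V=\mathbb{F}_{q^2}^m$, and let $\mathrm{AU}_m(q)=V\rtimes \mathrm{U}_m(q)$ act on $V$ via $u\mapsto ua+v$. Then the proportion of elements of $\mathrm{AU}_m(q)$ that are derangements of $p$-power order is $$\frac{1}{q^m(q+1)}\sum_{i=1}^m\frac{(-1)^i\left((-q)^{i+1}-1\right)}{(-q)^{i(i+1)/2}\,(-1/q)_{m-i}}.$$
   Context: A derangement is an element with no fixed points on $V$. For a non-negative integer $j$ and an indeterminate (or number) $x$, $(x)_0=1$ and $(x)_j=\prod_{i=1}^j(1-x^i)$ for $j\ge1$. -}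

module Defs where

open import Level using (Level; _⊔_)
open import Data.Nat as ℕ using (ℕ)
open import Data.Nat.Base using (zero; suc)
open import Data.Integer as ℤ using (ℤ)
open import Data.Fin as Fin using (Fin)
open import Data.List using (List; length)
open import Data.List.Relation.Unary.All using (All)
open import Data.List.Relation.Unary.Any using (Any)
open import Data.List.Relation.Unary.AllPairs using (AllPairs)
open import Data.Product using (Σ; ∃; _×_; _,_)
open import Data.Unit using (⊤)
open import Data.Rational as ℚ using (ℚ; 0ℚ; 1ℚ)
import Data.Rational.Properties as ℚP
open import Relation.Nullary using (¬_; yes; no)
open import Relation.Binary.PropositionalEquality using (_≡_)
open import Algebra.Bundles using (CommutativeRing)
open import Data.Nat.Primality using (Prime)

HasCard : ∀ {a ℓ p} (A : Set a) (_~_ : A → A → Set ℓ) (P : A → Set p) (n : ℕ) → Set (a ⊔ ℓ ⊔ p)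
HasCard A _~_ P n =
  Σ (List A) λ L →
    (length L ≡ n) × All P L × (∀ x → P x → Any (x ~_) L)
      × AllPairs (λ x y → ¬ (x ~ y)) L

IsPowerOf : ℕ → ℕ → Set
IsPowerOf q p = ∃ λ e → (1 ℕ.≤ e) × (q ≡ p ℕ.^ e)

module _ {c ℓ} (F : CommutativeRing c ℓ) where
  open CommutativeRing F using (Carrier; _≈_; _+_; _*_; 0#; 1#)

  IsField : Set (c ⊔ ℓ)
  IsField = (¬ (1# ≈ 0#)) × (∀ x → ¬ (x ≈ 0#) → ∃ λ y → (x * y) ≈ 1#)

  IsFiniteFieldOfSize : ℕ → Set (c ⊔ ℓ)
  IsFiniteFieldOfSize n = IsField × HasCard Carrier _≈_ (λ _ → ⊤) n

  pow : Carrier → ℕ → Carrier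
  pow x zero = 1#
  pow x (suc k) = pow x k * x

  sumF : ∀ {n} → (Fin n → Carrier) → Carrier
  sumF {zero} f = 0#
  sumF {ℕ.suc n} f = f Fin.zero + sumF (λ i → f (Fin.suc i))

  Vec' : ℕ → Set c
  Vec' m = Fin m → Carrier

  Mat : ℕ → Set c
  Mat m = Fin m → Fin m → Carrier

  _≈V_ : ∀ {m} → Vec' m → Vec' m → Set ℓ
  u ≈V v = ∀ i → u i ≈ v i

  _≈M_ : ∀ {m} → Mat m → Mat m → Set ℓ
  A ≈M B = ∀ i j → A i j ≈ B i j

  zeroV : ∀ {m} → Vec' m
  zeroV _ = 0#

  _+V_ : ∀ {m} → Vec' m → Vec' m → Vec' m
  (u +V v) i = u i + v i

  _·M_ : ∀ {m} → Vec' m → Mat m → Vec' m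
  (u ·M A) j = sumF (λ i → u i * A i j)

  _*M_ : ∀ {m} → Mat m → Mat m → Mat m
  (A *M B) i k = sumF (λ j → A i j * B j k)

  idM : ∀ {m} → Mat m
  idM i j with i Fin.≟ j
  ... | yes _ = 1#
  ... | no _  = 0#

  IsInvertible : ∀ {m} → Mat m → Set (c ⊔ ℓ)
  IsInvertible {m} A = ∃ λ (B : Mat m) → ((A *M B) ≈M idM) × ((B *M A) ≈M idM)

  -- Unitary (Hermitian) forms over a field of order q², with the
  -- involutive field automorphism σ(x) = x^q.
  module Unitary (q : ℕ) where

    σ : Carrier → Carrier
    σ x = pow x q

    Form : ℕ → Set c
    Form m = Vec' m → Vec' m → Carrier

    IsNondegHermitian : ∀ {m} → Form m → Set (c ⊔ ℓ)
    IsNondegHermitian {m} B =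
      (∀ u u' v → B (u +V u') v ≈ (B u v + B u' v))
      × (∀ (a : Carrier) u v → B (λ i → a * u i) v ≈ (a * B u v))
      × (∀ u v → B v u ≈ σ (B u v))
      × (∀ u u' v v' → u ≈V u' → v ≈V v' → B u v ≈ B u' v')
      × (∀ u → (∀ v → B u v ≈ 0#) → u ≈V zeroV)

    IsUnitary : ∀ {m} → Form m → Mat m → Set (c ⊔ ℓ)
    IsUnitary B A = IsInvertible A × (∀ u v → B (u ·M A) (v ·M A) ≈ B u v)

    AffElt : ℕ → Set c
    AffElt m = Mat m × Vec' m

    _≈A_ : ∀ {m} → AffElt m → AffElt m → Set ℓ
    (A , v) ≈A (A' , v') = (A ≈M A') × (v ≈V v')

    act : ∀ {m} → AffElt m → Vec' m → Vec' m
    act (A , v) u = (u ·M A) +V v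

    -- composition: first g then h
    _∘A_ : ∀ {m} → AffElt m → AffElt m → AffElt m
    (A , v) ∘A (A' , v') = (A *M A') , ((v ·M A') +V v')

    idA : ∀ {m} → AffElt m
    idA = idM , zeroV

    powA : ∀ {m} → AffElt m → ℕ → AffElt m
    powA g zero = idA
    powA g (suc k) = powA g k ∘A g

    InAU : ∀ {m} → Form m → AffElt m → Set (c ⊔ ℓ)
    InAU B (A , v) = IsUnitary B A

    IsDerangement : ∀ {m} → AffElt m → Set (c ⊔ ℓ)
    IsDerangement {m} g = ∀ (u : Vec' m) → ¬ (act g u ≈V u)

    HasPPowerOrder : ∀ {m} → ℕ → AffElt m → Set ℓ
    HasPPowerOrder p g = ∃ λ k → powA g (p ℕ.^ k) ≈A idA

-- total division (x ÷ 0 := 0); only ever used with nonzero divisors here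
_÷'_ : ℚ → ℚ → ℚ
x ÷' y with y ℚP.≟ 0ℚ
... | yes _ = 0ℚ
... | no y≢0 = ℚ._÷_ x y {{ℚ.≢-nonZero y≢0}}

powQ : ℚ → ℕ → ℚ
powQ x zero = 1ℚ
powQ x (suc k) = powQ x k ℚ.* x

qPoch : ℚ → ℕ → ℚ
qPoch x zero = 1ℚ
qPoch x (suc j) = qPoch x j ℚ.* (1ℚ ℚ.- powQ x (suc j))

sumQ1 : ℕ → (ℕ → ℚ) → ℚ
sumQ1 zero f = 0ℚ
sumQ1 (suc m) f = sumQ1 m f ℚ.+ f (suc m)

fromℕ : ℕ → ℚ
fromℕ n = ℤ.+ n ℚ./ 1

formula : ℕ → ℕ → ℚ
formula q m =
  (1ℚ ÷' (powQ Q m ℚ.* (Q ℚ.+ 1ℚ))) ℚ.*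
  sumQ1 m (λ i →
    (powQ (ℚ.- 1ℚ) i ℚ.* (powQ (ℚ.- Q) (suc i) ℚ.- 1ℚ))
    ÷' (powQ (ℚ.- Q) ((i ℕ.* suc i) ℕ./ 2)
          ℚ.* qPoch (ℚ.- (1ℚ ÷' Q)) (m ℕ.∸ i)))
  where Q = fromℕ q

module Submission where

-- An affine map (A , v) has p-power order iff A has, and it is a derangement iff v ∉ im (A - 1).  As
-- |im (A - 1)| = q^{2m} / |Fix A|, the proportion is the sum of 1 - 1 / |Fix A| over the A of p-power order,
-- divided by |U_m(q)|, so everything rests on the distribution of |Fix A|.
--
-- If m ≥ 1, such an A fixes nonzero vectors.  Count pairs (A , v) with A v = v ≠ 0 by v.  If v is
-- nonisotropic, A is an element of p-power order of U(v^⊥).  If v is isotropic with hyperbolic partner f, A is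
-- uniquely an element of U(⟨v , f⟩^⊥) followed by a Siegel transformation, and |Fix A| follows from linear algebra.
-- This gives, for every test function φ, a recurrence in m for the sum of (|Fix A| - 1) φ(|Fix A|), which determines
-- the distribution.  With t = -1/q the recurrence is solved by an explicit q-series; for φ(x) = 1 - 1/x
-- the q-binomial theorem collapses it to the stated sum.

open import Data.Nat as ℕ using (ℕ; zero; suc)
open import Data.Integer as ℤ using (ℤ; -[1+_])
import Data.Nat.Properties as ℕP
import Data.Integer.Properties as ℤP
open import Data.Maybe using (Maybe; just; nothing)
open import Relation.Nullary using (yes; no; ¬_; Dec)
open import Relation.Binary.PropositionalEquality hiding (isEquivalence)
open import Algebra.Bundles using (CommutativeRing; CommutativeMonoid; RawRing)
open import Algebra.Structures using (IsCommutativeRing; IsCommutativeMonoid)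
import Algebra.Properties.Ring
import Algebra.Properties.Semiring.Mult.TCOptimised
import Algebra.Solver.Ring
import Algebra.Solver.Ring.AlmostCommutativeRing as ACR
open import Defs
open import Level using (Level; 0ℓ)
import Data.Nat.Coprimality as Coprime
open import Data.Rational as ℚ using (mkℚ; ℚ; 0ℚ; 1ℚ; _≤_)
import Data.Rational.Properties as ℚP
open import Data.List using (List; []; _∷_; length; map; concatMap; deduplicate; filter; foldr; replicate; lookup; allFin)
open import Data.List.Relation.Unary.All as All using (All; []; _∷_)
open import Data.List.Relation.Unary.Any as Any using (Any; here; there)
open import Data.List.Relation.Unary.AllPairs as AllPairs using (AllPairs; []; _∷_)
import Data.List.Relation.Unary.Any.Properties as AnyP
import Data.List.Relation.Unary.All.Properties as AllP
import Data.List.Membership.Setoid.Properties as MemP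
import Data.List.Relation.Unary.Unique.DecSetoid.Properties as UniqueDecP
open import Data.Product using (∃; _×_; _,_; proj₁; proj₂)
open import Data.Empty using (⊥-elim)
open import Relation.Nullary.Decidable using (_×-dec_; ¬?; _→-dec_; map′; decidable-stable)
open import Relation.Binary.Bundles using (DecSetoid)
open import Relation.Binary.Structures using (IsEquivalence)
import Data.Nat.DivMod as ℕD
import Data.Nat.Divisibility as ℕDiv
import Data.Nat.Tactic.RingSolver as ℕSolver
open import Data.Nat.Primality using (Prime; euclidsLemma; prime⇒nonZero; prime⇒nonTrivial)
import Data.List.Properties as ListP
import Data.List.Relation.Unary.AllPairs.Properties as AllPairsP
import Data.List.Relation.Unary.Unique.Propositional.Properties as UniqueP
open import Data.List.Membership.Propositional using (_∈_)
open import Data.List.Membership.Propositional.Properties using (∈-map⁺; ∈-allFin)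
open import Data.List.Membership.Propositional.Properties.WithK using (unique∧set⇒bag)
open import Data.List.Relation.Binary.BagAndSetEquality using (∼bag⇒↭)
import Data.List.Relation.Binary.Permutation.Setoid.Properties as PermS
open import Data.List.Relation.Binary.Permutation.Propositional using (_↭_; ↭⇒↭ₛ)
open import Data.Sum using (inj₁; inj₂)
open import Function.Bundles using (mk⇔)
import Relation.Binary.PropositionalEquality as ≡
import Algebra.Properties.CommutativeMonoid.Mult
import Algebra.Definitions.RawMonoid
open import Data.Fin as Fin using (Fin)
import Data.Fin.Properties as FinP
open import Data.Vec as Vec using (Vec)
import Data.Vec.Properties as VecP
open import Data.Unit using (tt)
import Algebra.Morphism.RingMonomorphism as RingMono
open import Algebra.Morphism.Structures using (IsRingMonomorphism)
import Relation.Binary.Reasoning.Setoid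

-- The recurrence links rank m to ranks m - 1 and m - 2 and changes the test function on the way, so
-- an induction about φ(x) = 1 - 1/x alone would not close; all φ are treated at once. It only sees
-- (|Fix A| - 1) φ(|Fix A|). In positive rank |Fix A| ≠ 1, so every test function has this form, and
-- the q-series must match by giving dimension 0 no weight.
--
-- The geometry avoids bases and dimensions: a subspace is a decidable subset measured by double
-- counting, and vectors are compared by pairing them with all vectors, which leaves identities of
-- scalars. The groups of the subspaces W met in the induction all consist of maps of the one space
-- V, so the stabilizer of v in the group of W is literally the group of W ∩ v^⊥ and no map is
-- restricted or extended. Having p-power order is made decidable by a bound: in rank m the p^m-th
-- power is the identity.
--
-- The parameter -q in place of q absorbs the signs (-1)^m in the numbers of isotropic and of unit
-- vectors of a unitary space.

-- Polynomial identities over commutative rings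

module IntegerSolver {A : Set} (add mul : A → A → A) (neg : A → A) (z o : A)
  (isCR : IsCommutativeRing _≡_ add mul neg z o) where

  ring : CommutativeRing _ _
  ring = record { isCommutativeRing = isCR }

  open CommutativeRing ring hiding (ring; sym; trans; refl; setoid; isEquivalence)
  open Algebra.Properties.Ring (CommutativeRing.ring ring)
  open Algebra.Properties.Semiring.Mult.TCOptimised semiring renaming (_×_ to infixl 8 _×#_)
  open ≡-Reasoning

  -- The canonical homomorphism from the integers. Coefficients are compared before they are
  -- embedded, so the same normalisation serves the rationals and a field of positive
  -- characteristic.
  embed : ℤ → A
  embed (ℤ.+ n) = n ×# 1#
  embed (-[1+ n ]) = - (suc n ×# 1#)

  embed-⊖ : ∀ m n → embed (m ℤ.⊖ n) ≡ m ×# 1# + - (n ×# 1#)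
  embed-⊖ m zero = begin
    m ×# 1# ≡⟨ sym (+-identityʳ _) ⟩
    m ×# 1# + 0# ≡⟨ cong (λ w → m ×# 1# + w) (sym -0#≈0#) ⟩
    m ×# 1# + - 0# ∎
  embed-⊖ zero (suc n) = sym (+-identityˡ _)
  embed-⊖ (suc m) (suc n) = begin
    embed (suc m ℤ.⊖ suc n) ≡⟨ cong embed (ℤP.[1+m]⊖[1+n]≡m⊖n m n) ⟩
    embed (m ℤ.⊖ n) ≡⟨ embed-⊖ m n ⟩
    m ×# 1# + - (n ×# 1#) ≡⟨ cong (_+ - (n ×# 1#)) (sym (+-identityˡ _)) ⟩
    0# + m ×# 1# + - (n ×# 1#) ≡⟨ cong (λ w → w + m ×# 1# + - (n ×# 1#)) (sym (-‿inverseʳ 1#)) ⟩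
    1# + - 1# + m ×# 1# + - (n ×# 1#) ≡⟨ cong (_+ - (n ×# 1#)) (+-assoc _ _ _) ⟩
    1# + (- 1# + m ×# 1#) + - (n ×# 1#) ≡⟨ cong (λ w → 1# + w + - (n ×# 1#)) (+-comm _ _) ⟩
    1# + (m ×# 1# + - 1#) + - (n ×# 1#) ≡⟨ cong (_+ - (n ×# 1#)) (sym (+-assoc _ _ _)) ⟩
    1# + m ×# 1# + - 1# + - (n ×# 1#) ≡⟨ +-assoc _ _ _ ⟩
    1# + m ×# 1# + (- 1# + - (n ×# 1#)) ≡⟨ cong₂ _+_ (sym (1+× m 1#)) (-‿+-comm 1# (n ×# 1#)) ⟩
    suc m ×# 1# + - (1# + n ×# 1#) ≡⟨ cong (λ w → suc m ×# 1# + - w) (sym (1+× n 1#)) ⟩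
    suc m ×# 1# + - (suc n ×# 1#) ∎

  embed-neg : ∀ i → embed (ℤ.- i) ≡ - embed i
  embed-neg (ℤ.+ zero) = sym -0#≈0#
  embed-neg (ℤ.+ suc n) = refl
  embed-neg (-[1+ n ]) = sym (-‿involutive _)

  embed-+ : ∀ i j → embed (i ℤ.+ j) ≡ embed i + embed j
  embed-+ (ℤ.+ m) (ℤ.+ n) = ×-homo-+ 1# m n
  embed-+ (ℤ.+ m) -[1+ n ] = embed-⊖ m (suc n)
  embed-+ -[1+ m ] (ℤ.+ n) = trans (embed-⊖ n (suc m)) (+-comm _ _)
  embed-+ -[1+ m ] -[1+ n ] = begin
    - (suc (suc (m ℕ.+ n)) ×# 1#) ≡⟨ cong (λ k → - (suc k ×# 1#)) (sym (ℕP.+-suc m n)) ⟩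
    - ((suc m ℕ.+ suc n) ×# 1#) ≡⟨ cong -_ (×-homo-+ 1# (suc m) (suc n)) ⟩
    - (suc m ×# 1# + suc n ×# 1#) ≡⟨ sym (-‿+-comm _ _) ⟩
    - (suc m ×# 1#) + - (suc n ×# 1#) ∎

  embed-*⁺ : ∀ m j → embed (ℤ.+ m ℤ.* j) ≡ m ×# 1# * embed j
  embed-*⁺ m (ℤ.+ n) = trans (cong embed (sym (ℤP.pos-* m n))) (×1-homo-* m n)
  embed-*⁺ m -[1+ n ] = begin
    embed (ℤ.+ m ℤ.* -[1+ n ]) ≡⟨ cong embed (sym (ℤP.neg-distribʳ-* (ℤ.+ m) (ℤ.+ suc n))) ⟩
    embed (ℤ.- (ℤ.+ m ℤ.* ℤ.+ suc n)) ≡⟨ embed-neg (ℤ.+ m ℤ.* ℤ.+ suc n) ⟩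
    - embed (ℤ.+ m ℤ.* ℤ.+ suc n) ≡⟨ cong -_ (embed-*⁺ m (ℤ.+ suc n)) ⟩
    - (m ×# 1# * suc n ×# 1#) ≡⟨ -‿distribʳ-* _ _ ⟩
    m ×# 1# * - (suc n ×# 1#) ∎

  embed-* : ∀ i j → embed (i ℤ.* j) ≡ embed i * embed j
  embed-* (ℤ.+ m) j = embed-*⁺ m j
  embed-* -[1+ m ] j = begin
    embed (-[1+ m ] ℤ.* j) ≡⟨ cong embed (sym (ℤP.neg-distribˡ-* (ℤ.+ suc m) j)) ⟩
    embed (ℤ.- (ℤ.+ suc m ℤ.* j)) ≡⟨ embed-neg (ℤ.+ suc m ℤ.* j) ⟩
    - embed (ℤ.+ suc m ℤ.* j) ≡⟨ cong -_ (embed-*⁺ (suc m) j) ⟩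
    - (suc m ×# 1# * embed j) ≡⟨ -‿distribˡ-* _ _ ⟩
    - (suc m ×# 1#) * embed j ∎

  private
    morphism : ℤ.+-*-rawRing ACR.-Raw-AlmostCommutative⟶ ACR.fromCommutativeRing ring
    morphism = record
      { ⟦_⟧ = embed ; +-homo = embed-+ ; *-homo = embed-* ; -‿homo = embed-neg
      ; 0-homo = refl ; 1-homo = refl }

    _coeff≟_ : ∀ i j → Maybe (embed i ≡ embed j)
    i coeff≟ j with i ℤ.≟ j
    ... | yes p = just (cong embed p)
    ... | no _ = nothing

  open Algebra.Solver.Ring _ _ morphism _coeff≟_ public

  κ : ∀ {n} → ℕ → Polynomial n
  κ k = con (ℤ.+ k)

  private
    infixl 6 _⊕_
    infixl 7 _⊗_
    _⊕_ _⊗_ : A → A → A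
    _⊕_ = add
    _⊗_ = mul

  -- Derive x ≡ y as a linear combination of given equations; the last argument is a ring identity for the solver.
  linear₁ : ∀ {x y} c {a b} → a ≡ b → x ⊕ c ⊗ b ≡ y ⊕ c ⊗ a → x ≡ y
  linear₁ {x} {y} c {a} refl e = +-cancelʳ (c ⊗ a) x y e

  linear₂ : ∀ {x y} c {a b} → a ≡ b → ∀ c′ {a′ b′} → a′ ≡ b′ →
    x ⊕ c ⊗ b ⊕ c′ ⊗ b′ ≡ y ⊕ c ⊗ a ⊕ c′ ⊗ a′ → x ≡ y
  linear₂ c p c′ p′ e = linear₁ c p (linear₁ c′ p′ e)

  linear₃ : ∀ {x y} c {a b} → a ≡ b → ∀ c′ {a′ b′} → a′ ≡ b′ → ∀ c″ {a″ b″} → a″ ≡ b″ →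
    x ⊕ c ⊗ b ⊕ c′ ⊗ b′ ⊕ c″ ⊗ b″ ≡ y ⊕ c ⊗ a ⊕ c′ ⊗ a′ ⊕ c″ ⊗ a″ → x ≡ y
  linear₃ c p c′ p′ c″ p″ e = linear₂ c p c′ p′ (linear₁ c″ p″ e)

-- Rational arithmetic

-- The operations are opaque because unification can otherwise unfold them into integer arithmetic.
module Rat where

  fromℕ-mkℚ : ∀ n → fromℕ n ≡ mkℚ (ℤ.+ n) 0 (Coprime.sym (Coprime.1-coprimeTo n))
  fromℕ-mkℚ n = ℚP.normalize-coprime _

  opaque
    infixl 6 _+_
    infixl 7 _*_
    infix 8 -_
    _+_ _*_ : ℚ → ℚ → ℚ
    _+_ = ℚ._+_
    _*_ = ℚ._*_
    -_ : ℚ → ℚ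
    -_ = ℚ.-_
    ι : ℕ → ℚ
    ι = fromℕ

  opaque
    unfolding _+_

    +-*-isCommutativeRing : IsCommutativeRing _≡_ _+_ _*_ -_ 0ℚ 1ℚ
    +-*-isCommutativeRing = ℚP.+-*-isCommutativeRing

    +-unfold : ∀ x y → x ℚ.+ y ≡ x + y
    +-unfold x y = refl

    *-unfold : ∀ x y → x ℚ.* y ≡ x * y
    *-unfold x y = refl

    neg-unfold : ∀ x → ℚ.- x ≡ - x
    neg-unfold x = refl

    minus-unfold : ∀ x y → x ℚ.- y ≡ x + (- y)
    minus-unfold x y = refl

    ι-unfold : ∀ n → fromℕ n ≡ ι n
    ι-unfold n = refl

    ι-0 : ι 0 ≡ 0ℚ
    ι-0 = refl

    ι-1 : ι 1 ≡ 1ℚ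
    ι-1 = refl

    ι-+ : ∀ m n → ι (m ℕ.+ n) ≡ ι m + ι n
    ι-+ m n = sym (trans (cong₂ ℚ._+_ (fromℕ-mkℚ m) (fromℕ-mkℚ n))
      (ℚP./-cong {q₁ = 1} (cong₂ ℤ._+_ (ℤP.*-identityʳ (ℤ.+ m)) (ℤP.*-identityʳ (ℤ.+ n))) refl))

    ι-* : ∀ m n → ι (m ℕ.* n) ≡ ι m * ι n
    ι-* m n = sym (trans (cong₂ ℚ._*_ (fromℕ-mkℚ m) (fromℕ-mkℚ n))
      (ℚP./-cong {q₁ = 1} (sym (ℤP.pos-* m n)) refl))

    +-mono-≤ : ∀ {x y u v} → x ≤ y → u ≤ v → x + u ≤ y + v
    +-mono-≤ = ℚP.+-mono-≤

    *-monoʳ-≤ : ∀ {x y z} → 0ℚ ≤ z → x ≤ y → x * z ≤ y * z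
    *-monoʳ-≤ {z = z} 0≤z x≤y = ℚP.*-monoʳ-≤-nonNeg z {{ℚ.nonNegative 0≤z}} x≤y

    inverseOf : ∀ x → x ≢ 0ℚ → ∃ λ y → x * y ≡ 1ℚ
    inverseOf x x≢0 = ℚ.1/_ x {{ℚ.≢-nonZero x≢0}} , ℚP.*-inverseʳ x {{ℚ.≢-nonZero x≢0}}

    ÷-inverseOf : ∀ x y (y≢0 : y ≢ 0ℚ) → x ÷' y ≡ x * proj₁ (inverseOf y y≢0)
    ÷-inverseOf x y y≢0 with y ℚP.≟ 0ℚ
    ... | yes e = ⊥-elim (y≢0 e)
    ... | no _ = refl

  infixl 6 _-_
  _-_ : ℚ → ℚ → ℚ
  x - y = x + - y

  module ℚS = IntegerSolver _+_ _*_ -_ 0ℚ 1ℚ +-*-isCommutativeRing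
  open IsCommutativeRing +-*-isCommutativeRing public
    using (+-assoc; +-comm; +-identityˡ; +-identityʳ; *-assoc; *-comm; *-identityˡ; *-identityʳ; zeroˡ; zeroʳ; distribˡ; distribʳ; -‿inverseʳ)

  0≤1 : 0ℚ ≤ 1ℚ
  0≤1 = ℚP.nonNegative⁻¹ 1ℚ

  infixl 7 _÷_
  -- Set to 0 at 0, so that it can occur in a formula without a proof that its argument is nonzero.
  inv : ℚ → ℚ
  inv x with x ℚP.≟ 0ℚ
  ... | yes _ = 0ℚ
  ... | no x≢0 = proj₁ (inverseOf x x≢0)

  _÷_ : ℚ → ℚ → ℚ
  x ÷ y = x * inv y

  inv-inverseʳ : ∀ {x} → x ≢ 0ℚ → x * inv x ≡ 1ℚ
  inv-inverseʳ {x} x≢0 with x ℚP.≟ 0ℚ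
  ... | yes e = ⊥-elim (x≢0 e)
  ... | no x≢0 = proj₂ (inverseOf x x≢0)

  *-cancelˡ : ∀ {x} → x ≢ 0ℚ → ∀ {y z} → x * y ≡ x * z → y ≡ z
  *-cancelˡ {x} x≢0 {y} {z} e = ℚS.linear₃ (- y) (inv-inverseʳ x≢0) (inv x) e z (inv-inverseʳ x≢0)
    (ℚS.solve 4 (λ x i y z → y :+ :- y :* κ 1 :+ i :* (x :* z) :+ z :* κ 1
                          := z :+ :- y :* (x :* i) :+ i :* (x :* y) :+ z :* (x :* i)) refl x (inv x) y z)
    where
    open ℚS using (_:+_; _:*_; :-_; _:=_; κ)

  *-≢0 : ∀ {x y} → x ≢ 0ℚ → y ≢ 0ℚ → x * y ≢ 0ℚ
  *-≢0 x≢0 y≢0 e = y≢0 (*-cancelˡ x≢0 (trans e (sym (zeroʳ _))))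

  inv-unique : ∀ {x y} → x * y ≡ 1ℚ → y ≡ inv x
  inv-unique {x} {y} e = *-cancelˡ x≢0 (trans e (sym (inv-inverseʳ x≢0)))
    where
    x≢0 : x ≢ 0ℚ
    x≢0 refl with () ← trans (sym (zeroˡ y)) e

  ÷'-inv : ∀ x {y} → y ≢ 0ℚ → x ÷' y ≡ x * inv y
  ÷'-inv x {y} y≢0 = trans (÷-inverseOf x y y≢0) (cong (x *_) (inv-unique (proj₂ (inverseOf y y≢0))))

  ι-suc : ∀ n → ι (suc n) ≡ 1ℚ + ι n
  ι-suc n = trans (ι-+ 1 n) (cong (_+ ι n) ι-1)

  0≤ι : ∀ n → 0ℚ ≤ ι n
  0≤ι zero = ℚP.≤-reflexive (sym ι-0)
  0≤ι (suc n) = subst₂ _≤_ (+-identityʳ _) (sym (ι-suc n)) (+-mono-≤ 0≤1 (0≤ι n))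

  1≤⇒≢0 : ∀ {x} → 1ℚ ≤ x → x ≢ 0ℚ
  1≤⇒≢0 1≤x refl = ℚP.<-irrefl refl (ℚP.<-≤-trans (ℚP.positive⁻¹ 1ℚ) 1≤x)

  1≤ι-suc : ∀ n → 1ℚ ≤ ι (suc n)
  1≤ι-suc n = subst₂ _≤_ (+-identityʳ _) (sym (ι-suc n)) (+-mono-≤ (ℚP.≤-refl {1ℚ}) (0≤ι n))

  ι-mono : ∀ {m n} → m ℕ.≤ n → ι m ≤ ι n
  ι-mono {m} {n} m≤n = subst (λ k → ι m ≤ ι k) (ℕP.m+[n∸m]≡n m≤n)
    (subst₂ _≤_ (+-identityʳ _) (sym (ι-+ m _)) (+-mono-≤ (ℚP.≤-refl {ι m}) (0≤ι (n ℕ.∸ m))))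

-- Finite sums, indicators and double counting

module Sums where

  open Rat
  open ≡-Reasoning

  private variable
    a b p r : Level
    A : Set a
    B : Set b
    P : Set p
    R : Set r

  𝟙 : Dec P → ℚ
  𝟙 (yes _) = 1ℚ
  𝟙 (no _) = 0ℚ

  𝟙-yes : (d : Dec P) → P → 𝟙 d ≡ 1ℚ
  𝟙-yes (yes _) _ = refl
  𝟙-yes (no ¬x) x = ⊥-elim (¬x x)

  𝟙-no : (d : Dec P) → ¬ P → 𝟙 d ≡ 0ℚ
  𝟙-no (yes x) ¬x = ⊥-elim (¬x x)
  𝟙-no (no _) _ = refl

  𝟙-cong : (d : Dec P) (e : Dec R) → (P → R) → (R → P) → 𝟙 d ≡ 𝟙 e
  𝟙-cong d (yes y) f g = 𝟙-yes d (g y)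
  𝟙-cong d (no ¬y) f g = 𝟙-no d (λ x → ¬y (f x))

  𝟙-× : (d : Dec P) (e : Dec R) → 𝟙 (d ×-dec e) ≡ 𝟙 d * 𝟙 e
  𝟙-× (yes x) (yes y) = sym (*-identityˡ _)
  𝟙-× (yes x) (no y) = sym (*-identityˡ _)
  𝟙-× (no x) (yes y) = sym (zeroˡ _)
  𝟙-× (no x) (no y) = sym (zeroˡ _)

  -- Where the indicator vanishes nothing has to be shown. This lets an identity that holds only on
  -- a subset be applied under a sum over the whole set.
  𝟙-guard : (d : Dec P) {x y : ℚ} → (P → x ≡ y) → 𝟙 d * x ≡ 𝟙 d * y
  𝟙-guard (yes p) h = cong (1ℚ *_) (h p)
  𝟙-guard (no _) {x} {y} h = trans (zeroˡ x) (sym (zeroˡ y))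

  𝟙-guard-cong : (d : Dec P) (e : Dec R) {x y : ℚ} → (P → R) → (R → P) → (P → x ≡ y) → 𝟙 d * x ≡ 𝟙 e * y
  𝟙-guard-cong d e {x} {y} f g h = trans (𝟙-guard d h) (cong (_* y) (𝟙-cong d e f g))

  0≤𝟙 : (d : Dec P) → 0ℚ ≤ 𝟙 d
  0≤𝟙 (yes _) = 0≤1
  0≤𝟙 (no _) = ℚP.≤-refl

  sumL : (A → ℚ) → List A → ℚ
  sumL f [] = 0ℚ
  sumL f (x ∷ xs) = f x + sumL f xs

  sumL-cong : {f g : A → ℚ} (xs : List A) → (∀ x → f x ≡ g x) → sumL f xs ≡ sumL g xs
  sumL-cong [] h = refl
  sumL-cong (x ∷ xs) h = cong₂ _+_ (h x) (sumL-cong xs h)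

  sumL-zero : {f : A → ℚ} {xs : List A} → All (λ x → f x ≡ 0ℚ) xs → sumL f xs ≡ 0ℚ
  sumL-zero [] = refl
  sumL-zero (h ∷ hs) = trans (cong₂ _+_ h (sumL-zero hs)) (+-identityʳ _)

  sumL-+ : (f g : A → ℚ) (xs : List A) → sumL (λ x → f x + g x) xs ≡ sumL f xs + sumL g xs
  sumL-+ f g [] = sym (+-identityʳ _)
  sumL-+ f g (x ∷ xs) = trans (cong (λ w → f x + g x + w) (sumL-+ f g xs))
    (ℚS.solve 4 (λ a b c d → a ℚS.:+ b ℚS.:+ (c ℚS.:+ d) ℚS.:= a ℚS.:+ c ℚS.:+ (b ℚS.:+ d)) refl _ _ _ _)

  sumL-*ˡ : (c : ℚ) (f : A → ℚ) (xs : List A) → sumL (λ x → c * f x) xs ≡ c * sumL f xs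
  sumL-*ˡ c f [] = sym (zeroʳ c)
  sumL-*ˡ c f (x ∷ xs) = trans (cong (λ w → c * f x + w) (sumL-*ˡ c f xs)) (sym (distribˡ c _ _))

  sumL-swap : (f : A → B → ℚ) (xs : List A) (ys : List B) →
    sumL (λ x → sumL (f x) ys) xs ≡ sumL (λ y → sumL (λ x → f x y) xs) ys
  sumL-swap f [] ys = sym (sumL-zero (All.universal (λ _ → refl) ys))
  sumL-swap f (x ∷ xs) ys = trans (cong (λ w → sumL (f x) ys + w) (sumL-swap f xs ys))
    (sym (sumL-+ (f x) _ ys))

  sumL-1 : (xs : List A) → sumL (λ _ → 1ℚ) xs ≡ ι (length xs)
  sumL-1 [] = sym ι-0
  sumL-1 (x ∷ xs) = trans (cong (λ w → 1ℚ + w) (sumL-1 xs)) (sym (ι-suc (length xs)))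

  sumL-≤ : {f g : A → ℚ} (xs : List A) → (∀ x → f x ≤ g x) → sumL f xs ≤ sumL g xs
  sumL-≤ [] h = ℚP.≤-refl
  sumL-≤ (x ∷ xs) h = +-mono-≤ (h x) (sumL-≤ xs h)

  sumL-𝟙-unique : {D : A → Set p} (D? : ∀ x → Dec (D x)) {xs : List A} →
    Any D xs → AllPairs (λ x y → ¬ (D x × D y)) xs → sumL (λ x → 𝟙 (D? x)) xs ≡ 1ℚ
  sumL-𝟙-unique D? (here d) (n ∷ _) = trans (cong₂ _+_ (𝟙-yes (D? _) d) (sumL-zero (All.map (λ nd → 𝟙-no (D? _) (λ e → nd (d , e))) n))) (+-identityʳ _)
  sumL-𝟙-unique {D = D} D? {x ∷ xs} (there i) (n ∷ ns) = trans (cong₂ _+_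
    (𝟙-no (D? x) (λ d → All.lookupWith (λ nd e → nd (d , e)) n i))
    (sumL-𝟙-unique D? i ns)) (+-identityˡ _)

  Exhausts : (_~_ : A → A → Set r) → List A → Set _
  Exhausts _~_ xs = ∀ x → Any (x ~_) xs

  update : (_≟_ : ∀ (x y : A) → Dec (x ≡ y)) → A → B → (A → B) → A → B
  update _≟_ x y f z with z ≟ x
  ... | yes _ = y
  ... | no _ = f z

  -- Starts from the constant function `d` and overwrites one argument at a time. Once `xs` exhausts
  -- the domain the default `d` is no longer visible.
  allFunctions : (_≟_ : ∀ (x y : A) → Dec (x ≡ y)) → List A → B → List B → List (A → B)
  allFunctions _≟_ [] d ys = (λ _ → d) ∷ []
  allFunctions _≟_ (x ∷ xs) d ys = concatMap (λ y → map (update _≟_ x y) (allFunctions _≟_ xs d ys)) ys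

  update-agrees : (_≟_ : ∀ (x y : A) → Dec (x ≡ y)) {x : A} {xs : List A} {y : B} {f g : A → B} → f x ≡ y →
    All (λ z → f z ≡ g z) xs → All (λ z → f z ≡ update _≟_ x y g z) (x ∷ xs)
  update-agrees _≟_ {x} {y = y} {f} {g} e h = here-eq ∷ All.map there-eq h
    where
    here-eq : f x ≡ update _≟_ x y g x
    here-eq with x ≟ x
    ... | yes _ = e
    ... | no x≢x = ⊥-elim (x≢x refl)
    there-eq : ∀ {z} → f z ≡ g z → f z ≡ update _≟_ x y g z
    there-eq {z} h with z ≟ x
    ... | yes refl = e
    ... | no _ = h

  allFunctions-complete : (_≟_ : ∀ (x y : A) → Dec (x ≡ y)) (xs : List A) (d : B) (ys : List B) →
    Exhausts _≡_ ys → (f : A → B) →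
    Any (λ g → All (λ x → f x ≡ g x) xs) (allFunctions _≟_ xs d ys)
  allFunctions-complete _≟_ [] d ys ex f = here []
  allFunctions-complete _≟_ (x ∷ xs) d ys ex f = AnyP.concatMap⁺ _
    (Any.map (λ e → AnyP.map⁺ (Any.map (update-agrees _≟_ e) (allFunctions-complete _≟_ xs d ys ex f))) (ex (f x)))

  record FinSet : Set₁ where
    field
      Carrier : Set
      _~_ : Carrier → Carrier → Set
      isEquivalence : IsEquivalence _~_
      _~?_ : ∀ x y → Dec (x ~ y)
      elems : List Carrier
      complete : Exhausts _~_ elems
      distinct : AllPairs (λ x y → ¬ (x ~ y)) elems
    open IsEquivalence isEquivalence public renaming (refl to ~-refl; sym to ~-sym; trans to ~-trans)

  -- An exhaustive list may meet a class several times; deduplication leaves one representative of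
  -- each, so that sums over `elems` count classes.
  mkFinSet : (A : Set) (_~_ : A → A → Set) → IsEquivalence _~_ → (∀ x y → Dec (x ~ y)) →
    (xs : List A) → Exhausts _~_ xs → FinSet
  mkFinSet A _~_ eq _~?_ xs ex = record
    { Carrier = A ; _~_ = _~_ ; isEquivalence = eq ; _~?_ = _~?_
    ; elems = deduplicate _~?_ xs
    ; complete = λ x → MemP.∈-deduplicate⁺ S _~?_ (λ e f → trans~ f (sym~ e)) (ex x)
    ; distinct = UniqueDecP.deduplicate-! D xs }
    where
    D : DecSetoid _ _
    D = record { isDecEquivalence = record { isEquivalence = eq ; _≟_ = _~?_ } }
    S = DecSetoid.setoid D
    open IsEquivalence eq renaming (trans to trans~; sym to sym~)

  ∑ : (X : FinSet) → (FinSet.Carrier X → ℚ) → ℚ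
  ∑ X f = sumL f (FinSet.elems X)

  syntax ∑ X (λ x → e) = ∑[ x ∈ X ] e

  module _ (X : FinSet) where
    open FinSet X

    ∑-cong : {f g : Carrier → ℚ} → (∀ x → f x ≡ g x) → ∑ X f ≡ ∑ X g
    ∑-cong = sumL-cong elems

    ∑-+ : (f g : Carrier → ℚ) → ∑[ x ∈ X ] (f x + g x) ≡ ∑ X f + ∑ X g
    ∑-+ f g = sumL-+ f g elems

    ∑-*ˡ : (c : ℚ) (f : Carrier → ℚ) → ∑[ x ∈ X ] (c * f x) ≡ c * ∑ X f
    ∑-*ˡ c f = sumL-*ˡ c f elems

    ∑-*ʳ : (f : Carrier → ℚ) (c : ℚ) → ∑[ x ∈ X ] (f x * c) ≡ ∑ X f * c
    ∑-*ʳ f c = trans (∑-cong (λ x → *-comm (f x) c)) (trans (∑-*ˡ c f) (*-comm c _))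

    ∑-≤ : {f g : Carrier → ℚ} → (∀ x → f x ≤ g x) → ∑ X f ≤ ∑ X g
    ∑-≤ = sumL-≤ elems

    ∑-0 : {f : Carrier → ℚ} → (∀ x → f x ≡ 0ℚ) → ∑ X f ≡ 0ℚ
    ∑-0 h = sumL-zero (All.universal h elems)

    ∑-𝟙-unique : {D : Carrier → Set} (D? : ∀ x → Dec (D x)) → (∀ {x y} → x ~ y → D x → D y) →
      ∃ D → (∀ {x y} → D x → D y → x ~ y) → ∑[ x ∈ X ] 𝟙 (D? x) ≡ 1ℚ
    ∑-𝟙-unique D? resp (x , d) uniq = sumL-𝟙-unique D? (Any.map (λ e → resp e d) (complete x))
      (AllPairs.map (λ n (d₁ , d₂) → n (uniq d₁ d₂)) distinct)

    -- The Kronecker delta of the equivalence: exactly one listed element lies in the class of `y`.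
    ∑-point : (f : Carrier → ℚ) → (∀ {x y} → x ~ y → f x ≡ f y) → ∀ y → ∑[ x ∈ X ] (𝟙 (x ~? y) * f x) ≡ f y
    ∑-point f resp y = begin
      ∑[ x ∈ X ] (𝟙 (x ~? y) * f x) ≡⟨ ∑-cong (λ x → 𝟙-guard (x ~? y) resp) ⟩
      ∑[ x ∈ X ] (𝟙 (x ~? y) * f y) ≡⟨ ∑-*ʳ _ (f y) ⟩
      ∑[ x ∈ X ] 𝟙 (x ~? y) * f y ≡⟨ cong (_* f y) (∑-𝟙-unique (_~? y) (λ e h → ~-trans (~-sym e) h) (y , ~-refl)
                                        (λ h h′ → ~-trans h (~-sym h′))) ⟩
      1ℚ * f y ≡⟨ *-identityˡ _ ⟩
      f y ∎

    -- Turns inequalities of counts into equalities: bounds that are attained in total are attained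
    -- pointwise.
    ∑-nonneg-zero : (f : Carrier → ℚ) → (∀ {x y} → x ~ y → f x ≡ f y) → (∀ x → 0ℚ ≤ f x) → ∑ X f ≤ 0ℚ →
      ∀ x → f x ≡ 0ℚ
    ∑-nonneg-zero f resp pos tot y = ℚP.≤-antisym (ℚP.≤-trans fy≤∑ tot) (pos y)
      where
      fy≤∑ : f y ≤ ∑ X f
      fy≤∑ = subst (_≤ ∑ X f) (∑-point f resp y) (∑-≤ le)
        where
        le : ∀ x → 𝟙 (x ~? y) * f x ≤ f x
        le x with x ~? y
        ... | yes _ = ℚP.≤-reflexive (*-identityˡ _)
        ... | no _ = subst (_≤ f x) (sym (zeroˡ (f x))) (pos x)

  ∑-swap : (X Y : FinSet) (f : FinSet.Carrier X → FinSet.Carrier Y → ℚ) →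
    ∑[ x ∈ X ] ∑[ y ∈ Y ] f x y ≡ ∑[ y ∈ Y ] ∑[ x ∈ X ] f x y
  ∑-swap X Y f = sumL-swap f (FinSet.elems X) (FinSet.elems Y)

  module _ (X Y : FinSet) where
    private
      module X = FinSet X
      module Y = FinSet Y

    -- Both sides are the same double sum over pairs (x , y). On the supports the relations
    -- `y ~ to x` and `x ~ from y` coincide, so either variable can be eliminated with `∑-point`.
    ∑-bij : {P : X.Carrier → Set} (P? : ∀ x → Dec (P x)) {R : Y.Carrier → Set} (R? : ∀ y → Dec (R y))
      (f : X.Carrier → ℚ) (g : Y.Carrier → ℚ) (to : X.Carrier → Y.Carrier) (from : Y.Carrier → X.Carrier) →
      (∀ {x y} → x X.~ y → P x → P y) → (∀ {x y} → x Y.~ y → R x → R y) →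
      (∀ {x y} → x X.~ y → to x Y.~ to y) → (∀ {x y} → x Y.~ y → from x X.~ from y) →
      (∀ {x} → P x → R (to x)) → (∀ {y} → R y → P (from y)) →
      (∀ {x} → P x → from (to x) X.~ x) → (∀ {y} → R y → to (from y) Y.~ y) →
      (∀ {x y} → x Y.~ y → g x ≡ g y) → (∀ {x} → P x → f x ≡ g (to x)) →
      ∑[ x ∈ X ] (𝟙 (P? x) * f x) ≡ ∑[ y ∈ Y ] (𝟙 (R? y) * g y)
    ∑-bij {P} P? {R} R? f g to from P-resp R-resp to-cong from-cong P⇒R R⇒P from-to to-from g-cong f≡g = begin
      ∑[ x ∈ X ] (𝟙 (P? x) * f x)
        ≡⟨ ∑-cong X (λ x → trans (𝟙-guard (P? x) f≡g)
             (cong (𝟙 (P? x) *_) (sym (∑-point Y g g-cong (to x))))) ⟩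
      ∑[ x ∈ X ] (𝟙 (P? x) * ∑[ y ∈ Y ] (𝟙 (y Y.~? to x) * g y))
        ≡⟨ ∑-cong X (λ x → sym (∑-*ˡ Y (𝟙 (P? x)) _)) ⟩
      ∑[ x ∈ X ] ∑[ y ∈ Y ] (𝟙 (P? x) * (𝟙 (y Y.~? to x) * g y))
        ≡⟨ ∑-swap X Y _ ⟩
      ∑[ y ∈ Y ] ∑[ x ∈ X ] (𝟙 (P? x) * (𝟙 (y Y.~? to x) * g y))
        ≡⟨ ∑-cong Y (λ y → ∑-cong X (λ x → swap x y)) ⟩
      ∑[ y ∈ Y ] ∑[ x ∈ X ] (𝟙 (x X.~? from y) * (𝟙 (R? y) * g y))
        ≡⟨ ∑-cong Y (λ y → ∑-point X (λ _ → 𝟙 (R? y) * g y) (λ _ → refl) (from y)) ⟩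
      ∑[ y ∈ Y ] (𝟙 (R? y) * g y) ∎
      where
      swap : ∀ x y → 𝟙 (P? x) * (𝟙 (y Y.~? to x) * g y) ≡ 𝟙 (x X.~? from y) * (𝟙 (R? y) * g y)
      swap x y = begin
        𝟙 (P? x) * (𝟙 (y Y.~? to x) * g y) ≡⟨ sym (*-assoc _ _ _) ⟩
        𝟙 (P? x) * 𝟙 (y Y.~? to x) * g y ≡⟨ cong (_* g y) (sym (𝟙-× (P? x) (y Y.~? to x))) ⟩
        𝟙 (P? x ×-dec (y Y.~? to x)) * g y ≡⟨ cong (_* g y) (𝟙-cong (P? x ×-dec (y Y.~? to x)) ((x X.~? from y) ×-dec R? y)
            (λ (p , e) → X.~-sym (X.~-trans (from-cong e) (from-to p)) , R-resp (Y.~-sym e) (P⇒R p))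
            (λ (e , r) → P-resp (X.~-sym e) (R⇒P r) , Y.~-sym (Y.~-trans (to-cong e) (to-from r)))) ⟩
        𝟙 ((x X.~? from y) ×-dec R? y) * g y ≡⟨ cong (_* g y) (𝟙-× (x X.~? from y) (R? y)) ⟩
        𝟙 (x X.~? from y) * 𝟙 (R? y) * g y ≡⟨ *-assoc _ _ _ ⟩
        𝟙 (x X.~? from y) * (𝟙 (R? y) * g y) ∎

    ∑-fibre : (h : X.Carrier → Y.Carrier) (f : X.Carrier → ℚ) →
      ∑ X f ≡ ∑[ y ∈ Y ] ∑[ x ∈ X ] (𝟙 (y Y.~? h x) * f x)
    ∑-fibre h f = begin
      ∑ X f ≡⟨ ∑-cong X (λ x → sym (∑-point Y (λ _ → f x) (λ _ → refl) (h x))) ⟩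
      ∑[ x ∈ X ] ∑[ y ∈ Y ] (𝟙 (y Y.~? h x) * f x) ≡⟨ ∑-swap X Y _ ⟩
      ∑[ y ∈ Y ] ∑[ x ∈ X ] (𝟙 (y Y.~? h x) * f x) ∎

  module _ (X Y : FinSet) where
    private
      module X = FinSet X
      module Y = FinSet Y

    -- Reads the length of a list of representatives as a double sum. Each entry lies over exactly
    -- one pair of classes; over a pair in `R` lies exactly one entry, by completeness and
    -- distinctness of the list, and over any other pair none.
    card-pairs : {_~_ : A → A → Set r} {P : A → Set p} (L : List A) → All P L → (∀ x → P x → Any (x ~_) L) →
      AllPairs (λ x y → ¬ (x ~ y)) L →
      {R : X.Carrier → Y.Carrier → Set} (R? : ∀ x y → Dec (R x y)) →
      (to₁ : A → X.Carrier) (to₂ : A → Y.Carrier) (from : X.Carrier → Y.Carrier → A) →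
      (∀ {a x y} → P a → x X.~ to₁ a → y Y.~ to₂ a → R x y) →
      (∀ {a b} → a ~ b → to₁ a X.~ to₁ b × to₂ a Y.~ to₂ b) →
      (∀ {a b} → P a → P b → to₁ a X.~ to₁ b → to₂ a Y.~ to₂ b → a ~ b) →
      (∀ {x y} → R x y → P (from x y) × x X.~ to₁ (from x y) × y Y.~ to₂ (from x y)) →
      ι (length L) ≡ ∑[ x ∈ X ] ∑[ y ∈ Y ] 𝟙 (R? x y)
    card-pairs {A = A} {_~_ = _~_} {P = P} L LP LC LD {R} R? to₁ to₂ from to-R to-cong to-inj from-R = begin
      ι (length L) ≡⟨ sym (sumL-1 L) ⟩
      sumL (λ _ → 1ℚ) L ≡⟨ sumL-cong L (λ a → sym (one a)) ⟩
      sumL (λ a → ∑[ x ∈ X ] ∑[ y ∈ Y ] 𝟙 (D? x y a)) L ≡⟨ sumL-swap _ L (FinSet.elems X) ⟩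
      ∑[ x ∈ X ] sumL (λ a → ∑[ y ∈ Y ] 𝟙 (D? x y a)) L ≡⟨ ∑-cong X (λ x → sumL-swap _ L (FinSet.elems Y)) ⟩
      ∑[ x ∈ X ] ∑[ y ∈ Y ] sumL (λ a → 𝟙 (D? x y a)) L ≡⟨ ∑-cong X (λ x → ∑-cong Y (λ y → count x y)) ⟩
      ∑[ x ∈ X ] ∑[ y ∈ Y ] 𝟙 (R? x y) ∎
      where
      D : X.Carrier → Y.Carrier → A → Set
      D x y a = x X.~ to₁ a × y Y.~ to₂ a
      D? : ∀ x y a → Dec (D x y a)
      D? x y a = (x X.~? to₁ a) ×-dec (y Y.~? to₂ a)
      one : ∀ a → ∑[ x ∈ X ] ∑[ y ∈ Y ] 𝟙 (D? x y a) ≡ 1ℚ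
      one a = begin
        ∑[ x ∈ X ] ∑[ y ∈ Y ] 𝟙 (D? x y a)
          ≡⟨ ∑-cong X (λ x → trans (∑-cong Y (λ y → trans (𝟙-× (x X.~? to₁ a) (y Y.~? to₂ a)) (*-comm _ _))) (∑-point Y (λ _ → 𝟙 (x X.~? to₁ a)) (λ _ → refl) (to₂ a))) ⟩
        ∑[ x ∈ X ] 𝟙 (x X.~? to₁ a) ≡⟨ ∑-cong X (λ x → sym (*-identityʳ _)) ⟩
        ∑[ x ∈ X ] (𝟙 (x X.~? to₁ a) * 1ℚ) ≡⟨ ∑-point X (λ _ → 1ℚ) (λ _ → refl) (to₁ a) ⟩
        1ℚ ∎
      distinct : ∀ x y {M} → All P M → AllPairs (λ a b → ¬ (a ~ b)) M → AllPairs (λ a b → ¬ (D x y a × D x y b)) M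
      distinct x y [] [] = []
      distinct x y (pa ∷ ps) (n ∷ ns) = All.zipWith (λ (pb , nab) ((e₁ , e₂) , (f₁ , f₂)) →
        nab (to-inj pa pb (X.~-trans (X.~-sym e₁) f₁) (Y.~-trans (Y.~-sym e₂) f₂))) (ps , n) ∷ distinct x y ps ns
      count : ∀ x y → sumL (λ a → 𝟙 (D? x y a)) L ≡ 𝟙 (R? x y)
      count x y with R? x y
      ... | yes rxy = sumL-𝟙-unique (D? x y)
            (Any.map (λ e → X.~-trans (proj₁ (proj₂ (from-R rxy))) (proj₁ (to-cong e)) ,
                            Y.~-trans (proj₂ (proj₂ (from-R rxy))) (proj₂ (to-cong e)))
                     (LC _ (proj₁ (from-R rxy))))
            (distinct x y LP LD)
      ... | no ¬r = sumL-zero (All.map (λ {a} pa → 𝟙-no (D? x y a) (λ (e₁ , e₂) → ¬r (to-R pa e₁ e₂))) LP)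

  ∑-positive⇒∃ : (X : FinSet) {D : FinSet.Carrier X → Set} (D? : ∀ x → Dec (D x)) → ∑[ x ∈ X ] 𝟙 (D? x) ≢ 0ℚ → ∃ D
  ∑-positive⇒∃ X D? nz with Any.any? D? (FinSet.elems X)
  ... | yes a = Any.satisfied a
  ... | no ¬a = ⊥-elim (nz (sumL-zero (All.map (λ {x} → 𝟙-no (D? x)) (AllP.¬Any⇒All¬ _ ¬a))))

  ∑-1 : (X : FinSet) → ∑[ x ∈ X ] 1ℚ ≡ ι (length (FinSet.elems X))
  ∑-1 X = sumL-1 (FinSet.elems X)

-- Powers of rational numbers

module Powers where

  open Rat
  open ℚS hiding (_:^_)
  open ≡-Reasoning

  pw : ℚ → ℕ → ℚ
  pw x zero = 1ℚ
  pw x (suc n) = pw x n * x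

  pw-+ : ∀ x m n → pw x (m ℕ.+ n) ≡ pw x m * pw x n
  pw-+ x zero n = sym (*-identityˡ _)
  pw-+ x (suc m) n = trans (cong (_* x) (pw-+ x m n))
    (solve 3 (λ a b x → a :* b :* x := a :* x :* b) refl (pw x m) (pw x n) x)

  pw-distrib : ∀ x y n → pw (x * y) n ≡ pw x n * pw y n
  pw-distrib x y zero = sym (*-identityˡ _)
  pw-distrib x y (suc n) = trans (cong (_* (x * y)) (pw-distrib x y n))
    (solve 4 (λ a b x y → a :* b :* (x :* y) := a :* x :* (b :* y)) refl (pw x n) (pw y n) x y)

  pw-1 : ∀ n → pw 1ℚ n ≡ 1ℚ
  pw-1 zero = refl
  pw-1 (suc n) = trans (*-identityʳ _) (pw-1 n)

  pw-inverse : ∀ {x y} → x * y ≡ 1ℚ → ∀ n → pw x n * pw y n ≡ 1ℚ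
  pw-inverse {x} {y} e n = trans (sym (pw-distrib x y n)) (trans (cong (λ z → pw z n) e) (pw-1 n))

  pw-≢0 : ∀ {x} → x ≢ 0ℚ → ∀ n → pw x n ≢ 0ℚ
  pw-≢0 x≢0 zero ()
  pw-≢0 x≢0 (suc n) = *-≢0 (pw-≢0 x≢0 n) x≢0

-- Convolution of sequences

module Convolution where

  open Rat
  open ℚS
  open ≡-Reasoning

  conv : (ℕ → ℕ → ℚ) → ℕ → ℚ
  conv f zero = f 0 0
  conv f (suc n) = f 0 (suc n) + conv (λ k r → f (suc k) r) n

  conv-cong : ∀ {f g} → (∀ k r → f k r ≡ g k r) → ∀ n → conv f n ≡ conv g n
  conv-cong h zero = h 0 0
  conv-cong h (suc n) = cong₂ _+_ (h 0 (suc n)) (conv-cong (λ k r → h (suc k) r) n)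

  conv-+ : ∀ f g n → conv (λ k r → f k r + g k r) n ≡ conv f n + conv g n
  conv-+ f g zero = refl
  conv-+ f g (suc n) = trans (cong (λ w → f 0 (suc n) + g 0 (suc n) + w) (conv-+ _ _ n))
    (solve 4 (λ a b c d → a :+ b :+ (c :+ d) := a :+ c :+ (b :+ d)) refl _ _ _ _)

  conv-*ˡ : ∀ c f n → conv (λ k r → c * f k r) n ≡ c * conv f n
  conv-*ˡ c f zero = refl
  conv-*ˡ c f (suc n) = trans (cong (λ w → c * f 0 (suc n) + w) (conv-*ˡ c _ n)) (sym (distribˡ c _ _))

  conv-last : ∀ f n → conv f (suc n) ≡ conv (λ k r → f k (suc r)) n + f (suc n) 0
  conv-last f zero = refl
  conv-last f (suc n) = trans (cong (λ w → f 0 (suc (suc n)) + w) (conv-last (λ k r → f (suc k) r) n)) (sym (+-assoc _ _ _))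

  conv-flip : ∀ f n → conv f n ≡ conv (λ k r → f r k) n
  conv-flip f zero = refl
  conv-flip f (suc n) = trans (conv-last f n) (trans (+-comm _ _) (cong (λ w → f (suc n) 0 + w) (conv-flip (λ k r → f k (suc r)) n)))

  -- The sum k + r is constant along a convolution, so a weight depending on it alone is a scalar.
  conv-weight : ∀ h f n → conv (λ k r → h (k ℕ.+ r) * f k r) n ≡ h n * conv f n
  conv-weight h f zero = refl
  conv-weight h f (suc n) = trans (cong (λ w → h (suc n) * f 0 (suc n) + w) (conv-weight (λ i → h (suc i)) (λ k r → f (suc k) r) n))
    (sym (distribˡ _ _ _))

  -- Multiplication by the variable, when a sequence is read as the coefficients of a power series.
  shift : (ℕ → ℚ) → ℕ → ℚ
  shift f zero = 0ℚ
  shift f (suc n) = f n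

  shiftˡ shiftʳ : (ℕ → ℕ → ℚ) → ℕ → ℕ → ℚ
  shiftˡ f k r = shift (λ i → f i r) k
  shiftʳ f k r = shift (f k) r

  conv-shiftˡ : ∀ f n → conv (shiftˡ f) n ≡ shift (conv f) n
  conv-shiftˡ f zero = refl
  conv-shiftˡ f (suc n) = +-identityˡ _

  conv-shiftʳ : ∀ f n → conv (shiftʳ f) n ≡ shift (conv f) n
  conv-shiftʳ f zero = refl
  conv-shiftʳ f (suc n) = trans (conv-last (shiftʳ f) n) (+-identityʳ _)

  shift-cong : ∀ {f g} → (∀ n → f n ≡ g n) → ∀ n → shift f n ≡ shift g n
  shift-cong h zero = refl
  shift-cong h (suc n) = h n

-- The q-series that solves the recurrence

module QSeries (s t : ℚ) (st : s Rat.* t ≡ 1ℚ) (1-tⁿ≢0 : ∀ n → 1ℚ Rat.- Powers.pw t (suc n) ≢ 0ℚ) where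

  open Rat
  open Powers
  open Convolution
  open ℚS hiding (_:^_)
  open ≡-Reasoning

  poch T D ip a : ℕ → ℚ
  poch zero = 1ℚ
  poch (suc n) = poch n * (1ℚ - pw t (suc n))
  -- T n = t^(n(n+1)/2) and D k = (-1)^k t^(k(k-1)/2)
  T zero = 1ℚ
  T (suc n) = T n * pw t (suc n)
  D zero = 1ℚ
  D (suc k) = - (D k * pw t k)
  ip n = inv (poch n)
  a j = pw (- t) j * ip j

  poch≢0 : ∀ n → poch n ≢ 0ℚ
  poch≢0 zero ()
  poch≢0 (suc n) = *-≢0 (poch≢0 n) (1-tⁿ≢0 n)

  ip-step : ∀ n → ip n ≡ ip (suc n) * (1ℚ - pw t (suc n))
  ip-step n = sym (inv-unique (trans
    (solve 3 (λ p j w → p :* (j :* w) := p :* w :* j) refl (poch n) (ip (suc n)) (1ℚ - pw t (suc n)))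
    (inv-inverseʳ (poch≢0 (suc n)))))

  -- With n = k + r this is `T n * ip n` times (-1)^k t^(k(k-1)/2) times the Gaussian binomial
  -- coefficient of n over k in base t. Hence `E n φ` is, up to a factor, a q-analogue of the n-th
  -- finite difference of φ.
  e : ℕ → ℕ → ℚ
  e k r = T (k ℕ.+ r) * D k * ip k * ip r

  cong₃ : ∀ (f : ℚ → ℚ → ℚ → ℚ) {x x′ y y′ z z′} → x ≡ x′ → y ≡ y′ → z ≡ z′ → f x y z ≡ f x′ y′ z′
  cong₃ f refl refl refl = refl

  tsk : ∀ k → pw t k * pw s k ≡ 1ℚ
  tsk = pw-inverse (trans (*-comm t s) st)

  -- Here and in `e-downʳ`, lowering an index amounts to multiplying by a polynomial in s^k, s^r and
  -- t. Sums with shifted indices can then be compared term by term.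
  e-downˡ : ∀ k r → e k r ≡ - ((pw s (suc k) * pw s (suc k) - pw s (suc k)) * t * pw s r) * e (suc k) r
  e-downˡ k r = begin
    T (k ℕ.+ r) * D k * ip k * ip r
      ≡⟨ cong (λ w → T (k ℕ.+ r) * D k * w * ip r) (ip-step k) ⟩
    T (k ℕ.+ r) * D k * (ip (suc k) * (1ℚ - pw t k * t)) * ip r
      ≡⟨ solve 6 (λ T D i j x t → T :* D :* (i :* (κ 1 :- x :* t)) :* j
           := T :* D :* i :* j :* (κ 1 :* (κ 1 :* κ 1 :* κ 1 :* κ 1 :- κ 1 :* κ 1 :* x :* t)))
           refl (T (k ℕ.+ r)) (D k) (ip (suc k)) (ip r) (pw t k) t ⟩
    -- The arguments 1 of `G` are placeholders. Replaced by s t, t^k s^k and t^r s^r, which all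
    -- equal 1, they make the two sides agree as polynomials in independent variables.
    T (k ℕ.+ r) * D k * ip (suc k) * ip r * G 1ℚ 1ℚ 1ℚ
      ≡⟨ cong (λ w → T (k ℕ.+ r) * D k * ip (suc k) * ip r * w) (sym (cong₃ G st (tsk k) (tsk r))) ⟩
    T (k ℕ.+ r) * D k * ip (suc k) * ip r * G (s * t) (pw t k * pw s k) (pw t r * pw s r)
      ≡⟨ solve 10 (λ T D i j s t x X y Y → T :* D :* i :* j :* ((y :* Y) :* ((s :* t) :* (s :* t) :* (x :* X) :* (x :* X) :- (s :* t) :* (x :* X) :* x :* t))
           := :- ((X :* s :* (X :* s) :- X :* s) :* t :* Y) :* (T :* (x :* y :* t) :* :- (D :* x) :* i :* j))
           refl (T (k ℕ.+ r)) (D k) (ip (suc k)) (ip r) s t (pw t k) (pw s k) (pw t r) (pw s r) ⟩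
    - ((pw s (suc k) * pw s (suc k) - pw s (suc k)) * t * pw s r) * (T (k ℕ.+ r) * (pw t k * pw t r * t) * - (D k * pw t k) * ip (suc k) * ip r)
      ≡⟨ cong (λ w → - ((pw s (suc k) * pw s (suc k) - pw s (suc k)) * t * pw s r) * (T (k ℕ.+ r) * (w * t) * - (D k * pw t k) * ip (suc k) * ip r)) (sym (pw-+ t k r)) ⟩
    - ((pw s (suc k) * pw s (suc k) - pw s (suc k)) * t * pw s r) * e (suc k) r ∎
    where
    G : ℚ → ℚ → ℚ → ℚ
    G α β γ = γ * (α * α * β * β - α * β * pw t k * t)

  e-downʳ : ∀ k r → e k r ≡ pw s k * (pw s (suc r) - 1ℚ) * e k (suc r)
  e-downʳ k r = begin
    T (k ℕ.+ r) * D k * ip k * ip r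
      ≡⟨ cong (λ w → T (k ℕ.+ r) * D k * ip k * w) (ip-step r) ⟩
    T (k ℕ.+ r) * D k * ip k * (ip (suc r) * (1ℚ - pw t r * t))
      ≡⟨ solve 6 (λ T D i j y t → T :* D :* i :* (j :* (κ 1 :- y :* t))
           := T :* D :* i :* j :* (κ 1 :* (κ 1 :* κ 1 :- y :* t)))
           refl (T (k ℕ.+ r)) (D k) (ip k) (ip (suc r)) (pw t r) t ⟩
    T (k ℕ.+ r) * D k * ip k * ip (suc r) * G 1ℚ 1ℚ 1ℚ
      ≡⟨ cong (λ w → T (k ℕ.+ r) * D k * ip k * ip (suc r) * w) (sym (cong₃ G st (tsk k) (tsk r))) ⟩
    T (k ℕ.+ r) * D k * ip k * ip (suc r) * G (s * t) (pw t k * pw s k) (pw t r * pw s r)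
      ≡⟨ solve 10 (λ T D i j s t x X y Y → T :* D :* i :* j :* ((x :* X) :* ((y :* Y) :* (s :* t) :- y :* t))
           := X :* (Y :* s :- κ 1) :* (T :* (x :* y :* t) :* D :* i :* j))
           refl (T (k ℕ.+ r)) (D k) (ip k) (ip (suc r)) s t (pw t k) (pw s k) (pw t r) (pw s r) ⟩
    pw s k * (pw s (suc r) - 1ℚ) * (T (k ℕ.+ r) * (pw t k * pw t r * t) * D k * ip k * ip (suc r))
      ≡⟨ cong (λ w → pw s k * (pw s (suc r) - 1ℚ) * (w * D k * ip k * ip (suc r)))
           (trans (cong (λ w → T (k ℕ.+ r) * (w * t)) (sym (pw-+ t k r))) (cong T (sym (ℕP.+-suc k r)))) ⟩
    pw s k * (pw s (suc r) - 1ℚ) * e k (suc r) ∎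
    where
    G : ℚ → ℚ → ℚ → ℚ
    G α β γ = β * (γ * α - pw t r * t)

  E : ℕ → (ℕ → ℚ) → ℚ
  E n φ = conv (λ k r → e k r * φ k) n

  private
    X : ℕ → ℚ
    X = pw s
    x² : ℕ → ℚ
    x² k = pw t k * pw t k

  -- In `term₁` to `term₄` a shifted summand becomes a polynomial multiple of `e k r * φ k`. The
  -- factors that vanish at s^k or s^r equal to 1 or s make this true also at the indices 0 and 1,
  -- where `shift` inserts zeros.
  term₁ : ∀ (φ : ℕ → ℚ) k r → shiftˡ (λ k r → e k r * φ (suc k)) k r ≡ - ((X k * X k - X k) * t * X r) * (e k r * φ k)
  term₁ φ zero r = solve 3 (λ t Y z → κ 0 := :- ((κ 1 :* κ 1 :- κ 1) :* t :* Y) :* z) refl t (X r) (e 0 r * φ 0)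
  term₁ φ (suc k) r = trans (cong (_* φ (suc k)) (e-downˡ k r)) (*-assoc _ _ _)

  term₂ : ∀ (φ : ℕ → ℚ) k r → shiftʳ (shiftʳ (λ k r → e k r * ((1ℚ - x² k) * φ k))) k r ≡
    (X k * X k - 1ℚ) * (X r - 1ℚ) * (X r - s) * t * (e k r * φ k)
  term₂ φ k zero = solve 4 (λ X s t z → κ 0 := (X :* X :- κ 1) :* (κ 1 :- κ 1) :* (κ 1 :- s) :* t :* z)
    refl (X k) s t (e k 0 * φ k)
  term₂ φ k (suc zero) = solve 4 (λ X s t z → κ 0 := (X :* X :- κ 1) :* (κ 1 :* s :- κ 1) :* (κ 1 :* s :- s) :* t :* z)
    refl (X k) s t (e k 1 * φ k)
  term₂ φ k (suc (suc r)) = begin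
    e k r * ((1ℚ - x² k) * φ k)
      ≡⟨ cong (_* ((1ℚ - x² k) * φ k)) (trans (e-downʳ k r) (cong (X k * (X (suc r) - 1ℚ) *_) (e-downʳ k (suc r)))) ⟩
    X k * (X (suc r) - 1ℚ) * (X k * (X (2 ℕ.+ r) - 1ℚ) * e k (2 ℕ.+ r)) * ((1ℚ - x² k) * φ k)
      ≡⟨ solve 6 (λ x X Y s z f → X :* (Y :* s :- κ 1) :* (X :* (Y :* s :* s :- κ 1) :* z) :* ((κ 1 :- x :* x) :* f)
           := (X :* X :- (x :* X) :* (x :* X)) :* (Y :* s :* s :- κ 1) :* (Y :* s :- κ 1) :* (z :* f))
           refl (pw t k) (X k) (X r) s (e k (2 ℕ.+ r)) (φ k) ⟩
    (X k * X k - (pw t k * X k) * (pw t k * X k)) * (X (2 ℕ.+ r) - 1ℚ) * (X (suc r) - 1ℚ) * (e k (2 ℕ.+ r) * φ k)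
      ≡⟨ cong (λ w → (X k * X k - w * w) * (X (2 ℕ.+ r) - 1ℚ) * (X (suc r) - 1ℚ) * (e k (2 ℕ.+ r) * φ k)) (tsk k) ⟩
    (X k * X k - 1ℚ * 1ℚ) * (X (2 ℕ.+ r) - 1ℚ) * (X (suc r) - 1ℚ) * (e k (2 ℕ.+ r) * φ k)
      ≡⟨ linear₁ (- ((X k * X k - 1ℚ) * (X (2 ℕ.+ r) - 1ℚ) * (X (suc r) - 1ℚ) * (e k (2 ℕ.+ r) * φ k))) st
           (solve 5 (λ X Y s t z → (X :* X :- κ 1 :* κ 1) :* (Y :* s :* s :- κ 1) :* (Y :* s :- κ 1) :* z
                :+ :- ((X :* X :- κ 1) :* (Y :* s :* s :- κ 1) :* (Y :* s :- κ 1) :* z) :* κ 1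
              := (X :* X :- κ 1) :* (Y :* s :* s :- κ 1) :* (Y :* s :* s :- s) :* t :* z
                :+ :- ((X :* X :- κ 1) :* (Y :* s :* s :- κ 1) :* (Y :* s :- κ 1) :* z) :* (s :* t))
              refl (X k) (X r) s t (e k (2 ℕ.+ r) * φ k)) ⟩
    (X k * X k - 1ℚ) * (X (2 ℕ.+ r) - 1ℚ) * (X (2 ℕ.+ r) - s) * t * (e k (2 ℕ.+ r) * φ k) ∎

  term₃ : ∀ (φ : ℕ → ℚ) k r → shiftˡ (shiftˡ (λ k r → e k r * (- t * x² k * φ (2 ℕ.+ k)))) k r ≡
    - (t * (X k - 1ℚ) * (X k - s) * X r * X r) * (e k r * φ k)
  term₃ φ zero r = solve 4 (λ Y s t z → κ 0 := :- (t :* (κ 1 :- κ 1) :* (κ 1 :- s) :* Y :* Y) :* z)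
    refl (X r) s t (e 0 r * φ 0)
  term₃ φ (suc zero) r = solve 4 (λ Y s t z → κ 0 := :- (t :* (κ 1 :* s :- κ 1) :* (κ 1 :* s :- s) :* Y :* Y) :* z)
    refl (X r) s t (e 1 r * φ 1)
  term₃ φ (suc (suc k)) r = begin
    e k r * (- t * x² k * f)
      ≡⟨ cong (_* (- t * x² k * f)) (trans (e-downˡ k r) (cong (- ((X (suc k) * X (suc k) - X (suc k)) * t * X r) *_) (e-downˡ (suc k) r))) ⟩
    - ((X₁ * X₁ - X₁) * t * X r) * (- ((X₂ * X₂ - X₂) * t * X r) * z) * (- t * x² k * f)
      ≡⟨ solve 7 (λ x X Y s t z f → :- ((X :* s :* (X :* s) :- X :* s) :* t :* Y) :* (:- ((X :* s :* s :* (X :* s :* s) :- X :* s :* s) :* t :* Y) :* z) :* (:- t :* (x :* x) :* f)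
           := :- (t :* (X :* s :* s :- κ 1) :* ((s :* t) :* (s :* t) :* (x :* X) :* (x :* X) :* (X :* s :- κ 1) :* s) :* Y :* Y) :* (z :* f))
           refl (pw t k) (X k) (X r) s t z f ⟩
    G (s * t) (pw t k * X k) ≡⟨ cong₂ G st (tsk k) ⟩
    G 1ℚ 1ℚ
      ≡⟨ solve 5 (λ X Y s t z → :- (t :* (X :* s :* s :- κ 1) :* (κ 1 :* κ 1 :* κ 1 :* κ 1 :* (X :* s :- κ 1) :* s) :* Y :* Y) :* z
           := :- (t :* (X :* s :* s :- κ 1) :* (X :* s :* s :- s) :* Y :* Y) :* z) refl (X k) (X r) s t (z * f) ⟩
    - (t * (X₂ - 1ℚ) * (X₂ - s) * X r * X r) * (z * f) ∎
    where
    f = φ (2 ℕ.+ k)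
    z = e (2 ℕ.+ k) r
    X₁ = X (suc k)
    X₂ = X (2 ℕ.+ k)
    G : ℚ → ℚ → ℚ
    G α β = - (t * (X₂ - 1ℚ) * (α * α * β * β * (X₁ - 1ℚ) * s) * X r * X r) * (z * f)

  term₄ : ∀ (φ : ℕ → ℚ) k r → shiftˡ (shiftʳ (λ k r → e k r * ((1ℚ + t) * x² k * φ (suc k)))) k r ≡
    - ((1ℚ + t) * (X k - 1ℚ) * (X r * X r - X r)) * (e k r * φ k)
  term₄ φ zero r = solve 3 (λ Y t z → κ 0 := :- ((κ 1 :+ t) :* (κ 1 :- κ 1) :* (Y :* Y :- Y)) :* z)
    refl (X r) t (e 0 r * φ 0)
  term₄ φ (suc k) zero = solve 3 (λ X t z → κ 0 := :- ((κ 1 :+ t) :* (X :- κ 1) :* (κ 1 :* κ 1 :- κ 1)) :* z)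
    refl (X (suc k)) t (e (suc k) 0 * φ (suc k))
  term₄ φ (suc k) (suc r) = begin
    e k r * ((1ℚ + t) * x² k * f)
      ≡⟨ cong (_* ((1ℚ + t) * x² k * f)) (trans (e-downˡ k r) (cong (- ((X₁ * X₁ - X₁) * t * X r) *_) (e-downʳ (suc k) r))) ⟩
    - ((X₁ * X₁ - X₁) * t * X r) * (X₁ * (Y₁ - 1ℚ) * z) * ((1ℚ + t) * x² k * f)
      ≡⟨ solve 7 (λ x X Y s t z f → :- ((X :* s :* (X :* s) :- X :* s) :* t :* Y) :* (X :* s :* (Y :* s :- κ 1) :* z) :* ((κ 1 :+ t) :* (x :* x) :* f)
           := :- ((κ 1 :+ t) :* (X :* s :- κ 1) :* ((s :* t) :* (x :* X) :* (x :* X) :* (Y :* s) :* (Y :* s :- κ 1))) :* (z :* f))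
           refl (pw t k) (X k) (X r) s t z f ⟩
    G (s * t) (pw t k * X k) ≡⟨ cong₂ G st (tsk k) ⟩
    G 1ℚ 1ℚ
      ≡⟨ solve 4 (λ X Y t z → :- ((κ 1 :+ t) :* (X :- κ 1) :* (κ 1 :* κ 1 :* κ 1 :* Y :* (Y :- κ 1))) :* z
           := :- ((κ 1 :+ t) :* (X :- κ 1) :* (Y :* Y :- Y)) :* z) refl X₁ Y₁ t (z * f) ⟩
    - ((1ℚ + t) * (X₁ - 1ℚ) * (Y₁ * Y₁ - Y₁)) * (z * f) ∎
    where
    f = φ (suc k)
    z = e (suc k) (suc r)
    X₁ = X (suc k)
    Y₁ = X (suc r)
    G : ℚ → ℚ → ℚ
    G α β = - ((1ℚ + t) * (X₁ - 1ℚ) * (α * β * β * Y₁ * (Y₁ - 1ℚ))) * (z * f)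

  -- For s = -q and t = -1/q, q times this is the operator `φ⁺` that describes Siegel
  -- transformations, with φ read as a function of the dimension; see `φ⁺-Ψ`.
  Ψ : (ℕ → ℚ) → ℕ → ℚ
  Ψ φ k = (1ℚ - x² k) * φ k + (- t * x² k * φ (2 ℕ.+ k) + (1ℚ + t) * x² k * φ (suc k))

  E-cong : ∀ {φ χ} → (∀ k → φ k ≡ χ k) → ∀ n → E n φ ≡ E n χ
  E-cong h = conv-cong (λ k r → cong (e k r *_) (h k))

  E-+ : ∀ φ χ n → E n (λ k → φ k + χ k) ≡ E n φ + E n χ
  E-+ φ χ n = trans (conv-cong (λ k r → distribˡ (e k r) (φ k) (χ k)) n) (conv-+ _ _ n)

  E-*ˡ : ∀ c φ n → E n (λ k → c * φ k) ≡ c * E n φ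
  E-*ˡ c φ n = trans (conv-cong (λ k r → solve 3 (λ e c f → e :* (c :* f) := c :* (e :* f)) refl (e k r) c (φ k)) n) (conv-*ˡ c _ n)

  shift-+ : ∀ f g n → shift (λ n → f n + g n) n ≡ shift f n + shift g n
  shift-+ f g zero = sym (+-identityʳ _)
  shift-+ f g (suc n) = refl

  -- The sums of index n - 1 and n - 2 are brought to index n by the four `term` lemmas. What
  -- remains is one polynomial identity in s^k and s^r modulo s t = 1, valid for each summand.
  E-recurrence : ∀ φ n → E n (λ k → (X k * X k - 1ℚ) * φ k) ≡
    (- s - 1ℚ) * shift (λ n → E n (λ k → φ (suc k))) n + shift (shift (λ n → E n (Ψ φ))) n
  E-recurrence φ n = begin
    conv (λ k r → e k r * ((X k * X k - 1ℚ) * φ k)) n ≡⟨ conv-cong pointwise n ⟩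
    conv (λ k r → (- s - 1ℚ) * A k r + (B k r + (C k r + F k r))) n
      ≡⟨ trans (conv-+ _ _ n) (cong₂ _+_ (conv-*ˡ _ _ n) (trans (conv-+ _ _ n) (cong (λ w → conv B n + w) (conv-+ _ _ n)))) ⟩
    (- s - 1ℚ) * conv A n + (conv B n + (conv C n + conv F n))
      ≡⟨ cong₂ _+_ (cong ((- s - 1ℚ) *_) (conv-shiftˡ _ n))
           (cong₂ _+_ (twice conv-shiftʳ conv-shiftʳ _) (cong₂ _+_ (twice conv-shiftˡ conv-shiftˡ _) (twice conv-shiftˡ conv-shiftʳ _))) ⟩
    (- s - 1ℚ) * shift (λ n → E n (λ k → φ (suc k))) n +
      (shift (shift (λ n → E n ψ₁)) n + (shift (shift (λ n → E n ψ₂)) n + shift (shift (λ n → E n ψ₃)) n))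
      ≡⟨ cong (λ w → (- s - 1ℚ) * shift (λ n → E n (λ k → φ (suc k))) n + w) (sym collect) ⟩
    (- s - 1ℚ) * shift (λ n → E n (λ k → φ (suc k))) n + shift (shift (λ n → E n (Ψ φ))) n ∎
    where
    ψ₁ ψ₂ ψ₃ : ℕ → ℚ
    ψ₁ k = (1ℚ - x² k) * φ k
    ψ₂ k = - t * x² k * φ (2 ℕ.+ k)
    ψ₃ k = (1ℚ + t) * x² k * φ (suc k)
    A B C F : ℕ → ℕ → ℚ
    A = shiftˡ (λ k r → e k r * φ (suc k))
    B = shiftʳ (shiftʳ (λ k r → e k r * ψ₁ k))
    C = shiftˡ (shiftˡ (λ k r → e k r * ψ₂ k))
    F = shiftˡ (shiftʳ (λ k r → e k r * ψ₃ k))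
    twice : ∀ {S S′ : (ℕ → ℕ → ℚ) → ℕ → ℕ → ℚ} → (∀ f n → conv (S f) n ≡ shift (conv f) n) →
      (∀ f n → conv (S′ f) n ≡ shift (conv f) n) → ∀ f → conv (S (S′ f)) n ≡ shift (shift (conv f)) n
    twice h h′ f = trans (h _ n) (shift-cong (h′ f) n)
    collect : shift (shift (λ n → E n (Ψ φ))) n ≡
      shift (shift (λ n → E n ψ₁)) n + (shift (shift (λ n → E n ψ₂)) n + shift (shift (λ n → E n ψ₃)) n)
    collect = trans (shift-cong (shift-cong (λ n → trans (E-+ ψ₁ _ n) (cong (λ w → E n ψ₁ + w) (E-+ ψ₂ ψ₃ n)))) n)
      (trans (shift-cong (λ n → trans (shift-+ _ _ n) (cong (λ w → shift (λ n → E n ψ₁) n + w) (shift-+ _ _ n))) n)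
        (trans (shift-+ _ _ n) (cong (λ w → shift (shift (λ n → E n ψ₁)) n + w) (shift-+ _ _ n))))
    pointwise : ∀ k r → e k r * ((X k * X k - 1ℚ) * φ k) ≡ (- s - 1ℚ) * A k r + (B k r + (C k r + F k r))
    pointwise k r = trans
      (linear₁ (- ((X k - 1ℚ) * (X r * X r - X r + X k + 1ℚ) * z)) st
      (solve 6 (λ e f X Y s t →
        e :* ((X :* X :- κ 1) :* f) :+ :- ((X :- κ 1) :* (Y :* Y :- Y :+ X :+ κ 1) :* (e :* f)) :* κ 1
        := (:- s :- κ 1) :* (:- ((X :* X :- X) :* t :* Y) :* (e :* f))
           :+ ((X :* X :- κ 1) :* (Y :- κ 1) :* (Y :- s) :* t :* (e :* f)
           :+ (:- (t :* (X :- κ 1) :* (X :- s) :* Y :* Y) :* (e :* f)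
           :+ :- ((κ 1 :+ t) :* (X :- κ 1) :* (Y :* Y :- Y)) :* (e :* f))) :+ :- ((X :- κ 1) :* (Y :* Y :- Y :+ X :+ κ 1) :* (e :* f)) :* (s :* t))
        refl (e k r) (φ k) (X k) (X r) s t))
      (sym (cong₂ _+_ (cong ((- s - 1ℚ) *_) (term₁ φ k r)) (cong₂ _+_ (term₂ φ k r) (cong₂ _+_ (term₃ φ k r) (term₄ φ k r)))))
      where z = e k r * φ k

  -- The q-binomial theorem is S-step: S z n is the product of (1 - z tⁱ)/(1 - tⁱ⁺¹) over i < n.
  B : ℚ → ℕ → ℕ → ℚ
  B z k r = D k * pw z k * ip k * ip r

  S : ℚ → ℕ → ℚ
  S z = conv (B z)

  S-step : ∀ z n → (1ℚ - pw t (suc n)) * S z (suc n) ≡ (1ℚ - z * pw t n) * S z n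
  S-step z n = begin
    (1ℚ - pw t (suc n)) * S z (suc n)
      ≡⟨ sym (conv-weight (λ i → 1ℚ - pw t i) (B z) (suc n)) ⟩
    conv (λ k r → (1ℚ - pw t (k ℕ.+ r)) * (D k * pw z k * ip k * ip r)) (suc n)
      ≡⟨ conv-cong split (suc n) ⟩
    conv (λ k r → shiftʳ g k r + shiftˡ h k r) (suc n)
      ≡⟨ trans (conv-+ (shiftʳ g) (shiftˡ h) (suc n)) (cong₂ _+_ (conv-shiftʳ g (suc n)) (conv-shiftˡ h (suc n))) ⟩
    S z n + conv h n ≡⟨ cong (λ w → S z n + w) (conv-weight (λ i → - (z * pw t i)) (B z) n) ⟩
    S z n + - (z * pw t n) * S z n
      ≡⟨ solve 2 (λ a S → S :+ :- a :* S := (κ 1 :- a) :* S) refl (z * pw t n) (S z n) ⟩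
    (1ℚ - z * pw t n) * S z n ∎
    where
    g h : ℕ → ℕ → ℚ
    g k r = D k * pw z k * ip k * ip r
    h k r = - (z * pw t (k ℕ.+ r)) * (D k * pw z k * ip k * ip r)
    gʳ : ∀ k r → (1ℚ - pw t r) * g k r ≡ shiftʳ g k r
    gʳ k zero = solve 1 (λ g → (κ 1 :- κ 1) :* g := κ 0) refl (g k 0)
    gʳ k (suc r) = trans (solve 3 (λ a w j → (κ 1 :- w) :* (a :* j) := a :* (j :* (κ 1 :- w))) refl (D k * pw z k * ip k) (pw t (suc r)) (ip (suc r)))
      (cong (D k * pw z k * ip k *_) (sym (ip-step r)))
    hˡ : ∀ k r → pw t r * ((1ℚ - pw t k) * g k r) ≡ shiftˡ h k r
    hˡ zero r = solve 2 (λ w g → w :* ((κ 1 :- κ 1) :* g) := κ 0) refl (pw t r) (g 0 r)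
    hˡ (suc k) r = begin
      pw t r * ((1ℚ - pw t (suc k)) * (- (D k * pw t k) * (pw z k * z) * ip (suc k) * ip r))
        ≡⟨ solve 8 (λ y u d x zk z i j → y :* ((κ 1 :- u) :* (:- (d :* x) :* (zk :* z) :* i :* j))
             := :- (z :* (x :* y)) :* (d :* zk :* (i :* (κ 1 :- u)) :* j)) refl
             (pw t r) (pw t (suc k)) (D k) (pw t k) (pw z k) z (ip (suc k)) (ip r) ⟩
      - (z * (pw t k * pw t r)) * (D k * pw z k * (ip (suc k) * (1ℚ - pw t (suc k))) * ip r)
        ≡⟨ cong₂ (λ v w → - (z * v) * (D k * pw z k * w * ip r)) (sym (pw-+ t k r)) (sym (ip-step k)) ⟩
      h k r ∎
    -- The q-analogue of n = r + k. The factor 1 - t^r cancels against `ip r` and lowers r; the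
    -- factor 1 - t^k lowers k in the same way.
    split : ∀ k r → (1ℚ - pw t (k ℕ.+ r)) * g k r ≡ shiftʳ g k r + shiftˡ h k r
    split k r = begin
      (1ℚ - pw t (k ℕ.+ r)) * g k r ≡⟨ cong (λ w → (1ℚ - w) * g k r) (pw-+ t k r) ⟩
      (1ℚ - pw t k * pw t r) * g k r
        ≡⟨ solve 3 (λ x y g → (κ 1 :- x :* y) :* g := (κ 1 :- y) :* g :+ y :* ((κ 1 :- x) :* g)) refl (pw t k) (pw t r) (g k r) ⟩
      (1ℚ - pw t r) * g k r + pw t r * ((1ℚ - pw t k) * g k r) ≡⟨ cong₂ _+_ (gʳ k r) (hˡ k r) ⟩
      shiftʳ g k r + shiftˡ h k r ∎

  S-0 : ∀ z → S z 0 ≡ 1ℚ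
  S-0 z = trans (cong (λ w → 1ℚ * 1ℚ * w * w) (sym (inv-unique (*-identityˡ 1ℚ))))
    (solve 0 (κ 1 :* κ 1 :* κ 1 :* κ 1 := κ 1) refl)

  -- At z = 1 the factor with i = 0 vanishes.
  S-1 : ∀ n → S 1ℚ (suc n) ≡ 0ℚ
  S-1 n = *-cancelˡ (1-tⁿ≢0 n) (trans (S-step 1ℚ n) (trans (vanish n) (sym (zeroʳ _))))
    where
    vanish : ∀ n → (1ℚ - 1ℚ * pw t n) * S 1ℚ n ≡ 0ℚ
    vanish zero = solve 1 (λ x → (κ 1 :- κ 1 :* κ 1) :* x := κ 0) refl (S 1ℚ 0)
    vanish (suc n) = trans (cong ((1ℚ - 1ℚ * pw t (suc n)) *_) (S-1 n)) (zeroʳ _)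

  -- At z = t² the product of (1 - t^(i+2))/(1 - t^(i+1)) telescopes.
  S-t² : ∀ n → (1ℚ - t) * S (t * t) n ≡ 1ℚ - pw t (suc n)
  S-t² zero = trans (cong ((1ℚ - t) *_) (S-0 (t * t))) (solve 1 (λ t → (κ 1 :- t) :* κ 1 := κ 1 :- κ 1 :* t) refl t)
  S-t² (suc n) = *-cancelˡ (1-tⁿ≢0 n) (begin
    (1ℚ - pw t (suc n)) * ((1ℚ - t) * S (t * t) (suc n))
      ≡⟨ solve 3 (λ a b c → a :* (b :* c) := b :* (a :* c)) refl (1ℚ - pw t (suc n)) (1ℚ - t) (S (t * t) (suc n)) ⟩
    (1ℚ - t) * ((1ℚ - pw t (suc n)) * S (t * t) (suc n)) ≡⟨ cong ((1ℚ - t) *_) (S-step (t * t) n) ⟩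
    (1ℚ - t) * ((1ℚ - t * t * pw t n) * S (t * t) n)
      ≡⟨ solve 3 (λ x t S → (κ 1 :- t) :* ((κ 1 :- t :* t :* x) :* S) := (κ 1 :- x :* t :* t) :* ((κ 1 :- t) :* S)) refl (pw t n) t (S (t * t) n) ⟩
    (1ℚ - pw t (2 ℕ.+ n)) * ((1ℚ - t) * S (t * t) n) ≡⟨ cong ((1ℚ - pw t (2 ℕ.+ n)) *_) (S-t² n) ⟩
    (1ℚ - pw t (2 ℕ.+ n)) * (1ℚ - pw t (suc n)) ≡⟨ *-comm _ _ ⟩
    (1ℚ - pw t (suc n)) * (1ℚ - pw t (2 ℕ.+ n)) ∎)

  T-D : ∀ n → T n ≡ D n * pw (- t) n
  T-D zero = sym (*-identityʳ _)
  T-D (suc n) = trans (cong (_* pw t (suc n)) (T-D n))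
    (solve 4 (λ d w x t → d :* w :* (x :* t) := :- (d :* x) :* (w :* :- t)) refl (D n) (pw (- t) n) (pw t n) t)

  -- For s = -q and t = -1/q this is the sum of φ(dim Fix A) over the A ∈ U_m(q) of p-power order, divided by |U_m(q)|.
  R : ℕ → (ℕ → ℚ) → ℚ
  R m φ = conv (λ j n → a j * E n φ) m

  R-cong : ∀ {φ χ} → (∀ k → φ k ≡ χ k) → ∀ m → R m φ ≡ R m χ
  R-cong h = conv-cong (λ j n → cong (a j *_) (E-cong h n))

  R-+ : ∀ φ χ m → R m (λ k → φ k + χ k) ≡ R m φ + R m χ
  R-+ φ χ m = trans (conv-cong (λ j n → trans (cong (a j *_) (E-+ φ χ n)) (distribˡ _ _ _)) m) (conv-+ _ _ m)

  R-*ˡ : ∀ c φ m → R m (λ k → c * φ k) ≡ c * R m φ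
  R-*ˡ c φ m = trans (conv-cong (λ j n → trans (cong (a j *_) (E-*ˡ c φ n))
    (solve 3 (λ a c f → a :* (c :* f) := c :* (a :* f)) refl (a j) c (E n φ))) m) (conv-*ˡ c _ m)

  -- `E-recurrence` is linear and holds for every n, so it survives the convolution with a fixed
  -- sequence. The particular sequence `a` is the one that makes `R-δ₀` hold.
  R-recurrence : ∀ φ m → R m (λ k → (X k * X k - 1ℚ) * φ k) ≡
    (- s - 1ℚ) * shift (λ m → R m (λ k → φ (suc k))) m + shift (shift (λ m → R m (Ψ φ))) m
  R-recurrence φ m = begin
    conv (λ j n → a j * E n (λ k → (X k * X k - 1ℚ) * φ k)) m
      ≡⟨ conv-cong (λ j n → trans (cong (a j *_) (E-recurrence φ n))
           (trans (solve 4 (λ a c x y → a :* (c :* x :+ y) := c :* (a :* x) :+ a :* y) refl (a j) (- s - 1ℚ) (shift (λ n → E n (λ k → φ (suc k))) n) (shift (shift (λ n → E n (Ψ φ))) n))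
             (cong₂ (λ v w → (- s - 1ℚ) * v + w) (pull (a j) (λ n → E n (λ k → φ (suc k))) n)
               (trans (pull (a j) (shift (λ n → E n (Ψ φ))) n) (shift-cong (pull (a j) (λ n → E n (Ψ φ))) n))))) m ⟩
    conv (λ j n → (- s - 1ℚ) * shiftʳ (λ j n → a j * E n (λ k → φ (suc k))) j n + shiftʳ (shiftʳ (λ j n → a j * E n (Ψ φ))) j n) m
      ≡⟨ trans (conv-+ _ _ m) (cong₂ _+_ (trans (conv-*ˡ _ _ m) (cong ((- s - 1ℚ) *_) (conv-shiftʳ _ m)))
           (trans (conv-shiftʳ _ m) (shift-cong (conv-shiftʳ _) m))) ⟩
    (- s - 1ℚ) * shift (λ m → R m (λ k → φ (suc k))) m + shift (shift (λ m → R m (Ψ φ))) m ∎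
    where
    pull : ∀ c (f : ℕ → ℚ) n → c * shift f n ≡ shift (λ n → c * f n) n
    pull c f zero = zeroʳ c
    pull c f (suc n) = refl

  R-0 : ∀ φ → R 0 φ ≡ φ 0
  R-0 φ = trans (cong (λ w → 1ℚ * w * (1ℚ * 1ℚ * w * w * φ 0)) (sym (inv-unique (*-identityˡ 1ℚ))))
    (solve 1 (λ f → κ 1 :* κ 1 :* (κ 1 :* κ 1 :* κ 1 :* κ 1 :* f) := f) refl (φ 0))

  δ₀ : ℕ → ℚ
  δ₀ zero = 1ℚ
  δ₀ (suc k) = 0ℚ

  E-δ₀ : ∀ n → E n δ₀ ≡ T n * ip n
  E-δ₀ n = trans (at-zero n) (trans (cong (λ w → T n * 1ℚ * w * ip n * 1ℚ) (sym (inv-unique (*-identityˡ 1ℚ))))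
    (solve 2 (λ a b → a :* κ 1 :* κ 1 :* b :* κ 1 := a :* b) refl (T n) (ip n)))
    where
    at-zero : ∀ n → E n δ₀ ≡ e 0 n * 1ℚ
    at-zero zero = refl
    at-zero (suc n) = trans (cong (λ w → e 0 (suc n) * 1ℚ + w) (trans (conv-cong (λ k r → trans (zeroʳ _) (sym (zeroˡ 0ℚ))) n)
      (trans (conv-*ˡ 0ℚ (λ _ _ → 0ℚ) n) (zeroˡ _)))) (+-identityʳ _)

  -- The analytic counterpart of the fact that in positive rank an isometry of p-power order fixes a
  -- nonzero vector. By `T-D` the power (-t)^(j+n) leaves the convolution, and the rest is the
  -- q-binomial sum at z = 1.
  R-δ₀ : ∀ m → R (suc m) δ₀ ≡ 0ℚ
  R-δ₀ m = begin
    R (suc m) δ₀ ≡⟨ conv-cong (λ j n → trans (cong (a j *_) (E-δ₀ n)) (weight j n)) (suc m) ⟩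
    conv (λ j n → pw (- t) (j ℕ.+ n) * (D n * pw 1ℚ n * ip n * ip j)) (suc m) ≡⟨ conv-weight (pw (- t)) (λ j n → B 1ℚ n j) (suc m) ⟩
    pw (- t) (suc m) * conv (λ j n → D n * pw 1ℚ n * ip n * ip j) (suc m)
      ≡⟨ cong (pw (- t) (suc m) *_) (trans (conv-flip (λ j n → B 1ℚ n j) (suc m)) (S-1 m)) ⟩
    pw (- t) (suc m) * 0ℚ ≡⟨ zeroʳ _ ⟩
    0ℚ ∎
    where
    weight : ∀ j n → a j * (T n * ip n) ≡ pw (- t) (j ℕ.+ n) * (D n * pw 1ℚ n * ip n * ip j)
    weight j n = begin
      pw (- t) j * ip j * (T n * ip n) ≡⟨ cong (λ w → pw (- t) j * ip j * (w * ip n)) (T-D n) ⟩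
      pw (- t) j * ip j * (D n * pw (- t) n * ip n)
        ≡⟨ solve 5 (λ u i d v j → u :* i :* (d :* v :* j) := u :* v :* (d :* κ 1 :* j :* i)) refl (pw (- t) j) (ip j) (D n) (pw (- t) n) (ip n) ⟩
      pw (- t) j * pw (- t) n * (D n * 1ℚ * ip n * ip j)
        ≡⟨ cong₂ (λ v w → v * (D n * w * ip n * ip j)) (sym (pw-+ (- t) j n)) (sym (pw-1 n)) ⟩
      pw (- t) (j ℕ.+ n) * (D n * pw 1ℚ n * ip n * ip j) ∎

  -- The value at 0 may be altered freely because `R-δ₀` gives it no weight.
  R-support : ∀ m {φ χ} → (∀ k → φ (suc k) ≡ χ (suc k)) → R (suc m) φ ≡ R (suc m) χ
  R-support m {φ} {χ} h = begin
    R (suc m) φ ≡⟨ R-cong pointwise (suc m) ⟩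
    R (suc m) (λ k → χ k + (φ 0 - χ 0) * δ₀ k)
      ≡⟨ trans (R-+ χ _ (suc m)) (cong (λ w → R (suc m) χ + w) (R-*ˡ _ δ₀ (suc m))) ⟩
    R (suc m) χ + (φ 0 - χ 0) * R (suc m) δ₀ ≡⟨ cong (λ w → R (suc m) χ + (φ 0 - χ 0) * w) (R-δ₀ m) ⟩
    R (suc m) χ + (φ 0 - χ 0) * 0ℚ ≡⟨ solve 2 (λ a b → a :+ b :* κ 0 := a) refl (R (suc m) χ) (φ 0 - χ 0) ⟩
    R (suc m) χ ∎
    where
    pointwise : ∀ k → φ k ≡ χ k + (φ 0 - χ 0) * δ₀ k
    pointwise zero = solve 2 (λ a b → a := b :+ (a :- b) :* κ 1) refl (φ 0) (χ 0)
    pointwise (suc k) = trans (h k) (solve 2 (λ a b → a := a :+ b :* κ 0) refl (χ (suc k)) (φ 0 - χ 0))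

  -- Since t^(2k) = (t²)^k, this is a difference of q-binomial sums, at z = 1 and at z = t².
  E-1-x² : ∀ n → (1ℚ - t) * E (suc n) (λ k → 1ℚ - x² k) ≡ - (T (suc n) * (1ℚ - pw t (2 ℕ.+ n)))
  E-1-x² n = begin
    (1ℚ - t) * E (suc n) (λ k → 1ℚ - x² k) ≡⟨ cong ((1ℚ - t) *_) (conv-cong expand (suc n)) ⟩
    (1ℚ - t) * conv (λ k r → T (k ℕ.+ r) * (D k * pw 1ℚ k * ip k * ip r + - 1ℚ * (D k * pw (t * t) k * ip k * ip r))) (suc n)
      ≡⟨ cong ((1ℚ - t) *_) (trans (conv-weight T (λ k r → B 1ℚ k r + - 1ℚ * B (t * t) k r) (suc n)) (cong (T (suc n) *_)
           (trans (conv-+ (B 1ℚ) (λ k r → - 1ℚ * B (t * t) k r) (suc n)) (cong₂ _+_ (S-1 n) (conv-*ˡ (- 1ℚ) (B (t * t)) (suc n)))))) ⟩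
    (1ℚ - t) * (T (suc n) * (0ℚ + - 1ℚ * S (t * t) (suc n)))
      ≡⟨ solve 3 (λ t T S → (κ 1 :- t) :* (T :* (κ 0 :+ :- κ 1 :* S)) := :- (T :* ((κ 1 :- t) :* S))) refl t (T (suc n)) (S (t * t) (suc n)) ⟩
    - (T (suc n) * ((1ℚ - t) * S (t * t) (suc n))) ≡⟨ cong (λ w → - (T (suc n) * w)) (S-t² (suc n)) ⟩
    - (T (suc n) * (1ℚ - pw t (2 ℕ.+ n))) ∎
    where
    expand : ∀ k r → e k r * (1ℚ - x² k) ≡ T (k ℕ.+ r) * (D k * pw 1ℚ k * ip k * ip r + - 1ℚ * (D k * pw (t * t) k * ip k * ip r))
    expand k r = trans
      (solve 5 (λ T d i j x → T :* d :* i :* j :* (κ 1 :- x) := T :* (d :* κ 1 :* i :* j :+ :- κ 1 :* (d :* x :* i :* j)))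
        refl (T (k ℕ.+ r)) (D k) (ip k) (ip r) (x² k))
      (cong₂ (λ v w → T (k ℕ.+ r) * (D k * v * ip k * ip r + - 1ℚ * (D k * w * ip k * ip r))) (sym (pw-1 k)) (sym (pw-distrib t t k)))

  E-1-x²-0 : E 0 (λ k → 1ℚ - x² k) ≡ 0ℚ
  E-1-x²-0 = solve 1 (λ e → e :* (κ 1 :- κ 1 :* κ 1) := κ 0) refl (e 0 0)

  s≢0 : s ≢ 0ℚ
  s≢0 e = 1≤⇒≢0 ℚP.≤-refl (trans (sym st) (trans (cong (_* t) e) (zeroˡ t)))

  1-t≢0 : 1ℚ - t ≢ 0ℚ
  1-t≢0 = subst (λ x → 1ℚ - x ≢ 0ℚ) (*-identityˡ t) (1-tⁿ≢0 0)

  powQ-pw : ∀ x k → powQ x k ≡ pw x k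
  powQ-pw x zero = refl
  powQ-pw x (suc k) = trans (*-unfold (powQ x k) x) (cong (_* x) (powQ-pw x k))

  sum₁ : ℕ → (ℕ → ℚ) → ℚ
  sum₁ zero f = 0ℚ
  sum₁ (suc m) f = sum₁ m f + f (suc m)

  sumQ1-cong : ∀ m {f g} → (∀ i → f i ≡ g i) → sumQ1 m f ≡ sum₁ m g
  sumQ1-cong zero h = refl
  sumQ1-cong (suc m) {f} h = trans (+-unfold (sumQ1 m f) (f (suc m))) (cong₂ _+_ (sumQ1-cong m h) (h (suc m)))

  sum₁-cong : ∀ m {f g} → (∀ i → i ℕ.< m → f (suc i) ≡ g (suc i)) → sum₁ m f ≡ sum₁ m g
  sum₁-cong zero h = refl
  sum₁-cong (suc m) h = cong₂ _+_ (sum₁-cong m (λ i i<m → h i (ℕP.m≤n⇒m≤1+n i<m))) (h m ℕP.≤-refl)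

  sum₁-*ˡ : ∀ m c f → sum₁ m (λ i → c * f i) ≡ c * sum₁ m f
  sum₁-*ˡ zero c f = sym (zeroʳ c)
  sum₁-*ˡ (suc m) c f = trans (cong (_+ c * f (suc m)) (sum₁-*ˡ m c f)) (sym (distribˡ _ _ _))

  conv-sum₁ : ∀ (f : ℕ → ℕ → ℚ) m → conv f m ≡ f 0 m + sum₁ m (λ i → f i (m ℕ.∸ i))
  conv-sum₁ f zero = sym (+-identityʳ _)
  conv-sum₁ f (suc m) = begin
    conv f (suc m) ≡⟨ conv-last f m ⟩
    conv (λ k r → f k (suc r)) m + f (suc m) 0 ≡⟨ cong (_+ f (suc m) 0) (conv-sum₁ _ m) ⟩
    f 0 (suc m) + sum₁ m (λ i → f i (suc (m ℕ.∸ i))) + f (suc m) 0 ≡⟨ +-assoc _ _ _ ⟩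
    f 0 (suc m) + (sum₁ m (λ i → f i (suc (m ℕ.∸ i))) + f (suc m) 0)
      ≡⟨ cong₂ (λ v w → f 0 (suc m) + (v + f (suc m) w))
           (sum₁-cong m (λ i i<m → cong (f (suc i)) (sym (ℕP.+-∸-assoc 1 i<m)))) (sym (ℕP.n∸n≡0 m)) ⟩
    f 0 (suc m) + (sum₁ m (λ i → f i (suc m ℕ.∸ i)) + f (suc m) (m ℕ.∸ m)) ∎

  -- Matches the recursive exponent 1 + 2 + ... + i of `T` with the quotient i(i+1)/2 of natural
  -- numbers that `formula` contains.
  T-triangle : ∀ i → pw s ((i ℕ.* suc i) ℕ./ 2) * T i ≡ 1ℚ
  T-triangle zero = *-identityˡ 1ℚ
  T-triangle (suc i) = begin
    pw s ((suc i ℕ.* suc (suc i)) ℕ./ 2) * (T i * pw t (suc i))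
      ≡⟨ cong (λ k → pw s k * (T i * pw t (suc i))) triangle ⟩
    pw s ((i ℕ.* suc i) ℕ./ 2 ℕ.+ suc i) * (T i * pw t (suc i))
      ≡⟨ cong (_* (T i * pw t (suc i))) (pw-+ s ((i ℕ.* suc i) ℕ./ 2) (suc i)) ⟩
    pw s ((i ℕ.* suc i) ℕ./ 2) * pw s (suc i) * (T i * pw t (suc i))
      ≡⟨ solve 4 (λ a b c d → a :* b :* (c :* d) := a :* c :* (b :* d)) refl (pw s ((i ℕ.* suc i) ℕ./ 2)) (pw s (suc i)) (T i) (pw t (suc i)) ⟩
    pw s ((i ℕ.* suc i) ℕ./ 2) * T i * (pw s (suc i) * pw t (suc i)) ≡⟨ cong₂ _*_ (T-triangle i) (pw-inverse st (suc i)) ⟩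
    1ℚ * 1ℚ ≡⟨ *-identityˡ 1ℚ ⟩
    1ℚ ∎
    where
    triangle : (suc i ℕ.* suc (suc i)) ℕ./ 2 ≡ (i ℕ.* suc i) ℕ./ 2 ℕ.+ suc i
    triangle = trans (cong (ℕ._/ 2) (arith i)) (trans (ℕD.+-distrib-/-∣ʳ (i ℕ.* suc i) (ℕDiv.n∣m*n (suc i)))
      (cong ((i ℕ.* suc i) ℕ./ 2 ℕ.+_) (ℕD.m*n/n≡m (suc i) 2)))
      where
      arith : ∀ i → suc i ℕ.* suc (suc i) ≡ i ℕ.* suc i ℕ.+ suc i ℕ.* 2
      arith = ℕSolver.solve-∀

  -- The term `formula` with its rational parameter made a variable, so that the opaque `ι q` can be
  -- exchanged for `fromℕ q`.
  formulaAt : ℚ → ℕ → ℚ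
  formulaAt Q m = (1ℚ ÷' (powQ Q m ℚ.* (Q ℚ.+ 1ℚ))) ℚ.*
    sumQ1 m (λ i → (powQ (ℚ.- 1ℚ) i ℚ.* (powQ (ℚ.- Q) (suc i) ℚ.- 1ℚ))
      ÷' (powQ (ℚ.- Q) ((i ℕ.* suc i) ℕ./ 2) ℚ.* qPoch (ℚ.- (1ℚ ÷' Q)) (m ℕ.∸ i)))

  module _ (q : ℕ) (s≡-q : s ≡ - ι q) where

    private
      u = ι q

    u-t : u * - t ≡ 1ℚ
    u-t = trans (solve 2 (λ u t → u :* :- t := :- u :* t) refl u t) (trans (cong (_* t) (sym s≡-q)) st)

    u≢0 : u ≢ 0ℚ
    u≢0 e = 1≤⇒≢0 ℚP.≤-refl (trans (sym u-t) (trans (cong (_* - t) e) (zeroˡ (- t))))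

    -inv-u : - (1ℚ ÷' u) ≡ t
    -inv-u = trans (cong -_ (trans (÷'-inv 1ℚ u≢0) (trans (*-identityˡ _) (sym (inv-unique u-t)))))
      (solve 1 (λ t → :- (:- t) := t) refl t)

    -u : ℚ.- u ≡ s
    -u = trans (neg-unfold u) (sym s≡-q)

    qPoch-poch : ∀ j → qPoch (ℚ.- (1ℚ ÷' u)) j ≡ poch j
    qPoch-poch zero = refl
    qPoch-poch (suc j) = trans (*-unfold (qPoch v j) (1ℚ ℚ.- powQ v (suc j))) (cong₂ _*_ (qPoch-poch j)
      (trans (minus-unfold 1ℚ (powQ v (suc j))) (cong (λ w → 1ℚ - w) (trans (powQ-pw v (suc j))
        (cong (λ w → pw w (suc j)) (trans (neg-unfold (1ℚ ÷' u)) -inv-u))))))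
      where v = ℚ.- (1ℚ ÷' u)

    -- The term i = 0 of the convolution vanishes, which is why the formula starts at i = 1. Its
    -- prefactor 1/(q^m (q+1)) comes from (-t)^(m-i) = q^(i-m) and from the denominator 1 - t =
    -- (q+1)/q of `S-t²`.
    R-1-x² : ∀ m → R m (λ k → 1ℚ - pw t k * pw t k) ≡ formula q m
    R-1-x² m = begin
      R m ψ ≡⟨ trans (conv-flip _ m) (conv-sum₁ (λ n j → a j * E n ψ) m) ⟩
      a m * E 0 ψ + sum₁ m (λ i → a (m ℕ.∸ i) * E i ψ)
        ≡⟨ trans (cong (λ w → a m * w + sum₁ m (λ i → a (m ℕ.∸ i) * E i ψ)) E-1-x²-0) (trans (cong (_+ sum₁ m (λ i → a (m ℕ.∸ i) * E i ψ)) (zeroʳ _)) (+-identityˡ _)) ⟩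
      sum₁ m (λ i → a (m ℕ.∸ i) * E i ψ) ≡⟨ sum₁-cong m term ⟩
      sum₁ m (λ i → inv (pw u m * (u + 1ℚ)) * G i) ≡⟨ sum₁-*ˡ m _ G ⟩
      inv (pw u m * (u + 1ℚ)) * sum₁ m G ≡⟨ cong₂ _*_ (sym prefactor) (sym (sumQ1-cong m summand)) ⟩
      (1ℚ ÷' (powQ u m ℚ.* (u ℚ.+ 1ℚ))) * sumQ1 m H ≡⟨ sym (*-unfold (1ℚ ÷' (powQ u m ℚ.* (u ℚ.+ 1ℚ))) (sumQ1 m H)) ⟩
      formulaAt u m ≡⟨ cong (λ Q → formulaAt Q m) (sym (ι-unfold q)) ⟩
      formula q m ∎
      where
      ψ : ℕ → ℚ
      ψ k = 1ℚ - pw t k * pw t k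

      G : ℕ → ℚ
      G i = pw (- 1ℚ) i * (pw s (suc i) - 1ℚ) * (T i * ip (m ℕ.∸ i))

      u+1≢0 : u + 1ℚ ≢ 0ℚ
      u+1≢0 e = 1≤⇒≢0 (1≤ι-suc q) (trans (ι-suc q) (trans (+-comm _ _) e))

      den≢0 : pw u m * (u + 1ℚ) ≢ 0ℚ
      den≢0 = *-≢0 (pw-≢0 u≢0 m) u+1≢0

      prefactor : 1ℚ ÷' (powQ u m ℚ.* (u ℚ.+ 1ℚ)) ≡ inv (pw u m * (u + 1ℚ))
      prefactor = trans (cong (1ℚ ÷'_) (trans (*-unfold (powQ u m) (u ℚ.+ 1ℚ)) (cong₂ _*_ (powQ-pw u m) (+-unfold u 1ℚ))))
        (trans (÷'-inv 1ℚ den≢0) (*-identityˡ _))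

      H : ℕ → ℚ
      H i = (powQ (ℚ.- 1ℚ) i ℚ.* (powQ (ℚ.- u) (suc i) ℚ.- 1ℚ)) ÷' (powQ (ℚ.- u) ((i ℕ.* suc i) ℕ./ 2) ℚ.* qPoch (ℚ.- (1ℚ ÷' u)) (m ℕ.∸ i))

      summand : ∀ i → H i ≡ G i
      summand i = begin
        H i
          ≡⟨ cong₂ _÷'_
               (trans (*-unfold (powQ (ℚ.- 1ℚ) i) (powQ (ℚ.- u) (suc i) ℚ.- 1ℚ)) (cong₂ _*_ (trans (powQ-pw (ℚ.- 1ℚ) i) (cong (λ x → pw x i) (neg-unfold 1ℚ)))
                 (trans (minus-unfold (powQ (ℚ.- u) (suc i)) 1ℚ) (cong (_- 1ℚ) (trans (powQ-pw (ℚ.- u) (suc i)) (cong (λ x → pw x (suc i)) -u))))))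
               (trans (*-unfold (powQ (ℚ.- u) tri) (qPoch (ℚ.- (1ℚ ÷' u)) (m ℕ.∸ i))) (cong₂ _*_ (trans (powQ-pw (ℚ.- u) tri) (cong (λ x → pw x tri) -u)) (qPoch-poch (m ℕ.∸ i)))) ⟩
        (pw (- 1ℚ) i * (pw s (suc i) - 1ℚ)) ÷' (pw s tri * poch (m ℕ.∸ i))
          ≡⟨ ÷'-inv _ (*-≢0 (pw-≢0 s≢0 tri) (poch≢0 (m ℕ.∸ i))) ⟩
        pw (- 1ℚ) i * (pw s (suc i) - 1ℚ) * inv (pw s tri * poch (m ℕ.∸ i))
          ≡⟨ cong (pw (- 1ℚ) i * (pw s (suc i) - 1ℚ) *_) (sym (inv-unique (begin
               pw s tri * poch (m ℕ.∸ i) * (T i * ip (m ℕ.∸ i))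
                 ≡⟨ solve 4 (λ a b c d → a :* b :* (c :* d) := a :* c :* (b :* d)) refl (pw s tri) (poch (m ℕ.∸ i)) (T i) (ip (m ℕ.∸ i)) ⟩
               pw s tri * T i * (poch (m ℕ.∸ i) * ip (m ℕ.∸ i)) ≡⟨ cong₂ _*_ (T-triangle i) (inv-inverseʳ (poch≢0 (m ℕ.∸ i))) ⟩
               1ℚ * 1ℚ ≡⟨ *-identityˡ 1ℚ ⟩
               1ℚ ∎))) ⟩
        G i ∎
        where tri = (i ℕ.* suc i) ℕ./ 2

      term : ∀ i → i ℕ.< m → a (m ℕ.∸ suc i) * E (suc i) ψ ≡ inv (pw u m * (u + 1ℚ)) * G (suc i)
      term i i<m = *-cancelˡ den≢0 (*-cancelˡ 1-t≢0 (begin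
        (1ℚ - t) * (pw u m * (u + 1ℚ) * (pw (- t) j * ip j * E n ψ))
          ≡⟨ cong (λ w → (1ℚ - t) * (w * (u + 1ℚ) * (pw (- t) j * ip j * E n ψ)))
               (trans (cong (pw u) (sym (ℕP.m∸n+n≡m i<m))) (pw-+ u j n)) ⟩
        (1ℚ - t) * (pw u j * pw u n * (u + 1ℚ) * (pw (- t) j * ip j * E n ψ))
          ≡⟨ solve 7 (λ t b c u d i e → (κ 1 :- t) :* (b :* c :* (u :+ κ 1) :* (d :* i :* e))
               := (b :* d) :* c :* (u :+ κ 1) :* i :* ((κ 1 :- t) :* e)) refl t (pw u j) (pw u n) u (pw (- t) j) (ip j) (E n ψ) ⟩
        pw u j * pw (- t) j * pw u n * (u + 1ℚ) * ip j * ((1ℚ - t) * E n ψ)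
          ≡⟨ cong₂ (λ v w → v * pw u n * (u + 1ℚ) * ip j * w) (pw-inverse u-t j) (E-1-x² i) ⟩
        1ℚ * pw u n * (u + 1ℚ) * ip j * - (T n * (1ℚ - pw t n * t))
          ≡⟨ cong (λ w → 1ℚ * w * (u + 1ℚ) * ip j * - (T n * (1ℚ - pw t n * t))) un ⟩
        1ℚ * (pw (- 1ℚ) n * pw s n) * (u + 1ℚ) * ip j * - (T n * (1ℚ - pw t n * t))
          ≡⟨ linear₃ ((t - s * t) * M) (pw-inverse st n) ((pw s n - 1ℚ) * M) st (- (pw s n * (1ℚ - pw t n * t) * M)) s≡-q
               (solve 8 (λ ε Y y u s t T i → κ 1 :* (ε :* Y) :* (u :+ κ 1) :* i :* :- (T :* (κ 1 :- y :* t))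
                    :+ (t :- s :* t) :* (ε :* T :* i) :* κ 1 :+ (Y :- κ 1) :* (ε :* T :* i) :* κ 1 :+ :- (Y :* (κ 1 :- y :* t) :* (ε :* T :* i)) :* (:- u)
                  := (κ 1 :- t) :* (ε :* (Y :* s :- κ 1) :* (T :* i))
                    :+ (t :- s :* t) :* (ε :* T :* i) :* (Y :* y) :+ (Y :- κ 1) :* (ε :* T :* i) :* (s :* t) :+ :- (Y :* (κ 1 :- y :* t) :* (ε :* T :* i)) :* s)
                  refl (pw (- 1ℚ) n) (pw s n) (pw t n) u s t (T n) (ip j)) ⟩
        (1ℚ - t) * G n ≡⟨ cong ((1ℚ - t) *_) (sym (trans (sym (*-assoc _ _ _)) (trans (cong (_* G n) (inv-inverseʳ den≢0)) (*-identityˡ _)))) ⟩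
        (1ℚ - t) * (pw u m * (u + 1ℚ) * (inv (pw u m * (u + 1ℚ)) * G n)) ∎))
        where
        n = suc i
        j = m ℕ.∸ suc i
        M = pw (- 1ℚ) n * T n * ip j
        un : pw u n ≡ pw (- 1ℚ) n * pw s n
        un = trans (cong (λ x → pw x n) (trans (solve 1 (λ u → u := :- κ 1 :* :- u) refl u) (cong (- 1ℚ *_) (sym s≡-q)))) (pw-distrib (- 1ℚ) s n)

-- The parameters s = -q and t = -1/q

module Formula (q : ℕ) (2≤q : 2 ℕ.≤ q) where

  open Rat
  open Powers
  open Convolution
  open ℚS hiding (_:^_)
  open ≡-Reasoning

  u s t : ℚ
  u = ι q
  s = - u
  t = - inv u

  u≢0 : u ≢ 0ℚ
  u≢0 = 1≤⇒≢0 (subst (_≤ u) ι-1 (ι-mono {1} (ℕP.≤-trans (ℕ.s≤s ℕ.z≤n) 2≤q)))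

  ut : u * inv u ≡ 1ℚ
  ut = inv-inverseʳ u≢0

  st : s * t ≡ 1ℚ
  st = trans (solve 2 (λ u i → :- u :* :- i := u :* i) refl u (inv u)) ut

  ι-^ : ∀ k n → ι (k ℕ.^ n) ≡ pw (ι k) n
  ι-^ k zero = ι-1
  ι-^ k (suc n) = trans (ι-* k (k ℕ.^ n)) (trans (*-comm _ _) (cong (_* ι k) (ι-^ k n)))

  ι≢1 : ∀ {k} → 2 ℕ.≤ k → ι k ≢ 1ℚ
  ι≢1 (ℕ.s≤s (ℕ.s≤s {n = n} _)) e = 1≤⇒≢0 (1≤ι-suc n) (linear₁ 1ℚ (trans (sym (ι-suc (suc n))) e)
    (solve 1 (λ a → a :+ κ 1 :* κ 1 := κ 0 :+ κ 1 :* (κ 1 :+ a)) refl (ι (suc n))))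

  s² : ∀ k → pw s k * pw s k ≡ pw (u * u) k
  s² k = trans (sym (pw-distrib s s k)) (cong (λ x → pw x k) (solve 1 (λ u → :- u :* :- u := u :* u) refl u))

  uu^ : ∀ k → pw (u * u) k ≡ ι ((q ℕ.* q) ℕ.^ k)
  uu^ k = sym (trans (ι-^ (q ℕ.* q) k) (cong (λ x → pw x k) (ι-* q q)))

  uu^≢1 : ∀ n → pw (u * u) (suc n) ≢ 1ℚ
  uu^≢1 n e = ι≢1 big (trans (sym (uu^ (suc n))) e)
    where
    1≤ : 1 ℕ.≤ (q ℕ.* q) ℕ.^ n
    1≤ = ℕP.m^n>0 (q ℕ.* q) {{ℕ.>-nonZero (ℕP.*-mono-≤ (ℕP.≤-trans (ℕ.s≤s ℕ.z≤n) 2≤q) (ℕP.≤-trans (ℕ.s≤s ℕ.z≤n) 2≤q))}} n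
    big : 2 ℕ.≤ (q ℕ.* q) ℕ.^ suc n
    big = ℕP.*-mono-≤ (ℕP.≤-trans 2≤q (ℕP.m≤m*n q q {{ℕ.>-nonZero (ℕP.≤-trans (ℕ.s≤s ℕ.z≤n) 2≤q)}})) 1≤

  -- If a positive power of t were 1, so would be the same power of s; squaring removes the sign and
  -- leaves a positive power of q² equal to 1.
  1-tⁿ≢0 : ∀ n → 1ℚ - pw t (suc n) ≢ 0ℚ
  1-tⁿ≢0 n e = uu^≢1 n (trans (sym (s² (suc n))) (begin
    Y * Y ≡⟨ linear₂ (Y * Y + Y) e (Y + 1ℚ) (pw-inverse st (suc n))
               (solve 2 (λ Y x → Y :* Y :+ (Y :* Y :+ Y) :* κ 0 :+ (Y :+ κ 1) :* κ 1
                 := κ 1 :+ (Y :* Y :+ Y) :* (κ 1 :- x) :+ (Y :+ κ 1) :* (Y :* x)) refl Y (pw t (suc n))) ⟩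
    1ℚ ∎))
    where Y = pw s (suc n)

-- Binomial coefficients modulo a prime

choose : ℕ → ℕ → ℕ
choose n zero = 1
choose zero (suc k) = 0
choose (suc n) (suc k) = choose n k ℕ.+ choose n (suc k)

choose-above : ∀ n k → n ℕ.< k → choose n k ≡ 0
choose-above zero (suc k) _ = refl
choose-above (suc n) (suc k) (ℕ.s≤s n<k) = cong₂ ℕ._+_ (choose-above n k n<k) (choose-above n (suc k) (ℕP.m<n⇒m<1+n n<k))

choose-diagonal : ∀ n → choose n n ≡ 1
choose-diagonal zero = refl
choose-diagonal (suc n) = cong₂ ℕ._+_ (choose-diagonal n) (choose-above n (suc n) ℕP.≤-refl)

choose-absorb : ∀ n k → suc k ℕ.* choose (suc n) (suc k) ≡ suc n ℕ.* choose n k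
choose-absorb zero zero = refl
choose-absorb zero (suc k) = ℕP.*-zeroʳ k
choose-absorb (suc n) zero = trans (ℕP.+-identityʳ _) (cong suc (trans (sym (ℕP.+-identityʳ _)) (choose-absorb n zero)))
choose-absorb (suc n) (suc k) = begin
  (2 ℕ.+ k) ℕ.* (x ℕ.+ y) ≡⟨ split k x y ⟩
  suc k ℕ.* x ℕ.+ x ℕ.+ (2 ℕ.+ k) ℕ.* y ≡⟨ cong₂ (λ v w → v ℕ.+ x ℕ.+ w) (choose-absorb n k) (choose-absorb n (suc k)) ⟩
  suc n ℕ.* choose n k ℕ.+ x ℕ.+ suc n ℕ.* choose n (suc k) ≡⟨ join n (choose n k) (choose n (suc k)) ⟩
  (2 ℕ.+ n) ℕ.* x ∎
  where
  open ≡-Reasoning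
  x = choose (suc n) (suc k)
  y = choose (suc n) (suc (suc k))
  split : ∀ k x y → (2 ℕ.+ k) ℕ.* (x ℕ.+ y) ≡ suc k ℕ.* x ℕ.+ x ℕ.+ (2 ℕ.+ k) ℕ.* y
  split = ℕSolver.solve-∀
  join : ∀ n a b → suc n ℕ.* a ℕ.+ (a ℕ.+ b) ℕ.+ suc n ℕ.* b ≡ (2 ℕ.+ n) ℕ.* (a ℕ.+ b)
  join = ℕSolver.solve-∀

-- By `choose-absorb` the prime divides the product of k + 1 and the coefficient, and k + 1 is too
-- small to be divisible by it.
prime∣choose : ∀ {n} → Prime (suc n) → ∀ k → k ℕ.< n → suc n ℕDiv.∣ choose (suc n) (suc k)
prime∣choose {n} pr k k<n with euclidsLemma (suc k) (choose (suc n) (suc k)) pr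
    (ℕDiv.divides (choose n k) (trans (choose-absorb n k) (ℕP.*-comm (suc n) _)))
... | inj₁ p∣k = ⊥-elim (ℕP.<⇒≱ (ℕ.s≤s k<n) (ℕDiv.∣⇒≤ p∣k))
... | inj₂ p∣c = p∣c

-- Iteration, and (1 + T)^p = 1 + T^p in exponent p

module _ {A : Set} where

  iterate : (A → A) → ℕ → A → A
  iterate f zero x = x
  iterate f (suc n) x = f (iterate f n x)

  iterate-+ : ∀ f m n x → iterate f (m ℕ.+ n) x ≡ iterate f m (iterate f n x)
  iterate-+ f zero n x = refl
  iterate-+ f (suc m) n x = cong f (iterate-+ f m n x)

  iterate-* : ∀ f m n x → iterate f (m ℕ.* n) x ≡ iterate (iterate f n) m x
  iterate-* f zero n x = refl
  iterate-* f (suc m) n x = trans (iterate-+ f n (m ℕ.* n) x) (cong (iterate f n) (iterate-* f m n x))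

  iterate-cong : ∀ {f g : A → A} → (∀ x → f x ≡ g x) → ∀ n x → iterate f n x ≡ iterate g n x
  iterate-cong h zero x = refl
  iterate-cong {f} {g} h (suc n) x = trans (h _) (cong g (iterate-cong h n x))

  iterate-fixed : ∀ {f : A → A} {x} → f x ≡ x → ∀ n → iterate f n x ≡ x
  iterate-fixed e zero = refl
  iterate-fixed {f} e (suc n) = trans (cong f (iterate-fixed e n)) e

module Frobenius {M : Set} (add : M → M → M) (0# : M) (isCM : IsCommutativeMonoid _≡_ add 0#) where

  private
    infixl 6 _+_
    _+_ : M → M → M
    _+_ = add

  monoid : CommutativeMonoid _ _
  monoid = record { isCommutativeMonoid = isCM }

  open CommutativeMonoid monoid using (assoc; comm; identityˡ; identityʳ)
  module Mult = Algebra.Properties.CommutativeMonoid.Mult monoid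
  open Mult using () renaming (_×_ to _×#_)
  open ≡-Reasoning

  sumBelow : (ℕ → M) → ℕ → M
  sumBelow f zero = 0#
  sumBelow f (suc n) = f 0 + sumBelow (λ k → f (suc k)) n

  interchange : ∀ a b c d → (a + b) + (c + d) ≡ (a + c) + (b + d)
  interchange a b c d = begin
    (a + b) + (c + d) ≡⟨ assoc a b _ ⟩
    a + (b + (c + d)) ≡⟨ cong (a +_) (trans (sym (assoc b c d)) (trans (cong (_+ d) (comm b c)) (assoc c b d))) ⟩
    a + (c + (b + d)) ≡⟨ sym (assoc a c _) ⟩
    (a + c) + (b + d) ∎

  sumBelow-cong : ∀ {f g} n → (∀ k → k ℕ.< n → f k ≡ g k) → sumBelow f n ≡ sumBelow g n
  sumBelow-cong zero h = refl
  sumBelow-cong (suc n) h = cong₂ _+_ (h 0 (ℕ.s≤s ℕ.z≤n)) (sumBelow-cong n (λ k k<n → h (suc k) (ℕ.s≤s k<n)))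

  sumBelow-+ : ∀ f g n → sumBelow (λ k → f k + g k) n ≡ sumBelow f n + sumBelow g n
  sumBelow-+ f g zero = sym (identityˡ 0#)
  sumBelow-+ f g (suc n) = trans (cong ((f 0 + g 0) +_) (sumBelow-+ _ _ n)) (interchange _ _ _ _)

  sumBelow-zero : ∀ n → sumBelow (λ _ → 0#) n ≡ 0#
  sumBelow-zero zero = refl
  sumBelow-zero (suc n) = trans (identityˡ _) (sumBelow-zero n)

  sumBelow-last : ∀ f n → sumBelow f (suc n) ≡ sumBelow f n + f n
  sumBelow-last f zero = comm _ _
  sumBelow-last f (suc n) = trans (cong (f 0 +_) (sumBelow-last (λ k → f (suc k)) n)) (sym (assoc _ _ _))

  binomialSum : ℕ → (ℕ → M) → M
  binomialSum n f = sumBelow (λ k → choose n k ×# f k) (suc n)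

  binomialSum-suc : ∀ n f → binomialSum (suc n) f ≡ binomialSum n f + binomialSum n (λ k → f (suc k))
  binomialSum-suc n f = begin
    1 ×# f 0 + sumBelow (λ k → (choose n k ℕ.+ choose n (suc k)) ×# f (suc k)) (suc n)
      ≡⟨ cong (1 ×# f 0 +_) (trans (sumBelow-cong (suc n) (λ k _ → Mult.×-homo-+ (f (suc k)) (choose n k) (choose n (suc k)))) (sumBelow-+ (λ k → choose n k ×# f (suc k)) (λ k → choose n (suc k) ×# f (suc k)) (suc n))) ⟩
    1 ×# f 0 + (binomialSum n (λ k → f (suc k)) + sumBelow (λ k → choose n (suc k) ×# f (suc k)) (suc n))
      ≡⟨ trans (cong (1 ×# f 0 +_) (comm _ _)) (sym (assoc _ _ _)) ⟩
    sumBelow (λ k → choose n k ×# f k) (suc (suc n)) + binomialSum n (λ k → f (suc k))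
      ≡⟨ cong (_+ binomialSum n (λ k → f (suc k))) (trans (sumBelow-last (λ k → choose n k ×# f k) (suc n))
           (trans (cong (λ c → binomialSum n f + (c ×# f (suc n))) (choose-above n (suc n) ℕP.≤-refl)) (identityʳ _))) ⟩
    binomialSum n f + binomialSum n (λ k → f (suc k)) ∎

  module _ (T : M → M) (T-+ : ∀ x y → T (x + y) ≡ T x + T y) (T-0 : T 0# ≡ 0#) where

    T-sum : ∀ f n → T (sumBelow f n) ≡ sumBelow (λ k → T (f k)) n
    T-sum f zero = T-0
    T-sum f (suc n) = trans (T-+ _ _) (cong (T (f 0) +_) (T-sum _ n))

    T-× : ∀ n x → T (n ×# x) ≡ n ×# T x
    T-× zero x = T-0
    T-× (suc n) x = trans (T-+ _ _) (cong (T x +_) (T-× n x))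

    iterate-binomial : ∀ n x → iterate (λ y → y + T y) n x ≡ binomialSum n (λ k → iterate T k x)
    iterate-binomial zero x = sym (trans (identityʳ _) (identityʳ _))
    iterate-binomial (suc n) x = begin
      iterate (λ y → y + T y) n x + T (iterate (λ y → y + T y) n x) ≡⟨ cong (λ z → z + T z) (iterate-binomial n x) ⟩
      binomialSum n (λ k → iterate T k x) + T (binomialSum n (λ k → iterate T k x))
        ≡⟨ cong (binomialSum n (λ k → iterate T k x) +_) (trans (T-sum (λ k → choose n k ×# iterate T k x) (suc n)) (sumBelow-cong (suc n) (λ k _ → T-× (choose n k) (iterate T k x)))) ⟩
      binomialSum n (λ k → iterate T k x) + binomialSum n (λ k → iterate T (suc k) x) ≡⟨ sym (binomialSum-suc n (λ k → iterate T k x)) ⟩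
      binomialSum (suc n) (λ k → iterate T k x) ∎

    -- The inner binomial coefficients are multiples of p and annihilate the monoid. Formulated for
    -- an additive map so as to serve twice: for multiplication by a scalar in the field, and for A
    -- - 1 on the space.
    frobenius : ∀ {p} → Prime p → (∀ x → p ×# x ≡ 0#) → ∀ x → iterate (λ y → y + T y) p x ≡ x + iterate T p x
    frobenius {zero} pr _ x = ⊥-elim (ℕ.≢-nonZero⁻¹ 0 {{prime⇒nonZero pr}} refl)
    frobenius {suc p} pr torsion x = begin
      iterate (λ y → y + T y) (suc p) x ≡⟨ iterate-binomial (suc p) x ⟩
      1 ×# x + sumBelow g (suc p) ≡⟨ cong₂ _+_ (identityʳ x) (sumBelow-last g p) ⟩
      x + (sumBelow g p + g p) ≡⟨ cong₂ (λ v w → x + (v + (w ×# iterate T (suc p) x)))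
          (trans (sumBelow-cong p (λ k k<p → multiple _ (prime∣choose pr k k<p))) (sumBelow-zero p)) (choose-diagonal (suc p)) ⟩
      x + (0# + (1 ×# iterate T (suc p) x)) ≡⟨ cong (x +_) (trans (identityˡ _) (identityʳ _)) ⟩
      x + iterate T (suc p) x ∎
      where
      g : ℕ → M
      g k = choose (suc p) (suc k) ×# iterate T (suc k) x
      multiple : ∀ {c} y → suc p ℕDiv.∣ c → c ×# y ≡ 0#
      multiple y (ℕDiv.divides d refl) = trans (sym (Mult.×-assocˡ y d (suc p))) (trans (cong (d ×#_) (torsion y)) (vanish d))
        where
        vanish : ∀ d → d ×# 0# ≡ 0#
        vanish zero = refl
        vanish (suc d) = trans (identityˡ _) (vanish d)

module _ {A : Set} where
  open Sums
  open Rat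

  sumL-filter : {P : A → Set} (P? : ∀ x → Dec (P x)) (xs : List A) → sumL (λ x → 𝟙 (P? x)) xs ≡ ι (length (filter P? xs))
  sumL-filter P? [] = sym ι-0
  sumL-filter P? (x ∷ xs) with P? x
  ... | yes _ = trans (cong (1ℚ +_) (sumL-filter P? xs)) (sym (ι-suc _))
  ... | no _ = trans (+-identityˡ _) (sumL-filter P? xs)

-- The finite field: characteristic, Frobenius map, traces and norms

module FiniteField (p q e : ℕ) (pr : Prime p) (1≤e : 1 ℕ.≤ e) (q≡pᵉ : q ≡ p ℕ.^ e)
  {F : Set} (add mul : F → F → F) (neg : F → F) (0# 1# : F) (isCR : IsCommutativeRing _≡_ add mul neg 0# 1#)
  (_≟_ : ∀ (x y : F) → Dec (x ≡ y)) (elems : List F) (complete : ∀ x → x ∈ elems)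
  (distinct : AllPairs (λ x y → ¬ (x ≡ y)) elems) (card : length elems ≡ q ℕ.^ 2)
  (1≢0 : ¬ (1# ≡ 0#)) (inverse : ∀ x → ¬ (x ≡ 0#) → ∃ λ y → mul x y ≡ 1#) where

  private
    infixl 6 _+_
    infixl 7 _*_
    infix 8 -_
    _+_ _*_ : F → F → F
    _+_ = add
    _*_ = mul
    -_ : F → F
    -_ = neg
    infixl 6 _-_
    _-_ : F → F → F
    x - y = add x (- y)

  module FS = IntegerSolver add mul neg 0# 1# isCR
  open FS using (linear₁; linear₂; solve; _:+_; _:*_; :-_; _:-_; _:=_; κ)
  open IsCommutativeRing isCR
    using (+-assoc; +-comm; +-identityˡ; +-identityʳ; *-assoc; *-comm; *-identityˡ; *-identityʳ; zeroˡ; zeroʳ; distribˡ; distribʳ; +-isCommutativeMonoid)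
  open ≡-Reasoning
  module Fr = Frobenius add 0# +-isCommutativeMonoid
  open Fr.Mult using () renaming (_×_ to _×#_)

  module ℚO = Rat
  open Sums

  Fˢ : FinSet
  Fˢ = record { Carrier = F ; _~_ = _≡_ ; isEquivalence = ≡.isEquivalence ; _~?_ = _≟_
              ; elems = elems ; complete = complete ; distinct = distinct }

  power : F → ℕ → F
  power x zero = 1#
  power x (suc k) = power x k * x

  σ : F → F
  σ x = power x q

  no-zero-divisors : ∀ {x y} → x * y ≡ 0# → ¬ (x ≡ 0#) → y ≡ 0#
  no-zero-divisors {x} {y} xy≡0 x≢0 = linear₂ (- y) (proj₂ (inverse x x≢0)) (proj₁ (inverse x x≢0)) xy≡0
    (solve 3 (λ x y i → y :+ :- y :* κ 1 :+ i :* κ 0 := κ 0 :+ :- y :* (x :* i) :+ i :* (x :* y)) refl x y (proj₁ (inverse x x≢0)))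

  power-* : ∀ x y k → power (x * y) k ≡ power x k * power y k
  power-* x y zero = sym (*-identityˡ _)
  power-* x y (suc k) = trans (cong (_* (x * y)) (power-* x y k))
    (solve 4 (λ a b x y → a :* b :* (x :* y) := a :* x :* (b :* y)) refl (power x k) (power y k) x y)

  power-+ : ∀ x j k → power x (j ℕ.+ k) ≡ power x j * power x k
  power-+ x zero k = sym (*-identityˡ _)
  power-+ x (suc j) k = trans (cong (_* x) (power-+ x j k)) (solve 3 (λ a b x → a :* b :* x := a :* x :* b) refl (power x j) (power x k) x)

  power-power : ∀ x j k → power x (k ℕ.* j) ≡ power (power x j) k
  power-power x j zero = refl
  power-power x j (suc k) = trans (power-+ x j (k ℕ.* j)) (trans (*-comm _ _) (cong (_* power x j) (power-power x j k)))

  power≡0 : ∀ x k → power x k ≡ 0# → x ≡ 0#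
  power≡0 x zero eq = ⊥-elim (1≢0 eq)
  power≡0 x (suc k) eq with x ≟ 0#
  ... | yes x≡0 = x≡0
  ... | no x≢0 = ⊥-elim (x≢0 (power≡0 x k (no-zero-divisors (trans (*-comm _ _) eq) x≢0)))

  ×-* : ∀ n x → n ×# x ≡ (n ×# 1#) * x
  ×-* zero x = sym (zeroˡ x)
  ×-* (suc n) x = trans (cong₂ _+_ (sym (*-identityˡ x)) (×-* n x)) (sym (distribʳ x 1# (n ×# 1#)))

  ×1-* : ∀ m n → (m ℕ.* n) ×# 1# ≡ (m ×# 1#) * (n ×# 1#)
  ×1-* m n = trans (sym (Fr.Mult.×-assocˡ 1# m n)) (×-* m (n ×# 1#))

  ×1-^ : ∀ k → (p ℕ.^ k) ×# 1# ≡ power (p ×# 1#) k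
  ×1-^ zero = +-identityʳ 1#
  ×1-^ (suc k) = trans (×1-* p (p ℕ.^ k)) (trans (cong ((p ×# 1#) *_) (×1-^ k)) (*-comm _ _))

  -- x ↦ 1 + x permutes the elements.
  total-shift : foldr _+_ 0# elems ≡ (length elems) ×# 1# + foldr _+_ 0# elems
  total-shift = trans (PermS.foldr-commMonoid (≡.setoid F) +-isCommutativeMonoid (↭⇒↭ₛ shift)) (sum-map elems)
    where
    shift : elems ↭ map (1# +_) elems
    shift = ∼bag⇒↭ (unique∧set⇒bag distinct (UniqueP.map⁺ (λ {x} {y} eq → cancel x y eq) distinct)
      (λ {x} → mk⇔ (λ _ → subst (_∈ map (1# +_) elems) (solve 1 (λ x → κ 1 :+ (x :- κ 1) := x) refl x) (∈-map⁺ (1# +_) (complete (x - 1#))))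
           (λ _ → complete x)))
      where
      cancel : ∀ x y → 1# + x ≡ 1# + y → x ≡ y
      cancel x y eq = linear₁ 1# eq (solve 2 (λ x y → x :+ κ 1 :* (κ 1 :+ y) := y :+ κ 1 :* (κ 1 :+ x)) refl x y)
    sum-map : ∀ xs → foldr _+_ 0# (map (1# +_) xs) ≡ (length xs) ×# 1# + foldr _+_ 0# xs
    sum-map [] = sym (+-identityʳ 0#)
    sum-map (x ∷ xs) = trans (cong (1# + x +_) (sum-map xs)) (Fr.interchange 1# x _ _)

  -- `total-shift` shows that |F| times 1 is 0. As |F| = p^(2e), this multiple is the 2e-th power of
  -- p · 1, and a field has no nilpotent elements.
  p×1≡0 : p ×# 1# ≡ 0#
  p×1≡0 = power≡0 _ (e ℕ.* 2) (trans (sym (×1-^ (e ℕ.* 2))) (trans (cong (_×# 1#) (trans (sym (ℕP.^-*-assoc p e 2)) (trans (cong (ℕ._^ 2) (sym q≡pᵉ)) (sym card))))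
    (linear₁ (- 1#) total-shift (solve 2 (λ l s → l :+ :- κ 1 :* (l :+ s) := κ 0 :+ :- κ 1 :* s) refl (length elems ×# 1#) (foldr _+_ 0# elems)))))

  torsion : ∀ x → p ×# x ≡ 0#
  torsion x = trans (×-* p x) (trans (cong (_* x) p×1≡0) (zeroˡ x))

  -- For x ≠ 0 divide by x^p: with z = y/x the claim is (1 + z)^p = 1 + z^p, which is `frobenius`
  -- for multiplication by z, evaluated at 1.
  power-p-+ : ∀ x y → power (x + y) p ≡ power x p + power y p
  power-p-+ x y with x ≟ 0#
  ... | yes refl = trans (cong (λ z → power z p) (+-identityˡ y)) (sym (trans (cong (_+ power y p) (zero^p)) (+-identityˡ _)))
    where
    zero^p : power 0# p ≡ 0#
    zero^p = go p (prime⇒nonZero pr)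
      where
      go : ∀ n → ℕ.NonZero n → power 0# n ≡ 0#
      go (suc n) _ = zeroʳ _
  ... | no x≢0 = begin
    power (x + y) p ≡⟨ cong (λ z → power z p) (linear₁ (- y) (proj₂ (inverse x x≢0))
                       (solve 3 (λ x y i → x :+ y :+ :- y :* κ 1 := x :* (κ 1 :+ y :* i) :+ :- y :* (x :* i)) refl x y x⁻¹)) ⟩
    power (x * (1# + z)) p ≡⟨ power-* x (1# + z) p ⟩
    power x p * power (1# + z) p ≡⟨ cong (power x p *_) (trans (sym (power-iterate p)) (trans (Fr.frobenius (_* z) (λ a b → distribʳ z a b) (zeroˡ z) pr torsion 1#) (cong (1# +_) (iterate-mul p)))) ⟩
    power x p * (1# + power z p) ≡⟨ distribˡ _ _ _ ⟩
    power x p * 1# + power x p * power z p ≡⟨ cong₂ _+_ (*-identityʳ _) (trans (sym (power-* x z p))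
         (cong (λ w → power w p) (linear₁ y (proj₂ (inverse x x≢0)) (solve 3 (λ x y i → x :* (y :* i) :+ y :* κ 1 := y :+ y :* (x :* i)) refl x y x⁻¹)))) ⟩
    power x p + power y p ∎
    where
    x⁻¹ = proj₁ (inverse x x≢0)
    z = y * x⁻¹
    iterate-mul : ∀ n → iterate (_* z) n 1# ≡ power z n
    iterate-mul zero = refl
    iterate-mul (suc n) = cong (_* z) (iterate-mul n)
    power-iterate : ∀ n → iterate (λ w → w + w * z) n 1# ≡ power (1# + z) n
    power-iterate zero = refl
    power-iterate (suc n) = trans (cong (λ w → w + w * z) (power-iterate n))
      (solve 2 (λ w z → w :+ w :* z := w :* (κ 1 :+ z)) refl (power (1# + z) n) z)

  power-pᵏ-+ : ∀ k x y → power (x + y) (p ℕ.^ k) ≡ power x (p ℕ.^ k) + power y (p ℕ.^ k)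
  power-pᵏ-+ zero x y = solve 2 (λ x y → κ 1 :* (x :+ y) := κ 1 :* x :+ κ 1 :* y) refl x y
  power-pᵏ-+ (suc k) x y = begin
    power (x + y) (p ℕ.* p ℕ.^ k) ≡⟨ power-power (x + y) (p ℕ.^ k) p ⟩
    power (power (x + y) (p ℕ.^ k)) p ≡⟨ cong (λ z → power z p) (power-pᵏ-+ k x y) ⟩
    power (power x (p ℕ.^ k) + power y (p ℕ.^ k)) p ≡⟨ power-p-+ _ _ ⟩
    power (power x (p ℕ.^ k)) p + power (power y (p ℕ.^ k)) p ≡⟨ sym (cong₂ _+_ (power-power x (p ℕ.^ k) p) (power-power y (p ℕ.^ k) p)) ⟩
    power x (p ℕ.* p ℕ.^ k) + power y (p ℕ.* p ℕ.^ k) ∎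

  σ-+ : ∀ x y → σ (x + y) ≡ σ x + σ y
  σ-+ x y = subst (λ n → power (x + y) n ≡ power x n + power y n) (sym q≡pᵉ) (power-pᵏ-+ e x y)

  σ-* : ∀ x y → σ (x * y) ≡ σ x * σ y
  σ-* x y = power-* x y q

  σ-0 : σ 0# ≡ 0#
  σ-0 = linear₁ (- 1#) (trans (sym (cong σ (+-identityˡ 0#))) (σ-+ 0# 0#))
    (solve 1 (λ s → s :+ :- κ 1 :* (s :+ s) := κ 0 :+ :- κ 1 :* s) refl (σ 0#))

  -- The monic polynomial xⁿ + … with lower coefficients cs, constant term first.
  eval : List F → F → F
  eval [] x = 1#
  eval (c ∷ cs) x = c + x * eval cs x

  -- Horner's scheme: the coefficients of the quotient by x - a are the values at a of the
  -- successive tails.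
  quotient : List F → F → List F
  quotient [] a = []
  quotient (c ∷ []) a = []
  quotient (c ∷ d ∷ cs) a = eval (d ∷ cs) a ∷ quotient (d ∷ cs) a

  quotient-length : ∀ c cs a → length (quotient (c ∷ cs) a) ≡ length cs
  quotient-length c [] a = refl
  quotient-length c (d ∷ cs) a = cong suc (quotient-length d cs a)

  quotient-eval : ∀ c cs a x → eval (c ∷ cs) x - eval (c ∷ cs) a ≡ (x - a) * eval (quotient (c ∷ cs) a) x
  quotient-eval c [] a x = solve 3 (λ c a x → c :+ x :* κ 1 :- (c :+ a :* κ 1) := (x :- a) :* κ 1) refl c a x
  quotient-eval c (d ∷ cs) a x = linear₁ x (quotient-eval d cs a x)
    (solve 6 (λ c a x P Q R → c :+ x :* P :- (c :+ a :* Q) :+ x :* ((x :- a) :* R) := (x :- a) :* (Q :+ x :* R) :+ x :* (P :- Q))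
      refl c a x (eval (d ∷ cs) x) (eval (d ∷ cs) a) (eval (quotient (d ∷ cs) a) x))

  -- Every coefficient list stands for a monic polynomial whose degree is its length, so the zero
  -- polynomial cannot occur. The other roots remain roots of the quotient by x - a, since x - a is
  -- invertible there.
  roots-bound : ∀ cs xs → AllPairs (λ x y → ¬ (x ≡ y)) xs → All (λ x → eval cs x ≡ 0#) xs → length xs ℕ.≤ length cs
  roots-bound cs [] _ _ = ℕ.z≤n
  roots-bound [] (x ∷ xs) _ (r ∷ _) = ⊥-elim (1≢0 r)
  roots-bound (c ∷ cs) (a ∷ xs) (a∉xs ∷ d) (r ∷ rs) = ℕ.s≤s (subst (length xs ℕ.≤_) (quotient-length c cs a)
    (roots-bound (quotient (c ∷ cs) a) xs d (All.zipWith (λ {x} (a≢x , rx) → no-zero-divisors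
      (trans (sym (quotient-eval c cs a x)) (trans (cong₂ _-_ rx r) (solve 0 (κ 0 :- κ 0 := κ 0) refl)))
      (λ x-a≡0 → a≢x (linear₁ (- 1#) x-a≡0 (solve 2 (λ a x → a :+ :- κ 1 :* κ 0 := x :+ :- κ 1 :* (x :- a)) refl a x))))
      (a∉xs , rs))))

  module ℚ⋆ where
    open Rat public
    count-roots : ∀ {P : F → Set} (P? : ∀ x → Dec (P x)) cs → (∀ x → P x → eval cs x ≡ 0#) → ∑[ x ∈ Fˢ ] 𝟙 (P? x) ≤ ι (length cs)
    count-roots P? cs h = subst (_≤ ι (length cs)) (sym (sumL-filter P? elems))
      (ι-mono (roots-bound cs (filter P? elems) (AllPairsP.filter⁺ P? distinct) (All.map (h _) (AllP.all-filter P? elems))))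
  open ℚ⋆ public using (count-roots)

  eval-zeros : ∀ n x → eval (replicate n 0#) x ≡ power x n
  eval-zeros zero x = refl
  eval-zeros (suc n) x = trans (+-identityˡ _) (trans (cong (x *_) (eval-zeros n x)) (*-comm _ _))

  1<q : 1 ℕ.< q
  1<q = subst (1 ℕ.<_) (sym q≡pᵉ) (ℕP.<-≤-trans 1<p (ℕP.≤-trans (ℕP.≤-reflexive (sym (ℕP.^-identityʳ p))) (ℕP.^-monoʳ-≤ p {{prime⇒nonZero pr}} 1≤e)))
    where
    1<p : 1 ℕ.< p
    1<p = ℕ.nonTrivial⇒n>1 p {{prime⇒nonTrivial pr}}

  module Fibres (σσ : ∀ x → σ (σ x) ≡ x) where

    open Rat hiding (_+_; _*_; -_; _-_; +-assoc; +-comm; +-identityˡ; +-identityʳ; *-assoc; *-comm; *-identityˡ; *-identityʳ; zeroˡ; zeroʳ; distribˡ; distribʳ; *-cancelˡ)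

    u : ℚ
    u = ι q

    u≥0 : 0ℚ ≤ u
    u≥0 = 0≤ι q

    total : ∑[ x ∈ Fˢ ] 1ℚ ≡ u ℚO.* u
    total = trans (∑-1 Fˢ) (trans (cong ι (trans card (cong (q ℕ.*_) (ℕP.*-identityʳ q)))) (ι-* q q))

    -- Fibres of size at most N over at most K points that together contain N K points have size exactly N.
    saturated : {P Q : F → Set} (P? : ∀ b → Dec (P b)) (Q? : ∀ x → Dec (Q x)) (h : F → F) → (∀ {x} → Q x → P (h x)) →
      (N K : ℚ) → 0ℚ ≤ N → ∑[ b ∈ Fˢ ] 𝟙 (P? b) ≤ K → ∑[ x ∈ Fˢ ] 𝟙 (Q? x) ≡ K ℚO.* N →
      (∀ b → ∑[ x ∈ Fˢ ] (𝟙 (Q? x) ℚO.* 𝟙 (b ≟ h x)) ≤ N) →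
      ∀ b → P b → ∑[ x ∈ Fˢ ] (𝟙 (Q? x) ℚO.* 𝟙 (b ≟ h x)) ≡ N
    saturated {P} {Q} P? Q? h Q⇒P N K N≥0 #P≤K #Q fib≤N b pb = ℚS.linear₂ 1ℚ (sym (∑-nonneg-zero Fˢ f (λ { refl → refl }) f≥0 ∑f≤0 b))
        (N ℚO.- fib b) (𝟙-yes (P? b) pb)
        (ℚS.solve 3 (λ i m n → m ℚS.:+ ℚS.κ 1 ℚS.:* (i ℚS.:* (n ℚS.:- m)) ℚS.:+ (n ℚS.:- m) ℚS.:* ℚS.κ 1
           ℚS.:= n ℚS.:+ ℚS.κ 1 ℚS.:* ℚS.κ 0 ℚS.:+ (n ℚS.:- m) ℚS.:* i) refl (𝟙 (P? b)) (fib b) N)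
      where
      fib f : F → ℚ
      fib b = ∑[ x ∈ Fˢ ] (𝟙 (Q? x) ℚO.* 𝟙 (b ≟ h x))
      f b = 𝟙 (P? b) ℚO.* (N ℚO.- fib b)
      f≥0 : ∀ b → 0ℚ ≤ f b
      f≥0 b with P? b
      ... | yes _ = subst₂ _≤_ (ℚS.solve 1 (λ m → m ℚS.:+ ℚS.:- m ℚS.:= ℚS.κ 0) refl (fib b)) (sym (ℚO.*-identityˡ _))
                      (+-mono-≤ (fib≤N b) (ℚP.≤-refl {ℚO.- fib b}))
      ... | no _ = ℚP.≤-reflexive (sym (ℚO.zeroˡ _))
      incidence : ∑[ b ∈ Fˢ ] (𝟙 (P? b) ℚO.* fib b) ≡ K ℚO.* N
      incidence = begin
        ∑[ b ∈ Fˢ ] (𝟙 (P? b) ℚO.* fib b) ≡⟨ ∑-cong Fˢ (λ b → sym (∑-*ˡ Fˢ (𝟙 (P? b)) _)) ⟩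
        ∑[ b ∈ Fˢ ] ∑[ x ∈ Fˢ ] (𝟙 (P? b) ℚO.* (𝟙 (Q? x) ℚO.* 𝟙 (b ≟ h x))) ≡⟨ ∑-swap Fˢ Fˢ _ ⟩
        ∑[ x ∈ Fˢ ] ∑[ b ∈ Fˢ ] (𝟙 (P? b) ℚO.* (𝟙 (Q? x) ℚO.* 𝟙 (b ≟ h x)))
          ≡⟨ ∑-cong Fˢ (λ x → ∑-cong Fˢ (λ b → ℚS.solve 3 (λ i j k → i ℚS.:* (j ℚS.:* k) ℚS.:= k ℚS.:* (j ℚS.:* i)) refl (𝟙 (P? b)) (𝟙 (Q? x)) (𝟙 (b ≟ h x)))) ⟩
        ∑[ x ∈ Fˢ ] ∑[ b ∈ Fˢ ] (𝟙 (b ≟ h x) ℚO.* (𝟙 (Q? x) ℚO.* 𝟙 (P? b)))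
          ≡⟨ ∑-cong Fˢ (λ x → ∑-point Fˢ (λ b → 𝟙 (Q? x) ℚO.* 𝟙 (P? b)) (λ { refl → refl }) (h x)) ⟩
        ∑[ x ∈ Fˢ ] (𝟙 (Q? x) ℚO.* 𝟙 (P? (h x)))
          ≡⟨ ∑-cong Fˢ (λ x → trans (𝟙-guard (Q? x) (λ qx → 𝟙-yes (P? (h x)) (Q⇒P qx))) (ℚO.*-identityʳ _)) ⟩
        ∑[ x ∈ Fˢ ] 𝟙 (Q? x) ≡⟨ #Q ⟩
        K ℚO.* N ∎
      ∑f≤0 : ∑ Fˢ f ≤ 0ℚ
      ∑f≤0 = subst₂ _≤_ (sym ∑f) (ℚS.solve 2 (λ k n → k ℚS.:* n ℚS.:+ ℚS.:- (k ℚS.:* n) ℚS.:= ℚS.κ 0) refl K N)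
               (+-mono-≤ (*-monoʳ-≤ N≥0 #P≤K) (ℚP.≤-refl {ℚO.- (K ℚO.* N)}))
        where
        ∑f : ∑ Fˢ f ≡ (∑[ b ∈ Fˢ ] 𝟙 (P? b)) ℚO.* N ℚO.+ ℚO.- (K ℚO.* N)
        ∑f = begin
          ∑ Fˢ f ≡⟨ ∑-cong Fˢ (λ b → ℚS.solve 3 (λ i n m → i ℚS.:* (n ℚS.:- m) ℚS.:= i ℚS.:* n ℚS.:+ ℚS.:- ℚS.κ 1 ℚS.:* (i ℚS.:* m)) refl (𝟙 (P? b)) N (fib b)) ⟩
          ∑[ b ∈ Fˢ ] (𝟙 (P? b) ℚO.* N ℚO.+ ℚO.- 1ℚ ℚO.* (𝟙 (P? b) ℚO.* fib b))
            ≡⟨ trans (∑-+ Fˢ _ _) (cong₂ ℚO._+_ (∑-*ʳ Fˢ _ N) (trans (∑-*ˡ Fˢ (ℚO.- 1ℚ) _) (cong (ℚO.- 1ℚ ℚO.*_) incidence))) ⟩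
          (∑[ b ∈ Fˢ ] 𝟙 (P? b)) ℚO.* N ℚO.+ ℚO.- 1ℚ ℚO.* (K ℚO.* N)
            ≡⟨ cong ((∑[ b ∈ Fˢ ] 𝟙 (P? b)) ℚO.* N ℚO.+_) (ℚS.solve 1 (λ x → ℚS.:- ℚS.κ 1 ℚS.:* x ℚS.:= ℚS.:- x) refl (K ℚO.* N)) ⟩
          (∑[ b ∈ Fˢ ] 𝟙 (P? b)) ℚO.* N ℚO.+ ℚO.- (K ℚO.* N) ∎

    q-2 = q ℕ.∸ 2

    2+q-2 : 2 ℕ.+ q-2 ≡ q
    2+q-2 = ℕP.m+[n∸m]≡n 1<q

    -- Two factors are split off, using q ≥ 2. In x^q - x and x^q + x - b the two lowest
    -- coefficients thus become explicit and are followed by q - 2 zeros.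
    power-q : ∀ x → σ x ≡ power x q-2 * x * x
    power-q x = cong (power x) (sym 2+q-2)

    zeros-length : ∀ n → length (replicate n 0#) ≡ n
    zeros-length n = ListP.length-replicate n

    fixed? : ∀ x → Dec (σ x ≡ x)
    fixed? x = σ x ≟ x

    fixed-count : ∑[ x ∈ Fˢ ] 𝟙 (fixed? x) ≤ u
    fixed-count = subst (λ n → ∑[ x ∈ Fˢ ] 𝟙 (fixed? x) ≤ ι n) (trans (cong (λ n → suc (suc n)) (zeros-length q-2)) 2+q-2)
      (count-roots fixed? (0# ∷ - 1# ∷ replicate q-2 0#) (λ x fx → trans (cong (λ w → 0# + x * (- 1# + x * w)) (eval-zeros q-2 x))
        (linear₁ 1# (trans (sym (power-q x)) fx) (solve 2 (λ x w → κ 0 :+ x :* (:- κ 1 :+ x :* w) :+ κ 1 :* x := κ 0 :+ κ 1 :* (w :* x :* x)) refl x (power x q-2)))))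

    trace-bound : ∀ b → ∑[ c ∈ Fˢ ] 𝟙 (b ≟ (c + σ c)) ≤ u
    trace-bound b = subst (λ n → ∑[ c ∈ Fˢ ] 𝟙 (b ≟ (c + σ c)) ≤ ι n) (trans (cong (λ n → suc (suc n)) (zeros-length q-2)) 2+q-2)
      (count-roots (λ c → b ≟ (c + σ c)) (- b ∷ 1# ∷ replicate q-2 0#) (λ x eq → trans (cong (λ w → - b + x * (1# + x * w)) (eval-zeros q-2 x))
        (linear₁ (- 1#) (trans eq (cong (x +_) (power-q x))) (solve 3 (λ b x w → :- b :+ x :* (κ 1 :+ x :* w) :+ :- κ 1 :* (x :+ w :* x :* x) := κ 0 :+ :- κ 1 :* b) refl b x (power x q-2)))))

    norm-bound : ∀ b → ∑[ x ∈ Fˢ ] 𝟙 (b ≟ (x * σ x)) ≤ 1ℚ ℚO.+ u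
    norm-bound b = subst (∑[ x ∈ Fˢ ] 𝟙 (b ≟ (x * σ x)) ≤_) (trans (cong (λ n → ι (suc n)) (zeros-length q)) (ι-suc q))
      (count-roots (λ x → b ≟ (x * σ x)) (- b ∷ replicate q 0#) (λ x eq → trans (cong (λ w → - b + x * w) (eval-zeros q x))
        (linear₁ (- 1#) eq (solve 2 (λ b w → :- b :+ w :+ :- κ 1 :* w := κ 0 :+ :- κ 1 :* b) refl b (x * σ x)))))

    -- The trace sends all q² elements into the at most q fixed points of σ, with at most q in each
    -- fibre. The bounds multiply to the exact total, so both are attained.
    trace-count : ∀ b → σ b ≡ b → ∑[ c ∈ Fˢ ] 𝟙 (b ≟ (c + σ c)) ≡ u
    trace-count b fb = trans (∑-cong Fˢ (λ c → sym (ℚO.*-identityˡ _)))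
      (saturated {Q = λ x → x ≡ x} fixed? (λ _ → yes refl) (λ c → c + σ c)
        (λ {c} _ → trans (σ-+ c (σ c)) (trans (cong (σ c +_) (σσ c)) (+-comm _ _)))
        u u u≥0 fixed-count total (λ b → subst (_≤ u) (∑-cong Fˢ (λ c → sym (ℚO.*-identityˡ _))) (trace-bound b)) b fb)

    norm≡0 : ∀ {x} → x * σ x ≡ 0# → x ≡ 0#
    norm≡0 {x} eq with x ≟ 0#
    ... | yes x≡0 = x≡0
    ... | no x≢0 = power≡0 x q (no-zero-divisors eq x≢0)

    norm-fixed : ∀ x → σ (x * σ x) ≡ x * σ x
    norm-fixed x = trans (σ-* x (σ x)) (trans (cong (σ x *_) (σσ x)) (*-comm _ _))

    nonzero? : ∀ x → Dec (¬ (x ≡ 0#))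
    nonzero? x = ¬? (x ≟ 0#)

    remove-zero : {P : F → Set} (P? : ∀ x → Dec (P x)) → P 0# →
      ∑[ x ∈ Fˢ ] 𝟙 (P? x ×-dec nonzero? x) ≡ ∑[ x ∈ Fˢ ] 𝟙 (P? x) ℚO.- 1ℚ
    remove-zero P? p0 = begin
      ∑[ x ∈ Fˢ ] 𝟙 (P? x ×-dec nonzero? x) ≡⟨ ∑-cong Fˢ split ⟩
      ∑[ x ∈ Fˢ ] (𝟙 (P? x) ℚO.+ ℚO.- 1ℚ ℚO.* (𝟙 (x ≟ 0#) ℚO.* 1ℚ))
        ≡⟨ trans (∑-+ Fˢ _ _) (cong (∑[ x ∈ Fˢ ] 𝟙 (P? x) ℚO.+_) (trans (∑-*ˡ Fˢ (ℚO.- 1ℚ) _) (cong (ℚO.- 1ℚ ℚO.*_) (∑-point Fˢ (λ _ → 1ℚ) (λ _ → refl) 0#)))) ⟩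
      ∑[ x ∈ Fˢ ] 𝟙 (P? x) ℚO.+ ℚO.- 1ℚ ℚO.* 1ℚ ≡⟨ cong (∑[ x ∈ Fˢ ] 𝟙 (P? x) ℚO.+_) (ℚO.*-identityʳ _) ⟩
      ∑[ x ∈ Fˢ ] 𝟙 (P? x) ℚO.- 1ℚ ∎
      where
      split : ∀ x → 𝟙 (P? x ×-dec nonzero? x) ≡ 𝟙 (P? x) ℚO.+ ℚO.- 1ℚ ℚO.* (𝟙 (x ≟ 0#) ℚO.* 1ℚ)
      split x with x ≟ 0#
      ... | yes refl = trans (𝟙-no (P? x ×-dec no (λ nz → nz refl)) (λ (_ , nz) → nz refl))
            (sym (trans (cong (ℚO._+ _) (𝟙-yes (P? 0#) p0)) (ℚS.solve 0 (ℚS.κ 1 ℚS.:+ ℚS.:- ℚS.κ 1 ℚS.:* (ℚS.κ 1 ℚS.:* ℚS.κ 1) ℚS.:= ℚS.κ 0) refl)))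
      ... | no x≢0 = trans (𝟙-cong (P? x ×-dec yes x≢0) (P? x) proj₁ (λ px → px , x≢0))
            (ℚS.solve 1 (λ i → i ℚS.:= i ℚS.:+ ℚS.:- ℚS.κ 1 ℚS.:* (ℚS.κ 0 ℚS.:* ℚS.κ 1)) refl (𝟙 (P? x)))

    nonzero-count : ∑[ x ∈ Fˢ ] 𝟙 (nonzero? x) ≡ u ℚO.* u ℚO.- 1ℚ
    nonzero-count = trans (∑-cong Fˢ (λ x → 𝟙-cong (nonzero? x) (yes (refl {x = x}) ×-dec nonzero? x) (λ nz → refl , nz) proj₂))
      (trans (remove-zero (λ x → yes (refl {x = x})) refl) (cong (ℚO._- 1ℚ) total))

    -- As for the trace, now with the q² - 1 nonzero elements over at most q - 1 nonzero fixed
    -- points and fibres of at most q + 1 roots.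
    norm-count : ∀ b → σ b ≡ b → ¬ (b ≡ 0#) → ∑[ x ∈ Fˢ ] 𝟙 (b ≟ (x * σ x)) ≡ 1ℚ ℚO.+ u
    norm-count b fb b≢0 = trans (∑-cong Fˢ drop) (saturated P? nonzero? (λ x → x * σ x)
        (λ {x} x≢0 → norm-fixed x , (λ n≡0 → x≢0 (norm≡0 n≡0)))
        (1ℚ ℚO.+ u) (u ℚO.- 1ℚ) (ℚP.≤-trans u≥0 (subst (_≤ 1ℚ ℚO.+ u) (ℚO.+-identityˡ u) (+-mono-≤ 0≤1 (ℚP.≤-refl {u}))))
        (subst (_≤ u ℚO.- 1ℚ) (sym (remove-zero fixed? σ-0)) (+-mono-≤ fixed-count (ℚP.≤-refl {ℚO.- 1ℚ})))
        (trans nonzero-count (ℚS.solve 1 (λ u → u ℚS.:* u ℚS.:- ℚS.κ 1 ℚS.:= (u ℚS.:- ℚS.κ 1) ℚS.:* (ℚS.κ 1 ℚS.:+ u)) refl u))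
        (λ b → ℚP.≤-trans (∑-≤ Fˢ (λ x → le b x)) (norm-bound b)) b (fb , b≢0))
      where
      P? : ∀ b → Dec (σ b ≡ b × ¬ (b ≡ 0#))
      P? b = fixed? b ×-dec nonzero? b
      drop : ∀ x → 𝟙 (b ≟ (x * σ x)) ≡ 𝟙 (nonzero? x) ℚO.* 𝟙 (b ≟ (x * σ x))
      drop x = trans (𝟙-cong (b ≟ (x * σ x)) (nonzero? x ×-dec (b ≟ (x * σ x)))
        (λ eq → (λ { refl → b≢0 (trans eq (zeroˡ _)) }) , eq) proj₂) (𝟙-× (nonzero? x) (b ≟ (x * σ x)))
      le : ∀ b x → 𝟙 (nonzero? x) ℚO.* 𝟙 (b ≟ (x * σ x)) ≤ 𝟙 (b ≟ (x * σ x))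
      le b x with nonzero? x
      ... | yes _ = ℚP.≤-reflexive (ℚO.*-identityˡ _)
      ... | no _ = subst (_≤ 𝟙 (b ≟ (x * σ x))) (sym (ℚO.zeroˡ _)) (0≤𝟙 (b ≟ (x * σ x)))

-- Hermitian spaces, abstractly

open Sums
open Rat using (ι; ι-unfold; ι-0; ι-1; ι-suc; ι-*; 0≤ι; inv; inv-inverseʳ; inv-unique; 1≤⇒≢0)
open Powers

module ℚO = Rat
open Rat using () renaming (_+_ to infixl 6 _+′_; _*_ to infixl 7 _*′_; _-_ to infixl 6 _-′_; -_ to infix 8 -′_)

-- All that the geometry uses of σ is that it is an involutive automorphism and that its trace and
-- norm have known fibre sizes; its origin as a power map is forgotten here.
record UnitaryField : Set₁ where
  infix 4 _≟_
  field
    p q : ℕ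
    prime : Prime p
    F : Set
    add mul : F → F → F
    neg : F → F
    0# 1# : F
    isCR : IsCommutativeRing _≡_ add mul neg 0# 1#
    _≟_ : ∀ (x y : F) → Dec (x ≡ y)
    elems : List F
    complete : ∀ x → x ∈ elems
    distinct : AllPairs (λ x y → ¬ (x ≡ y)) elems
    1≢0 : ¬ (1# ≡ 0#)
    inverse : ∀ x → ¬ (x ≡ 0#) → ∃ λ y → mul x y ≡ 1#
    characteristic : Algebra.Definitions.RawMonoid._×_ (record { _≈_ = _≡_ ; _∙_ = add ; ε = 0# }) p 1# ≡ 0#
    σ : F → F
    σ-+ : ∀ x y → σ (add x y) ≡ add (σ x) (σ y)
    σ-* : ∀ x y → σ (mul x y) ≡ mul (σ x) (σ y)
    σσ : ∀ x → σ (σ x) ≡ x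

  Fˢ : FinSet
  Fˢ = record { Carrier = F ; _~_ = _≡_ ; isEquivalence = ≡.isEquivalence ; _~?_ = _≟_
              ; elems = elems ; complete = complete ; distinct = distinct }

  field
    2≤q : 2 ℕ.≤ q
    total : ∑[ x ∈ Fˢ ] 1ℚ ≡ ι q *′ ι q
    trace-count : ∀ b → σ b ≡ b → ∑[ c ∈ Fˢ ] 𝟙 (b ≟ add c (σ c)) ≡ ι q
    norm-count : ∀ b → σ b ≡ b → ¬ (b ≡ 0#) → ∑[ x ∈ Fˢ ] 𝟙 (b ≟ mul x (σ x)) ≡ 1ℚ +′ ι q
    nonzero-count : ∑[ x ∈ Fˢ ] 𝟙 (¬? (x ≟ 0#)) ≡ ι q *′ ι q -′ 1ℚ

-- Instead of the vector space laws it asks that the form be linear and separate vectors. Any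
-- identity of vectors then follows by pairing both sides with an arbitrary z, which leaves an
-- identity of scalars.
record HermitianSpace (K : UnitaryField) : Set₁ where
  open UnitaryField K
  infixl 6 _⊕_
  infixr 7 _·_
  infix 4 _≟ⱽ_
  field
    V : Set
    _≟ⱽ_ : ∀ (x y : V) → Dec (x ≡ y)
    elemsⱽ : List V
    completeⱽ : ∀ x → x ∈ elemsⱽ
    distinctⱽ : AllPairs (λ x y → ¬ (x ≡ y)) elemsⱽ
    _⊕_ : V → V → V
    _·_ : F → V → V
    𝟎 : V
    B : V → V → F
    B-⊕ : ∀ x y z → B (x ⊕ y) z ≡ add (B x z) (B y z)
    B-· : ∀ a x z → B (a · x) z ≡ mul a (B x z)
    B-𝟎 : ∀ z → B 𝟎 z ≡ 0#
    B-herm : ∀ x y → B y x ≡ σ (B x y)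
    B-separates : ∀ {x y} → (∀ z → B x z ≡ B y z) → x ≡ y

  Vˢ : FinSet
  Vˢ = record { Carrier = V ; _~_ = _≡_ ; isEquivalence = ≡.isEquivalence ; _~?_ = _≟ⱽ_
              ; elems = elemsⱽ ; complete = completeⱽ ; distinct = distinctⱽ }

-- Elementary consequences for scalars and vectors

module Geometry (K : UnitaryField) (H : HermitianSpace K) where

  open UnitaryField K
  open HermitianSpace H

  private
    infixl 6 _+_ _-_
    infixl 7 _*_
    infix 8 -_
    _+_ _*_ : F → F → F
    _+_ = add
    _*_ = mul
    -_ : F → F
    -_ = neg
    _-_ : F → F → F
    x - y = add x (- y)

  module FS = IntegerSolver add mul neg 0# 1# isCR
  open FS using (linear₁; linear₂; linear₃; solve; _:+_; _:*_; :-_; _:-_; _:=_; κ)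
  module QS = ℚO.ℚS
  open QS using () renaming (linear₁ to linear₁′; linear₂ to linear₂′; linear₃ to linear₃′; solve to solve′;
    _:+_ to _:+′_; _:*_ to _:*′_; :-_ to :-′_; _:-_ to _:-′_; _:=_ to _:=′_; κ to con′)
  open IsCommutativeRing isCR
    using (+-assoc; +-comm; +-identityˡ; +-identityʳ; *-assoc; *-comm; *-identityˡ; *-identityʳ; zeroˡ; zeroʳ; distribˡ; distribʳ; +-isCommutativeMonoid)
  open ≡-Reasoning

  u Q : ℚ
  u = ι q
  Q = u *′ u

  u≢0 : u ≢ 0ℚ
  u≢0 = 1≤⇒≢0 (subst (_≤ u) ι-1 (ℚO.ι-mono (ℕP.<⇒≤ 2≤q)))

  Q≢0 : Q ≢ 0ℚ
  Q≢0 = ℚO.*-≢0 u≢0 u≢0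

  _⁻¹ : ∀ {a} → ¬ (a ≡ 0#) → F
  a≢0 ⁻¹ = proj₁ (inverse _ a≢0)

  inverseʳ : ∀ {a} (a≢0 : ¬ (a ≡ 0#)) → a * a≢0 ⁻¹ ≡ 1#
  inverseʳ a≢0 = proj₂ (inverse _ a≢0)

  no-zero-divisors : ∀ {x y} → x * y ≡ 0# → ¬ (x ≡ 0#) → y ≡ 0#
  no-zero-divisors {x} {y} xy≡0 x≢0 = linear₂ (- y) (inverseʳ x≢0) (x≢0 ⁻¹) xy≡0
    (solve 3 (λ x y i → y :+ :- y :* κ 1 :+ i :* κ 0 := κ 0 :+ :- y :* (x :* i) :+ i :* (x :* y)) refl x y (x≢0 ⁻¹))

  σ-0 : σ 0# ≡ 0#
  σ-0 = linear₁ (- 1#) (trans (sym (cong σ (+-identityˡ 0#))) (σ-+ 0# 0#))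
    (solve 1 (λ s → s :+ :- κ 1 :* (s :+ s) := κ 0 :+ :- κ 1 :* s) refl (σ 0#))

  σ-neg : ∀ x → σ (- x) ≡ - σ x
  σ-neg x = linear₁ (- 1#) (trans (sym σ-0) (trans (cong σ (solve 1 (λ x → κ 0 := x :+ :- x) refl x)) (σ-+ x (- x))))
    (solve 2 (λ a b → b :+ :- κ 1 :* (a :+ b) := :- a :+ :- κ 1 :* κ 0) refl (σ x) (σ (- x)))

  σ-1 : σ 1# ≡ 1#
  σ-1 = begin
    σ 1# ≡⟨ sym (*-identityˡ _) ⟩
    1# * σ 1# ≡⟨ cong (_* σ 1#) (sym (σσ 1#)) ⟩
    σ (σ 1#) * σ 1# ≡⟨ sym (σ-* (σ 1#) 1#) ⟩
    σ (σ 1# * 1#) ≡⟨ cong σ (*-identityʳ _) ⟩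
    σ (σ 1#) ≡⟨ σσ 1# ⟩
    1# ∎

  σ≡0 : ∀ {x} → σ x ≡ 0# → x ≡ 0#
  σ≡0 {x} eq = trans (sym (σσ x)) (trans (cong σ eq) σ-0)

  trace-surjective : ∀ b → σ b ≡ b → ∃ λ c → b ≡ c + σ c
  trace-surjective b fb = ∑-positive⇒∃ Fˢ (λ c → b ≟ (c + σ c)) (λ z → u≢0 (trans (sym (trace-count b fb)) z))

  norm-surjective : ∀ b → σ b ≡ b → ¬ (b ≡ 0#) → ∃ λ x → b ≡ x * σ x
  norm-surjective b fb b≢0 = ∑-positive⇒∃ Fˢ (λ x → b ≟ (x * σ x))
    (λ z → 1≤⇒≢0 (ℚO.1≤ι-suc q) (trans (ι-suc q) (trans (sym (norm-count b fb b≢0)) z)))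

  infixl 6 _⊖_
  _⊖_ : V → V → V
  x ⊖ y = x ⊕ (- 1#) · y

  B-⊖ : ∀ x y z → B (x ⊖ y) z ≡ B x z - B y z
  B-⊖ x y z = trans (B-⊕ x _ z) (cong (B x z +_) (trans (B-· (- 1#) y z) (solve 1 (λ b → :- κ 1 :* b := :- b) refl (B y z))))

  B-⊕ʳ : ∀ x y z → B x (y ⊕ z) ≡ B x y + B x z
  B-⊕ʳ x y z = trans (B-herm (y ⊕ z) x) (trans (cong σ (B-⊕ y z x)) (trans (σ-+ _ _) (sym (cong₂ _+_ (B-herm y x) (B-herm z x)))))

  B-·ʳ : ∀ x a y → B x (a · y) ≡ σ a * B x y
  B-·ʳ x a y = trans (B-herm (a · y) x) (trans (cong σ (B-· a y x)) (trans (σ-* _ _) (cong (σ a *_) (sym (B-herm y x)))))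

  B-𝟎ʳ : ∀ x → B x 𝟎 ≡ 0#
  B-𝟎ʳ x = trans (B-herm 𝟎 x) (trans (cong σ (B-𝟎 x)) σ-0)

  B-⊖ʳ : ∀ x y z → B x (y ⊖ z) ≡ B x y - B x z
  B-⊖ʳ x y z = trans (B-⊕ʳ x y _) (cong (B x y +_) (trans (B-·ʳ x (- 1#) z) (trans (cong (_* B x z) (trans (σ-neg 1#) (cong -_ σ-1)))
    (solve 1 (λ b → :- κ 1 :* b := :- b) refl (B x z)))))

  B-sym0 : ∀ {x y} → B x y ≡ 0# → B y x ≡ 0#
  B-sym0 {x} {y} eq = trans (B-herm x y) (trans (cong σ eq) σ-0)

  B-fixed : ∀ x → σ (B x x) ≡ B x x
  B-fixed x = sym (B-herm x x)

  ⊖-⊕ : ∀ x y → (x ⊖ y) ⊕ y ≡ x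
  ⊖-⊕ x y = B-separates λ z → trans (B-⊕ _ y z) (trans (cong (_+ B y z) (B-⊖ x y z)) (solve 2 (λ a b → a :- b :+ b := a) refl (B x z) (B y z)))

  ⊕-⊖ : ∀ x y → (x ⊕ y) ⊖ y ≡ x
  ⊕-⊖ x y = B-separates λ z → trans (B-⊖ _ y z) (trans (cong (_- B y z) (B-⊕ x y z)) (solve 2 (λ a b → a :+ b :- b := a) refl (B x z) (B y z)))

  ⊖-self : ∀ x → x ⊖ x ≡ 𝟎
  ⊖-self x = B-separates λ z → trans (B-⊖ x x z) (trans (solve 1 (λ a → a :- a := κ 0) refl (B x z)) (sym (B-𝟎 z)))

  ⊕-identityˡ : ∀ x → 𝟎 ⊕ x ≡ x
  ⊕-identityˡ x = B-separates λ z → trans (B-⊕ 𝟎 x z) (trans (cong (_+ B x z) (B-𝟎 z)) (+-identityˡ _))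

  ⊖≡𝟎 : ∀ {x y} → x ⊖ y ≡ 𝟎 → x ≡ y
  ⊖≡𝟎 {x} {y} eq = trans (sym (⊖-⊕ x y)) (trans (cong (_⊕ y) eq) (⊕-identityˡ y))

  all-dec : {P : V → Set} → (∀ x → Dec (P x)) → Dec (∀ x → P x)
  all-dec P? = map′ (λ a x → All.lookup a (completeⱽ x)) (λ h → All.universal h elemsⱽ) (All.all? P? elemsⱽ)

  all-decF : {P : F → Set} → (∀ x → Dec (P x)) → Dec (∀ x → P x)
  all-decF P? = map′ (λ a x → All.lookup a (complete x)) (λ h → All.universal h elems) (All.all? P? elems)

  #_ : {P : V → Set} → (∀ x → Dec (P x)) → ℚ
  # P? = ∑[ x ∈ Vˢ ] 𝟙 (P? x)

  #-cong : {P R : V → Set} (P? : ∀ x → Dec (P x)) (R? : ∀ x → Dec (R x)) → (∀ x → P x → R x) → (∀ x → R x → P x) → # P? ≡ # R?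
  #-cong P? R? f g = ∑-cong Vˢ (λ x → 𝟙-cong (P? x) (R? x) (f x) (g x))

  #-bij : {P R : V → Set} (P? : ∀ x → Dec (P x)) (R? : ∀ x → Dec (R x)) (to from : V → V) →
    (∀ {x} → P x → R (to x)) → (∀ {y} → R y → P (from y)) → (∀ {x} → P x → from (to x) ≡ x) → (∀ {y} → R y → to (from y) ≡ y) → # P? ≡ # R?
  #-bij {P} {R} P? R? to from f g h k = trans (sym (∑-cong Vˢ (λ x → ℚO.*-identityʳ _)))
    (trans (∑-bij Vˢ Vˢ P? R? (λ _ → 1ℚ) (λ _ → 1ℚ) to from (subst P) (subst R) (cong to) (cong from) f g h k (λ _ → refl) (λ _ → refl))
      (∑-cong Vˢ (λ x → ℚO.*-identityʳ _)))

  #-subset : {P R : V → Set} (P? : ∀ x → Dec (P x)) (R? : ∀ x → Dec (R x)) → (∀ x → P x → R x) → # R? ≤ # P? → ∀ x → R x → P x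
  #-subset {P} {R} P? R? P⊆R le x rx = decidable-stable (P? x) (λ ¬px → 1≤⇒≢0 (ℚP.≤-refl {1ℚ}) (begin
      1ℚ ≡⟨ solve′ 0 (con′ 1 :=′ con′ 1 :-′ con′ 0) refl ⟩
      1ℚ -′ 0ℚ ≡⟨ sym (cong₂ _-′_ (𝟙-yes (R? x) rx) (𝟙-no (P? x) ¬px)) ⟩
      f x ≡⟨ ∑-nonneg-zero Vˢ f (λ { refl → refl }) f≥0 ∑f≤0 x ⟩
      0ℚ ∎))
    where
    -- The difference of the indicators is nonnegative by inclusion and has sum at most 0 by
    -- assumption, hence vanishes everywhere. This takes the place of comparing dimensions.
    f : V → ℚ
    f x = 𝟙 (R? x) -′ 𝟙 (P? x)
    f≥0 : ∀ x → 0ℚ ≤ f x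
    f≥0 x with P? x
    ... | yes px = ℚP.≤-reflexive (sym (trans (cong (_-′ 1ℚ) (𝟙-yes (R? x) (P⊆R x px))) (solve′ 0 (con′ 1 :-′ con′ 1 :=′ con′ 0) refl)))
    ... | no _ = subst (0ℚ ≤_) (solve′ 1 (λ r → r :=′ r :-′ con′ 0) refl (𝟙 (R? x))) (0≤𝟙 (R? x))
    ∑f : ∑ Vˢ f ≡ # R? -′ # P?
    ∑f = begin
      ∑ Vˢ f ≡⟨ ∑-cong Vˢ (λ x → solve′ 2 (λ r p → r :-′ p :=′ r :+′ :-′ con′ 1 :*′ p) refl (𝟙 (R? x)) (𝟙 (P? x))) ⟩
      ∑[ x ∈ Vˢ ] (𝟙 (R? x) +′ -′ 1ℚ *′ 𝟙 (P? x)) ≡⟨ ∑-+ Vˢ (λ x → 𝟙 (R? x)) (λ x → -′ 1ℚ *′ 𝟙 (P? x)) ⟩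
      # R? +′ ∑[ x ∈ Vˢ ] (-′ 1ℚ *′ 𝟙 (P? x)) ≡⟨ cong (# R? +′_) (∑-*ˡ Vˢ (-′ 1ℚ) (λ x → 𝟙 (P? x))) ⟩
      # R? +′ -′ 1ℚ *′ # P? ≡⟨ solve′ 2 (λ r p → r :+′ :-′ con′ 1 :*′ p :=′ r :-′ p) refl (# R?) (# P?) ⟩
      # R? -′ # P? ∎
    ∑f≤0 : ∑ Vˢ f ≤ 0ℚ
    ∑f≤0 = subst₂ _≤_ (sym ∑f) (solve′ 1 (λ a → a :-′ a :=′ con′ 0) refl (# P?)) (ℚO.+-mono-≤ le (ℚP.≤-refl { -′ # P?}))

  -- Subspaces and duality by counting

  record Subspace : Set₁ where
    field
      In : V → Set
      In? : ∀ x → Dec (In x)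
      ⊕-closed : ∀ {x y} → In x → In y → In (x ⊕ y)
      ·-closed : ∀ a {x} → In x → In (a · x)
      𝟎-in : In 𝟎
    ⊖-closed : ∀ {x y} → In x → In y → In (x ⊖ y)
    ⊖-closed wx wy = ⊕-closed wx (·-closed (- 1#) wy)
    size : ℚ
    size = # In?

  open Subspace

  infix 5 _∩_^⊥
  _∩_^⊥ : Subspace → V → Subspace
  W ∩ v ^⊥ = record
    { In = λ x → In W x × B x v ≡ 0#
    ; In? = λ x → In? W x ×-dec (B x v ≟ 0#)
    ; ⊕-closed = λ (wx , ex) (wy , ey) → ⊕-closed W wx wy , trans (B-⊕ _ _ v) (trans (cong₂ _+_ ex ey) (+-identityˡ 0#))
    ; ·-closed = λ a (wx , ex) → ·-closed W a wx , trans (B-· a _ v) (trans (cong (a *_) ex) (zeroʳ a))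
    ; 𝟎-in = 𝟎-in W , B-𝟎 v }

  -- All q² fibres of pairing with v are translates of the kernel, by multiples of a vector x₀ in X
  -- normalised to B x₀ v = 1.
  kernel-count : (X : Subspace) (v : V) → (∃ λ x → In X x × ¬ (B x v ≡ 0#)) → Q *′ size (X ∩ v ^⊥) ≡ size X
  kernel-count X v (x₁ , wx₁ , B≢0) = sym (begin
    size X ≡⟨ ∑-fibre Vˢ Fˢ (λ x → B x v) _ ⟩
    ∑[ b ∈ Fˢ ] ∑[ x ∈ Vˢ ] (𝟙 (b ≟ B x v) *′ 𝟙 (In? X x)) ≡⟨ ∑-cong Fˢ fibre ⟩
    ∑[ b ∈ Fˢ ] size (X ∩ v ^⊥) ≡⟨ ∑-cong Fˢ (λ _ → sym (ℚO.*-identityˡ _)) ⟩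
    ∑[ b ∈ Fˢ ] (1ℚ *′ size (X ∩ v ^⊥)) ≡⟨ trans (∑-*ʳ Fˢ _ _) (cong (_*′ size (X ∩ v ^⊥)) total) ⟩
    Q *′ size (X ∩ v ^⊥) ∎)
    where
    x₀ = (B≢0 ⁻¹) · x₁
    Bx₀ : B x₀ v ≡ 1#
    Bx₀ = trans (B-· _ x₁ v) (trans (*-comm _ _) (inverseʳ B≢0))
    fibre : ∀ b → ∑[ x ∈ Vˢ ] (𝟙 (b ≟ B x v) *′ 𝟙 (In? X x)) ≡ size (X ∩ v ^⊥)
    fibre b = trans (∑-cong Vˢ (λ x → sym (𝟙-× (b ≟ B x v) (In? X x))))
      (#-bij (λ x → (b ≟ B x v) ×-dec In? X x) (In? (X ∩ v ^⊥)) (λ x → x ⊖ b · x₀) (λ x → x ⊕ b · x₀)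
        (λ {x} (e , wx) → ⊖-closed X wx (·-closed X b (·-closed X _ wx₁)) ,
           trans (B-⊖ x _ v) (trans (cong₂ _-_ (sym e) (trans (B-· b x₀ v) (cong (b *_) Bx₀))) (solve 1 (λ b → b :- b :* κ 1 := κ 0) refl b)))
        (λ {x} (wx , e) → sym (trans (B-⊕ x _ v) (trans (cong₂ _+_ e (trans (B-· b x₀ v) (cong (b *_) Bx₀))) (solve 1 (λ b → κ 0 :+ b :* κ 1 := b) refl b))) ,
           ⊕-closed X wx (·-closed X b (·-closed X _ wx₁)))
        (λ _ → ⊖-⊕ _ _) (λ _ → ⊕-⊖ _ _))

  Nondegenerate : Subspace → Set
  Nondegenerate W = ∀ x → In W x → (∀ y → In W y → B x y ≡ 0#) → x ≡ 𝟎

  infix 5 _∩_^⊥ˢ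
  _∩_^⊥ˢ : Subspace → Subspace → Subspace
  W ∩ X ^⊥ˢ = record
    { In = λ y → In W y × (∀ x → In X x → B y x ≡ 0#)
    ; In? = λ y → In? W y ×-dec all-dec (λ x → In? X x →-dec (B y x ≟ 0#))
    ; ⊕-closed = λ (wx , ex) (wy , ey) → ⊕-closed W wx wy , λ x wx → trans (B-⊕ _ _ x) (trans (cong₂ _+_ (ex x wx) (ey x wx)) (+-identityˡ 0#))
    ; ·-closed = λ a (wx , ex) → ·-closed W a wx , λ x wx → trans (B-· a _ x) (trans (cong (a *_) (ex x wx)) (zeroʳ a))
    ; 𝟎-in = 𝟎-in W , λ x _ → B-𝟎 x }

  witness : {P R : V → Set} → (∀ x → Dec (P x)) → (∀ x → Dec (R x)) → ¬ (∀ x → P x → R x) → ∃ λ x → P x × ¬ R x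
  witness {P} {R} P? R? ¬h with Any.any? (λ x → P? x ×-dec ¬? (R? x)) elemsⱽ
  ... | yes a = Any.satisfied a
  ... | no ¬a = ⊥-elim (¬h (λ x px → decidable-stable (R? x) (λ ¬rx → ¬a (Any.map (λ { refl → px , ¬rx }) (completeⱽ x)))))

  u-1≢0 : u -′ 1ℚ ≢ 0ℚ
  u-1≢0 e = 1≤⇒≢0 (subst (_≤ ι (q ℕ.∸ 1)) ι-1 (ℚO.ι-mono (ℕP.∸-monoˡ-≤ 1 2≤q)))
    (linear₂′ 1ℚ e (-′ 1ℚ) (trans (cong ι (sym (ℕP.m+[n∸m]≡n (ℕP.<⇒≤ 2≤q)))) (ι-suc (q ℕ.∸ 1)))
      (solve′ 2 (λ n u → n :+′ con′ 1 :*′ con′ 0 :+′ :-′ con′ 1 :*′ (con′ 1 :+′ n) :=′ con′ 0 :+′ con′ 1 :*′ (u :-′ con′ 1) :+′ :-′ con′ 1 :*′ u) refl (ι (q ℕ.∸ 1)) u))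

  1+u≢0 : 1ℚ +′ u ≢ 0ℚ
  1+u≢0 e = 1≤⇒≢0 (ℚO.1≤ι-suc q) (trans (ι-suc q) e)

  Q-1≢0 : Q -′ 1ℚ ≢ 0ℚ
  Q-1≢0 e = ℚO.*-≢0 u-1≢0 1+u≢0 (trans (solve′ 1 (λ u → (u :-′ con′ 1) :*′ (con′ 1 :+′ u) :=′ u :*′ u :-′ con′ 1) refl u) e)

  -- Merges the two cases, a hyperplane section and all of X, into one formula that can be summed
  -- over y.
  section-count : (X : Subspace) (y : V) (d : Dec (∀ x → In X x → B x y ≡ 0#)) →
    Q *′ size (X ∩ y ^⊥) ≡ size X *′ (1ℚ +′ (Q -′ 1ℚ) *′ 𝟙 d)
  section-count X y (yes h) = trans (cong (Q *′_) (#-cong (In? (X ∩ y ^⊥)) (In? X) (λ _ → proj₁) (λ x wx → wx , h x wx)))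
    (solve′ 2 (λ Q x → Q :*′ x :=′ x :*′ (con′ 1 :+′ (Q :-′ con′ 1) :*′ con′ 1)) refl Q (size X))
  section-count X y (no ¬h) = trans (kernel-count X y (witness (In? X) (λ x → B x y ≟ 0#) ¬h))
    (solve′ 2 (λ Q x → x :=′ x :*′ (con′ 1 :+′ (Q :-′ con′ 1) :*′ con′ 0)) refl Q (size X))

  -- Count the pairs (x , y) in X × W with B x y = 0, by rows and by columns.
  perp-count : (W X : Subspace) → Nondegenerate W → (∀ {x} → In X x → In W x) → size (W ∩ X ^⊥ˢ) *′ size X ≡ size W
  perp-count W X nd X⊆W = ℚO.*-cancelˡ Q-1≢0 (linear₁′ (-′ 1ℚ) (trans (sym rows) columns) (solve′ 4 (λ Q p x w →
       (Q :-′ con′ 1) :*′ (p :*′ x) :+′ :-′ con′ 1 :*′ (x :*′ (w :+′ (Q :-′ con′ 1) :*′ p))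
         :=′ (Q :-′ con′ 1) :*′ w :+′ :-′ con′ 1 :*′ (w :*′ (x :+′ (Q :-′ con′ 1) :*′ con′ 1))) refl Q (size P) (size X) (size W)))
    where
    P = W ∩ X ^⊥ˢ
    pairs : ℚ
    pairs = ∑[ y ∈ Vˢ ] ∑[ x ∈ Vˢ ] (𝟙 (In? W y) *′ (𝟙 (In? X x) *′ 𝟙 (B x y ≟ 0#)))
    X⊥? : ∀ y → Dec (∀ x → In X x → B x y ≡ 0#)
    X⊥? y = all-dec (λ x → In? X x →-dec (B x y ≟ 0#))
    W⊥? : ∀ x → Dec (∀ y → In W y → B y x ≡ 0#)
    W⊥? x = all-dec (λ y → In? W y →-dec (B y x ≟ 0#))
    weigh : {R : V → Set} (R? : ∀ x → Dec (R x)) {D : V → Set} (D? : ∀ x → Dec (D x)) (s : ℚ) →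
      ∑[ x ∈ Vˢ ] (𝟙 (R? x) *′ (s *′ (1ℚ +′ (Q -′ 1ℚ) *′ 𝟙 (D? x)))) ≡ s *′ (# R? +′ (Q -′ 1ℚ) *′ # (λ x → R? x ×-dec D? x))
    weigh R? D? s = begin
      ∑[ x ∈ Vˢ ] (𝟙 (R? x) *′ (s *′ (1ℚ +′ (Q -′ 1ℚ) *′ 𝟙 (D? x))))
        ≡⟨ ∑-cong Vˢ (λ x → trans (solve′ 4 (λ r s c d → r :*′ (s :*′ (con′ 1 :+′ c :*′ d)) :=′ s :*′ (r :+′ c :*′ (r :*′ d))) refl (𝟙 (R? x)) s (Q -′ 1ℚ) (𝟙 (D? x)))
             (cong (λ w → s *′ (𝟙 (R? x) +′ (Q -′ 1ℚ) *′ w)) (sym (𝟙-× (R? x) (D? x))))) ⟩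
      ∑[ x ∈ Vˢ ] (s *′ (𝟙 (R? x) +′ (Q -′ 1ℚ) *′ 𝟙 (R? x ×-dec D? x))) ≡⟨ ∑-*ˡ Vˢ s _ ⟩
      s *′ ∑[ x ∈ Vˢ ] (𝟙 (R? x) +′ (Q -′ 1ℚ) *′ 𝟙 (R? x ×-dec D? x))
        ≡⟨ cong (s *′_) (trans (∑-+ Vˢ _ _) (cong (# R? +′_) (∑-*ˡ Vˢ (Q -′ 1ℚ) _))) ⟩
      s *′ (# R? +′ (Q -′ 1ℚ) *′ # (λ x → R? x ×-dec D? x)) ∎
    columns : Q *′ pairs ≡ size X *′ (size W +′ (Q -′ 1ℚ) *′ size P)
    columns = begin
      Q *′ pairs ≡⟨ sym (∑-*ˡ Vˢ Q _) ⟩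
      ∑[ y ∈ Vˢ ] (Q *′ ∑[ x ∈ Vˢ ] (𝟙 (In? W y) *′ (𝟙 (In? X x) *′ 𝟙 (B x y ≟ 0#)))) ≡⟨ ∑-cong Vˢ column ⟩
      ∑[ y ∈ Vˢ ] (𝟙 (In? W y) *′ (size X *′ (1ℚ +′ (Q -′ 1ℚ) *′ 𝟙 (X⊥? y)))) ≡⟨ weigh (In? W) X⊥? (size X) ⟩
      size X *′ (size W +′ (Q -′ 1ℚ) *′ # (λ y → In? W y ×-dec X⊥? y))
        ≡⟨ cong (λ w → size X *′ (size W +′ (Q -′ 1ℚ) *′ w)) (#-cong (λ y → In? W y ×-dec X⊥? y) (In? P)
             (λ y (wy , h) → wy , λ x wx → B-sym0 (h x wx)) (λ y (wy , h) → wy , λ x wx → B-sym0 (h x wx))) ⟩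
      size X *′ (size W +′ (Q -′ 1ℚ) *′ size P) ∎
      where
      column : ∀ y → Q *′ ∑[ x ∈ Vˢ ] (𝟙 (In? W y) *′ (𝟙 (In? X x) *′ 𝟙 (B x y ≟ 0#))) ≡ 𝟙 (In? W y) *′ (size X *′ (1ℚ +′ (Q -′ 1ℚ) *′ 𝟙 (X⊥? y)))
      column y = begin
        Q *′ ∑[ x ∈ Vˢ ] (𝟙 (In? W y) *′ (𝟙 (In? X x) *′ 𝟙 (B x y ≟ 0#)))
          ≡⟨ cong (Q *′_) (trans (∑-*ˡ Vˢ _ _) (cong (𝟙 (In? W y) *′_) (∑-cong Vˢ (λ x → sym (𝟙-× (In? X x) (B x y ≟ 0#)))))) ⟩
        Q *′ (𝟙 (In? W y) *′ size (X ∩ y ^⊥)) ≡⟨ solve′ 3 (λ a b c → a :*′ (b :*′ c) :=′ b :*′ (a :*′ c)) refl Q (𝟙 (In? W y)) (size (X ∩ y ^⊥)) ⟩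
        𝟙 (In? W y) *′ (Q *′ size (X ∩ y ^⊥)) ≡⟨ cong (𝟙 (In? W y) *′_) (section-count X y (X⊥? y)) ⟩
        𝟙 (In? W y) *′ (size X *′ (1ℚ +′ (Q -′ 1ℚ) *′ 𝟙 (X⊥? y))) ∎
    rows : Q *′ pairs ≡ size W *′ (size X +′ (Q -′ 1ℚ) *′ 1ℚ)
    rows = begin
      Q *′ pairs ≡⟨ cong (Q *′_) (∑-swap Vˢ Vˢ _) ⟩
      Q *′ ∑[ x ∈ Vˢ ] ∑[ y ∈ Vˢ ] (𝟙 (In? W y) *′ (𝟙 (In? X x) *′ 𝟙 (B x y ≟ 0#))) ≡⟨ sym (∑-*ˡ Vˢ Q _) ⟩
      ∑[ x ∈ Vˢ ] (Q *′ ∑[ y ∈ Vˢ ] (𝟙 (In? W y) *′ (𝟙 (In? X x) *′ 𝟙 (B x y ≟ 0#)))) ≡⟨ ∑-cong Vˢ row ⟩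
      ∑[ x ∈ Vˢ ] (𝟙 (In? X x) *′ (size W *′ (1ℚ +′ (Q -′ 1ℚ) *′ 𝟙 (W⊥? x)))) ≡⟨ weigh (In? X) W⊥? (size W) ⟩
      size W *′ (size X +′ (Q -′ 1ℚ) *′ # (λ x → In? X x ×-dec W⊥? x))
        ≡⟨ cong (λ w → size W *′ (size X +′ (Q -′ 1ℚ) *′ w)) (∑-𝟙-unique Vˢ (λ x → In? X x ×-dec W⊥? x) (λ { refl h → h })
             (𝟎 , 𝟎-in X , λ y _ → B-𝟎ʳ y)
             (λ (x∈ , x⊥) (y∈ , y⊥) → trans (vanish x∈ x⊥) (sym (vanish y∈ y⊥)))) ⟩
      size W *′ (size X +′ (Q -′ 1ℚ) *′ 1ℚ) ∎
      where
      vanish : ∀ {x} → In X x → (∀ y → In W y → B y x ≡ 0#) → x ≡ 𝟎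
      vanish x∈ x⊥ = nd _ (X⊆W x∈) (λ y y∈ → B-sym0 (x⊥ y y∈))
      row : ∀ x → Q *′ ∑[ y ∈ Vˢ ] (𝟙 (In? W y) *′ (𝟙 (In? X x) *′ 𝟙 (B x y ≟ 0#))) ≡ 𝟙 (In? X x) *′ (size W *′ (1ℚ +′ (Q -′ 1ℚ) *′ 𝟙 (W⊥? x)))
      row x = begin
        Q *′ ∑[ y ∈ Vˢ ] (𝟙 (In? W y) *′ (𝟙 (In? X x) *′ 𝟙 (B x y ≟ 0#)))
          ≡⟨ cong (Q *′_) (trans (∑-cong Vˢ (λ y → trans (solve′ 3 (λ a b c → a :*′ (b :*′ c) :=′ b :*′ (a :*′ c)) refl (𝟙 (In? W y)) (𝟙 (In? X x)) (𝟙 (B x y ≟ 0#)))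
               (cong (𝟙 (In? X x) *′_) (trans (cong (𝟙 (In? W y) *′_) (𝟙-cong (B x y ≟ 0#) (B y x ≟ 0#) B-sym0 B-sym0)) (sym (𝟙-× (In? W y) (B y x ≟ 0#))))))) (∑-*ˡ Vˢ _ _)) ⟩
        Q *′ (𝟙 (In? X x) *′ size (W ∩ x ^⊥)) ≡⟨ solve′ 3 (λ a b c → a :*′ (b :*′ c) :=′ b :*′ (a :*′ c)) refl Q (𝟙 (In? X x)) (size (W ∩ x ^⊥)) ⟩
        𝟙 (In? X x) *′ (Q *′ size (W ∩ x ^⊥)) ≡⟨ cong (𝟙 (In? X x) *′_) (section-count W x (W⊥? x)) ⟩
        𝟙 (In? X x) *′ (size W *′ (1ℚ +′ (Q -′ 1ℚ) *′ 𝟙 (W⊥? x))) ∎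

  -- Nondegenerate subspaces, nonisotropic vectors and hyperbolic pairs

  record IsSpace (m : ℕ) (W : Subspace) : Set where
    field
      dimension : size W ≡ pw Q m
      nondegenerate : Nondegenerate W

  open IsSpace

  #-𝟎 : # (λ x → x ≟ⱽ 𝟎) ≡ 1ℚ
  #-𝟎 = ∑-𝟙-unique Vˢ (λ x → x ≟ⱽ 𝟎) (λ { refl h → h }) (𝟎 , refl) (λ e f → trans e (sym f))

  trivial : (W : Subspace) → size W ≡ 1ℚ → ∀ x → In W x → x ≡ 𝟎
  trivial W s = #-subset (λ x → x ≟ⱽ 𝟎) (In? W) (λ { x refl → 𝟎-in W }) (ℚP.≤-reflexive (trans s (sym #-𝟎)))

  nonzero-exists : ∀ {m W} → IsSpace (suc m) W → ∃ λ x → In W x × ¬ (x ≡ 𝟎)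
  nonzero-exists {m} {W} sp = witness (In? W) (λ x → x ≟ⱽ 𝟎) (λ h → Formula.uu^≢1 q 2≤q m
    (trans (sym (dimension sp)) (trans (#-cong (In? W) (λ x → x ≟ⱽ 𝟎) h (λ { x refl → 𝟎-in W })) #-𝟎)))

  pairing-exists : ∀ {m W} → IsSpace m W → ∀ {x} → In W x → ¬ (x ≡ 𝟎) → ∀ c → ∃ λ y → In W y × B x y ≡ c
  pairing-exists {W = W} sp {x} wx x≢𝟎 c with witness (In? W) (λ y → B x y ≟ 0#) (λ h → x≢𝟎 (nondegenerate sp x wx h))
  ... | y , wy , B≢0 = σ (c * B≢0 ⁻¹) · y , ·-closed W _ wy , (begin
    B x (σ (c * B≢0 ⁻¹) · y) ≡⟨ B-·ʳ x _ y ⟩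
    σ (σ (c * B≢0 ⁻¹)) * B x y ≡⟨ cong (_* B x y) (σσ _) ⟩
    c * B≢0 ⁻¹ * B x y ≡⟨ linear₁ c (inverseʳ B≢0) (solve 3 (λ c i b → c :* i :* b :+ c :* κ 1 := c :+ c :* (b :* i)) refl c (B≢0 ⁻¹) (B x y)) ⟩
    c ∎)

  B-sum : ∀ x y → B (x ⊕ y) (x ⊕ y) ≡ B x x + B y y + (B x y + σ (B x y))
  B-sum x y = begin
    B (x ⊕ y) (x ⊕ y) ≡⟨ trans (B-⊕ x y _) (cong₂ _+_ (B-⊕ʳ x x y) (B-⊕ʳ y x y)) ⟩
    B x x + B x y + (B y x + B y y) ≡⟨ cong (λ w → B x x + B x y + (w + B y y)) (B-herm x y) ⟩
    B x x + B x y + (σ (B x y) + B y y) ≡⟨ solve 4 (λ a b c d → a :+ b :+ (c :+ d) := a :+ d :+ (b :+ c)) refl (B x x) (B x y) (σ (B x y)) (B y y) ⟩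
    B x x + B y y + (B x y + σ (B x y)) ∎

  -- If x and y are both isotropic, then x + y has norm c + σ c = 1. Taking c of trace 1, rather
  -- than halving, covers characteristic 2 as well.
  nonisotropic-sum : ∀ {W x y c} → In W x → In W y → B x y ≡ c → 1# ≡ c + σ c →
    Dec (B x x ≡ 0#) → Dec (B y y ≡ 0#) → ∃ λ v → In W v × ¬ (B v v ≡ 0#)
  nonisotropic-sum {x = x} wx wy Bxy Tc (no n) _ = x , wx , n
  nonisotropic-sum {y = y} wx wy Bxy Tc (yes _) (no n) = y , wy , n
  nonisotropic-sum {W} {x} {y} {c} wx wy Bxy Tc (yes ex) (yes ey) = x ⊕ y , ⊕-closed W wx wy , λ e → 1≢0 (begin
    1# ≡⟨ Tc ⟩
    c + σ c ≡⟨ sym (trans (cong₂ _+_ (cong₂ _+_ ex ey) (cong (λ w → w + σ w) Bxy)) (solve 1 (λ t → κ 0 :+ κ 0 :+ t := t) refl (c + σ c))) ⟩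
    B x x + B y y + (B x y + σ (B x y)) ≡⟨ sym (B-sum x y) ⟩
    B (x ⊕ y) (x ⊕ y) ≡⟨ e ⟩
    0# ∎)

  nonisotropic-exists : ∀ {m W} → IsSpace (suc m) W → ∃ λ v → In W v × ¬ (B v v ≡ 0#)
  nonisotropic-exists {W = W} sp =
    let x , wx , x≢𝟎 = nonzero-exists sp
        c , Tc = trace-surjective 1# σ-1
        y , wy , Bxy = pairing-exists sp wx x≢𝟎 c
    in nonisotropic-sum {W} wx wy Bxy Tc (B x x ≟ 0#) (B y y ≟ 0#)

  -- Subtracting from y the multiple (B y v / B v v) v moves it into v^⊥. A vector of v^⊥ that is
  -- orthogonal to W ∩ v^⊥ is therefore orthogonal to all of W.
  hyperplane-space : ∀ {m W} → IsSpace (suc m) W → ∀ {v} → In W v → ¬ (B v v ≡ 0#) → IsSpace m (W ∩ v ^⊥)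
  hyperplane-space {m} {W} sp {v} wv n = record
    { dimension = ℚO.*-cancelˡ Q≢0 (trans (kernel-count W v (v , wv , n)) (trans (dimension sp) (ℚO.*-comm _ _)))
    ; nondegenerate = λ x (wx , x⊥v) h → nondegenerate sp x wx λ y wy → let a = B y v * n ⁻¹ in begin
        B x y ≡⟨ cong (B x) (sym (⊖-⊕ y (a · v))) ⟩
        B x ((y ⊖ a · v) ⊕ a · v) ≡⟨ B-⊕ʳ x _ _ ⟩
        B x (y ⊖ a · v) + B x (a · v) ≡⟨ cong₂ _+_ (h _ (⊖-closed W wy (·-closed W a wv) ,
            trans (B-⊖ y _ v) (trans (cong (λ w → B y v - w) (B-· a v v))
              (linear₁ (- B y v) (inverseʳ n) (solve 3 (λ b i c → b :- b :* i :* c :+ :- b :* κ 1 := κ 0 :+ :- b :* (c :* i)) refl (B y v) (n ⁻¹) (B v v))))))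
            (trans (B-·ʳ x a v) (trans (cong (σ a *_) x⊥v) (zeroʳ _))) ⟩
        0# + 0# ≡⟨ +-identityˡ 0# ⟩
        0# ∎ }

  record HyperbolicPair (W : Subspace) (e : V) : Set where
    field
      f : V
      f∈W : In W f
      e∈W : In W e
      Bee : B e e ≡ 0#
      Bff : B f f ≡ 0#
      Bef : B e f ≡ 1#
    Bfe : B f e ≡ 1#
    Bfe = trans (B-herm e f) (trans (cong σ Bef) σ-1)

  -- Adding a e to y keeps B e y and adds the trace of a to B y y, so a suitable trace makes the
  -- partner isotropic.
  hyperbolic-shift : ∀ {W e y a} → In W e → B e e ≡ 0# → In W y → B e y ≡ 1# → - B y y ≡ a + σ a → HyperbolicPair W e
  hyperbolic-shift {W} {e} {y} {a} we Bee wy Bey Ta =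
    record { f = y ⊕ a · e ; f∈W = ⊕-closed W wy (·-closed W a we) ; e∈W = we ; Bee = Bee ; Bff = ff ; Bef = ef }
    where
    ef : B e (y ⊕ a · e) ≡ 1#
    ef = trans (B-⊕ʳ e y _) (trans (cong₂ _+_ Bey (trans (B-·ʳ e a e) (trans (cong (σ a *_) Bee) (zeroʳ _)))) (+-identityʳ 1#))
    Bya : B y (a · e) ≡ σ a
    Bya = trans (B-·ʳ y a e) (trans (cong (σ a *_) (trans (B-herm e y) (trans (cong σ Bey) σ-1))) (*-identityʳ _))
    Baa : B (a · e) (a · e) ≡ 0#
    Baa = trans (B-· a e _) (trans (cong (a *_) (trans (B-·ʳ e a e) (trans (cong (σ a *_) Bee) (zeroʳ _)))) (zeroʳ a))
    ff : B (y ⊕ a · e) (y ⊕ a · e) ≡ 0#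
    ff = begin
      B (y ⊕ a · e) (y ⊕ a · e) ≡⟨ B-sum y (a · e) ⟩
      B y y + B (a · e) (a · e) + (B y (a · e) + σ (B y (a · e))) ≡⟨ cong₂ _+_ (cong (B y y +_) Baa) (trans (cong (λ w → w + σ w) Bya) (cong (σ a +_) (σσ a))) ⟩
      B y y + 0# + (σ a + a) ≡⟨ linear₁ (- 1#) Ta (solve 3 (λ b a s → b :+ κ 0 :+ (s :+ a) :+ :- κ 1 :* (a :+ s) := κ 0 :+ :- κ 1 :* (:- b)) refl (B y y) a (σ a)) ⟩
      0# ∎

  hyperbolic-exists : ∀ {m W} → IsSpace m W → ∀ {e} → In W e → ¬ (e ≡ 𝟎) → B e e ≡ 0# → HyperbolicPair W e
  hyperbolic-exists sp {e} we e≢𝟎 Bee =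
    let y , wy , Bey = pairing-exists sp we e≢𝟎 1#
        a , Ta = trace-surjective (- B y y) (trans (σ-neg _) (cong -_ (B-fixed y)))
    in hyperbolic-shift we Bee wy Bey Ta

  infix 5 _∩⟨_∙_⟩^⊥
  _∩⟨_∙_⟩^⊥ : Subspace → V → V → Subspace
  W ∩⟨ e ∙ f ⟩^⊥ = (W ∩ e ^⊥) ∩ f ^⊥

  hyperbolic-project : V → V → V → V
  hyperbolic-project e f y = (y ⊖ B y f · e) ⊖ B y e · f

  hyperbolic-project-in : ∀ {W e} (h : HyperbolicPair W e) {y} → In W y →
    In (W ∩⟨ e ∙ HyperbolicPair.f h ⟩^⊥) (hyperbolic-project e (HyperbolicPair.f h) y)
  hyperbolic-project-in {W} {e} h {y} wy = (⊖-closed W (⊖-closed W wy (·-closed W _ e∈W)) (·-closed W _ f∈W) ,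
      trans (B-⊖ _ _ e) (trans (cong₂ _-_ (trans (B-⊖ y _ e) (cong (λ w → B y e - w) (trans (B-· _ e e) (cong (B y f *_) Bee)))) (trans (B-· _ f e) (cong (B y e *_) Bfe)))
        (solve 2 (λ a b → a :- b :* κ 0 :- a :* κ 1 := κ 0) refl (B y e) (B y f)))) ,
      trans (B-⊖ _ _ f) (trans (cong₂ _-_ (trans (B-⊖ y _ f) (cong (λ w → B y f - w) (trans (B-· _ e f) (cong (B y f *_) Bef)))) (trans (B-· _ f f) (cong (B y e *_) Bff)))
        (solve 2 (λ a b → b :- b :* κ 1 :- a :* κ 0 := κ 0) refl (B y e) (B y f)))
    where
    open HyperbolicPair h

  -- For the size, `kernel-count` is used twice: f shows that pairing with e is nonzero on W, and e
  -- shows that pairing with f is nonzero on W ∩ e^⊥.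
  hyperbolic-space : ∀ {m W} → IsSpace (2 ℕ.+ m) W → ∀ {e} (h : HyperbolicPair W e) → IsSpace m (W ∩⟨ e ∙ HyperbolicPair.f h ⟩^⊥)
  hyperbolic-space {m} {W} sp {e} h = record
    { dimension = ℚO.*-cancelˡ Q≢0 (ℚO.*-cancelˡ Q≢0 (begin
        Q *′ (Q *′ size (W ∩⟨ e ∙ f ⟩^⊥)) ≡⟨ cong (Q *′_) (kernel-count (W ∩ e ^⊥) f (e , (e∈W , Bee) , λ z → 1≢0 (trans (sym Bef) z))) ⟩
        Q *′ size (W ∩ e ^⊥) ≡⟨ kernel-count W e (f , f∈W , λ z → 1≢0 (trans (sym Bfe) z)) ⟩
        size W ≡⟨ dimension sp ⟩
        pw Q m *′ Q *′ Q ≡⟨ solve′ 2 (λ a Q → a :*′ Q :*′ Q :=′ Q :*′ (Q :*′ a)) refl (pw Q m) Q ⟩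
        Q *′ (Q *′ pw Q m) ∎))
    ; nondegenerate = λ x ((wx , x⊥e) , x⊥f) k → nondegenerate sp x wx λ y wy → let y′ = hyperbolic-project e f y in begin
        B x y ≡⟨ linear₁ (- 1#) (trans (B-⊖ʳ x _ _) (cong₂ _-_ (trans (B-⊖ʳ x y _) (cong (λ w → B x y - w) (trans (B-·ʳ x (B y f) e) (trans (cong (σ (B y f) *_) x⊥e) (zeroʳ _)))))
                   (trans (B-·ʳ x (B y e) f) (trans (cong (σ (B y e) *_) x⊥f) (zeroʳ _)))))
                   (solve 2 (λ b c → b :+ :- κ 1 :* (b :- κ 0 :- κ 0) := c :+ :- κ 1 :* c) refl (B x y) (B x y′)) ⟩
        B x y′ ≡⟨ k y′ (hyperbolic-project-in h wy) ⟩
        0# ∎ }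
    where
    open HyperbolicPair h

  -- The numbers of isotropic vectors and of unit vectors

  *-≢0 : ∀ {x y} → ¬ (x ≡ 0#) → ¬ (y ≡ 0#) → ¬ (x * y ≡ 0#)
  *-≢0 x≢0 y≢0 e = y≢0 (no-zero-divisors e x≢0)

  σ-inverse : ∀ {c} (c≢0 : ¬ (c ≡ 0#)) → σ c ≡ c → σ (c≢0 ⁻¹) ≡ c≢0 ⁻¹
  σ-inverse {c} c≢0 fc = linear₂ (- j) (inverseʳ c≢0) i (trans (cong (_* j) (sym fc)) (trans (sym (σ-* c (c≢0 ⁻¹))) (trans (cong σ (inverseʳ c≢0)) σ-1)))
    (solve 3 (λ c i j → j :+ :- j :* κ 1 :+ i :* κ 1 := i :+ :- j :* (c :* i) :+ i :* (c :* j)) refl c i j)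
    where
    i = c≢0 ⁻¹
    j = σ (c≢0 ⁻¹)

  norm-zero-count : ∑[ a ∈ Fˢ ] 𝟙 (0# ≟ (a * σ a)) ≡ 1ℚ
  norm-zero-count = ∑-𝟙-unique Fˢ (λ a → 0# ≟ (a * σ a)) (λ { refl h → h }) (0# , sym (zeroˡ _)) (λ e f → trans (vanish (sym e)) (sym (vanish (sym f))))
    where
    vanish : ∀ {x} → x * σ x ≡ 0# → x ≡ 0#
    vanish {x} eq = decidable-stable (x ≟ 0#) (λ x≢0 → x≢0 (σ≡0 (no-zero-divisors eq x≢0)))

  isotropic? : (W : Subspace) → ∀ x → Dec (In W x × B x x ≡ 0#)
  isotropic? W x = In? W x ×-dec (B x x ≟ 0#)

  -- The number of isotropic vectors in rank m, with the zero vector included.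
  zeros : ℕ → ℚ
  zeros zero = 1ℚ
  zeros (suc m) = (1ℚ +′ u) *′ pw Q m -′ u *′ zeros m

  module _ {m W} (sp : IsSpace (suc m) W) {v : V} (wv : In W v) (n : ¬ (B v v ≡ 0#)) where

    private
      W′ = W ∩ v ^⊥
      c = B v v
      i = n ⁻¹
      Bav : ∀ {w} a → B w v ≡ 0# → B (w ⊕ a · v) (w ⊕ a · v) ≡ B w w + a * σ a * c
      Bav {w} a w⊥v = begin
        B (w ⊕ a · v) (w ⊕ a · v) ≡⟨ B-sum w (a · v) ⟩
        B w w + B (a · v) (a · v) + (B w (a · v) + σ (B w (a · v)))
          ≡⟨ cong₂ (λ b d → B w w + b + (d + σ d)) (trans (B-· a v _) (cong (a *_) (B-·ʳ v a v))) (trans (B-·ʳ w a v) (trans (cong (σ a *_) w⊥v) (zeroʳ _))) ⟩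
        B w w + a * (σ a * c) + (0# + σ 0#) ≡⟨ cong (λ z → B w w + a * (σ a * c) + (0# + z)) σ-0 ⟩
        B w w + a * (σ a * c) + (0# + 0#) ≡⟨ solve 4 (λ b a s c → b :+ a :* (s :* c) :+ (κ 0 :+ κ 0) := b :+ a :* s :* c) refl (B w w) a (σ a) c ⟩
        B w w + a * σ a * c ∎
      R? : ∀ a w → Dec (In W′ w × - (B w w * i) ≡ a * σ a)
      R? a w = In? W′ w ×-dec ((- (B w w * i)) ≟ (a * σ a))
      fibre : ∀ a → ∑[ x ∈ Vˢ ] (𝟙 (a ≟ (B x v * i)) *′ 𝟙 (isotropic? W x)) ≡ ∑[ w ∈ Vˢ ] (𝟙 (In? W′ w) *′ 𝟙 ((- (B w w * i)) ≟ (a * σ a)))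
      fibre a = trans (∑-cong Vˢ (λ x → sym (𝟙-× (a ≟ (B x v * i)) (isotropic? W x))))
        (trans (#-bij (λ x → (a ≟ (B x v * i)) ×-dec isotropic? W x) (R? a) (λ x → x ⊖ a · v) (λ w → w ⊕ a · v) to from (λ _ → ⊖-⊕ _ _) (λ _ → ⊕-⊖ _ _))
          (∑-cong Vˢ (λ w → 𝟙-× (In? W′ w) _)))
        where
        perp : ∀ {x} → a ≡ B x v * i → B (x ⊖ a · v) v ≡ 0#
        perp {x} refl = trans (B-⊖ x _ v) (trans (cong (λ w → B x v - w) (B-· _ v v))
          (linear₁ (- B x v) (inverseʳ n) (solve 3 (λ b c i → b :- b :* i :* c :+ :- b :* κ 1 := κ 0 :+ :- b :* (c :* i)) refl (B x v) c i)))
        to : ∀ {x} → a ≡ B x v * i × In W x × B x x ≡ 0# → In W′ (x ⊖ a · v) × - (B (x ⊖ a · v) (x ⊖ a · v) * i) ≡ a * σ a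
        to {x} (e , wx , iso) = (⊖-closed W wx (·-closed W a wv) , perp e) ,
          linear₂ i (trans (sym iso) (trans (cong (λ y → B y y) (sym (⊖-⊕ x (a · v)))) (Bav a (perp e)))) (a * σ a) (inverseʳ n)
            (solve 4 (λ b i N c → :- (b :* i) :+ i :* (b :+ N :* c) :+ N :* κ 1 := N :+ i :* κ 0 :+ N :* (c :* i)) refl (B (x ⊖ a · v) (x ⊖ a · v)) i (a * σ a) c)
        from : ∀ {w} → In W′ w × - (B w w * i) ≡ a * σ a → a ≡ B (w ⊕ a · v) v * i × In W (w ⊕ a · v) × B (w ⊕ a · v) (w ⊕ a · v) ≡ 0#
        from {w} ((ww , w⊥v) , e) =
          linear₁ (- a) (inverseʳ n) (trans (solve 3 (λ a c i → a :+ :- a :* κ 1 := (κ 0 :+ a :* c) :* i :+ :- a :* (c :* i)) refl a c i)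
            (cong (λ z → z * i + - a * (c * i)) (sym (trans (B-⊕ w _ v) (cong₂ _+_ w⊥v (B-· a v v)))))) ,
          ⊕-closed W ww (·-closed W a wv) ,
          trans (Bav a w⊥v) (linear₂ (- c) e (- B w w) (inverseʳ n)
            (solve 4 (λ b i N c → b :+ N :* c :+ :- c :* N :+ :- b :* κ 1 := κ 0 :+ :- c :* (:- (b :* i)) :+ :- b :* (c :* i)) refl (B w w) i (a * σ a) c))
      count : ∀ w (d : Dec (B w w ≡ 0#)) → ∑[ a ∈ Fˢ ] 𝟙 ((- (B w w * i)) ≟ (a * σ a)) ≡ 1ℚ +′ u -′ u *′ 𝟙 d
      count w (yes e) = trans (∑-cong Fˢ (λ a → cong (λ b → 𝟙 (b ≟ (a * σ a))) (trans (cong (λ b → - (b * i)) e) (solve 1 (λ i → :- (κ 0 :* i) := κ 0) refl i))))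
        (trans norm-zero-count (solve′ 1 (λ u → con′ 1 :=′ con′ 1 :+′ u :-′ u :*′ con′ 1) refl u))
      count w (no ne) = trans (norm-count (- (B w w * i)) (trans (σ-neg _) (cong -_ (trans (σ-* _ _) (cong₂ _*_ (B-fixed w) (σ-inverse n (B-fixed v))))))
          (λ z → *-≢0 ne (λ i≡0 → 1≢0 (trans (sym (inverseʳ n)) (trans (cong (c *_) i≡0) (zeroʳ c))))
            (trans (solve 1 (λ x → x := :- (:- x)) refl (B w w * i)) (trans (cong -_ z) (solve 0 (:- κ 0 := κ 0) refl)))))
        (solve′ 1 (λ u → con′ 1 :+′ u :=′ con′ 1 :+′ u :-′ u :*′ con′ 0) refl u)
      expand : ∀ w → 𝟙 (In? W′ w) *′ (1ℚ +′ u -′ u *′ 𝟙 (B w w ≟ 0#)) ≡ (1ℚ +′ u) *′ 𝟙 (In? W′ w) +′ -′ u *′ 𝟙 (isotropic? W′ w)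
      expand w = trans (solve′ 3 (λ k u b → k :*′ (con′ 1 :+′ u :-′ u :*′ b) :=′ (con′ 1 :+′ u) :*′ k :+′ :-′ u :*′ (k :*′ b)) refl (𝟙 (In? W′ w)) u (𝟙 (B w w ≟ 0#)))
        (cong (λ z → (1ℚ +′ u) *′ 𝟙 (In? W′ w) +′ -′ u *′ z) (sym (𝟙-× (In? W′ w) (B w w ≟ 0#))))

    -- Write x = w + a v with w in v^⊥. Then x is isotropic iff a has norm -B w w / B v v, which has
    -- q + 1 solutions a, but only the solution 0 when w is itself isotropic.
    isotropic-step : # (isotropic? W) ≡ (1ℚ +′ u) *′ size (W ∩ v ^⊥) -′ u *′ # (isotropic? (W ∩ v ^⊥))
    isotropic-step = begin
      # (isotropic? W) ≡⟨ ∑-fibre Vˢ Fˢ (λ x → B x v * n ⁻¹) _ ⟩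
      ∑[ a ∈ Fˢ ] ∑[ x ∈ Vˢ ] (𝟙 (a ≟ (B x v * n ⁻¹)) *′ 𝟙 (isotropic? W x)) ≡⟨ ∑-cong Fˢ fibre ⟩
      ∑[ a ∈ Fˢ ] ∑[ w ∈ Vˢ ] (𝟙 (In? W′ w) *′ 𝟙 ((- (B w w * n ⁻¹)) ≟ (a * σ a))) ≡⟨ ∑-swap Fˢ Vˢ _ ⟩
      ∑[ w ∈ Vˢ ] ∑[ a ∈ Fˢ ] (𝟙 (In? W′ w) *′ 𝟙 ((- (B w w * n ⁻¹)) ≟ (a * σ a)))
        ≡⟨ ∑-cong Vˢ (λ w → trans (∑-*ˡ Fˢ (𝟙 (In? W′ w)) _) (trans (cong (𝟙 (In? W′ w) *′_) (count w (B w w ≟ 0#))) (expand w))) ⟩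
      ∑[ w ∈ Vˢ ] ((1ℚ +′ u) *′ 𝟙 (In? W′ w) +′ -′ u *′ 𝟙 (isotropic? W′ w))
        ≡⟨ trans (∑-+ Vˢ _ _) (cong₂ _+′_ (∑-*ˡ Vˢ (1ℚ +′ u) _) (∑-*ˡ Vˢ (-′ u) _)) ⟩
      (1ℚ +′ u) *′ size W′ +′ -′ u *′ # (isotropic? W′) ≡⟨ solve′ 3 (λ a u z → a :+′ :-′ u :*′ z :=′ a :-′ u :*′ z) refl ((1ℚ +′ u) *′ size W′) u (# (isotropic? W′)) ⟩
      (1ℚ +′ u) *′ size W′ -′ u *′ # (isotropic? W′) ∎
  isotropic-count : ∀ m {W} → IsSpace m W → # (isotropic? W) ≡ zeros m
  isotropic-count zero {W} sp = trans (#-cong (isotropic? W) (λ x → x ≟ⱽ 𝟎) (λ x (wx , _) → trivial W (dimension sp) x wx)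
    (λ { x refl → 𝟎-in W , B-𝟎 𝟎 })) #-𝟎
  isotropic-count (suc m) sp =
    let v , wv , n = nonisotropic-exists sp
        sp′ = hyperplane-space sp wv n
    in trans (isotropic-step sp wv n) (cong₂ (λ s i → (1ℚ +′ u) *′ s -′ u *′ i) (dimension sp′) (isotropic-count m sp′))

  unit? : (W : Subspace) → ∀ x → Dec (In W x × B x x ≡ 1#)
  unit? W x = In? W x ×-dec (B x x ≟ 1#)

  units : ℕ → ℚ
  units m = (pw Q m -′ zeros m) *′ inv (u -′ 1ℚ)

  -- Count pairs (a , x) for which a x has norm 1. Each of the q² - 1 scalars a ≠ 0 contributes the
  -- unit vectors, rescaled; each nonisotropic x contributes q + 1 scalars and each isotropic x
  -- none.
  unit-count : ∀ m {W} → IsSpace m W → # (unit? W) ≡ units m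
  unit-count m {W} sp = ℚO.*-cancelˡ Q-1≢0 (begin
    (Q -′ 1ℚ) *′ # (unit? W) ≡⟨ cong (_*′ # (unit? W)) (sym nonzero-count) ⟩
    ∑[ a ∈ Fˢ ] 𝟙 (¬? (a ≟ 0#)) *′ # (unit? W) ≡⟨ sym (∑-*ʳ Fˢ _ _) ⟩
    ∑[ a ∈ Fˢ ] (𝟙 (¬? (a ≟ 0#)) *′ # (unit? W)) ≡⟨ ∑-cong Fˢ (λ a → sym (row a (a ≟ 0#))) ⟩
    ∑[ a ∈ Fˢ ] ∑[ x ∈ Vˢ ] (𝟙 (In? W x) *′ 𝟙 (1# ≟ (a * σ a * B x x))) ≡⟨ ∑-swap Fˢ Vˢ _ ⟩
    ∑[ x ∈ Vˢ ] ∑[ a ∈ Fˢ ] (𝟙 (In? W x) *′ 𝟙 (1# ≟ (a * σ a * B x x)))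
      ≡⟨ ∑-cong Vˢ (λ x → trans (∑-*ˡ Fˢ _ _) (trans (cong (𝟙 (In? W x) *′_) (column x (B x x ≟ 0#))) (expand x))) ⟩
    ∑[ x ∈ Vˢ ] ((1ℚ +′ u) *′ 𝟙 (In? W x) +′ -′ (1ℚ +′ u) *′ 𝟙 (isotropic? W x))
      ≡⟨ trans (∑-+ Vˢ _ _) (cong₂ _+′_ (∑-*ˡ Vˢ (1ℚ +′ u) _) (∑-*ˡ Vˢ (-′ (1ℚ +′ u)) _)) ⟩
    (1ℚ +′ u) *′ size W +′ -′ (1ℚ +′ u) *′ # (isotropic? W)
      ≡⟨ cong₂ (λ s z → (1ℚ +′ u) *′ s +′ -′ (1ℚ +′ u) *′ z) (dimension sp) (isotropic-count m sp) ⟩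
    (1ℚ +′ u) *′ pw Q m +′ -′ (1ℚ +′ u) *′ zeros m
      ≡⟨ linear₁′ (-′ ((1ℚ +′ u) *′ (pw Q m -′ zeros m))) (inv-inverseʳ u-1≢0)
           (solve′ 4 (λ u p z i → (con′ 1 :+′ u) :*′ p :+′ :-′ (con′ 1 :+′ u) :*′ z :+′ :-′ ((con′ 1 :+′ u) :*′ (p :-′ z)) :*′ con′ 1
              :=′ (u :*′ u :-′ con′ 1) :*′ ((p :-′ z) :*′ i) :+′ :-′ ((con′ 1 :+′ u) :*′ (p :-′ z)) :*′ ((u :-′ con′ 1) :*′ i)) refl u (pw Q m) (zeros m) (inv (u -′ 1ℚ))) ⟩
    (Q -′ 1ℚ) *′ units m ∎)
    where
    Baa : ∀ a x → B (a · x) (a · x) ≡ a * σ a * B x x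
    Baa a x = trans (B-· a x _) (trans (cong (a *_) (B-·ʳ x a x)) (sym (*-assoc _ _ _)))
    scale : ∀ {a b} → b * a ≡ 1# → ∀ x → b · (a · x) ≡ x
    scale {a} {b} ba x = B-separates λ z → trans (B-· b _ z) (trans (cong (b *_) (B-· a x z)) (trans (sym (*-assoc _ _ _)) (trans (cong (_* B x z) ba) (*-identityˡ _))))
    row : ∀ a (d : Dec (a ≡ 0#)) → ∑[ x ∈ Vˢ ] (𝟙 (In? W x) *′ 𝟙 (1# ≟ (a * σ a * B x x))) ≡ 𝟙 (¬? d) *′ # (unit? W)
    row a (yes refl) = trans (∑-0 Vˢ (λ x → trans (cong (𝟙 (In? W x) *′_) (𝟙-no (1# ≟ _) (λ e → 1≢0 (trans e (trans (cong (_* B x x) (zeroˡ _)) (zeroˡ _)))))) (ℚO.zeroʳ _))) (sym (ℚO.zeroˡ _))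
    row a (no a≢0) = trans (trans (∑-cong Vˢ (λ x → sym (𝟙-× (In? W x) (1# ≟ (a * σ a * B x x)))))
      (#-bij (λ x → In? W x ×-dec (1# ≟ (a * σ a * B x x))) (unit? W) (a ·_) (a≢0 ⁻¹ ·_)
        (λ (wx , e) → ·-closed W a wx , trans (Baa a _) (sym e))
        (λ {y} (wy , e) → ·-closed W _ wy , trans (sym e) (trans (cong (λ z → B z z) (sym (scale (inverseʳ a≢0) y))) (Baa a _)))
        (λ _ → scale (trans (*-comm _ _) (inverseʳ a≢0)) _) (λ _ → scale (inverseʳ a≢0) _))) (sym (ℚO.*-identityˡ _))
    column : ∀ x (d : Dec (B x x ≡ 0#)) → ∑[ a ∈ Fˢ ] 𝟙 (1# ≟ (a * σ a * B x x)) ≡ (1ℚ +′ u) *′ (1ℚ -′ 𝟙 d)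
    column x (yes e) = trans (∑-0 Fˢ (λ a → 𝟙-no (1# ≟ _) (λ h → 1≢0 (trans h (trans (cong (a * σ a *_) e) (zeroʳ _))))))
      (solve′ 1 (λ u → con′ 0 :=′ u :*′ (con′ 1 :-′ con′ 1)) refl (1ℚ +′ u))
    column x (no n) = trans (∑-cong Fˢ (λ a → 𝟙-cong (1# ≟ (a * σ a * B x x)) ((n ⁻¹) ≟ (a * σ a))
          (λ h → linear₂ (n ⁻¹) h (a * σ a) (inverseʳ n)
             (solve 3 (λ N c i → i :+ i :* (N :* c) :+ N :* κ 1 := N :+ i :* κ 1 :+ N :* (c :* i)) refl (a * σ a) (B x x) (n ⁻¹)))
          (λ h → linear₂ (B x x) h (- 1#) (inverseʳ n)
             (solve 3 (λ N c i → κ 1 :+ c :* N :+ :- κ 1 :* κ 1 := N :* c :+ c :* i :+ :- κ 1 :* (c :* i)) refl (a * σ a) (B x x) (n ⁻¹)))))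
      (trans (norm-count (n ⁻¹) (σ-inverse n (B-fixed x)) (λ i≡0 → 1≢0 (trans (sym (inverseʳ n)) (trans (cong (B x x *_) i≡0) (zeroʳ _)))))
        (solve′ 1 (λ u → u :=′ u :*′ (con′ 1 :-′ con′ 0)) refl (1ℚ +′ u)))
    expand : ∀ x → 𝟙 (In? W x) *′ ((1ℚ +′ u) *′ (1ℚ -′ 𝟙 (B x x ≟ 0#))) ≡ (1ℚ +′ u) *′ 𝟙 (In? W x) +′ -′ (1ℚ +′ u) *′ 𝟙 (isotropic? W x)
    expand x = trans (solve′ 3 (λ k u b → k :*′ (u :*′ (con′ 1 :-′ b)) :=′ u :*′ k :+′ :-′ u :*′ (k :*′ b)) refl (𝟙 (In? W x)) (1ℚ +′ u) (𝟙 (B x x ≟ 0#)))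
      (cong (λ z → (1ℚ +′ u) *′ 𝟙 (In? W x) +′ -′ (1ℚ +′ u) *′ z) (sym (𝟙-× (In? W x) (B x x ≟ 0#))))


  -- Isometry groups of subspaces

  Funs : FinSet
  Funs = mkFinSet (V → V) (λ f g → ∀ x → f x ≡ g x)
    (record { refl = λ _ → refl ; sym = λ h x → sym (h x) ; trans = λ h k x → trans (h x) (k x) })
    (λ f g → all-dec (λ x → f x ≟ⱽ g x))
    (allFunctions _≟ⱽ_ elemsⱽ 𝟎 elemsⱽ)
    (λ f → Any.map (λ a x → All.lookup a (completeⱽ x)) (allFunctions-complete _≟ⱽ_ elemsⱽ 𝟎 elemsⱽ completeⱽ f))

  -- The isometries of V that preserve W and act trivially on its orthogonal complement.
  record InG (W : Subspace) (f : V → V) : Set where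
    field
      additive : ∀ x y → f (x ⊕ y) ≡ f x ⊕ f y
      homogeneous : ∀ a x → f (a · x) ≡ a · f x
      isometric : ∀ x y → B (f x) (f y) ≡ B x y
      support : ∀ x → In W (f x ⊖ x)

  open InG public

  InG? : ∀ W f → Dec (InG W f)
  InG? W f = map′ (λ (a , h , i , s) → record { additive = a ; homogeneous = h ; isometric = i ; support = s })
    (λ g → additive g , homogeneous g , isometric g , support g)
    (all-dec (λ x → all-dec (λ y → f (x ⊕ y) ≟ⱽ f x ⊕ f y)) ×-dec all-decF (λ a → all-dec (λ x → f (a · x) ≟ⱽ a · f x))
      ×-dec all-dec (λ x → all-dec (λ y → B (f x) (f y) ≟ B x y)) ×-dec all-dec (λ x → In? W (f x ⊖ x)))

  InG-resp : ∀ {W f g} → f ≗ g → InG W f → InG W g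
  InG-resp {W} e h = record
    { additive = λ x y → trans (sym (e _)) (trans (additive h x y) (cong₂ _⊕_ (e x) (e y)))
    ; homogeneous = λ a x → trans (sym (e _)) (trans (homogeneous h a x) (cong (a ·_) (e x)))
    ; isometric = λ x y → trans (sym (cong₂ B (e x) (e y))) (isometric h x y)
    ; support = λ x → subst (λ y → In W (y ⊖ x)) (e x) (support h x) }

  id-InG : ∀ {W} → InG W (λ x → x)
  id-InG {W} = record { additive = λ _ _ → refl ; homogeneous = λ _ _ → refl ; isometric = λ _ _ → refl
                      ; support = λ x → subst (In W) (sym (⊖-self x)) (𝟎-in W) }

  ⊖-telescope : ∀ x y z → (x ⊖ y) ⊕ (y ⊖ z) ≡ x ⊖ z
  ⊖-telescope x y z = B-separates λ t → trans (B-⊕ _ _ t) (trans (cong₂ _+_ (B-⊖ x y t) (B-⊖ y z t))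
    (trans (solve 3 (λ a b c → a :- b :+ (b :- c) := a :- c) refl (B x t) (B y t) (B z t)) (sym (B-⊖ x z t))))

  ∘-InG : ∀ {W f g} → InG W g → InG W f → InG W (λ x → g (f x))
  ∘-InG {W} {f} {g} hg hf = record
    { additive = λ x y → trans (cong g (additive hf x y)) (additive hg _ _)
    ; homogeneous = λ a x → trans (cong g (homogeneous hf a x)) (homogeneous hg a _)
    ; isometric = λ x y → trans (isometric hg _ _) (isometric hf x y)
    ; support = λ x → subst (In W) (⊖-telescope (g (f x)) (f x) x) (⊕-closed W (support hg (f x)) (support hf x)) }

  InG-preserves : ∀ {W f} → InG W f → ∀ {x} → In W x → In W (f x)
  InG-preserves {W} {f} h {x} wx = subst (In W) (⊖-⊕ (f x) x) (⊕-closed W (support h x) wx)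

  InG-mono : ∀ {W W′ f} → (∀ {x} → In W′ x → In W x) → InG W′ f → InG W f
  InG-mono s h = record { additive = additive h ; homogeneous = homogeneous h ; isometric = isometric h ; support = λ x → s (support h x) }

  -- Since v = f v, isometry gives B (f x) v = B x v: the displacement f x - x is orthogonal to v.
  stabilizer : ∀ {W f v} → InG W f → f v ≡ v → InG (W ∩ v ^⊥) f
  stabilizer {f = f} {v} h fv = record
    { additive = additive h ; homogeneous = homogeneous h ; isometric = isometric h
    ; support = λ x → support h x , (begin
        B (f x ⊖ x) v ≡⟨ B-⊖ (f x) x v ⟩
        B (f x) v - B x v ≡⟨ cong (λ w → B (f x) w - B x v) (sym fv) ⟩
        B (f x) (f v) - B x v ≡⟨ cong (_- B x v) (isometric h x v) ⟩
        B x v - B x v ≡⟨ solve 1 (λ b → b :- b := κ 0) refl (B x v) ⟩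
        0# ∎) }

  InG-injective : ∀ {W f} → InG W f → ∀ {x y} → f x ≡ f y → x ≡ y
  InG-injective {f = f} h {x} {y} e = B-separates λ z → trans (sym (isometric h x z)) (trans (cong (λ w → B w (f z)) e) (isometric h y z))

  -- Injectivity comes from the form; on a finite set it makes the image as large as V, counted by
  -- fibres.
  InG-surjective : ∀ {W f} → InG W f → ∀ y → ∃ λ x → f x ≡ y
  InG-surjective {f = f} h y = Any.satisfied (#-subset P? (λ _ → yes (refl {x = y})) (λ _ _ → refl) all≤ y refl)
    where
    P? : ∀ y → Dec (Any (λ x → f x ≡ y) elemsⱽ)
    P? y = Any.any? (λ x → f x ≟ⱽ y) elemsⱽ
    hit : ∀ x → 1ℚ ≡ 𝟙 (P? (f x))
    hit x = sym (𝟙-yes (P? (f x)) (Any.map (cong f) (Any.map sym (completeⱽ x))))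
    all≤ : # (λ x → yes (refl {x = y})) ≤ # P?
    all≤ = ℚP.≤-reflexive (begin
      ∑[ x ∈ Vˢ ] 1ℚ ≡⟨ ∑-cong Vˢ hit ⟩
      ∑[ x ∈ Vˢ ] 𝟙 (P? (f x)) ≡⟨ ∑-fibre Vˢ Vˢ f _ ⟩
      ∑[ z ∈ Vˢ ] ∑[ x ∈ Vˢ ] (𝟙 (z ≟ⱽ f x) *′ 𝟙 (P? (f x))) ≡⟨ ∑-cong Vˢ (λ z → fibre z (P? z)) ⟩
      # P? ∎)
      where
      fibre : ∀ z (d : Dec (Any (λ x → f x ≡ z) elemsⱽ)) → ∑[ x ∈ Vˢ ] (𝟙 (z ≟ⱽ f x) *′ 𝟙 (P? (f x))) ≡ 𝟙 d
      fibre z (yes a) = trans (∑-cong Vˢ (λ x → trans (𝟙-guard (z ≟ⱽ f x) (λ _ → sym (hit x))) (ℚO.*-identityʳ _)))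
        (∑-𝟙-unique Vˢ (λ x → z ≟ⱽ f x) (λ { refl k → k }) (proj₁ (Any.satisfied a) , sym (proj₂ (Any.satisfied a)))
          (λ e e′ → InG-injective h (trans (sym e) e′)))
      fibre z (no ¬a) = ∑-0 Vˢ (λ x → trans (cong (_*′ 𝟙 (P? (f x))) (𝟙-no (z ≟ⱽ f x) (λ { refl → ¬a (Any.map (cong f) (Any.map sym (completeⱽ x))) }))) (ℚO.zeroˡ _))

  -- The converse of `stabilizer`: f v - v is orthogonal to every f x, and these exhaust V. Neither
  -- direction assumes v nonisotropic, so the two together also describe stabilizers of isotropic
  -- vectors.
  fixes : ∀ {W v f} → InG (W ∩ v ^⊥) f → f v ≡ v
  fixes {W} {v} {f} h = ⊖≡𝟎 (B-separates λ y →
    let x , fx = InG-surjective h y in trans (subst (λ y → B (f v ⊖ v) y ≡ 0#) fx (perp x)) (sym (B-𝟎 y)))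
    where
    perp : ∀ x → B (f v ⊖ v) (f x) ≡ 0#
    perp x = begin
      B (f v ⊖ v) (f x) ≡⟨ B-⊖ (f v) v (f x) ⟩
      B (f v) (f x) - B v (f x) ≡⟨ cong (_- B v (f x)) (isometric h v x) ⟩
      B v x - B v (f x) ≡⟨ linear₁ (- 1#) (trans (sym (B-⊖ʳ v (f x) x)) (B-sym0 (proj₂ (support h x))))
            (solve 2 (λ b c → b :- c :+ :- κ 1 :* κ 0 := κ 0 :+ :- κ 1 :* (c :- b)) refl (B v x) (B v (f x))) ⟩
      0# ∎

  -- The displacement h x - x lies in W and is orthogonal to W.
  identity-on : ∀ {W h} → Nondegenerate W → InG W h → (∀ x → In W x → h x ≡ x) → h ≗ (λ x → x)
  identity-on {h = h} nd hG fix x = ⊖≡𝟎 (nd _ (support hG x) (λ y wy → begin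
    B (h x ⊖ x) y ≡⟨ B-⊖ (h x) x y ⟩
    B (h x) y - B x y ≡⟨ cong (λ w → B (h x) w - B x y) (sym (fix y wy)) ⟩
    B (h x) (h y) - B x y ≡⟨ cong (_- B x y) (isometric hG x y) ⟩
    B x y - B x y ≡⟨ solve 1 (λ b → b :- b := κ 0) refl (B x y) ⟩
    0# ∎))

  -- Quasi-reflections and transitivity on unit vectors

  reflect : V → F → V → V
  reflect d l x = x ⊕ (l * B x d) · d

  B-reflect : ∀ d l x z → B (reflect d l x) z ≡ B x z + l * B x d * B d z
  B-reflect d l x z = trans (B-⊕ x _ z) (cong (B x z +_) (B-· _ d z))

  reflect-inverse : ∀ {d l μ} → l + μ + l * μ * B d d ≡ 0# → ∀ x → reflect d l (reflect d μ x) ≡ x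
  reflect-inverse {d} {l} {μ} c x = B-separates λ z → begin
    B (reflect d l (reflect d μ x)) z ≡⟨ trans (B-reflect d l _ z) (cong₂ (λ a b → a + l * b * B d z) (B-reflect d μ x z) (B-reflect d μ x d)) ⟩
    B x z + μ * B x d * B d z + l * (B x d + μ * B x d * B d d) * B d z
      ≡⟨ linear₁ (B x d * B d z) c (solve 6 (λ xz μ xd dz l dd → xz :+ μ :* xd :* dz :+ l :* (xd :+ μ :* xd :* dd) :* dz :+ xd :* dz :* κ 0
           := xz :+ xd :* dz :* (l :+ μ :+ l :* μ :* dd)) refl (B x z) μ (B x d) (B d z) l (B d d)) ⟩
    B x z ∎

  -- The condition on l is the vanishing of the coefficient of B x d · B d y in the change of B x y.
  reflect-InG : ∀ {W d l} → In W d → l + σ l + l * σ l * B d d ≡ 0# → InG W (reflect d l)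
  reflect-InG {W} {d} {l} wd c = record
    { additive = λ x y → B-separates λ z → trans (B-reflect d l _ z) (trans (cong₂ (λ a b → a + l * b * B d z) (B-⊕ x y z) (B-⊕ x y d))
        (trans (solve 6 (λ xz yz l xd yd dz → xz :+ yz :+ l :* (xd :+ yd) :* dz := xz :+ l :* xd :* dz :+ (yz :+ l :* yd :* dz)) refl (B x z) (B y z) l (B x d) (B y d) (B d z))
          (sym (trans (B-⊕ _ _ z) (cong₂ _+_ (B-reflect d l x z) (B-reflect d l y z))))))
    ; homogeneous = λ a x → B-separates λ z → trans (B-reflect d l _ z) (trans (cong₂ (λ b e → b + l * e * B d z) (B-· a x z) (B-· a x d))
        (trans (solve 5 (λ a xz l xd dz → a :* xz :+ l :* (a :* xd) :* dz := a :* (xz :+ l :* xd :* dz)) refl a (B x z) l (B x d) (B d z))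
          (sym (trans (B-· a _ z) (cong (a *_) (B-reflect d l x z))))))
    ; isometric = λ x y → begin
        B (reflect d l x) (reflect d l y) ≡⟨ trans (B-reflect d l x _) (cong₂ (λ a b → a + l * B x d * b) (right x y) (right d y)) ⟩
        B x y + σ l * σ (B y d) * B x d + l * B x d * (B d y + σ l * σ (B y d) * B d d)
          ≡⟨ cong (λ w → B x y + σ l * w * B x d + l * B x d * (B d y + σ l * w * B d d)) (sym (B-herm y d)) ⟩
        B x y + σ l * B d y * B x d + l * B x d * (B d y + σ l * B d y * B d d)
          ≡⟨ linear₁ (B x d * B d y) c (solve 6 (λ xy s dy xd l dd → xy :+ s :* dy :* xd :+ l :* xd :* (dy :+ s :* dy :* dd) :+ xd :* dy :* κ 0
               := xy :+ xd :* dy :* (l :+ s :+ l :* s :* dd)) refl (B x y) (σ l) (B d y) (B x d) l (B d d)) ⟩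
        B x y ∎
    ; support = λ x → subst (In W) (sym (trans (cong (_⊖ x) refl) (move x _))) (·-closed W _ wd) }
    where
    right : ∀ x y → B x (reflect d l y) ≡ B x y + σ l * σ (B y d) * B x d
    right x y = trans (B-⊕ʳ x y _) (cong (B x y +_) (trans (B-·ʳ x _ d) (cong (_* B x d) (σ-* _ _))))
    move : ∀ x w → (x ⊕ w) ⊖ x ≡ w
    move x w = B-separates λ z → trans (B-⊖ _ x z) (trans (cong (_- B x z) (B-⊕ x w z)) (solve 2 (λ a b → a :+ b :- a := b) refl (B x z) (B w z)))

  record Transport (W : Subspace) (v w : V) : Set where
    field
      to from : V → V
      to-InG : InG W to
      from-InG : InG W from
      to-from : ∀ x → to (from x) ≡ x
      from-to : ∀ x → from (to x) ≡ x
      to-v : to v ≡ w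

  transport-∘ : ∀ {W u v w} → Transport W u v → Transport W v w → Transport W u w
  transport-∘ s t = record
    { to = λ x → T.to (S.to x) ; from = λ x → S.from (T.from x)
    ; to-InG = ∘-InG T.to-InG S.to-InG ; from-InG = ∘-InG S.from-InG T.from-InG
    ; to-from = λ x → trans (cong T.to (S.to-from _)) (T.to-from x)
    ; from-to = λ x → trans (cong S.from (T.from-to _)) (S.from-to x)
    ; to-v = trans (cong T.to S.to-v) T.to-v }
    where
    module S = Transport s
    module T = Transport t

  -- The witness is the quasi-reflection in v - w.
  transport-reflect : ∀ {W v w} → In W v → In W w → B v v ≡ 1# → B w w ≡ 1# → ¬ (B v w ≡ 1#) → Transport W v w
  transport-reflect {W} {v} {w} wv ww vv ww1 ne = record
    { to = reflect d l ; from = reflect d (σ l)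
    ; to-InG = reflect-InG wd cond ; from-InG = reflect-InG wd cond′
    ; to-from = reflect-inverse cond
    ; from-to = reflect-inverse (trans (solve 3 (λ l s b → s :+ l :+ s :* l :* b := l :+ s :+ l :* s :* b) refl l (σ l) (B d d)) cond)
    ; to-v = B-separates λ z → begin
        B (reflect d l v) z ≡⟨ B-reflect d l v z ⟩
        B v z + l * β * B d z ≡⟨ cong (λ b → B v z + l * β * b) (B-⊖ v w z) ⟩
        B v z + - i * β * (B v z - B w z) ≡⟨ linear₁ (- (B v z - B w z)) (inverseʳ β≢0)
             (solve 4 (λ a b i c → a :+ :- i :* c :* (a :- b) :+ :- (a :- b) :* κ 1 := b :+ :- (a :- b) :* (c :* i)) refl (B v z) (B w z) i β) ⟩
        B w z ∎ }
    where
    d = v ⊖ w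
    β = B v d
    wd : In W d
    wd = ⊖-closed W wv ww
    βeq : β ≡ 1# - B v w
    βeq = trans (B-⊖ʳ v v w) (cong (_- B v w) vv)
    β≢0 : ¬ (β ≡ 0#)
    β≢0 e = ne (linear₁ (- 1#) (trans (sym βeq) e) (solve 1 (λ b → b :+ :- κ 1 :* κ 0 := κ 1 :+ :- κ 1 :* (κ 1 :- b)) refl (B v w)))
    i = β≢0 ⁻¹
    -- With this scalar v goes to v - d = w. The isometry condition holds because B d d is the trace
    -- of β.
    l = - i
    Bdd : B d d ≡ β + σ β
    Bdd = begin
      B d d ≡⟨ B-⊖ v w d ⟩
      β - B w d ≡⟨ cong (λ b → β - b) (trans (B-⊖ʳ w v w) (cong₂ _-_ (B-herm v w) ww1)) ⟩
      β - (σ (B v w) - 1#) ≡⟨ linear₁ (- 1#) (trans (cong σ βeq) (trans (σ-+ _ _) (cong₂ _+_ σ-1 (σ-neg _))))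
           (solve 3 (λ β s t → β :- (s :- κ 1) :+ :- κ 1 :* (κ 1 :+ :- s) := β :+ t :+ :- κ 1 :* t) refl β (σ (B v w)) (σ β)) ⟩
      β + σ β ∎
    σβi : σ β * σ i ≡ 1#
    σβi = trans (sym (σ-* β i)) (trans (cong σ (inverseʳ β≢0)) σ-1)
    cond : l + σ l + l * σ l * B d d ≡ 0#
    cond = begin
      - i + σ (- i) + - i * σ (- i) * B d d ≡⟨ cong₂ (λ s b → - i + s + - i * s * b) (σ-neg i) Bdd ⟩
      - i + - σ i + - i * - σ i * (β + σ β) ≡⟨ linear₂ (σ i) (inverseʳ β≢0) i σβi
          (solve 4 (λ i j b c → :- i :+ :- j :+ :- i :* :- j :* (b :+ c) :+ j :* κ 1 :+ i :* κ 1 := κ 0 :+ j :* (b :* i) :+ i :* (c :* j)) refl i (σ i) β (σ β)) ⟩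
      0# ∎
    cond′ : σ l + σ (σ l) + σ l * σ (σ l) * B d d ≡ 0#
    cond′ = trans (cong (λ s → σ l + s + σ l * s * B d d) (σσ l)) (trans (solve 3 (λ l s b → s :+ l :+ s :* l :* b := l :+ s :+ l :* s :* b) refl l (σ l) (B d d)) cond)

  -- There are q + 1 scalars of norm 1, hence more than one.
  unit-scalar : ∃ λ ζ → 1# ≡ ζ * σ ζ × ¬ (ζ ≡ 1#)
  unit-scalar = find (Any.any? (λ ζ → (1# ≟ (ζ * σ ζ)) ×-dec ¬? (ζ ≟ 1#)) elems)
    where
    find : Dec (Any (λ ζ → 1# ≡ ζ * σ ζ × ¬ (ζ ≡ 1#)) elems) → _
    find (yes a) = Any.satisfied a
    find (no ¬a) = ⊥-elim (u≢0 (linear₁′ 1ℚ count (solve′ 1 (λ u → u :+′ con′ 1 :*′ con′ 1 :=′ con′ 0 :+′ con′ 1 :*′ (con′ 1 :+′ u)) refl u)))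
      where
      only1 : ∀ {ζ} → 1# ≡ ζ * σ ζ → ζ ≡ 1#
      only1 {ζ} e = decidable-stable (ζ ≟ 1#) (λ ne → ¬a (Any.map (λ { refl → e , ne }) (complete ζ)))
      count : 1ℚ +′ u ≡ 1ℚ
      count = trans (sym (norm-count 1# σ-1 1≢0)) (∑-𝟙-unique Fˢ (λ ζ → 1# ≟ (ζ * σ ζ)) (λ { refl h → h })
        (1# , sym (trans (*-identityˡ _) σ-1)) (λ e f → trans (only1 e) (sym (only1 f))))

  -- When B v w = 1, in particular when v = w, no single quasi-reflection in v - w is available. A
  -- detour through ζ v, with ζ ≠ 1 of norm 1, works because B v (ζ v) = σ ζ and B (ζ v) w = ζ both
  -- differ from 1.
  transport : ∀ {W v w} → In W v → In W w → B v v ≡ 1# → B w w ≡ 1# → Dec (B v w ≡ 1#) → Transport W v w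
  transport wv ww vv ww1 (no ne) = transport-reflect wv ww vv ww1 ne
  transport {W} {v} {w} wv ww vv ww1 (yes vw) = transport-∘
      (transport-reflect wv wz vv zz (λ e → ζ≢1 (trans (sym (σσ ζ)) (trans (cong σ (trans (sym vz) e)) σ-1))))
      (transport-reflect wz ww zz ww1 (λ e → ζ≢1 (trans (sym zw) e)))
    where
    ζ = proj₁ unit-scalar
    ζ≢1 = proj₂ (proj₂ unit-scalar)
    z = ζ · v
    wz : In W z
    wz = ·-closed W ζ wv
    vz : B v z ≡ σ ζ
    vz = trans (B-·ʳ v ζ v) (trans (cong (σ ζ *_) vv) (*-identityʳ _))
    zw : B z w ≡ ζ
    zw = trans (B-· ζ v w) (trans (cong (ζ *_) vw) (*-identityʳ _))
    zz : B z z ≡ 1#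
    zz = trans (B-· ζ v z) (trans (cong (ζ *_) vz) (sym (proj₁ (proj₂ unit-scalar))))

  unit-exists : ∀ {m W} → IsSpace (suc m) W → ∃ λ v → In W v × B v v ≡ 1#
  unit-exists {W = W} sp =
    let v , wv , n = nonisotropic-exists sp
        a , Na = norm-surjective (n ⁻¹) (σ-inverse n (B-fixed v)) (λ i≡0 → 1≢0 (trans (sym (inverseʳ n)) (trans (cong (B v v *_) i≡0) (zeroʳ _))))
    in a · v , ·-closed W a wv , (begin
      B (a · v) (a · v) ≡⟨ trans (B-· a v _) (cong (a *_) (B-·ʳ v a v)) ⟩
      a * (σ a * B v v) ≡⟨ linear₂ (- B v v) Na 1# (inverseʳ n) (solve 4 (λ a s c i → a :* (s :* c) :+ :- c :* (a :* s) :+ κ 1 :* κ 1 := κ 1 :+ :- c :* i :+ κ 1 :* (c :* i)) refl a (σ a) (B v v) (n ⁻¹)) ⟩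
      1# ∎)

  -- The order of the unitary group

  order : Subspace → ℚ
  order W = ∑[ f ∈ Funs ] 𝟙 (InG? W f)

  groupOrder : ℕ → ℚ
  groupOrder zero = 1ℚ
  groupOrder (suc m) = units (suc m) *′ groupOrder m

  -- The elements taking v to a unit vector w form a coset of the stabilizer of v: composing with
  -- the inverse of a transport identifies them with the group of W ∩ v^⊥. Other w are never
  -- reached.
  transporter-count : ∀ {W v} → In W v → B v v ≡ 1# → ∀ w (d : Dec (In W w × B w w ≡ 1#)) →
    ∑[ f ∈ Funs ] (𝟙 (w ≟ⱽ f v) *′ 𝟙 (InG? W f)) ≡ 𝟙 d *′ order (W ∩ v ^⊥)
  transporter-count {W} {v} wv vv w (no ¬d) = trans (∑-0 Funs (λ f → trans (sym (𝟙-× (w ≟ⱽ f v) (InG? W f)))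
      (𝟙-no ((w ≟ⱽ f v) ×-dec InG? W f) (λ { (refl , h) → ¬d (InG-preserves h wv , trans (isometric h v v) vv) })))) (sym (ℚO.zeroˡ _))
  transporter-count {W} {v} wv vv w (yes (ww , ww1)) = begin
    ∑[ f ∈ Funs ] (𝟙 (w ≟ⱽ f v) *′ 𝟙 (InG? W f)) ≡⟨ ∑-cong Funs (λ f → trans (sym (𝟙-× (w ≟ⱽ f v) (InG? W f))) (sym (ℚO.*-identityʳ _))) ⟩
    ∑[ f ∈ Funs ] (𝟙 ((w ≟ⱽ f v) ×-dec InG? W f) *′ 1ℚ)
      ≡⟨ ∑-bij Funs Funs (λ f → (w ≟ⱽ f v) ×-dec InG? W f) (InG? (W ∩ v ^⊥)) (λ _ → 1ℚ) (λ _ → 1ℚ)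
           (λ f x → T.from (f x)) (λ g x → T.to (g x))
           (λ e (k , h) → trans k (e v) , InG-resp e h) InG-resp
           (λ e x → cong T.from (e x)) (λ e x → cong T.to (e x))
           (λ {f} (k , h) → stabilizer (∘-InG T.from-InG h) (trans (cong T.from (trans (sym k) (sym T.to-v))) (T.from-to v)))
           (λ {g} h → trans (sym T.to-v) (cong T.to (sym (fixes {W} h))) , ∘-InG T.to-InG (InG-mono proj₁ h))
           (λ _ x → T.to-from _) (λ _ x → T.from-to _) (λ _ → refl) (λ _ → refl) ⟩
    ∑[ g ∈ Funs ] (𝟙 (InG? (W ∩ v ^⊥) g) *′ 1ℚ) ≡⟨ trans (∑-cong Funs (λ g → ℚO.*-identityʳ _)) (sym (ℚO.*-identityˡ _)) ⟩
    1ℚ *′ order (W ∩ v ^⊥) ∎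
    where
    module T = Transport (transport {W} wv ww vv ww1 (B v w ≟ 1#))

  group-order : ∀ m {W} → IsSpace m W → order W ≡ groupOrder m
  group-order zero {W} sp = ∑-𝟙-unique Funs (InG? W) InG-resp ((λ x → x) , id-InG)
    (λ h k x → trans (⊖≡𝟎 (trivial W (dimension sp) _ (support h x))) (sym (⊖≡𝟎 (trivial W (dimension sp) _ (support k x)))))
  group-order (suc m) {W} sp = let v , wv , vv = unit-exists sp in begin
    order W ≡⟨ ∑-fibre Funs Vˢ (λ f → f v) _ ⟩
    ∑[ w ∈ Vˢ ] ∑[ f ∈ Funs ] (𝟙 (w ≟ⱽ f v) *′ 𝟙 (InG? W f)) ≡⟨ ∑-cong Vˢ (λ w → transporter-count {W} wv vv w (unit? W w)) ⟩
    ∑[ w ∈ Vˢ ] (𝟙 (unit? W w) *′ order (W ∩ v ^⊥)) ≡⟨ ∑-*ʳ Vˢ _ _ ⟩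
    # (unit? W) *′ order (W ∩ v ^⊥)
      ≡⟨ cong₂ _*′_ (unit-count (suc m) sp) (group-order m (hyperplane-space sp wv (λ e → 1≢0 (trans (sym vv) e)))) ⟩
    units (suc m) *′ groupOrder m ∎


  -- Elements of p-power order have fixed vectors

  iterate-InG : ∀ {W f} → InG W f → ∀ n → InG W (iterate f n)
  iterate-InG h zero = id-InG
  iterate-InG h (suc n) = ∘-InG h (iterate-InG h n)

  ⊕-isCommutativeMonoid : IsCommutativeMonoid _≡_ _⊕_ 𝟎
  ⊕-isCommutativeMonoid = record
    { isMonoid = record
      { isSemigroup = record { isMagma = record { isEquivalence = ≡.isEquivalence ; ∙-cong = cong₂ _⊕_ } ; assoc = assoc′ }
      ; identity = ⊕-identityˡ , λ x → trans (comm′ x 𝟎) (⊕-identityˡ x) }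
    ; comm = comm′ }
    where
    comm′ : ∀ x y → x ⊕ y ≡ y ⊕ x
    comm′ x y = B-separates λ z → trans (B-⊕ x y z) (trans (+-comm _ _) (sym (B-⊕ y x z)))
    assoc′ : ∀ x y z → (x ⊕ y) ⊕ z ≡ x ⊕ (y ⊕ z)
    assoc′ x y z = B-separates λ t → trans (B-⊕ _ z t) (trans (cong (_+ B z t) (B-⊕ x y t)) (trans (+-assoc _ _ _)
      (sym (trans (B-⊕ x _ t) (cong (B x t +_) (B-⊕ y z t))))))

  module VFr = Frobenius _⊕_ 𝟎 ⊕-isCommutativeMonoid
  module FFr = Frobenius add 0# +-isCommutativeMonoid

  B-× : ∀ n x z → B (n VFr.Mult.× x) z ≡ (n FFr.Mult.× 1#) * B x z
  B-× zero x z = trans (B-𝟎 z) (sym (zeroˡ _))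
  B-× (suc n) x z = trans (B-⊕ x _ z) (trans (cong (B x z +_) (B-× n x z))
    (solve 2 (λ b n → b :+ n :* b := (κ 1 :+ n) :* b) refl (B x z) (n FFr.Mult.× 1#)))

  torsionⱽ : ∀ x → p VFr.Mult.× x ≡ 𝟎
  torsionⱽ x = B-separates λ z → trans (B-× p x z) (trans (cong (_* B x z) characteristic) (trans (zeroˡ _) (sym (B-𝟎 z))))

  delta : (V → V) → V → V
  delta f x = f x ⊖ x

  delta-+ : ∀ {W f} → InG W f → ∀ x y → delta f (x ⊕ y) ≡ delta f x ⊕ delta f y
  delta-+ {f = f} h x y = B-separates λ z → begin
    B (f (x ⊕ y) ⊖ (x ⊕ y)) z ≡⟨ trans (B-⊖ _ _ z) (cong₂ _-_ (trans (cong (λ w → B w z) (additive h x y)) (B-⊕ _ _ z)) (B-⊕ x y z)) ⟩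
    B (f x) z + B (f y) z - (B x z + B y z) ≡⟨ solve 4 (λ a b c d → a :+ b :- (c :+ d) := a :- c :+ (b :- d)) refl (B (f x) z) (B (f y) z) (B x z) (B y z) ⟩
    B (f x) z - B x z + (B (f y) z - B y z) ≡⟨ sym (trans (B-⊕ _ _ z) (cong₂ _+_ (B-⊖ (f x) x z) (B-⊖ (f y) y z))) ⟩
    B (delta f x ⊕ delta f y) z ∎

  fix-𝟎 : ∀ {W f} → InG W f → f 𝟎 ≡ 𝟎
  fix-𝟎 {f = f} h = trans (cong f (sym 0·𝟎)) (trans (homogeneous h 0# 𝟎) (B-separates λ z → trans (B-· 0# _ z) (trans (zeroˡ _) (sym (B-𝟎 z)))))
    where
    0·𝟎 : 0# · 𝟎 ≡ 𝟎
    0·𝟎 = B-separates λ z → trans (B-· 0# 𝟎 z) (trans (zeroˡ _) (sym (B-𝟎 z)))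

  ⊕-delta : ∀ f x → x ⊕ delta f x ≡ f x
  ⊕-delta f x = B-separates λ z → trans (B-⊕ x _ z) (trans (cong (B x z +_) (B-⊖ (f x) x z)) (solve 2 (λ a b → b :+ (a :- b) := a) refl (B (f x) z) (B x z)))

  frobeniusⱽ : ∀ {W f} → InG W f → ∀ x → iterate f p x ≡ x ⊕ iterate (delta f) p x
  frobeniusⱽ {f = f} h x = trans (iterate-cong (λ y → sym (⊕-delta f y)) p x)
    (VFr.frobenius (delta f) (delta-+ h) (trans (cong (_⊖ 𝟎) (fix-𝟎 h)) (⊖-self 𝟎)) prime torsionⱽ x)

  ⊕-cancel : ∀ {x y} → x ⊕ y ≡ x → y ≡ 𝟎
  ⊕-cancel {x} {y} e = B-separates λ z → trans (linear₁ 1# (trans (sym (B-⊕ x y z)) (cong (λ w → B w z) e))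
    (solve 2 (λ a b → b :+ κ 1 :* a := κ 0 :+ κ 1 :* (a :+ b)) refl (B x z) (B y z))) (sym (B-𝟎 z))

  iterate-pᵏ-suc : ∀ (f : V → V) k → iterate f (p ℕ.^ suc k) ≗ iterate (iterate f (p ℕ.^ k)) p
  iterate-pᵏ-suc f k x = iterate-* f p (p ℕ.^ k) x

  PPower : (V → V) → Set
  PPower f = ∃ λ k → iterate f (p ℕ.^ k) ≗ (λ x → x)

  -- With g = f^(p^k), `frobeniusⱽ` gives g^p - 1 = (g - 1)^p. If g - 1 is injective on W, so is its
  -- p-th power; hence absence of nonzero fixed vectors passes from f to all f^(p^k).
  no-fixed : ∀ {W f} → InG W f → (∀ x → In W x → f x ≡ x → x ≡ 𝟎) → ∀ k x → In W x → iterate f (p ℕ.^ k) x ≡ x → x ≡ 𝟎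
  no-fixed h nf zero x wx e = nf x wx e
  no-fixed {W} {f} h nf (suc k) x wx e = descend p x wx (⊕-cancel (trans (sym (frobeniusⱽ gG x)) (trans (sym (iterate-pᵏ-suc f k x)) e)))
    where
    g = iterate f (p ℕ.^ k)
    gG : InG W g
    gG = iterate-InG h (p ℕ.^ k)
    kernel : ∀ x → In W x → delta g x ≡ 𝟎 → x ≡ 𝟎
    kernel x wx e = no-fixed h nf k x wx (⊖≡𝟎 e)
    stays : ∀ n x → In W x → In W (iterate (delta g) n x)
    stays zero x wx = wx
    stays (suc n) x wx = support gG _
    descend : ∀ n x → In W x → iterate (delta g) n x ≡ 𝟎 → x ≡ 𝟎
    descend zero x wx e = e
    descend (suc n) x wx e = descend n x wx (kernel _ (stays n x wx) e)

  fixed-vector : ∀ {m W f} → IsSpace (suc m) W → InG W f → PPower f → ∃ λ v → In W v × ¬ (v ≡ 𝟎) × f v ≡ v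
  fixed-vector {W = W} {f} sp h (k , fk) =
    let x , wx , x≢𝟎 = nonzero-exists sp
        v , (wv , fv) , v≢𝟎 = witness (λ x → In? W x ×-dec (f x ≟ⱽ x)) (λ x → x ≟ⱽ 𝟎)
          (λ nf → x≢𝟎 (no-fixed h (λ y wy e → nf y (wy , e)) k x wx (fk x)))
    in v , wv , v≢𝟎 , fv

  -- The n-th iterate moves x by n d, and p d = 0.
  iterate-translate : ∀ {W h} → InG W h → ∀ {x d} → h x ≡ x ⊕ d → h d ≡ d → iterate h p x ≡ x
  iterate-translate {h = h} hG {x} {d} hx hd = trans (go p) (trans (cong (x ⊕_) (torsionⱽ d)) (VFrId x))
    where
    open CommutativeMonoid VFr.monoid using (assoc) renaming (identityʳ to VFrId; comm to ⊕-comm)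
    h× : ∀ n → h (n VFr.Mult.× d) ≡ n VFr.Mult.× d
    h× zero = fix-𝟎 hG
    h× (suc n) = trans (additive hG d _) (cong₂ _⊕_ hd (h× n))
    go : ∀ n → iterate h n x ≡ x ⊕ n VFr.Mult.× d
    go zero = sym (VFrId x)
    go (suc n) = trans (cong h (go n)) (trans (additive hG x _) (trans (cong₂ _⊕_ hx (h× n)) (assoc x d _)))

  -- Siegel transformations

  -- The Siegel transformation fixing e, with f ↦ f + w + c e.
  siegel : V → V → F → V → V
  siegel e w c x = x ⊕ (B x e · (w ⊕ c · e) ⊖ B x w · e)

  B-siegel : ∀ e w c x z → B (siegel e w c x) z ≡ B x z + (B x e * (B w z + c * B e z) - B x w * B e z)
  B-siegel e w c x z = trans (B-⊕ x _ z) (cong (B x z +_) (trans (B-⊖ _ _ z) (cong₂ _-_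
    (trans (B-· _ _ z) (cong (B x e *_) (trans (B-⊕ w _ z) (cong (B w z +_) (B-· c e z))))) (B-· _ e z))))

  module Siegel {W : Subspace} {e w : V} {c : F} (we : In W e) (ww : In W w) (Bee : B e e ≡ 0#) (Bwe : B w e ≡ 0#)
    (trace : c + σ c ≡ - B w w) where

    Bew : B e w ≡ 0#
    Bew = B-sym0 Bwe

    τ : V → V
    τ = siegel e w c

    Bτe : ∀ x → B (τ x) e ≡ B x e
    Bτe x = trans (B-siegel e w c x e) (trans (cong₂ (λ a b → B x e + (B x e * (a + c * b) - B x w * b)) Bwe Bee)
      (solve 3 (λ a c b → a :+ (a :* (κ 0 :+ c :* κ 0) :- b :* κ 0) := a) refl (B x e) c (B x w)))

    Bτw : ∀ x → B (τ x) w ≡ B x w + B x e * B w w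
    Bτw x = trans (B-siegel e w c x w) (trans (cong (λ b → B x w + (B x e * (B w w + c * b) - B x w * b)) Bew)
      (solve 4 (λ a c b d → b :+ (a :* (d :+ c :* κ 0) :- b :* κ 0) := b :+ a :* d) refl (B x e) c (B x w) (B w w)))

    -- In the expansion of B (τ x) (τ y) the surplus is B x e · B e y times B w w + c + σ c, which
    -- the trace condition kills.
    τ-InG : InG W τ
    τ-InG = record
      { additive = λ x y → B-separates λ z → trans (B-siegel e w c _ z) (trans (cong₃′ (B-⊕ x y z) (B-⊕ x y e) (B-⊕ x y w) z)
          (trans (solve 8 (λ xz yz xe ye xw yw l k → xz :+ yz :+ ((xe :+ ye) :* l :- (xw :+ yw) :* k) := xz :+ (xe :* l :- xw :* k) :+ (yz :+ (ye :* l :- yw :* k)))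
              refl (B x z) (B y z) (B x e) (B y e) (B x w) (B y w) (B w z + c * B e z) (B e z))
            (sym (trans (B-⊕ _ _ z) (cong₂ _+_ (B-siegel e w c x z) (B-siegel e w c y z))))))
      ; homogeneous = λ a x → B-separates λ z → trans (B-siegel e w c _ z) (trans (cong₃′ (B-· a x z) (B-· a x e) (B-· a x w) z)
          (trans (solve 6 (λ a xz xe xw l k → a :* xz :+ (a :* xe :* l :- a :* xw :* k) := a :* (xz :+ (xe :* l :- xw :* k)))
              refl a (B x z) (B x e) (B x w) (B w z + c * B e z) (B e z))
            (sym (trans (B-· a _ z) (cong (a *_) (B-siegel e w c x z))))))
      ; isometric = iso
      ; support = λ x → subst (In W) (sym (move x _)) (⊖-closed W (·-closed W _ (⊕-closed W ww (·-closed W c we))) (·-closed W _ we)) }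
      where
      cong₃′ : ∀ {a a′ b b′ d d′} → a ≡ a′ → b ≡ b′ → d ≡ d′ → ∀ z →
        a + (b * (B w z + c * B e z) - d * B e z) ≡ a′ + (b′ * (B w z + c * B e z) - d′ * B e z)
      cong₃′ refl refl refl z = refl
      move : ∀ x y → (x ⊕ y) ⊖ x ≡ y
      move x y = B-separates λ z → trans (B-⊖ _ x z) (trans (cong (_- B x z) (B-⊕ x y z)) (solve 2 (λ a b → a :+ b :- a := b) refl (B x z) (B y z)))
      iso : ∀ x y → B (τ x) (τ y) ≡ B x y
      iso x y = begin
        B (τ x) (τ y) ≡⟨ B-siegel e w c x (τ y) ⟩
        B x (τ y) + (B x e * (B w (τ y) + c * B e (τ y)) - B x w * B e (τ y))
          ≡⟨ cong₃″ (trans (B-herm (τ y) x) (trans (cong σ (B-siegel e w c y x)) σexpand))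
               (trans (B-herm (τ y) w) (trans (cong σ (Bτw y)) (trans (σ-+ _ _) (cong₂ _+_ (sym (B-herm y w)) (trans (σ-* _ _) (cong₂ _*_ (sym (B-herm y e)) (B-fixed w)))))))
               (trans (B-herm (τ y) e) (trans (cong σ (Bτe y)) (sym (B-herm y e)))) ⟩
        B x y + (B e y * (B x w + σ c * B x e) - B w y * B x e) + (B x e * ((B w y + B e y * B w w) + c * B e y) - B x w * B e y)
          ≡⟨ linear₁ (B x e * B e y) trace (solve 8 (λ xy ey xw s xe wy ww c →
               xy :+ (ey :* (xw :+ s :* xe) :- wy :* xe) :+ (xe :* ((wy :+ ey :* ww) :+ c :* ey) :- xw :* ey) :+ xe :* ey :* (:- ww)
               := xy :+ xe :* ey :* (c :+ s)) refl (B x y) (B e y) (B x w) (σ c) (B x e) (B w y) (B w w) c) ⟩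
        B x y ∎
        where
        cong₃″ : ∀ {a a′ b b′ d d′} → a ≡ a′ → b ≡ b′ → d ≡ d′ → a + (B x e * (b + c * d) - B x w * d) ≡ a′ + (B x e * (b′ + c * d′) - B x w * d′)
        cong₃″ refl refl refl = refl
        σexpand : σ (B y x + (B y e * (B w x + c * B e x) - B y w * B e x)) ≡ B x y + (B e y * (B x w + σ c * B x e) - B w y * B x e)
        σexpand = trans (σ-+ _ _) (cong₂ _+_ (sym (B-herm y x)) (trans (σ-+ _ _) (cong₂ _+_
          (trans (σ-* _ _) (cong₂ _*_ (sym (B-herm y e)) (trans (σ-+ _ _) (cong₂ _+_ (sym (B-herm w x)) (trans (σ-* _ _) (cong (σ c *_) (sym (B-herm e x))))))))
          (trans (σ-neg _) (cong -_ (trans (σ-* _ _) (cong₂ _*_ (sym (B-herm y w)) (sym (B-herm e x)))))))))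

    τ-e : τ e ≡ e
    τ-e = B-separates λ z → trans (B-siegel e w c e z) (trans (cong₂ (λ a b → B e z + (a * (B w z + c * B e z) - b * B e z)) Bee Bew)
      (solve 3 (λ z a b → z :+ (κ 0 :* a :- κ 0 :* b) := z) refl (B e z) (B w z + c * B e z) (B e z)))

    τ-perp : ∀ {x} → B x e ≡ 0# → τ x ≡ x ⊖ B x w · e
    τ-perp {x} xe = B-separates λ z → trans (B-siegel e w c x z) (trans (cong (λ a → B x z + (a * (B w z + c * B e z) - B x w * B e z)) xe)
      (trans (solve 4 (λ x a b d → x :+ (κ 0 :* a :- b :* d) := x :- b :* d) refl (B x z) (B w z + c * B e z) (B x w) (B e z))
        (sym (trans (B-⊖ x _ z) (cong (λ a → B x z - a) (B-· _ e z))))))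

  -- The inverse has parameters -w and -B w w - c; under the trace condition the latter is σ c.
  siegel-inverse : ∀ {e w c c′} → B e e ≡ 0# → B w e ≡ 0# → c + c′ ≡ - B w w → ∀ x → siegel e w c (siegel e ((- 1#) · w) c′ x) ≡ x
  siegel-inverse {e} {w} {c} {c′} Bee Bwe tr x = B-separates λ z → begin
    B (siegel e w c y) z ≡⟨ B-siegel e w c y z ⟩
    B y z + (B y e * (B w z + c * B e z) - B y w * B e z) ≡⟨ three (yz z) ye yw z ⟩
    B x z + (B x e * (- B w z + c′ * B e z) - - B x w * B e z) + (B x e * (B w z + c * B e z) - (B x w - B x e * B w w) * B e z)
      ≡⟨ linear₁ (B x e * B e z) tr (solve 8 (λ xz xe wz c′ ez xw c ww → xz :+ (xe :* (:- wz :+ c′ :* ez) :- :- xw :* ez) :+ (xe :* (wz :+ c :* ez) :- (xw :- xe :* ww) :* ez) :+ xe :* ez :* (:- ww)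
           := xz :+ xe :* ez :* (c :+ c′)) refl (B x z) (B x e) (B w z) c′ (B e z) (B x w) c (B w w)) ⟩
    B x z ∎
    where
    w′ = (- 1#) · w
    y = siegel e w′ c′ x
    Bw′ : ∀ z → B w′ z ≡ - B w z
    Bw′ z = trans (B-· _ w z) (solve 1 (λ b → :- κ 1 :* b := :- b) refl (B w z))
    Bxw′ : B x w′ ≡ - B x w
    Bxw′ = trans (B-·ʳ x _ w) (trans (cong (_* B x w) (trans (σ-neg 1#) (cong -_ σ-1))) (solve 1 (λ b → :- κ 1 :* b := :- b) refl (B x w)))
    yz : ∀ z → B y z ≡ B x z + (B x e * (- B w z + c′ * B e z) - - B x w * B e z)
    yz z = trans (B-siegel e w′ c′ x z) (cong₂ (λ a b → B x z + (B x e * (a + c′ * B e z) - b * B e z)) (Bw′ z) Bxw′)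
    ye : B y e ≡ B x e
    ye = trans (yz e) (trans (cong₂ (λ a b → B x e + (B x e * (- a + c′ * b) - - B x w * b)) Bwe Bee)
      (solve 3 (λ a c b → a :+ (a :* (:- κ 0 :+ c :* κ 0) :- :- b :* κ 0) := a) refl (B x e) c′ (B x w)))
    yw : B y w ≡ B x w - B x e * B w w
    yw = trans (yz w) (trans (cong (λ b → B x w + (B x e * (- B w w + c′ * b) - - B x w * b)) (B-sym0 Bwe))
      (solve 4 (λ a c b d → b :+ (a :* (:- d :+ c :* κ 0) :- :- b :* κ 0) := b :- a :* d) refl (B x e) c′ (B x w) (B w w)))
    three : ∀ {a a′ b b′ d d′} → a ≡ a′ → b ≡ b′ → d ≡ d′ → ∀ z → a + (b * (B w z + c * B e z) - d * B e z) ≡ a′ + (b′ * (B w z + c * B e z) - d′ * B e z)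
    three refl refl refl z = refl

  -- Fixed spaces and the image of A - 1

  fixSize : Subspace → (V → V) → ℚ
  fixSize W A = # (λ x → In? W x ×-dec (A x ≟ⱽ x))

  Fix : ∀ W {A} → InG W A → Subspace
  Fix W {A} h = record
    { In = λ x → In W x × A x ≡ x
    ; In? = λ x → In? W x ×-dec (A x ≟ⱽ x)
    ; ⊕-closed = λ (wx , ex) (wy , ey) → ⊕-closed W wx wy , trans (additive h _ _) (cong₂ _⊕_ ex ey)
    ; ·-closed = λ a (wx , ex) → ·-closed W a wx , trans (homogeneous h a _) (cong (a ·_) ex)
    ; 𝟎-in = 𝟎-in W , fix-𝟎 h }

  1≤size : ∀ W → 1ℚ ≤ size W
  1≤size W = subst (_≤ size W) #-𝟎 (∑-≤ Vˢ (λ x → le x (x ≟ⱽ 𝟎)))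
    where
    le : ∀ x (d : Dec (x ≡ 𝟎)) → 𝟙 d ≤ 𝟙 (In? W x)
    le x (yes refl) = ℚP.≤-reflexive (sym (𝟙-yes (In? W 𝟎) (𝟎-in W)))
    le x (no _) = 0≤𝟙 (In? W x)

  size≢0 : ∀ W → size W ≢ 0ℚ
  size≢0 W = 1≤⇒≢0 (1≤size W)

  fix-nonisotropic : ∀ {W v A} → In W v → ¬ (B v v ≡ 0#) → InG (W ∩ v ^⊥) A → fixSize W A ≡ Q *′ fixSize (W ∩ v ^⊥) A
  fix-nonisotropic {W} {v} {A} wv n h = trans (sym (kernel-count X v (v , (wv , fixes {W} h) , n)))
    (cong (Q *′_) (#-cong (In? (X ∩ v ^⊥)) (λ x → In? (W ∩ v ^⊥) x ×-dec (A x ≟ⱽ x))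
      (λ x ((wx , ax) , xv) → (wx , xv) , ax) (λ x ((wx , xv) , ax) → (wx , ax) , xv)))
    where X = Fix W (InG-mono {W} proj₁ h)

  -- The image of W under A - 1. Membership of w decides whether the affine map x ↦ A x + w has a
  -- fixed point.
  Coboundary : Subspace → (V → V) → V → Set
  Coboundary W A w = Any (λ y → In W y × delta A y ≡ w) elemsⱽ

  coboundary? : ∀ W A w → Dec (Coboundary W A w)
  coboundary? W A w = Any.any? (λ y → In? W y ×-dec (delta A y ≟ⱽ w)) elemsⱽ

  coboundary : ∀ {W A w y} → In W y → delta A y ≡ w → Coboundary W A w
  coboundary wy e = Any.map (λ { refl → wy , e }) (completeⱽ _)

  -- Each nonempty fibre of A - 1 on W is a coset of the fixed space.
  image-count : ∀ {W A} → InG W A → # (coboundary? W A) *′ fixSize W A ≡ size W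
  image-count {W} {A} h = sym (begin
    size W ≡⟨ ∑-fibre Vˢ Vˢ (delta A) _ ⟩
    ∑[ w ∈ Vˢ ] ∑[ y ∈ Vˢ ] (𝟙 (w ≟ⱽ delta A y) *′ 𝟙 (In? W y)) ≡⟨ ∑-cong Vˢ (λ w → fibre w (coboundary? W A w)) ⟩
    ∑[ w ∈ Vˢ ] (𝟙 (coboundary? W A w) *′ fixSize W A) ≡⟨ ∑-*ʳ Vˢ _ _ ⟩
    # (coboundary? W A) *′ fixSize W A ∎)
    where
    fibre : ∀ w (d : Dec (Coboundary W A w)) → ∑[ y ∈ Vˢ ] (𝟙 (w ≟ⱽ delta A y) *′ 𝟙 (In? W y)) ≡ 𝟙 d *′ fixSize W A
    fibre w (no ¬c) = trans (∑-0 Vˢ (λ y → trans (sym (𝟙-× (w ≟ⱽ delta A y) (In? W y)))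
      (𝟙-no ((w ≟ⱽ delta A y) ×-dec In? W y) (λ (e , wy) → ¬c (coboundary {W} wy (sym e)))))) (sym (ℚO.zeroˡ _))
    fibre w (yes c) = let y₀ , wy₀ , e₀ = Any.satisfied c in
      trans (∑-cong Vˢ (λ y → sym (𝟙-× (w ≟ⱽ delta A y) (In? W y))))
      (trans (#-bij (λ y → (w ≟ⱽ delta A y) ×-dec In? W y) (λ x → In? W x ×-dec (A x ≟ⱽ x)) (λ y → y ⊖ y₀) (λ x → x ⊕ y₀)
        (λ {y} (e , wy) → ⊖-closed W wy wy₀ , ⊖≡𝟎 (trans (shift-⊖ y y₀) (trans (cong₂ _⊖_ (sym e) e₀) (⊖-self w))))
        (λ {x} (wx , ax) → sym (trans (delta-+ h x y₀) (trans (cong₂ _⊕_ (trans (cong (_⊖ x) ax) (⊖-self x)) e₀) (⊕-identityˡ w))) , ⊕-closed W wx wy₀)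
        (λ _ → ⊖-⊕ _ _) (λ _ → ⊕-⊖ _ _)) (sym (ℚO.*-identityˡ _)))
      where
      shift-⊖ : ∀ y y₀ → delta A (y ⊖ y₀) ≡ delta A y ⊖ delta A y₀
      shift-⊖ y y₀ = trans (sym (⊕-⊖ _ (delta A y₀))) (cong (_⊖ delta A y₀) (trans (sym (delta-+ h (y ⊖ y₀) y₀)) (cong (delta A) (⊖-⊕ y y₀))))

  coboundary-perp : ∀ {W A w} (h : InG W A) → Coboundary W A w → In (W ∩ Fix W h ^⊥ˢ) w
  coboundary-perp {W} {A} {w} h c = let y , wy , e = Any.satisfied c in
    subst (In (W ∩ Fix W h ^⊥ˢ)) e (support h y , λ x (wx , ax) → begin
      B (A y ⊖ y) x ≡⟨ B-⊖ (A y) y x ⟩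
      B (A y) x - B y x ≡⟨ cong (λ z → B (A y) z - B y x) (sym ax) ⟩
      B (A y) (A x) - B y x ≡⟨ cong (_- B y x) (isometric h y x) ⟩
      B y x - B y x ≡⟨ solve 1 (λ b → b :- b := κ 0) refl (B y x) ⟩
      0# ∎)

  -- The image of A - 1 is contained in the complement of the fixed space, and by `image-count` and
  -- `perp-count` both have size |W| / |Fix A|.
  perp-coboundary : ∀ {W A w} → Nondegenerate W → (h : InG W A) → In (W ∩ Fix W h ^⊥ˢ) w → Coboundary W A w
  perp-coboundary {W} {A} {w} nd h = #-subset (coboundary? W A) (In? (W ∩ Fix W h ^⊥ˢ)) (λ w → coboundary-perp h)
    (ℚP.≤-reflexive (ℚO.*-cancelˡ (size≢0 (Fix W h)) (trans (ℚO.*-comm _ _) (trans (perp-count W (Fix W h) nd proj₁)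
      (trans (sym (image-count h)) (ℚO.*-comm _ _)))))) w

  iterate-p-suc : ∀ {f : V → V} k → iterate f (p ℕ.^ k) ≗ (λ x → x) → iterate f (p ℕ.^ suc k) ≗ (λ x → x)
  iterate-p-suc {f} k h x = trans (iterate-pᵏ-suc f k x) (iterate-fixed {f = iterate f (p ℕ.^ k)} (h x) p)

  -- The stabilizer of an isotropic vector

  module Hyperbolic {m W} (sp : IsSpace (2 ℕ.+ m) W) {e} (hyp : HyperbolicPair W e) where

    open HyperbolicPair hyp public

    W₀ : Subspace
    W₀ = W ∩⟨ e ∙ f ⟩^⊥

    sp₀ : IsSpace m W₀
    sp₀ = hyperbolic-space sp hyp

    W₀⊆W : ∀ {x} → In W₀ x → In W x
    W₀⊆W ((wx , _) , _) = wx

    ⊥e : ∀ {x} → In W₀ x → B x e ≡ 0#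
    ⊥e ((_ , xe) , _) = xe

    ⊥f : ∀ {x} → In W₀ x → B x f ≡ 0#
    ⊥f (_ , xf) = xf

    -- W is spanned by W₀, e and f, as `hyperbolic-project` makes explicit.
    identity : ∀ {h} → InG W h → h e ≡ e → h f ≡ f → (∀ x → In W₀ x → h x ≡ x) → h ≗ (λ x → x)
    identity {h} hG he hf h₀ = identity-on (nondegenerate sp) hG λ x wx → let x₀ = hyperbolic-project e f x in begin
      h x ≡⟨ cong h (sym (rebuild x)) ⟩
      h ((x₀ ⊕ B x e · f) ⊕ B x f · e) ≡⟨ trans (additive hG _ _) (cong₂ _⊕_ (additive hG _ _) (homogeneous hG _ _)) ⟩
      (h x₀ ⊕ h (B x e · f)) ⊕ B x f · h e ≡⟨ cong₂ _⊕_ (cong₂ _⊕_ (h₀ x₀ (hyperbolic-project-in hyp wx)) (trans (homogeneous hG _ _) (cong (B x e ·_) hf))) (cong (B x f ·_) he) ⟩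
      (x₀ ⊕ B x e · f) ⊕ B x f · e ≡⟨ rebuild x ⟩
      x ∎
      where
      rebuild : ∀ x → (hyperbolic-project e f x ⊕ B x e · f) ⊕ B x f · e ≡ x
      rebuild x = trans (cong (_⊕ B x f · e) (⊖-⊕ _ _)) (⊖-⊕ x _)

    fixes-e : ∀ {A} → InG W₀ A → A e ≡ e
    fixes-e h = fixes {W} (InG-mono {W ∩ e ^⊥} proj₁ h)

    fixes-f : ∀ {A} → InG W₀ A → A f ≡ f
    fixes-f h = fixes {W ∩ e ^⊥} h

    lift-InG : ∀ {A} → InG W₀ A → InG W A
    lift-InG h = InG-mono {W} W₀⊆W h

    -- If g f = f + w + c e with w in W₀, then pairing g f - f with f returns c, since w is
    -- orthogonal to f and B e f = 1.
    unipotentPart : (V → V) → F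
    unipotentPart g = B (g f ⊖ f) f

    vectorPart : (V → V) → V
    vectorPart g = (g f ⊖ f) ⊖ unipotentPart g · e

    Admissible : V → F → Set
    Admissible w c = In W₀ w × c + σ c ≡ - B w w

    τ⁻¹ : V → F → V → V
    τ⁻¹ w c = siegel e ((- 1#) · w) (σ c)

    B-neg : ∀ w → B ((- 1#) · w) ((- 1#) · w) ≡ B w w
    B-neg w = trans (B-· _ w _) (trans (cong (- 1# *_) (trans (B-·ʳ w _ w) (cong (_* B w w) (trans (σ-neg 1#) (cong -_ σ-1)))))
      (solve 1 (λ b → :- κ 1 :* (:- κ 1 :* b) := b) refl (B w w)))

    admissible-inverse : ∀ {w c} → Admissible w c → Admissible ((- 1#) · w) (σ c)
    admissible-inverse {w} {c} (ww , tr) = ·-closed W₀ _ ww , trans (trans (cong (σ c +_) (σσ c)) (+-comm _ _)) (trans tr (cong -_ (sym (B-neg w))))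

    τ-InG : ∀ {w c} → Admissible w c → InG W (siegel e w c)
    τ-InG (ww , tr) = Siegel.τ-InG {W} e∈W (W₀⊆W ww) Bee (⊥e ww) tr

    ττ⁻¹ : ∀ {w c} → Admissible w c → ∀ x → siegel e w c (τ⁻¹ w c x) ≡ x
    ττ⁻¹ (ww , tr) = siegel-inverse Bee (⊥e ww) tr

    τ⁻¹τ : ∀ {w c} → Admissible w c → ∀ x → τ⁻¹ w c (siegel e w c x) ≡ x
    τ⁻¹τ {w} {c} adm@(ww , _) x = trans (cong (τ⁻¹ w c) (cong₂ (λ v d → siegel e v d x) (sym neg-neg) (sym (σσ c))))
      (ττ⁻¹ (admissible-inverse adm) x)
      where
      neg-neg : (- 1#) · (- 1#) · w ≡ w
      neg-neg = B-separates λ z → trans (B-· _ _ z) (trans (cong (- 1# *_) (B-· _ w z)) (solve 1 (λ b → :- κ 1 :* (:- κ 1 :* b) := b) refl (B w z)))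

    τ-e : ∀ {w c} → Admissible w c → siegel e w c e ≡ e
    τ-e (ww , tr) = Siegel.τ-e {W} e∈W (W₀⊆W ww) Bee (⊥e ww) tr

    τ-f : ∀ {w} c → In W₀ w → siegel e w c f ≡ f ⊕ (w ⊕ c · e)
    τ-f {w} c ww = B-separates λ z → trans (B-siegel e w c f z) (trans (cong₂ (λ a b → B f z + (a * (B w z + c * B e z) - b * B e z)) Bfe (B-sym0 (⊥f ww)))
      (trans (solve 3 (λ f l k → f :+ (κ 1 :* l :- κ 0 :* k) := f :+ l) refl (B f z) (B w z + c * B e z) (B e z))
        (sym (trans (B-⊕ f _ z) (cong (B f z +_) (trans (B-⊕ w _ z) (cong (B w z +_) (B-· c e z))))))))

    module Decompose {g : V → V} (gG : InG W g) (ge : g e ≡ e) where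

      c : F
      c = unipotentPart g
      w : V
      w = vectorPart g

      B-w : ∀ z → B w z ≡ B (g f) z - B f z - c * B e z
      B-w z = trans (B-⊖ _ _ z) (cong₂ _-_ (B-⊖ (g f) f z) (B-· c e z))

      gfe : B (g f) e ≡ 1#
      gfe = trans (cong (B (g f)) (sym ge)) (trans (isometric gG f e) Bfe)

      gff : B (g f) f ≡ c
      gff = sym (trans (B-⊖ (g f) f f) (trans (cong (λ b → B (g f) f - b) Bff) (solve 1 (λ b → b :- κ 0 := b) refl (B (g f) f))))

      we : B w e ≡ 0#
      we = trans (B-w e) (trans (cong₃ gfe Bfe Bee) (solve 1 (λ c → κ 1 :- κ 1 :- c :* κ 0 := κ 0) refl c))
        where
        cong₃ : ∀ {a a′ b b′ d d′} → a ≡ a′ → b ≡ b′ → d ≡ d′ → a - b - c * d ≡ a′ - b′ - c * d′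
        cong₃ refl refl refl = refl

      wf : B w f ≡ 0#
      wf = trans (B-w f) (trans (cong₃ gff Bff Bef) (solve 1 (λ c → c :- κ 0 :- c :* κ 1 := κ 0) refl c))
        where
        cong₃ : ∀ {a a′ b b′ d d′} → a ≡ a′ → b ≡ b′ → d ≡ d′ → a - b - c * d ≡ a′ - b′ - c * d′
        cong₃ refl refl refl = refl

      w∈W₀ : In W₀ w
      w∈W₀ = (⊖-closed W (support gG f) (·-closed W c e∈W) , we) , wf

      -- This is the condition that g f be isotropic, written in terms of w and c; it is the trace
      -- condition for the Siegel transformation.
      ww : B w w ≡ - c - σ c
      ww = begin
        B w w ≡⟨ B-w w ⟩
        B (g f) w - B f w - c * B e w ≡⟨ cong₂ (λ a b → B (g f) w - a - c * b) (B-sym0 wf) (B-sym0 we) ⟩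
        B (g f) w - 0# - c * 0# ≡⟨ cong (λ a → a - 0# - c * 0#) (trans (B-herm w (g f)) (trans (cong σ (B-w (g f))) (cong σ (cong₃ (trans (isometric gG f f) Bff)
             (trans (B-herm (g f) f) (cong σ gff)) (trans (B-herm (g f) e) (trans (cong σ gfe) σ-1)))))) ⟩
        σ (0# - σ c - c * 1#) - 0# - c * 0# ≡⟨ cong (λ a → a - 0# - c * 0#) (trans (σ-+ _ _) (cong₂ _+_ (trans (σ-+ _ _) (cong₂ _+_ σ-0 (trans (σ-neg _) (cong -_ (σσ c)))))
             (trans (σ-neg _) (cong -_ (trans (σ-* c 1#) (cong (σ c *_) σ-1)))))) ⟩
        0# - c - σ c * 1# - 0# - c * 0# ≡⟨ solve 2 (λ c s → κ 0 :- c :- s :* κ 1 :- κ 0 :- c :* κ 0 := :- c :- s) refl c (σ c) ⟩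
        - c - σ c ∎
        where
        cong₃ : ∀ {a a′ b b′ d d′} → a ≡ a′ → b ≡ b′ → d ≡ d′ → a - b - c * d ≡ a′ - b′ - c * d′
        cong₃ refl refl refl = refl

      admissible : Admissible w c
      admissible = w∈W₀ , trans (solve 2 (λ c s → c :+ s := :- (:- c :- s)) refl c (σ c)) (cong -_ (sym ww))

      τf≡gf : siegel e w c f ≡ g f
      τf≡gf = trans (τ-f c w∈W₀) (B-separates λ z → trans (B-⊕ f _ z) (trans (cong (B f z +_) (trans (B-⊕ w _ z) (cong₂ _+_ (B-w z) (B-· c e z))))
        (solve 3 (λ f g k → f :+ (g :- f :- k :+ k) := g) refl (B f z) (B (g f) z) (c * B e z))))

      A : V → V
      A x = τ⁻¹ w c (g x)

      -- The Siegel transformation with parameters w and c agrees with g on e and f. Dividing it off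
      -- leaves a map fixing both, and `stabilizer` applied twice puts it into the group of W₀.
      A-InG : InG W₀ A
      A-InG = stabilizer (stabilizer hA (trans (cong (τ⁻¹ w c) ge) (τ-e (admissible-inverse admissible))))
        (trans (cong (τ⁻¹ w c) (sym τf≡gf)) (τ⁻¹τ admissible f))
        where
        hA : InG W A
        hA = ∘-InG (τ-InG (admissible-inverse admissible)) gG

    module Compose {A : V → V} (hA : InG W₀ A) {w : V} {c : F} (adm : Admissible w c) where

      module S = Siegel {W} e∈W (W₀⊆W (proj₁ adm)) Bee (⊥e (proj₁ adm)) (proj₂ adm)

      g : V → V
      g x = siegel e w c (A x)

      g-InG : InG W g
      g-InG = ∘-InG (τ-InG adm) (lift-InG hA)

      g-e : g e ≡ e
      g-e = trans (cong (siegel e w c) (fixes-e hA)) (τ-e adm)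

      g-f : g f ≡ f ⊕ (w ⊕ c · e)
      g-f = trans (cong (siegel e w c) (fixes-f hA)) (τ-f c (proj₁ adm))

      g-W₀ : ∀ {x} → In W₀ x → g x ≡ A x ⊖ B (A x) w · e
      g-W₀ wx = S.τ-perp (⊥e (InG-preserves hA wx))

      gf-f : g f ⊖ f ≡ w ⊕ c · e
      gf-f = trans (cong (_⊖ f) g-f) (B-separates λ z → trans (B-⊖ _ f z) (trans (cong (_- B f z) (B-⊕ f _ z)) (solve 2 (λ a b → a :+ b :- a := b) refl (B f z) (B (w ⊕ c · e) z))))

      unipotentPart-g : unipotentPart g ≡ c
      unipotentPart-g = trans (cong (λ y → B y f) gf-f) (trans (B-⊕ w _ f) (trans (cong₂ _+_ (⊥f (proj₁ adm)) (trans (B-· c e f) (cong (c *_) Bef)))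
        (solve 1 (λ c → κ 0 :+ c :* κ 1 := c) refl c)))

      vectorPart-g : vectorPart g ≡ w
      vectorPart-g = trans (cong₂ (λ y d → y ⊖ d · e) gf-f unipotentPart-g) (⊕-⊖ w _)

      -- Modulo e, the map g acts on W₀ as A does.
      iterate-mod-e : ∀ n {x} → In W₀ x → ∃ λ b → iterate g n x ≡ iterate A n x ⊕ b · e
      iterate-mod-e zero {x} wx = 0# , B-separates λ z → sym (trans (B-⊕ x _ z) (trans (cong (B x z +_) (B-· _ e z)) (solve 2 (λ a b → a :+ κ 0 :* b := a) refl (B x z) (B e z))))
      iterate-mod-e (suc n) {x} wx = let b , ih = iterate-mod-e n wx
                                         y = iterate A n x
                                         wy = InG-preserves (iterate-InG hA n) wx in
        b - B (A y) w , trans (cong g ih) (trans (additive g-InG y _) (trans (cong₂ _⊕_ (g-W₀ wy) (trans (homogeneous g-InG b e) (cong (b ·_) g-e)))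
          (B-separates λ z → trans (B-⊕ _ _ z) (trans (cong₂ _+_ (trans (B-⊖ _ _ z) (cong (λ k → B (A y) z - k) (B-· _ e z))) (B-· b e z))
            (trans (solve 4 (λ a k b e → a :- k :* e :+ b :* e := a :+ (b :- k) :* e) refl (B (A y) z) (B (A y) w) b (B e z))
              (sym (trans (B-⊕ _ _ z) (cong (B (A y) z +_) (B-· _ e z)))))))))

      -- If g^n x = x for x in W₀, the multiple b of e by which g^n x differs from A^n x is 0, as
      -- pairing with f shows.
      lower : ∀ n → iterate g n ≗ (λ x → x) → iterate A n ≗ (λ x → x)
      lower n gn = identity-on (nondegenerate sp₀) (iterate-InG hA n) λ x wx →
        let b , eq = iterate-mod-e n wx
            y = iterate A n x
            b≡0 : b ≡ 0#
            b≡0 = begin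
              b ≡⟨ solve 1 (λ b → b := κ 0 :+ b :* κ 1) refl b ⟩
              0# + b * 1# ≡⟨ sym (cong₂ _+_ (⊥f (InG-preserves (iterate-InG hA n) wx)) (trans (B-· b e f) (cong (b *_) Bef))) ⟩
              B y f + B (b · e) f ≡⟨ sym (B-⊕ y _ f) ⟩
              B (y ⊕ b · e) f ≡⟨ cong (λ v → B v f) (trans (sym eq) (gn x)) ⟩
              B x f ≡⟨ ⊥f wx ⟩
              0# ∎
        in B-separates λ z → begin
          B y z ≡⟨ solve 2 (λ a b → a := a :+ κ 0 :* b) refl (B y z) (B e z) ⟩
          B y z + 0# * B e z ≡⟨ cong (λ b → B y z + b * B e z) (sym b≡0) ⟩
          B y z + b * B e z ≡⟨ sym (trans (B-⊕ y _ z) (cong (B y z +_) (B-· b e z))) ⟩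
          B (y ⊕ b · e) z ≡⟨ cong (λ v → B v z) (trans (sym eq) (gn x)) ⟩
          B x z ∎

      -- Unipotence in two steps: first on W₀ + ⟨e⟩, then on f.
      raise : ∀ k → iterate A (p ℕ.^ k) ≗ (λ x → x) → iterate g (p ℕ.^ (2 ℕ.+ k)) ≗ (λ x → x)
      raise k Ak = identity (iterate-InG g-InG (p ℕ.^ (2 ℕ.+ k))) (iterate-fixed {f = g} g-e (p ℕ.^ (2 ℕ.+ k)))
          (trans (iterate-pᵏ-suc g (suc k) f) (iterate-translate h₁G (sym (⊕-delta h₁ f)) h₁δ))
          (λ x wx → trans (iterate-pᵏ-suc g (suc k) x) (iterate-fixed {f = h₁} (h₁-W₀ wx) p))
        where
        h₀ h₁ : V → V
        h₀ = iterate g (p ℕ.^ k)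
        h₁ = iterate g (p ℕ.^ suc k)
        h₀G = iterate-InG g-InG (p ℕ.^ k)
        h₁G = iterate-InG g-InG (p ℕ.^ suc k)
        h₁-W₀ : ∀ {x} → In W₀ x → h₁ x ≡ x
        h₁-W₀ {x} wx = let b , eq = iterate-mod-e (p ℕ.^ k) wx in
          trans (iterate-pᵏ-suc g k x) (iterate-translate h₀G (trans eq (cong (_⊕ b · e) (Ak x)))
            (trans (homogeneous h₀G b e) (cong (b ·_) (iterate-fixed {f = g} g-e (p ℕ.^ k)))))
        h₁-e : h₁ e ≡ e
        h₁-e = iterate-fixed {f = g} g-e (p ℕ.^ suc k)
        d = delta h₁ f
        de : B d e ≡ 0#
        de = trans (B-⊖ (h₁ f) f e) (trans (cong (_- B f e) (trans (cong (B (h₁ f)) (sym h₁-e)) (isometric h₁G f e))) (solve 1 (λ a → a :- a := κ 0) refl (B f e)))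
        d₀ = d ⊖ B d f · e
        d₀∈W₀ : In W₀ d₀
        d₀∈W₀ = (⊖-closed W (support h₁G f) (·-closed W _ e∈W) ,
            trans (B-⊖ d _ e) (trans (cong₂ _-_ de (trans (B-· _ e e) (cong (B d f *_) Bee))) (solve 1 (λ b → κ 0 :- b :* κ 0 := κ 0) refl (B d f)))) ,
            trans (B-⊖ d _ f) (trans (cong (λ b → B d f - b) (trans (B-· _ e f) (cong (B d f *_) Bef))) (solve 1 (λ b → b :- b :* κ 1 := κ 0) refl (B d f)))
        h₁δ : h₁ d ≡ d
        h₁δ = begin
          h₁ d ≡⟨ cong h₁ (sym (⊖-⊕ d (B d f · e))) ⟩
          h₁ (d₀ ⊕ B d f · e) ≡⟨ trans (additive h₁G _ _) (cong₂ _⊕_ (h₁-W₀ d₀∈W₀) (trans (homogeneous h₁G _ e) (cong (B d f ·_) h₁-e))) ⟩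
          d₀ ⊕ B d f · e ≡⟨ ⊖-⊕ d _ ⟩
          d ∎

  -- A hyperbolic partner of e would force e^⊥ to have size 1 although it contains e.
  no-isotropic-line : ∀ {W} → IsSpace 1 W → ∀ {e} → In W e → ¬ (e ≡ 𝟎) → ¬ (B e e ≡ 0#)
  no-isotropic-line {W} sp {e} we e≢𝟎 iso = e≢𝟎 (trivial (W ∩ e ^⊥)
      (ℚO.*-cancelˡ Q≢0 (trans (kernel-count W e (f , f∈W , λ z → 1≢0 (trans (sym Bfe) z))) (trans (dimension sp) (ℚO.*-comm 1ℚ Q)))) e (we , iso))
    where
    open HyperbolicPair (hyperbolic-exists sp we e≢𝟎 iso)

  -- One factor p is spent per dimension: a nonisotropic fixed vector lowers the rank by 1 and costs
  -- one factor, an isotropic one lowers it by 2 and costs the two factors of `raise`.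
  ppower-bound : ∀ m {W A} → IsSpace m W → InG W A → PPower A → iterate A (p ℕ.^ m) ≗ (λ x → x)
  ppower-bound-step : ∀ m {W A} → IsSpace (suc m) W → InG W A → PPower A → ∀ {v} → In W v → ¬ (v ≡ 𝟎) → A v ≡ v → Dec (B v v ≡ 0#) →
    iterate A (p ℕ.^ suc m) ≗ (λ x → x)
  ppower-bound zero {W} {A} sp h _ x = ⊖≡𝟎 (trivial W (dimension sp) _ (support h x))
  ppower-bound (suc m) sp h pp = let v , wv , v≢𝟎 , fv = fixed-vector sp h pp in ppower-bound-step m sp h pp wv v≢𝟎 fv (B v v ≟ 0#)
  ppower-bound-step m sp h pp wv v≢𝟎 fv (no n) = iterate-p-suc m (ppower-bound m (hyperplane-space sp wv n) (stabilizer h fv) pp)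
  ppower-bound-step zero sp h pp wv v≢𝟎 fv (yes iso) = ⊥-elim (no-isotropic-line sp wv v≢𝟎 iso)
  ppower-bound-step (suc m) {W} {g} sp h (k , gk) {e} wv v≢𝟎 fv (yes iso) x =
      trans (sym (iterate-cong τA≗g (p ℕ.^ (2 ℕ.+ m)) x))
        (C.raise m (ppower-bound m Hy.sp₀ D.A-InG (k , C.lower (p ℕ.^ k) (λ x → trans (iterate-cong τA≗g (p ℕ.^ k) x) (gk x)))) x)
    where
    module Hy = Hyperbolic sp (hyperbolic-exists sp wv v≢𝟎 iso)
    module D = Hy.Decompose h fv
    module C = Hy.Compose D.A-InG D.admissible
    τA≗g : C.g ≗ g
    τA≗g x = Hy.ττ⁻¹ D.admissible (g x)

  -- Sums over isometries of p-power order

  fixSize-cong : ∀ {W A A′} → A ≗ A′ → fixSize W A ≡ fixSize W A′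
  fixSize-cong {W} {A} {A′} e = #-cong (λ x → In? W x ×-dec (A x ≟ⱽ x)) (λ x → In? W x ×-dec (A′ x ≟ⱽ x))
    (λ x (wx , ax) → wx , trans (sym (e x)) ax) (λ x (wx , ax) → wx , trans (e x) ax)

  Unipotent : ℕ → (V → V) → Set
  Unipotent m A = iterate A (p ℕ.^ m) ≗ (λ x → x)

  unipotent? : ∀ m A → Dec (Unipotent m A)
  unipotent? m A = all-dec (λ x → iterate A (p ℕ.^ m) x ≟ⱽ x)

  unipotent-resp : ∀ {m A A′} → A ≗ A′ → Unipotent m A → Unipotent m A′
  unipotent-resp {m} e h x = trans (sym (iterate-cong e (p ℕ.^ m) x)) (h x)

  inU? : ∀ m W A → Dec (InG W A × Unipotent m A)
  inU? m W A = InG? W A ×-dec unipotent? m A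

  unipotentSum : ℕ → Subspace → (ℚ → ℚ) → ℚ
  unipotentSum m W φ = ∑[ A ∈ Funs ] (𝟙 (inU? m W A) *′ φ (fixSize W A))

  -- If A has |Fix A| = s, the Siegel transformations above A contribute |W₀| · φ⁺ φ s to the sum of φ(|Fix|).
  φ⁺ : (ℚ → ℚ) → ℚ → ℚ
  φ⁺ φ s = u *′ φ s +′ inv s *′ (φ (Q *′ (Q *′ s)) +′ (u -′ 1ℚ) *′ φ (Q *′ s) -′ u *′ φ s)

  -- Fixed points of the Siegel transformations above an isometry

  module IsotropicStabilizer {m W} (sp : IsSpace (2 ℕ.+ m) W) {e} (hyp : HyperbolicPair W e) where

    open Hyperbolic sp hyp

    module FixedPoints {A : V → V} (hA : InG W₀ A) {w : V} {c : F} (adm : Admissible w c) where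

      open Compose hA adm

      F₀ X : Subspace
      F₀ = Fix W₀ hA
      X = Fix W g-InG

      w∈W₀ : In W₀ w
      w∈W₀ = proj₁ adm

      x⊖0e : ∀ {x b} → b ≡ 0# → x ⊖ b · e ≡ x
      x⊖0e {x} refl = B-separates λ z → trans (B-⊖ x _ z) (trans (cong (λ k → B x z - k) (B-· 0# e z)) (solve 2 (λ a b → a :- κ 0 :* b := a) refl (B x z) (B e z)))

      -- The space X ∩ e^⊥ contains e, and intersecting with f^⊥ removes this factor Q. For x in W₀
      -- one has g x = A x - B (A x) w e, so x is fixed by g iff A x = x and x is orthogonal to w.
      perp-size : size (X ∩ e ^⊥) ≡ Q *′ size (F₀ ∩ w ^⊥)
      perp-size = trans (sym (kernel-count (X ∩ e ^⊥) f (e , ((e∈W , g-e) , Bee) , λ z → 1≢0 (trans (sym Bef) z))))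
        (cong (Q *′_) (#-cong (In? ((X ∩ e ^⊥) ∩ f ^⊥)) (In? (F₀ ∩ w ^⊥)) to from))
        where
        to : ∀ x → In ((X ∩ e ^⊥) ∩ f ^⊥) x → In (F₀ ∩ w ^⊥) x
        to x (((wx , gx) , xe) , xf) = (x∈W₀ , Ax) , trans (cong (λ y → B y w) (sym Ax)) Axw
          where
          x∈W₀ : In W₀ x
          x∈W₀ = (wx , xe) , xf
          Axw : B (A x) w ≡ 0#
          Axw = linear₁ (- 1#) (begin
            0# - B (A x) w ≡⟨ cong₂ _-_ (sym (⊥f (InG-preserves hA x∈W₀))) (sym (trans (B-· _ e f) (trans (cong (B (A x) w *_) Bef) (*-identityʳ _)))) ⟩
            B (A x) f - B (B (A x) w · e) f ≡⟨ sym (B-⊖ _ _ f) ⟩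
            B (A x ⊖ B (A x) w · e) f ≡⟨ cong (λ y → B y f) (trans (sym (g-W₀ x∈W₀)) gx) ⟩
            B x f ≡⟨ xf ⟩
            0# ∎) (solve 1 (λ b → b :+ :- κ 1 :* κ 0 := κ 0 :+ :- κ 1 :* (κ 0 :- b)) refl (B (A x) w))
          Ax : A x ≡ x
          Ax = trans (sym (x⊖0e Axw)) (trans (sym (g-W₀ x∈W₀)) gx)
        from : ∀ x → In (F₀ ∩ w ^⊥) x → In ((X ∩ e ^⊥) ∩ f ^⊥) x
        from x ((x∈W₀ , Ax) , xw) = ((W₀⊆W x∈W₀ , trans (g-W₀ x∈W₀) (trans (x⊖0e (trans (cong (λ y → B y w) Ax) xw)) Ax)) , ⊥e x∈W₀) , ⊥f x∈W₀

      ⊥e-size : (∀ x → In X x → B x e ≡ 0#) → size X ≡ size (X ∩ e ^⊥)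
      ⊥e-size h = #-cong (In? X) (In? (X ∩ e ^⊥)) (λ x x∈ → x∈ , h x x∈) (λ x → proj₁)

      -- Take y in F₀ not orthogonal to w. Comparing B (g y) (g x) with B y x for a fixed point x
      -- forces B e x = 0, so X lies in e^⊥. The factor Q gained from e is then lost to the
      -- condition of being orthogonal to w.
      generic-size : ¬ (∀ x → In F₀ x → B x w ≡ 0#) → size X ≡ size F₀
      generic-size ¬h = let x₁ , x₁∈ , B≢0 = witness (In? F₀) (λ x → B x w ≟ 0#) ¬h in
        trans (⊥e-size (λ x x∈ → in-e⊥ x₁∈ B≢0 x∈)) (trans perp-size (kernel-count F₀ w (x₁ , x₁∈ , B≢0)))
        where
        in-e⊥ : ∀ {x y} → In F₀ y → ¬ (B y w ≡ 0#) → In X x → B x e ≡ 0#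
        in-e⊥ {x} {y} (y∈ , Ay) B≢0 (_ , gx) = B-sym0 (no-zero-divisors (linear₁ (- 1#) (begin
          B y x - B y w * B e x ≡⟨ sym (trans (B-⊖ y _ x) (cong (λ k → B y x - k) (B-· _ e x))) ⟩
          B (y ⊖ B y w · e) x ≡⟨ cong₂ B (trans (cong (λ v → v ⊖ B v w · e) (sym Ay)) (sym (g-W₀ y∈))) (sym gx) ⟩
          B (g y) (g x) ≡⟨ isometric g-InG y x ⟩
          B y x ∎) (solve 2 (λ a b → b :+ :- κ 1 :* a := κ 0 :+ :- κ 1 :* (a :- b)) refl (B y x) (B y w * B e x))) B≢0)

      module Special {y : V} (y∈ : In W₀ y) (δy : delta A y ≡ w) where

        -- The critical value of c: g (f - y) = f - y + (c - κ₀) e.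
        κ₀ : F
        κ₀ = B (A y) y - B y y

        Ayw : B (A y) w ≡ - κ₀
        Ayw = begin
          B (A y) w ≡⟨ cong (B (A y)) (sym δy) ⟩
          B (A y) (A y ⊖ y) ≡⟨ B-⊖ʳ (A y) (A y) y ⟩
          B (A y) (A y) - B (A y) y ≡⟨ cong (_- B (A y) y) (isometric hA y y) ⟩
          B y y - B (A y) y ≡⟨ solve 2 (λ a b → a :- b := :- (b :- a)) refl (B y y) (B (A y) y) ⟩
          - κ₀ ∎

        Bwz : ∀ z → B w z ≡ B (A y) z - B y z
        Bwz z = trans (cong (λ v → B v z) (sym δy)) (B-⊖ (A y) y z)

        w∈perp : In (W₀ ∩ F₀ ^⊥ˢ) w
        w∈perp = coboundary-perp hA (coboundary {W₀} y∈ δy)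

        F₀⊥w : size (F₀ ∩ w ^⊥) ≡ size F₀
        F₀⊥w = #-cong (In? (F₀ ∩ w ^⊥)) (In? F₀) (λ x → proj₁) (λ x x∈ → x∈ , B-sym0 (proj₂ w∈perp x x∈))

        -- Now f - y is a fixed point outside e^⊥, which adds a second factor Q.
        special-size : c ≡ κ₀ → size X ≡ Q *′ (Q *′ size F₀)
        special-size c≡κ = trans (sym (kernel-count X e (x , (x∈W , gx) , λ z → 1≢0 (trans (sym xe) z)))) (cong (Q *′_) (trans perp-size (cong (Q *′_) F₀⊥w)))
          where
          x = f ⊖ y
          x∈W : In W x
          x∈W = ⊖-closed W f∈W (W₀⊆W y∈)
          xe : B x e ≡ 1#
          xe = trans (B-⊖ f y e) (trans (cong₂ _-_ Bfe (⊥e y∈)) (solve 0 (κ 1 :- κ 0 := κ 1) refl))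
          gx : g x ≡ x
          gx = B-separates λ z → begin
            B (g (f ⊕ (- 1#) · y)) z ≡⟨ cong (λ v → B v z) (trans (additive g-InG f _) (cong (g f ⊕_) (homogeneous g-InG _ y))) ⟩
            B (g f ⊖ g y) z ≡⟨ trans (B-⊖ (g f) (g y) z) (cong₂ _-_
                 (trans (cong (λ v → B v z) g-f) (trans (B-⊕ f _ z) (cong (B f z +_) (trans (B-⊕ w _ z) (cong₂ _+_ (Bwz z) (B-· c e z))))))
                 (trans (cong (λ v → B v z) (g-W₀ y∈)) (trans (B-⊖ (A y) _ z) (cong (λ k → B (A y) z - k) (trans (B-· _ e z) (cong (_* B e z) Ayw)))))) ⟩
            B f z + (B (A y) z - B y z + c * B e z) - (B (A y) z - - κ₀ * B e z)
              ≡⟨ linear₁ (B e z) c≡κ (solve 6 (λ f a y c k e → f :+ (a :- y :+ c :* e) :- (a :- :- k :* e) :+ e :* k := f :- y :+ e :* c) refl (B f z) (B (A y) z) (B y z) c κ₀ (B e z)) ⟩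
            B f z - B y z ≡⟨ sym (B-⊖ f y z) ⟩
            B x z ∎

        -- A fixed point outside e^⊥ would make c equal to κ₀, so only the factor Q of e remains.
        ordinary-size : ¬ (c ≡ κ₀) → size X ≡ Q *′ size F₀
        ordinary-size c≢κ = trans (⊥e-size in-e⊥) (trans perp-size (cong (Q *′_) F₀⊥w))
          where
          in-e⊥ : ∀ x → In X x → B x e ≡ 0#
          in-e⊥ x (wx , gx) = decidable-stable (B x e ≟ 0#) (λ a≢0 → c≢κ (trans (sym (σσ c)) (trans (cong σ (σc≡ a≢0)) (σσ κ₀))))
            where
            -- Two evaluations of B x w, by isometry against f and against y.
            first : B x f + (B x w + σ c * B x e) ≡ B x f
            first = trans (sym (trans (B-⊕ʳ x f _) (cong (B x f +_) (trans (B-⊕ʳ x w _) (cong (B x w +_) (B-·ʳ x c e))))))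
              (trans (cong₂ B (sym gx) (sym g-f)) (isometric g-InG x f))
            second : B (A y) x - - κ₀ * B e x ≡ B y x
            second = trans (sym (trans (B-⊖ (A y) _ x) (cong (λ k → B (A y) x - k) (trans (B-· _ e x) (cong (_* B e x) Ayw)))))
              (trans (cong₂ B (sym (g-W₀ y∈)) (sym gx)) (isometric g-InG y x))
            Bwx : B w x ≡ - κ₀ * B e x
            Bwx = trans (Bwz x) (linear₁ 1# second (solve 4 (λ a y k e → a :- y :+ κ 1 :* y := :- k :* e :+ κ 1 :* (a :- :- k :* e)) refl (B (A y) x) (B y x) κ₀ (B e x)))
            Bxw : B x w ≡ - σ κ₀ * B x e
            Bxw = trans (B-herm w x) (trans (cong σ Bwx) (trans (σ-* _ _) (cong₂ _*_ (σ-neg κ₀) (sym (B-herm e x)))))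
            σc≡ : ¬ (B x e ≡ 0#) → σ c ≡ σ κ₀
            σc≡ a≢0 = linear₁ 1# (no-zero-divisors (linear₂ 1# first (- 1#) Bxw
                (solve 5 (λ a s k xw xf → a :* (s :- k) :+ κ 1 :* xf :+ :- κ 1 :* (:- k :* a) := κ 0 :+ κ 1 :* (xf :+ (xw :+ s :* a)) :+ :- κ 1 :* xw) refl (B x e) (σ c) (σ κ₀) (B x w) (B x f))) a≢0)
              (solve 2 (λ s k → s :+ κ 1 :* κ 0 := k :+ κ 1 :* (s :- k)) refl (σ c) (σ κ₀))

    admissible? : ∀ w c → Dec (Admissible w c)
    admissible? w c = In? W₀ w ×-dec (c + σ c ≟ - B w w)

    module Inner (φ : ℚ → ℚ) {A : V → V} (hA : InG W₀ A) where

      private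
        F₀ : Subspace
        F₀ = Fix W₀ hA
        s = fixSize W₀ A
        D = φ (Q *′ (Q *′ s)) +′ (u -′ 1ℚ) *′ φ (Q *′ s) -′ u *′ φ s

      P? : ∀ w → Dec (∀ x → In F₀ x → B w x ≡ 0#)
      P? w = all-dec (λ x → In? F₀ x →-dec (B w x ≟ 0#))

      value : ∀ w c → ℚ
      value w c = φ (fixSize W (λ x → siegel e w c (A x)))

      -- For w not orthogonal to F₀ all q values of c give φ(s). Otherwise w = A y - y for some y,
      -- exactly one of the q values gives φ(Q Q s), and the other q - 1 give φ(Q s). The constant
      -- `D` is the difference of the two totals.
      c-sum : ∀ {w} → In W₀ w → (d : Dec (∀ x → In F₀ x → B w x ≡ 0#)) →
        ∑[ c ∈ Fˢ ] (𝟙 (- B w w ≟ c + σ c) *′ value w c) ≡ u *′ φ s +′ 𝟙 d *′ D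
      c-sum {w} ww (no ¬h) = begin
        ∑[ c ∈ Fˢ ] (𝟙 (- B w w ≟ c + σ c) *′ value w c)
          ≡⟨ ∑-cong Fˢ (λ c → 𝟙-guard (- B w w ≟ c + σ c) (λ tr → cong φ (FixedPoints.generic-size hA (ww , sym tr) (λ h → ¬h (λ x x∈ → B-sym0 (h x x∈)))))) ⟩
        ∑[ c ∈ Fˢ ] (𝟙 (- B w w ≟ c + σ c) *′ φ s) ≡⟨ trans (∑-*ʳ Fˢ _ _) (cong (_*′ φ s) (trace-count (- B w w) (trans (σ-neg _) (cong -_ (B-fixed w))))) ⟩
        u *′ φ s ≡⟨ solve′ 2 (λ a d → a :=′ a :+′ con′ 0 :*′ d) refl (u *′ φ s) D ⟩
        u *′ φ s +′ 0ℚ *′ D ∎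
      c-sum {w} ww (yes h) = let y , y∈ , δy = Any.satisfied (perp-coboundary (nondegenerate sp₀) hA (ww , h)) in begin
        ∑[ c ∈ Fˢ ] (𝟙 (- B w w ≟ c + σ c) *′ value w c) ≡⟨ ∑-cong Fˢ (λ c → term y∈ δy c (c ≟ κ′ y)) ⟩
        ∑[ c ∈ Fˢ ] (𝟙 (- B w w ≟ c + σ c) *′ φ (Q *′ s) +′ 𝟙 (c ≟ κ′ y) *′ D′) ≡⟨ ∑-+ Fˢ _ _ ⟩
        ∑[ c ∈ Fˢ ] (𝟙 (- B w w ≟ c + σ c) *′ φ (Q *′ s)) +′ ∑[ c ∈ Fˢ ] (𝟙 (c ≟ κ′ y) *′ D′)
          ≡⟨ cong₂ _+′_ (trans (∑-*ʳ Fˢ _ _) (cong (_*′ φ (Q *′ s)) (trace-count (- B w w) (trans (σ-neg _) (cong -_ (B-fixed w))))))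
               (∑-point Fˢ (λ _ → D′) (λ _ → refl) (κ′ y)) ⟩
        u *′ φ (Q *′ s) +′ D′ ≡⟨ solve′ 4 (λ u a b c → u :*′ b :+′ (c :-′ b) :=′ u :*′ a :+′ con′ 1 :*′ (c :+′ (u :-′ con′ 1) :*′ b :-′ u :*′ a)) refl u (φ s) (φ (Q *′ s)) (φ (Q *′ (Q *′ s))) ⟩
        u *′ φ s +′ 1ℚ *′ D ∎
        where
        D′ = φ (Q *′ (Q *′ s)) -′ φ (Q *′ s)
        κ′ : V → F
        κ′ y = B (A y) y - B y y
        term : ∀ {y} → In W₀ y → delta A y ≡ w → ∀ c (d : Dec (c ≡ κ′ y)) →
          𝟙 (- B w w ≟ c + σ c) *′ value w c ≡ 𝟙 (- B w w ≟ c + σ c) *′ φ (Q *′ s) +′ 𝟙 d *′ D′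
        term {y} y∈ δy c (yes c≡κ) = trans (trans (𝟙-guard (- B w w ≟ c + σ c) (λ tr → cong φ (FixedPoints.Special.special-size hA (ww , sym tr) y∈ δy c≡κ)))
            (cong (_*′ φ (Q *′ (Q *′ s))) one))
          (trans (solve′ 2 (λ a b → con′ 1 :*′ b :=′ con′ 1 :*′ a :+′ con′ 1 :*′ (b :-′ a)) refl (φ (Q *′ s)) (φ (Q *′ (Q *′ s))))
            (cong (λ i → i *′ φ (Q *′ s) +′ 1ℚ *′ D′) (sym one)))
          where
          -- The critical value satisfies the trace condition, so it is one of the q values of c
          -- that are summed over.
          trace₀ : - B w w ≡ κ′ y + σ (κ′ y)
          trace₀ = trans (cong -_ wweq) (trans (cong (λ b → - (B y y - B (A y) y - (b - B y y))) (B-herm (A y) y))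
            (trans (solve 3 (λ b a t → :- (b :- a :- (t :- b)) := a :- b :+ (t :- b)) refl (B y y) (B (A y) y) (σ (B (A y) y)))
              (cong (κ′ y +_) (sym (trans (σ-+ _ _) (cong (σ (B (A y) y) +_) (trans (σ-neg _) (cong -_ (B-fixed y)))))))))
            where
            wweq : B w w ≡ B y y - B (A y) y - (B y (A y) - B y y)
            wweq = trans (cong₂ B (sym δy) (sym δy)) (trans (B-⊖ (A y) y _) (cong₂ _-_ (trans (B-⊖ʳ (A y) (A y) y) (cong (_- B (A y) y) (isometric hA y y))) (B-⊖ʳ y (A y) y)))
          one : 𝟙 (- B w w ≟ c + σ c) ≡ 1ℚ
          one = 𝟙-yes (- B w w ≟ c + σ c) (trans trace₀ (cong (λ k → k + σ k) (sym c≡κ)))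
        term {y} y∈ δy c (no c≢κ) = trans (𝟙-guard (- B w w ≟ c + σ c) (λ tr → cong φ (FixedPoints.Special.ordinary-size hA (ww , sym tr) y∈ δy c≢κ)))
          (solve′ 3 (λ i a b → i :*′ a :=′ i :*′ a :+′ con′ 0 :*′ b) refl (𝟙 (- B w w ≟ c + σ c)) (φ (Q *′ s)) D′)

      -- By `perp-count` a fraction 1/s of the vectors w of W₀ is orthogonal to F₀; this is the
      -- origin of `inv s` in `φ⁺`.
      total-sum : ∑[ w ∈ Vˢ ] ∑[ c ∈ Fˢ ] (𝟙 (admissible? w c) *′ value w c) ≡ pw Q m *′ φ⁺ φ s
      total-sum = begin
        ∑[ w ∈ Vˢ ] ∑[ c ∈ Fˢ ] (𝟙 (admissible? w c) *′ value w c) ≡⟨ ∑-cong Vˢ (λ w → trans (∑-cong Fˢ (split w)) (∑-*ˡ Fˢ (𝟙 (In? W₀ w)) _)) ⟩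
        ∑[ w ∈ Vˢ ] (𝟙 (In? W₀ w) *′ ∑[ c ∈ Fˢ ] (𝟙 (- B w w ≟ c + σ c) *′ value w c)) ≡⟨ ∑-cong Vˢ (λ w → 𝟙-guard (In? W₀ w) (λ ww → c-sum ww (P? w))) ⟩
        ∑[ w ∈ Vˢ ] (𝟙 (In? W₀ w) *′ (u *′ φ s +′ 𝟙 (P? w) *′ D))
          ≡⟨ ∑-cong Vˢ (λ w → trans (solve′ 4 (λ i a p d → i :*′ (a :+′ p :*′ d) :=′ i :*′ a :+′ (i :*′ p) :*′ d) refl (𝟙 (In? W₀ w)) (u *′ φ s) (𝟙 (P? w)) D)
               (cong (λ k → 𝟙 (In? W₀ w) *′ (u *′ φ s) +′ k *′ D) (sym (𝟙-× (In? W₀ w) (P? w))))) ⟩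
        ∑[ w ∈ Vˢ ] (𝟙 (In? W₀ w) *′ (u *′ φ s) +′ 𝟙 (In? W₀ w ×-dec P? w) *′ D) ≡⟨ trans (∑-+ Vˢ _ _) (cong₂ _+′_ (∑-*ʳ Vˢ _ _) (∑-*ʳ Vˢ _ _)) ⟩
        size W₀ *′ (u *′ φ s) +′ size (W₀ ∩ F₀ ^⊥ˢ) *′ D ≡⟨ cong₂ (λ a b → a *′ (u *′ φ s) +′ b *′ D) (dimension sp₀) perp ⟩
        pw Q m *′ (u *′ φ s) +′ pw Q m *′ inv s *′ D ≡⟨ solve′ 4 (λ a b i d → a :*′ b :+′ a :*′ i :*′ d :=′ a :*′ (b :+′ i :*′ d)) refl (pw Q m) (u *′ φ s) (inv s) D ⟩
        pw Q m *′ φ⁺ φ s ∎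
        where
        split : ∀ w c → 𝟙 (admissible? w c) *′ value w c ≡ 𝟙 (In? W₀ w) *′ (𝟙 (- B w w ≟ c + σ c) *′ value w c)
        split w c = trans (cong (_*′ value w c) (trans (𝟙-× (In? W₀ w) (c + σ c ≟ - B w w)) (cong (𝟙 (In? W₀ w) *′_) (𝟙-cong (c + σ c ≟ - B w w) (- B w w ≟ c + σ c) sym sym)))) (ℚO.*-assoc _ _ _)
        perp : size (W₀ ∩ F₀ ^⊥ˢ) ≡ pw Q m *′ inv s
        perp = linear₂′ (inv s) (trans (perp-count W₀ F₀ (nondegenerate sp₀) proj₁) (dimension sp₀)) (-′ size (W₀ ∩ F₀ ^⊥ˢ)) (inv-inverseʳ (size≢0 F₀))
          (solve′ 4 (λ p q i s → p :+′ i :*′ q :+′ :-′ p :*′ con′ 1 :=′ q :*′ i :+′ i :*′ (p :*′ s) :+′ :-′ p :*′ (s :*′ i)) refl (size (W₀ ∩ F₀ ^⊥ˢ)) (pw Q m) (inv s) s)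

  -- Summation over the stabilizers of fixed vectors

  module StabilizerSum {m W} (sp : IsSpace (2 ℕ.+ m) W) {e} (hyp : HyperbolicPair W e) (φ : ℚ → ℚ) where

    open Hyperbolic sp hyp
    open IsotropicStabilizer sp hyp

    stab? : ∀ g → Dec ((InG W g × Unipotent (2 ℕ.+ m) g) × g e ≡ e)
    stab? g = inU? (2 ℕ.+ m) W g ×-dec (g e ≟ⱽ e)

    value : (V → V) → ℚ
    value g = φ (fixSize W g)

    unipotentPart-cong : ∀ {g g′} → g ≗ g′ → unipotentPart g ≡ unipotentPart g′
    unipotentPart-cong h = cong (λ y → B (y ⊖ f) f) (h f)

    vectorPart-cong : ∀ {g g′} → g ≗ g′ → vectorPart g ≡ vectorPart g′
    vectorPart-cong h = cong (λ y → (y ⊖ f) ⊖ B (y ⊖ f) f · e) (h f)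

    Piece : V → F → (V → V) → Set
    Piece w c g = (c ≡ unipotentPart g × w ≡ vectorPart g) × (InG W g × Unipotent (2 ℕ.+ m) g) × g e ≡ e

    piece? : ∀ w c g → Dec (Piece w c g)
    piece? w c g = ((c ≟ unipotentPart g) ×-dec (w ≟ⱽ vectorPart g)) ×-dec stab? g

    -- Dividing off the Siegel transformation with parameters w and c maps the piece bijectively
    -- onto the elements of p-power order of the group of W₀. The exponents p^(m+2) and p^m are
    -- matched by `raise` in one direction and by `lower` with `ppower-bound` in the other.
    piece-sum : ∀ w c (d : Dec (Admissible w c)) →
      ∑[ g ∈ Funs ] (𝟙 (piece? w c g) *′ value g) ≡ 𝟙 d *′ ∑[ A ∈ Funs ] (𝟙 (inU? m W₀ A) *′ value (λ x → siegel e w c (A x)))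
    piece-sum w c (no ¬adm) = trans (∑-0 Funs (λ g → trans (cong (_*′ value g) (𝟙-no (piece? w c g)
      (λ { ((refl , refl) , (gG , _) , ge) → ¬adm (Decompose.admissible gG ge) }))) (ℚO.zeroˡ _))) (sym (ℚO.zeroˡ _))
    piece-sum w c (yes adm) = trans
      (∑-bij Funs Funs (piece? w c) (inU? m W₀) value (λ A → value (λ x → siegel e w c (A x)))
        (λ g x → τ⁻¹ w c (g x)) (λ A x → siegel e w c (A x))
        (λ h ((c≡ , w≡) , (gG , gU) , ge) → (trans c≡ (unipotentPart-cong h) , trans w≡ (vectorPart-cong h)) , (InG-resp h gG , unipotent-resp {2 ℕ.+ m} h gU) , trans (sym (h e)) ge)
        (λ h (AG , AU) → InG-resp h AG , unipotent-resp {m} h AU)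
        (λ h x → cong (τ⁻¹ w c) (h x)) (λ h x → cong (siegel e w c) (h x))
        (λ { ((refl , refl) , (gG , gU) , ge) → down gG gU ge }) up
        (λ _ x → ττ⁻¹ adm _) (λ _ x → τ⁻¹τ adm _)
        (λ h → cong φ (fixSize-cong {W} (λ x → cong (siegel e w c) (h x))))
        (λ _ → cong φ (fixSize-cong {W} (λ x → sym (ττ⁻¹ adm _)))))
      (sym (ℚO.*-identityˡ _))
      where
      down : ∀ {g} (gG : InG W g) → Unipotent (2 ℕ.+ m) g → (ge : g e ≡ e) → InG W₀ (Decompose.A gG ge) × Unipotent m (Decompose.A gG ge)
      down {g} gG gU ge = D.A-InG , ppower-bound m sp₀ D.A-InG (2 ℕ.+ m , C.lower (p ℕ.^ (2 ℕ.+ m))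
          (λ x → trans (iterate-cong (λ y → ττ⁻¹ D.admissible (g y)) (p ℕ.^ (2 ℕ.+ m)) x) (gU x)))
        where
        module D = Decompose gG ge
        module C = Compose D.A-InG D.admissible
      up : ∀ {A} → InG W₀ A × Unipotent m A → Piece w c (λ x → siegel e w c (A x))
      up (AG , AU) = (sym C.unipotentPart-g , sym C.vectorPart-g) , (C.g-InG , C.raise m AU) , C.g-e
        where
        module C = Compose AG adm

    stabilizer-sum : ∑[ g ∈ Funs ] (𝟙 (stab? g) *′ value g) ≡ pw Q m *′ unipotentSum m W₀ (φ⁺ φ)
    stabilizer-sum = begin
      ∑[ g ∈ Funs ] (𝟙 (stab? g) *′ value g) ≡⟨ ∑-fibre Funs Vˢ vectorPart _ ⟩
      ∑[ w ∈ Vˢ ] ∑[ g ∈ Funs ] (𝟙 (w ≟ⱽ vectorPart g) *′ (𝟙 (stab? g) *′ value g)) ≡⟨ ∑-cong Vˢ (λ w → ∑-fibre Funs Fˢ unipotentPart _) ⟩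
      ∑[ w ∈ Vˢ ] ∑[ c ∈ Fˢ ] ∑[ g ∈ Funs ] (𝟙 (c ≟ unipotentPart g) *′ (𝟙 (w ≟ⱽ vectorPart g) *′ (𝟙 (stab? g) *′ value g)))
        ≡⟨ ∑-cong Vˢ (λ w → ∑-cong Fˢ (λ c → trans (∑-cong Funs (merge w c)) (piece-sum w c (admissible? w c)))) ⟩
      ∑[ w ∈ Vˢ ] ∑[ c ∈ Fˢ ] (𝟙 (admissible? w c) *′ ∑[ A ∈ Funs ] (𝟙 (inU? m W₀ A) *′ v w c A))
        ≡⟨ ∑-cong Vˢ (λ w → trans (∑-cong Fˢ (λ c → sym (∑-*ˡ Funs (𝟙 (admissible? w c)) _))) (∑-swap Fˢ Funs _)) ⟩
      ∑[ w ∈ Vˢ ] ∑[ A ∈ Funs ] ∑[ c ∈ Fˢ ] (𝟙 (admissible? w c) *′ (𝟙 (inU? m W₀ A) *′ v w c A)) ≡⟨ ∑-swap Vˢ Funs _ ⟩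
      ∑[ A ∈ Funs ] ∑[ w ∈ Vˢ ] ∑[ c ∈ Fˢ ] (𝟙 (admissible? w c) *′ (𝟙 (inU? m W₀ A) *′ v w c A))
        ≡⟨ ∑-cong Funs (λ A → trans (∑-cong Vˢ (λ w → trans (∑-cong Fˢ (λ c → solve′ 3 (λ a i v → a :*′ (i :*′ v) :=′ i :*′ (a :*′ v)) refl (𝟙 (admissible? w c)) (𝟙 (inU? m W₀ A)) (v w c A)))
             (∑-*ˡ Fˢ (𝟙 (inU? m W₀ A)) _))) (∑-*ˡ Vˢ (𝟙 (inU? m W₀ A)) _)) ⟩
      ∑[ A ∈ Funs ] (𝟙 (inU? m W₀ A) *′ ∑[ w ∈ Vˢ ] ∑[ c ∈ Fˢ ] (𝟙 (admissible? w c) *′ v w c A))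
        ≡⟨ ∑-cong Funs (λ A → trans (𝟙-guard (inU? m W₀ A) (λ (AG , _) → Inner.total-sum φ AG))
             (solve′ 3 (λ i q v → i :*′ (q :*′ v) :=′ q :*′ (i :*′ v)) refl (𝟙 (inU? m W₀ A)) (pw Q m) (φ⁺ φ (fixSize W₀ A)))) ⟩
      ∑[ A ∈ Funs ] (pw Q m *′ (𝟙 (inU? m W₀ A) *′ φ⁺ φ (fixSize W₀ A))) ≡⟨ ∑-*ˡ Funs (pw Q m) _ ⟩
      pw Q m *′ unipotentSum m W₀ (φ⁺ φ) ∎
      where
      v : V → F → (V → V) → ℚ
      v w c A = value (λ x → siegel e w c (A x))
      merge : ∀ w c g → 𝟙 (c ≟ unipotentPart g) *′ (𝟙 (w ≟ⱽ vectorPart g) *′ (𝟙 (stab? g) *′ value g)) ≡ 𝟙 (piece? w c g) *′ value g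
      merge w c g = trans (solve′ 4 (λ a b i v → a :*′ (b :*′ (i :*′ v)) :=′ (a :*′ b) :*′ i :*′ v) refl (𝟙 (c ≟ unipotentPart g)) (𝟙 (w ≟ⱽ vectorPart g)) (𝟙 (stab? g)) (value g))
        (cong (_*′ value g) (trans (cong (_*′ 𝟙 (stab? g)) (sym (𝟙-× (c ≟ unipotentPart g) (w ≟ⱽ vectorPart g)))) (sym (𝟙-× ((c ≟ unipotentPart g) ×-dec (w ≟ⱽ vectorPart g)) (stab? g)))))

  stabilizerSum : ℕ → Subspace → V → (ℚ → ℚ) → ℚ
  stabilizerSum m W v φ = ∑[ A ∈ Funs ] (𝟙 (inU? m W A ×-dec (A v ≟ⱽ v)) *′ φ (fixSize W A))

  -- Both sums run over the same maps of V. Only the reference space changes, and with it |Fix| by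
  -- the factor Q of the line through v.
  stabilizer-nonisotropic : ∀ {m W} → IsSpace (suc m) W → ∀ {v} → In W v → ¬ (B v v ≡ 0#) → ∀ φ →
    stabilizerSum (suc m) W v φ ≡ unipotentSum m (W ∩ v ^⊥) (λ s → φ (Q *′ s))
  stabilizer-nonisotropic {m} {W} sp {v} wv n φ = ∑-cong Funs λ A → 𝟙-guard-cong (inU? (suc m) W A ×-dec (A v ≟ⱽ v)) (inU? m (W ∩ v ^⊥) A)
    (λ ((AG , AU) , Av) → stabilizer AG Av , ppower-bound m (hyperplane-space sp wv n) (stabilizer AG Av) (suc m , AU))
    (λ (AG , AU) → (InG-mono {W} proj₁ AG , iterate-p-suc m AU) , fixes {W} AG)
    (λ ((AG , _) , Av) → cong φ (fix-nonisotropic {W} wv n (stabilizer AG Av)))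

  -- Pairs of an isometry and a nonzero fixed vector

  fixed-pairs : ∀ m W φ → unipotentSum m W (λ s → (s -′ 1ℚ) *′ φ s) ≡
    ∑[ v ∈ Vˢ ] (𝟙 (In? W v ×-dec ¬? (v ≟ⱽ 𝟎)) *′ stabilizerSum m W v φ)
  fixed-pairs m W φ = begin
    ∑[ A ∈ Funs ] (𝟙 (inU? m W A) *′ ((fixSize W A -′ 1ℚ) *′ φ (fixSize W A))) ≡⟨ ∑-cong Funs term ⟩
    ∑[ A ∈ Funs ] ∑[ v ∈ Vˢ ] (𝟙 (nz? v) *′ (𝟙 (inU? m W A ×-dec (A v ≟ⱽ v)) *′ φ (fixSize W A))) ≡⟨ ∑-swap Funs Vˢ _ ⟩
    ∑[ v ∈ Vˢ ] ∑[ A ∈ Funs ] (𝟙 (nz? v) *′ (𝟙 (inU? m W A ×-dec (A v ≟ⱽ v)) *′ φ (fixSize W A))) ≡⟨ ∑-cong Vˢ (λ v → ∑-*ˡ Funs (𝟙 (nz? v)) _) ⟩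
    ∑[ v ∈ Vˢ ] (𝟙 (nz? v) *′ stabilizerSum m W v φ) ∎
    where
    nz? : ∀ v → Dec (In W v × ¬ (v ≡ 𝟎))
    nz? v = In? W v ×-dec ¬? (v ≟ⱽ 𝟎)
    count : ∀ {A} → InG W A → ∑[ v ∈ Vˢ ] (𝟙 (nz? v) *′ 𝟙 (A v ≟ⱽ v)) ≡ fixSize W A -′ 1ℚ
    count {A} AG = begin
      ∑[ v ∈ Vˢ ] (𝟙 (nz? v) *′ 𝟙 (A v ≟ⱽ v)) ≡⟨ ∑-cong Vˢ (λ v → part v (v ≟ⱽ 𝟎)) ⟩
      ∑[ v ∈ Vˢ ] (𝟙 (In? W v ×-dec (A v ≟ⱽ v)) +′ -′ 1ℚ *′ 𝟙 (v ≟ⱽ 𝟎)) ≡⟨ trans (∑-+ Vˢ _ _) (cong (fixSize W A +′_) (trans (∑-*ˡ Vˢ (-′ 1ℚ) _) (cong (-′ 1ℚ *′_) #-𝟎))) ⟩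
      fixSize W A +′ -′ 1ℚ *′ 1ℚ ≡⟨ cong (fixSize W A +′_) (ℚO.*-identityʳ _) ⟩
      fixSize W A -′ 1ℚ ∎
      where
      part : ∀ v (d : Dec (v ≡ 𝟎)) → 𝟙 (In? W v ×-dec ¬? d) *′ 𝟙 (A v ≟ⱽ v) ≡ 𝟙 (In? W v ×-dec (A v ≟ⱽ v)) +′ -′ 1ℚ *′ 𝟙 d
      part v (no v≢𝟎) = trans (cong (_*′ 𝟙 (A v ≟ⱽ v)) (𝟙-cong (In? W v ×-dec ¬? (no v≢𝟎)) (In? W v) proj₁ (λ wv → wv , v≢𝟎)))
        (trans (sym (𝟙-× (In? W v) (A v ≟ⱽ v))) (solve′ 1 (λ a → a :=′ a :+′ :-′ con′ 1 :*′ con′ 0) refl (𝟙 (In? W v ×-dec (A v ≟ⱽ v)))))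
      part v (yes refl) = trans (trans (cong (_*′ 𝟙 (A 𝟎 ≟ⱽ 𝟎)) (𝟙-no (In? W 𝟎 ×-dec ¬? (yes refl)) (λ (_ , n) → n refl))) (ℚO.zeroˡ _))
        (sym (trans (cong (_+′ -′ 1ℚ *′ 1ℚ) (𝟙-yes (In? W 𝟎 ×-dec (A 𝟎 ≟ⱽ 𝟎)) (𝟎-in W , fix-𝟎 AG))) (solve′ 0 (con′ 1 :+′ :-′ con′ 1 :*′ con′ 1 :=′ con′ 0) refl)))
    term : ∀ A → 𝟙 (inU? m W A) *′ ((fixSize W A -′ 1ℚ) *′ φ (fixSize W A)) ≡ ∑[ v ∈ Vˢ ] (𝟙 (nz? v) *′ (𝟙 (inU? m W A ×-dec (A v ≟ⱽ v)) *′ φ (fixSize W A)))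
    term A = begin
      𝟙 (inU? m W A) *′ ((fixSize W A -′ 1ℚ) *′ φ (fixSize W A)) ≡⟨ 𝟙-guard (inU? m W A) (λ (AG , _) → cong (_*′ φ (fixSize W A)) (sym (count AG))) ⟩
      𝟙 (inU? m W A) *′ (∑[ v ∈ Vˢ ] (𝟙 (nz? v) *′ 𝟙 (A v ≟ⱽ v)) *′ φ (fixSize W A)) ≡⟨ cong (𝟙 (inU? m W A) *′_) (sym (∑-*ʳ Vˢ _ _)) ⟩
      𝟙 (inU? m W A) *′ ∑[ v ∈ Vˢ ] (𝟙 (nz? v) *′ 𝟙 (A v ≟ⱽ v) *′ φ (fixSize W A)) ≡⟨ sym (∑-*ˡ Vˢ _ _) ⟩
      ∑[ v ∈ Vˢ ] (𝟙 (inU? m W A) *′ (𝟙 (nz? v) *′ 𝟙 (A v ≟ⱽ v) *′ φ (fixSize W A)))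
        ≡⟨ ∑-cong Vˢ (λ v → trans (solve′ 4 (λ i n a f → i :*′ (n :*′ a :*′ f) :=′ n :*′ (i :*′ a :*′ f)) refl (𝟙 (inU? m W A)) (𝟙 (nz? v)) (𝟙 (A v ≟ⱽ v)) (φ (fixSize W A)))
             (cong (λ k → 𝟙 (nz? v) *′ (k *′ φ (fixSize W A))) (sym (𝟙-× (inU? m W A) (A v ≟ⱽ v))))) ⟩
      ∑[ v ∈ Vˢ ] (𝟙 (nz? v) *′ (𝟙 (inU? m W A ×-dec (A v ≟ⱽ v)) *′ φ (fixSize W A))) ∎

  cone-sum : ∀ {m W} → IsSpace m W → (h : V → ℚ) (N I : ℚ) →
    (∀ v → In W v → ¬ (B v v ≡ 0#) → h v ≡ N) → (∀ v → In W v → ¬ (v ≡ 𝟎) → B v v ≡ 0# → h v ≡ I) →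
    ∑[ v ∈ Vˢ ] (𝟙 (In? W v ×-dec ¬? (v ≟ⱽ 𝟎)) *′ h v) ≡ (pw Q m -′ zeros m) *′ N +′ (zeros m -′ 1ℚ) *′ I
  cone-sum {m} {W} sp h N I hN hI = begin
    ∑[ v ∈ Vˢ ] (𝟙 (In? W v ×-dec ¬? (v ≟ⱽ 𝟎)) *′ h v) ≡⟨ ∑-cong Vˢ (λ v → term v (v ≟ⱽ 𝟎) (B v v ≟ 0#)) ⟩
    -- The last term corrects for the zero vector, which counts as isotropic but is excluded from
    -- the sum.
    ∑[ v ∈ Vˢ ] (𝟙 (In? W v) *′ N +′ (𝟙 (isotropic? W v) *′ (I -′ N) +′ 𝟙 (v ≟ⱽ 𝟎) *′ -′ I))
      ≡⟨ trans (∑-+ Vˢ _ _) (cong₂ _+′_ (∑-*ʳ Vˢ _ N) (trans (∑-+ Vˢ _ _) (cong₂ _+′_ (∑-*ʳ Vˢ _ (I -′ N)) (∑-*ʳ Vˢ _ (-′ I))))) ⟩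
    size W *′ N +′ (# (isotropic? W) *′ (I -′ N) +′ # (λ v → v ≟ⱽ 𝟎) *′ -′ I)
      ≡⟨ three (dimension sp) (isotropic-count m sp) #-𝟎 ⟩
    pw Q m *′ N +′ (zeros m *′ (I -′ N) +′ 1ℚ *′ -′ I)
      ≡⟨ solve′ 4 (λ q z n i → q :*′ n :+′ (z :*′ (i :-′ n) :+′ con′ 1 :*′ :-′ i) :=′ (q :-′ z) :*′ n :+′ (z :-′ con′ 1) :*′ i) refl (pw Q m) (zeros m) N I ⟩
    (pw Q m -′ zeros m) *′ N +′ (zeros m -′ 1ℚ) *′ I ∎
    where
    three : ∀ {a a′ b b′ d d′} → a ≡ a′ → b ≡ b′ → d ≡ d′ → a *′ N +′ (b *′ (I -′ N) +′ d *′ -′ I) ≡ a′ *′ N +′ (b′ *′ (I -′ N) +′ d′ *′ -′ I)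
    three refl refl refl = refl
    term : ∀ v (z : Dec (v ≡ 𝟎)) (d : Dec (B v v ≡ 0#)) →
      𝟙 (In? W v ×-dec ¬? z) *′ h v ≡ 𝟙 (In? W v) *′ N +′ (𝟙 (isotropic? W v) *′ (I -′ N) +′ 𝟙 z *′ -′ I)
    term v (yes refl) _ = trans (trans (cong (_*′ h 𝟎) (𝟙-no (In? W 𝟎 ×-dec ¬? (yes refl)) (λ (_ , n) → n refl))) (ℚO.zeroˡ _))
      (trans (solve′ 2 (λ n i → con′ 0 :=′ con′ 1 :*′ n :+′ (con′ 1 :*′ (i :-′ n) :+′ con′ 1 :*′ :-′ i)) refl N I)
        (sym (cong₂ (λ a b → a *′ N +′ (b *′ (I -′ N) +′ 1ℚ *′ -′ I)) (𝟙-yes (In? W 𝟎) (𝟎-in W)) (𝟙-yes (isotropic? W 𝟎) (𝟎-in W , B-𝟎 𝟎)))))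
    term v (no v≢𝟎) (no n) = trans (𝟙-guard-cong (In? W v ×-dec ¬? (no v≢𝟎)) (In? W v) proj₁ (λ wv → wv , v≢𝟎) (λ (wv , _) → hN v wv n))
      (trans (solve′ 3 (λ w n i → w :*′ n :=′ w :*′ n :+′ (con′ 0 :*′ (i :-′ n) :+′ con′ 0 :*′ :-′ i)) refl (𝟙 (In? W v)) N I)
        (cong (λ b → 𝟙 (In? W v) *′ N +′ (b *′ (I -′ N) +′ 0ℚ *′ -′ I)) (sym (𝟙-no (isotropic? W v) (λ (_ , e) → n e)))))
    term v (no v≢𝟎) (yes e) = trans (𝟙-guard-cong (In? W v ×-dec ¬? (no v≢𝟎)) (In? W v) proj₁ (λ wv → wv , v≢𝟎) (λ (wv , _) → hI v wv v≢𝟎 e))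
      (trans (solve′ 3 (λ w n i → w :*′ i :=′ w :*′ n :+′ (w :*′ (i :-′ n) :+′ con′ 0 :*′ :-′ i)) refl (𝟙 (In? W v)) N I)
        (cong (λ b → 𝟙 (In? W v) *′ N +′ (b *′ (I -′ N) +′ 0ℚ *′ -′ I)) (𝟙-cong (In? W v) (isotropic? W v) (λ wv → wv , e) proj₁)))

  -- Closed forms and the distribution of |Fix A|

  s t : ℚ
  s = -′ u
  t = -′ inv u

  st : s *′ t ≡ 1ℚ
  st = Formula.st q 2≤q

  1-tⁿ≢0 : ∀ n → 1ℚ -′ pw t (suc n) ≢ 0ℚ
  1-tⁿ≢0 = Formula.1-tⁿ≢0 q 2≤q

  R : ℕ → (ℕ → ℚ) → ℚ
  R = QSeries.R s t st 1-tⁿ≢0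

  sign² : ∀ m → pw (-′ 1ℚ) m *′ pw (-′ 1ℚ) m ≡ 1ℚ
  sign² = pw-inverse (solve′ 0 (:-′ con′ 1 :*′ :-′ con′ 1 :=′ con′ 1) refl)

  zeros-closed : ∀ m → u *′ zeros m ≡ pw u m *′ pw u m +′ (u -′ 1ℚ) *′ pw (-′ 1ℚ) m *′ pw u m
  zeros-closed zero = solve′ 1 (λ u → u :*′ con′ 1 :=′ con′ 1 :*′ con′ 1 :+′ (u :-′ con′ 1) :*′ con′ 1 :*′ con′ 1) refl u
  zeros-closed (suc m) = linear₂′ (u *′ (1ℚ +′ u)) (pw-distrib u u m) (-′ u) (zeros-closed m)
    (solve′ 5 (λ u X E P z → u :*′ ((con′ 1 :+′ u) :*′ P :-′ u :*′ z) :+′ u :*′ (con′ 1 :+′ u) :*′ (X :*′ X) :+′ :-′ u :*′ (X :*′ X :+′ (u :-′ con′ 1) :*′ E :*′ X)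
      :=′ X :*′ u :*′ (X :*′ u) :+′ (u :-′ con′ 1) :*′ (E :*′ :-′ con′ 1) :*′ (X :*′ u) :+′ u :*′ (con′ 1 :+′ u) :*′ P :+′ :-′ u :*′ (u :*′ z))
      refl u (pw u m) (pw (-′ 1ℚ) m) (pw Q m) (zeros m))

  nonisotropic-total : ∀ m → pw Q m -′ zeros m ≡ (u -′ 1ℚ) *′ units m
  nonisotropic-total m = linear₁′ (-′ (pw Q m -′ zeros m)) (inv-inverseʳ u-1≢0)
    (solve′ 3 (λ d c i → d :+′ :-′ d :*′ con′ 1 :=′ c :*′ (d :*′ i) :+′ :-′ d :*′ (c :*′ i)) refl (pw Q m -′ zeros m) (u -′ 1ℚ) (inv (u -′ 1ℚ)))

  -- In terms of s = -q the right side is s^m (s^m - 1).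
  units-closed : ∀ m → u *′ units m ≡ pw u m *′ pw u m -′ pw (-′ 1ℚ) m *′ pw u m
  units-closed m = ℚO.*-cancelˡ u-1≢0 (linear₃′ (-′ u) (nonisotropic-total m) (-′ 1ℚ) (zeros-closed m) u (pw-distrib u u m)
    (solve′ 6 (λ u n P z X E → (u :-′ con′ 1) :*′ (u :*′ n) :+′ :-′ u :*′ ((u :-′ con′ 1) :*′ n) :+′ :-′ con′ 1 :*′ (X :*′ X :+′ (u :-′ con′ 1) :*′ E :*′ X) :+′ u :*′ (X :*′ X)
      :=′ (u :-′ con′ 1) :*′ (X :*′ X :-′ E :*′ X) :+′ :-′ u :*′ (P :-′ z) :+′ :-′ con′ 1 :*′ (u :*′ z) :+′ u :*′ P)
      refl u (units m) (pw Q m) (zeros m) (pw u m) (pw (-′ 1ℚ) m)))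

  -- The orbit-stabilizer identity in numbers: above each element of U_m(q) lie q · q^(2m)
  -- stabilizer elements, one for each admissible pair (w , c), so both sides are |U_(m+2)(q)| /
  -- |U_m(q)|. It is checked on the closed forms.
  isotropic-total : ∀ m → (zeros (2 ℕ.+ m) -′ 1ℚ) *′ (u *′ pw Q m) ≡ units (2 ℕ.+ m) *′ units (suc m)
  isotropic-total m = ℚO.*-cancelˡ Q≢0 (begin
    Q *′ ((zeros (2 ℕ.+ m) -′ 1ℚ) *′ (u *′ pw Q m))
      ≡⟨ solve′ 3 (λ u z P → u :*′ u :*′ ((z :-′ con′ 1) :*′ (u :*′ P)) :=′ (u :*′ z :-′ u) :*′ (u :*′ u :*′ P)) refl u (zeros (2 ℕ.+ m)) (pw Q m) ⟩
    (u *′ zeros (2 ℕ.+ m) -′ u) *′ (u *′ u *′ pw Q m)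
      ≡⟨ cong₂ (λ a b → (a -′ u) *′ (u *′ u *′ b)) (zeros-closed (2 ℕ.+ m)) (pw-distrib u u m) ⟩
    (X *′ u *′ u *′ (X *′ u *′ u) +′ (u -′ 1ℚ) *′ (E *′ -′ 1ℚ *′ -′ 1ℚ) *′ (X *′ u *′ u) -′ u) *′ (u *′ u *′ (X *′ X))
      ≡⟨ linear₁′ (u *′ u *′ u *′ X *′ X) (sign² m)
           (solve′ 3 (λ u X E → (X :*′ u :*′ u :*′ (X :*′ u :*′ u) :+′ (u :-′ con′ 1) :*′ (E :*′ :-′ con′ 1 :*′ :-′ con′ 1) :*′ (X :*′ u :*′ u) :-′ u) :*′ (u :*′ u :*′ (X :*′ X))
                :+′ u :*′ u :*′ u :*′ X :*′ X :*′ con′ 1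
              :=′ (X :*′ u :*′ u :*′ (X :*′ u :*′ u) :-′ (E :*′ :-′ con′ 1 :*′ :-′ con′ 1) :*′ (X :*′ u :*′ u)) :*′ (X :*′ u :*′ (X :*′ u) :-′ (E :*′ :-′ con′ 1) :*′ (X :*′ u))
                :+′ u :*′ u :*′ u :*′ X :*′ X :*′ (E :*′ E)) refl u X E) ⟩
    (pw u (2 ℕ.+ m) *′ pw u (2 ℕ.+ m) -′ pw (-′ 1ℚ) (2 ℕ.+ m) *′ pw u (2 ℕ.+ m)) *′ (pw u (suc m) *′ pw u (suc m) -′ pw (-′ 1ℚ) (suc m) *′ pw u (suc m))
      ≡⟨ sym (cong₂ _*′_ (units-closed (2 ℕ.+ m)) (units-closed (suc m))) ⟩
    u *′ units (2 ℕ.+ m) *′ (u *′ units (suc m)) ≡⟨ solve′ 3 (λ u a b → u :*′ a :*′ (u :*′ b) :=′ u :*′ u :*′ (a :*′ b)) refl u (units (2 ℕ.+ m)) (units (suc m)) ⟩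
    Q *′ (units (2 ℕ.+ m) *′ units (suc m)) ∎)
    where
    X = pw u m
    E = pw (-′ 1ℚ) m

  -- In positive rank an element of p-power order has nonzero fixed vectors, so x = |Fix A| ≠ 1.
  divided : (ℚ → ℚ) → ℚ → ℚ
  divided ψ x = ψ x *′ inv (x -′ 1ℚ)

  divided-cancel : ∀ ψ {x} → x ≢ 1ℚ → ψ x ≡ (x -′ 1ℚ) *′ divided ψ x
  divided-cancel ψ {x} x≢1 = linear₁′ (-′ ψ x) (inv-inverseʳ {x -′ 1ℚ} (λ e → x≢1 (linear₁′ 1ℚ e (solve′ 1 (λ x → x :+′ con′ 1 :*′ con′ 0 :=′ con′ 1 :+′ con′ 1 :*′ (x :-′ con′ 1)) refl x))))
    (solve′ 3 (λ p c i → p :+′ :-′ p :*′ con′ 1 :=′ c :*′ (p :*′ i) :+′ :-′ p :*′ (c :*′ i)) refl (ψ x) (x -′ 1ℚ) (inv (x -′ 1ℚ)))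

  unipotentSum-divided : ∀ {m W} → IsSpace (suc m) W → ∀ ψ → unipotentSum (suc m) W ψ ≡ unipotentSum (suc m) W (λ x → (x -′ 1ℚ) *′ divided ψ x)
  unipotentSum-divided {m} {W} sp ψ = ∑-cong Funs λ A → 𝟙-guard (inU? (suc m) W A) (λ (AG , AU) → divided-cancel ψ (λ e →
    let v , wv , v≢𝟎 , Av = fixed-vector sp AG (suc m , AU) in v≢𝟎 (trivial (Fix W AG) e v (wv , Av))))

  -- The counterpart of `unipotentSum-divided` for the q-series. Only k = 0 has q^(2k) = 1, and
  -- `R-support` permits any value there.
  R-divided : ∀ m ψ → R (suc m) (λ k → ψ (pw Q k)) ≡ R (suc m) (λ k → (pw s k *′ pw s k -′ 1ℚ) *′ divided ψ (pw Q k))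
  R-divided m ψ = QSeries.R-support s t st 1-tⁿ≢0 m λ k → trans (divided-cancel ψ (Formula.uu^≢1 q 2≤q k))
    (cong (λ y → (y -′ 1ℚ) *′ divided ψ (pw Q (suc k))) (sym (Formula.s² q 2≤q (suc k))))

  orbit-sum : ∀ {m W} → IsSpace (suc m) W → ∀ φ N I →
    (∀ v → In W v → ¬ (B v v ≡ 0#) → stabilizerSum (suc m) W v φ ≡ N) →
    (∀ v → In W v → ¬ (v ≡ 𝟎) → B v v ≡ 0# → stabilizerSum (suc m) W v φ ≡ I) →
    unipotentSum (suc m) W (λ x → (x -′ 1ℚ) *′ φ x) ≡ (u -′ 1ℚ) *′ units (suc m) *′ N +′ (zeros (suc m) -′ 1ℚ) *′ I
  orbit-sum {m} {W} sp φ N I hN hI = trans (fixed-pairs (suc m) W φ) (trans (cone-sum sp _ N I hN hI)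
    (cong (λ a → a *′ N +′ (zeros (suc m) -′ 1ℚ) *′ I) (nonisotropic-total (suc m))))

  -- The dictionary is 1/|Fix A| = t^(2k) and 1/q = -t.
  φ⁺-Ψ : ∀ φ k → φ⁺ φ (pw Q k) ≡ u *′ QSeries.Ψ s t st 1-tⁿ≢0 (λ k → φ (pw Q k)) k
  φ⁺-Ψ φ k = begin
    u *′ φ P +′ inv P *′ (φ (Q *′ (Q *′ P)) +′ (u -′ 1ℚ) *′ φ (Q *′ P) -′ u *′ φ P)
      ≡⟨ three invP (cong φ (trans (ℚO.*-comm Q _) (cong (_*′ Q) (ℚO.*-comm Q P)))) (cong φ (ℚO.*-comm Q P)) ⟩
    u *′ φ P +′ x *′ x *′ (φ (pw Q (2 ℕ.+ k)) +′ (u -′ 1ℚ) *′ φ (pw Q (suc k)) -′ u *′ φ P)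
      ≡⟨ linear₁′ (x *′ x *′ (φ (pw Q (suc k)) -′ φ (pw Q (2 ℕ.+ k)))) (inv-inverseʳ u≢0)
           (solve′ 6 (λ u i x a b c → u :*′ a :+′ x :*′ x :*′ (c :+′ (u :-′ con′ 1) :*′ b :-′ u :*′ a) :+′ x :*′ x :*′ (b :-′ c) :*′ con′ 1
             :=′ u :*′ ((con′ 1 :-′ x :*′ x) :*′ a :+′ (:-′ (:-′ i) :*′ (x :*′ x) :*′ c :+′ (con′ 1 :+′ :-′ i) :*′ (x :*′ x) :*′ b)) :+′ x :*′ x :*′ (b :-′ c) :*′ (u :*′ i))
             refl u (inv u) x (φ P) (φ (pw Q (suc k))) (φ (pw Q (2 ℕ.+ k)))) ⟩
    u *′ QSeries.Ψ s t st 1-tⁿ≢0 (λ k → φ (pw Q k)) k ∎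
    where
    P = pw Q k
    x = pw t k
    three : ∀ {a a′ b b′ d d′} → a ≡ a′ → b ≡ b′ → d ≡ d′ → u *′ φ P +′ a *′ (b +′ (u -′ 1ℚ) *′ d -′ u *′ φ P) ≡ u *′ φ P +′ a′ *′ (b′ +′ (u -′ 1ℚ) *′ d′ -′ u *′ φ P)
    three refl refl refl = refl
    invP : inv P ≡ x *′ x
    invP = sym (inv-unique (trans (cong (_*′ (x *′ x)) (sym (Formula.s² q 2≤q k)))
      (trans (solve′ 2 (λ y x → y :*′ y :*′ (x :*′ x) :=′ y :*′ x :*′ (y :*′ x)) refl (pw s k) x) (trans (cong₂ _*′_ (pw-inverse st k) (pw-inverse st k)) (ℚO.*-identityˡ 1ℚ)))))

  -- With φ = `divided ψ` both sides obey the same recurrence from ranks m + 1 and m to rank m + 2.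
  -- Rank 1 stands apart because it has no nonzero isotropic vectors; correspondingly the doubly
  -- shifted term of `R-recurrence` vanishes at index 1.
  unipotent-distribution : ∀ m {W} → IsSpace m W → ∀ ψ → unipotentSum m W ψ ≡ groupOrder m *′ R m (λ k → ψ (pw Q k))
  unipotent-distribution zero {W} sp ψ = begin
    ∑[ A ∈ Funs ] (𝟙 (inU? 0 W A) *′ ψ (fixSize W A)) ≡⟨ ∑-cong Funs (λ A → 𝟙-guard (inU? 0 W A) (λ (_ , AU) → cong ψ (trans (fixSize-cong {W} AU) all-fixed))) ⟩
    ∑[ A ∈ Funs ] (𝟙 (inU? 0 W A) *′ ψ 1ℚ) ≡⟨ trans (∑-*ʳ Funs _ _) (cong (_*′ ψ 1ℚ) unique) ⟩
    1ℚ *′ ψ 1ℚ ≡⟨ cong (1ℚ *′_) (sym (QSeries.R-0 s t st 1-tⁿ≢0 (λ k → ψ (pw Q k)))) ⟩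
    1ℚ *′ R 0 (λ k → ψ (pw Q k)) ∎
    where
    all-fixed : fixSize W (λ x → x) ≡ 1ℚ
    all-fixed = trans (#-cong (λ x → In? W x ×-dec (x ≟ⱽ x)) (In? W) (λ _ → proj₁) (λ _ wx → wx , refl)) (dimension sp)
    unique : ∑[ A ∈ Funs ] 𝟙 (inU? 0 W A) ≡ 1ℚ
    unique = ∑-𝟙-unique Funs (inU? 0 W) (λ e (AG , AU) → InG-resp e AG , unipotent-resp {0} e AU)
      ((λ x → x) , id-InG , λ _ → refl) (λ (_ , AU) (_ , AU′) x → trans (AU x) (sym (AU′ x)))
  unipotent-distribution (suc zero) {W} sp ψ = begin
    unipotentSum 1 W ψ ≡⟨ unipotentSum-divided sp ψ ⟩
    unipotentSum 1 W (λ x → (x -′ 1ℚ) *′ φ x)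
      ≡⟨ orbit-sum sp φ (groupOrder 0 *′ R 0 (λ k → φ (Q *′ pw Q k))) 0ℚ
           (λ v wv n → trans (stabilizer-nonisotropic sp wv n φ) (unipotent-distribution 0 (hyperplane-space sp wv n) (λ x → φ (Q *′ x))))
           (λ v wv v≢𝟎 iso → ⊥-elim (no-isotropic-line sp wv v≢𝟎 iso)) ⟩
    (u -′ 1ℚ) *′ units 1 *′ (groupOrder 0 *′ R 0 (λ k → φ (Q *′ pw Q k))) +′ (zeros 1 -′ 1ℚ) *′ 0ℚ
      ≡⟨ cong (λ r → (u -′ 1ℚ) *′ units 1 *′ (groupOrder 0 *′ r) +′ (zeros 1 -′ 1ℚ) *′ 0ℚ) (QSeries.R-cong s t st 1-tⁿ≢0 (λ k → cong φ (ℚO.*-comm Q (pw Q k))) 0) ⟩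
    (u -′ 1ℚ) *′ units 1 *′ (groupOrder 0 *′ R 0 (λ k → φ (pw Q (suc k)))) +′ (zeros 1 -′ 1ℚ) *′ 0ℚ
      ≡⟨ solve′ 5 (λ u n g r z → (u :-′ con′ 1) :*′ n :*′ (g :*′ r) :+′ z :*′ con′ 0 :=′ n :*′ g :*′ ((:-′ (:-′ u) :-′ con′ 1) :*′ r :+′ con′ 0)) refl u (units 1) (groupOrder 0) (R 0 (λ k → φ (pw Q (suc k)))) (zeros 1 -′ 1ℚ) ⟩
    groupOrder 1 *′ ((-′ s -′ 1ℚ) *′ R 0 (λ k → φ (pw Q (suc k))) +′ 0ℚ) ≡⟨ cong (groupOrder 1 *′_) (sym (trans (R-divided 0 ψ) (QSeries.R-recurrence s t st 1-tⁿ≢0 (λ k → φ (pw Q k)) 1))) ⟩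
    groupOrder 1 *′ R 1 (λ k → ψ (pw Q k)) ∎
    where φ = divided ψ
  unipotent-distribution (suc (suc m)) {W} sp ψ = begin
    unipotentSum (2 ℕ.+ m) W ψ ≡⟨ unipotentSum-divided sp ψ ⟩
    unipotentSum (2 ℕ.+ m) W (λ x → (x -′ 1ℚ) *′ φ x)
      ≡⟨ orbit-sum sp φ (groupOrder (suc m) *′ R (suc m) (λ k → φ (Q *′ pw Q k))) (pw Q m *′ (groupOrder m *′ R m (λ k → φ⁺ φ (pw Q k))))
           (λ v wv n → trans (stabilizer-nonisotropic sp wv n φ) (unipotent-distribution (suc m) (hyperplane-space sp wv n) (λ x → φ (Q *′ x))))
           (λ v wv v≢𝟎 iso → let hyp = hyperbolic-exists sp wv v≢𝟎 iso in
              trans (StabilizerSum.stabilizer-sum sp hyp φ) (cong (pw Q m *′_) (unipotent-distribution m (hyperbolic-space sp hyp) (φ⁺ φ)))) ⟩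
    (u -′ 1ℚ) *′ n₂ *′ (n₁ *′ g *′ R (suc m) (λ k → φ (Q *′ pw Q k))) +′ (zeros (2 ℕ.+ m) -′ 1ℚ) *′ (pw Q m *′ (g *′ R m (λ k → φ⁺ φ (pw Q k))))
      ≡⟨ cong₂ (λ a b → (u -′ 1ℚ) *′ n₂ *′ (n₁ *′ g *′ a) +′ (zeros (2 ℕ.+ m) -′ 1ℚ) *′ (pw Q m *′ (g *′ b)))
           (QSeries.R-cong s t st 1-tⁿ≢0 (λ k → cong φ (ℚO.*-comm Q (pw Q k))) (suc m))
           (trans (QSeries.R-cong s t st 1-tⁿ≢0 (φ⁺-Ψ φ) m) (QSeries.R-*ˡ s t st 1-tⁿ≢0 u _ m)) ⟩
    (u -′ 1ℚ) *′ n₂ *′ (n₁ *′ g *′ r₁) +′ (zeros (2 ℕ.+ m) -′ 1ℚ) *′ (pw Q m *′ (g *′ (u *′ r₂)))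
      ≡⟨ linear₁′ (g *′ r₂) (isotropic-total m)
           (solve′ 8 (λ u n₂ n₁ g r₁ z P r₂ → (u :-′ con′ 1) :*′ n₂ :*′ (n₁ :*′ g :*′ r₁) :+′ z :*′ (P :*′ (g :*′ (u :*′ r₂))) :+′ g :*′ r₂ :*′ (n₂ :*′ n₁)
             :=′ n₂ :*′ (n₁ :*′ g) :*′ ((:-′ (:-′ u) :-′ con′ 1) :*′ r₁ :+′ r₂) :+′ g :*′ r₂ :*′ (z :*′ (u :*′ P))) refl u n₂ n₁ g r₁ (zeros (2 ℕ.+ m) -′ 1ℚ) (pw Q m) r₂) ⟩
    groupOrder (2 ℕ.+ m) *′ ((-′ s -′ 1ℚ) *′ r₁ +′ r₂)
      ≡⟨ cong (groupOrder (2 ℕ.+ m) *′_) (sym (trans (R-divided (suc m) ψ) (QSeries.R-recurrence s t st 1-tⁿ≢0 (λ k → φ (pw Q k)) (2 ℕ.+ m)))) ⟩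
    groupOrder (2 ℕ.+ m) *′ R (2 ℕ.+ m) (λ k → ψ (pw Q k)) ∎
    where
    φ = divided ψ
    n₂ = units (2 ℕ.+ m)
    n₁ = units (suc m)
    g = groupOrder m
    r₁ = R (suc m) (λ k → φ (pw Q (suc k)))
    r₂ = R m (QSeries.Ψ s t st 1-tⁿ≢0 (λ k → φ (pw Q k)))

  -- From fixed spaces to affine derangements

  derangement-sum : ∀ {m W} → IsSpace m W →
    ∑[ A ∈ Funs ] (𝟙 (inU? m W A) *′ # (λ w → In? W w ×-dec ¬? (coboundary? W A w))) ≡ pw Q m *′ (groupOrder m *′ formula q m)
  derangement-sum {m} {W} sp = begin
    ∑[ A ∈ Funs ] (𝟙 (inU? m W A) *′ # (λ w → In? W w ×-dec ¬? (coboundary? W A w))) ≡⟨ ∑-cong Funs (λ A → 𝟙-guard (inU? m W A) (λ (AG , _) → complement AG)) ⟩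
    ∑[ A ∈ Funs ] (𝟙 (inU? m W A) *′ (pw Q m *′ (1ℚ -′ inv (fixSize W A))))
      ≡⟨ trans (∑-cong Funs (λ A → solve′ 3 (λ a b c → a :*′ (b :*′ c) :=′ b :*′ (a :*′ c)) refl (𝟙 (inU? m W A)) (pw Q m) (1ℚ -′ inv (fixSize W A)))) (∑-*ˡ Funs (pw Q m) _) ⟩
    pw Q m *′ unipotentSum m W (λ x → 1ℚ -′ inv x) ≡⟨ cong (pw Q m *′_) (unipotent-distribution m sp (λ x → 1ℚ -′ inv x)) ⟩
    pw Q m *′ (groupOrder m *′ R m (λ k → 1ℚ -′ inv (pw Q k)))
      ≡⟨ cong (λ r → pw Q m *′ (groupOrder m *′ r)) (trans (QSeries.R-cong s t st 1-tⁿ≢0 (λ k → cong (λ i → 1ℚ -′ i) (invP k)) m) (QSeries.R-1-x² s t st 1-tⁿ≢0 q refl m)) ⟩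
    pw Q m *′ (groupOrder m *′ formula q m) ∎
    where
    invP : ∀ k → inv (pw Q k) ≡ pw t k *′ pw t k
    invP k = sym (inv-unique (trans (cong (_*′ (pw t k *′ pw t k)) (sym (Formula.s² q 2≤q k)))
      (trans (solve′ 2 (λ y x → y :*′ y :*′ (x :*′ x) :=′ y :*′ x :*′ (y :*′ x)) refl (pw s k) (pw t k)) (trans (cong₂ _*′_ (pw-inverse st k) (pw-inverse st k)) (ℚO.*-identityˡ 1ℚ)))))
    complement : ∀ {A} → InG W A → # (λ w → In? W w ×-dec ¬? (coboundary? W A w)) ≡ pw Q m *′ (1ℚ -′ inv (fixSize W A))
    complement {A} AG = begin
      # (λ w → In? W w ×-dec ¬? (coboundary? W A w)) ≡⟨ ∑-cong Vˢ (λ w → part w (coboundary? W A w)) ⟩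
      ∑[ w ∈ Vˢ ] (𝟙 (In? W w) +′ -′ 1ℚ *′ 𝟙 (coboundary? W A w)) ≡⟨ trans (∑-+ Vˢ _ _) (cong (size W +′_) (∑-*ˡ Vˢ (-′ 1ℚ) _)) ⟩
      size W +′ -′ 1ℚ *′ # (coboundary? W A)
        ≡⟨ linear₃′ (1ℚ -′ inv f₀) (dimension sp) (# (coboundary? W A)) (inv-inverseʳ (size≢0 (Fix W AG))) (-′ inv f₀) (image-count AG)
             (solve′ 5 (λ w c f i P → w :+′ :-′ con′ 1 :*′ c :+′ (con′ 1 :-′ i) :*′ P :+′ c :*′ con′ 1 :+′ :-′ i :*′ w
               :=′ P :*′ (con′ 1 :-′ i) :+′ (con′ 1 :-′ i) :*′ w :+′ c :*′ (f :*′ i) :+′ :-′ i :*′ (c :*′ f)) refl (size W) (# (coboundary? W A)) f₀ (inv f₀) (pw Q m)) ⟩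
      pw Q m *′ (1ℚ -′ inv f₀) ∎
      where
      f₀ = fixSize W A
      part : ∀ w (d : Dec (Coboundary W A w)) → 𝟙 (In? W w ×-dec ¬? d) ≡ 𝟙 (In? W w) +′ -′ 1ℚ *′ 𝟙 d
      part w (no ¬c) = trans (𝟙-cong (In? W w ×-dec ¬? (no ¬c)) (In? W w) proj₁ (λ ww → ww , ¬c)) (solve′ 1 (λ a → a :=′ a :+′ :-′ con′ 1 :*′ con′ 0) refl (𝟙 (In? W w)))
      part w (yes c) = trans (𝟙-no (In? W w ×-dec ¬? (yes c)) (λ (_ , n) → n c))
        (sym (trans (cong (_+′ -′ 1ℚ *′ 1ℚ) (𝟙-yes (In? W w) (proj₁ (coboundary-perp AG c)))) (solve′ 0 (con′ 1 :+′ :-′ con′ 1 :*′ con′ 1 :=′ con′ 0) refl)))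

  -- The proposition `x ≡ x` serves as the one that is true of every vector.
  whole : Subspace
  whole = record { In = λ x → x ≡ x ; In? = λ x → yes refl ; ⊕-closed = λ _ _ → refl ; ·-closed = λ _ _ → refl ; 𝟎-in = refl }

  whole-nondegenerate : Nondegenerate whole
  whole-nondegenerate x _ h = B-separates λ z → trans (h z refl) (sym (B-𝟎 z))

  inverse-InG : ∀ {f} → InG whole f → ∃ λ g → InG whole g × (∀ x → f (g x) ≡ x) × (∀ x → g (f x) ≡ x)
  inverse-InG {f} h = g , record
      { additive = λ x y → InG-injective h (trans (fg _) (sym (trans (additive h _ _) (cong₂ _⊕_ (fg x) (fg y)))))
      ; homogeneous = λ a x → InG-injective h (trans (fg _) (sym (trans (homogeneous h a _) (cong (a ·_) (fg x)))))
      ; isometric = λ x y → trans (sym (isometric h _ _)) (cong₂ B (fg x) (fg y))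
      ; support = λ _ → refl } , fg , λ x → InG-injective h (fg (f x))
    where
    g : V → V
    g y = proj₁ (InG-surjective h y)
    fg : ∀ x → f (g x) ≡ x
    fg y = proj₂ (InG-surjective h y)

  affine : (V → V) → V → V → V
  affine f v x = f x ⊕ v

  iterate-affine : ∀ {W f} → InG W f → ∀ v n x → iterate (affine f v) n x ≡ iterate f n x ⊕ iterate (affine f v) n 𝟎
  iterate-affine h v zero x = sym (trans (⊕-comm x 𝟎) (⊕-identityˡ x))
    where
    open CommutativeMonoid VFr.monoid using () renaming (comm to ⊕-comm)
  iterate-affine {f = f} h v (suc n) x = trans (cong (λ y → f y ⊕ v) (iterate-affine h v n x))
    (trans (cong (_⊕ v) (additive h _ _)) (⊕-assoc _ _ _))
    where
    open CommutativeMonoid VFr.monoid using () renaming (assoc to ⊕-assoc)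

  affine-ppower⇒ : ∀ {m W f v} → IsSpace m W → InG W f → PPower (affine f v) → Unipotent m f
  affine-ppower⇒ {m} {f = f} {v} sp h (k , e) = ppower-bound m sp h (k , λ x → trans (sym (⊕-identityʳ _))
      (trans (cong (iterate f (p ℕ.^ k) x ⊕_) (sym (e 𝟎))) (trans (sym (iterate-affine h v (p ℕ.^ k) x)) (e x))))
    where
    open CommutativeMonoid VFr.monoid using () renaming (identityʳ to ⊕-identityʳ)

  -- The p^m-th power of the affine map is a translation, whose p-th power is the identity.
  affine-ppower⇐ : ∀ {m W f} v → InG W f → Unipotent m f → PPower (affine f v)
  affine-ppower⇐ {m} {f = f} v h fU = suc m , λ x → trans (iterate-pᵏ-suc (affine f v) m x)
      (trans (iterate-cong {g = λ y → y ⊕ d} (λ y → trans (iterate-affine h v (p ℕ.^ m) y) (cong (_⊕ d) (fU y))) p x)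
        (trans (translate p x) (trans (cong (x ⊕_) (torsionⱽ d)) (⊕-identityʳ x))))
    where
    open CommutativeMonoid VFr.monoid using () renaming (identityʳ to ⊕-identityʳ; assoc to ⊕-assoc; comm to ⊕-comm)
    d = iterate (affine f v) (p ℕ.^ m) 𝟎
    translate : ∀ n x → iterate (λ y → y ⊕ d) n x ≡ x ⊕ n VFr.Mult.× d
    translate zero x = sym (⊕-identityʳ x)
    translate (suc n) x = trans (cong (_⊕ d) (translate n x)) (trans (⊕-assoc x _ d) (cong (x ⊕_) (⊕-comm _ d)))

  -- If v = f y - y, the fixed point is -y.
  Coboundary⇒fixed : ∀ {W f v} → InG W f → Coboundary whole f v → ∃ λ x → affine f v x ≡ x
  Coboundary⇒fixed {f = f} {v} h c = let y , _ , e = Any.satisfied c in (- 1#) · y , B-separates λ z → begin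
    B (f ((- 1#) · y) ⊕ v) z ≡⟨ trans (B-⊕ _ v z) (cong₂ _+_ (trans (cong (λ w → B w z) (homogeneous h _ y)) (B-· _ (f y) z))
         (trans (cong (λ w → B w z) (sym e)) (B-⊖ (f y) y z))) ⟩
    - 1# * B (f y) z + (B (f y) z - B y z) ≡⟨ solve 2 (λ a b → :- κ 1 :* a :+ (a :- b) := :- κ 1 :* b) refl (B (f y) z) (B y z) ⟩
    - 1# * B y z ≡⟨ sym (B-· _ y z) ⟩
    B ((- 1#) · y) z ∎

  fixed⇒Coboundary : ∀ {W f v x} → InG W f → affine f v x ≡ x → Coboundary whole f v
  fixed⇒Coboundary {f = f} {v} {x} h e = coboundary {whole} {y = (- 1#) · x} refl (B-separates λ z → begin
    B (f ((- 1#) · x) ⊖ (- 1#) · x) z ≡⟨ trans (B-⊖ _ _ z) (cong₂ _-_ (trans (cong (λ w → B w z) (homogeneous h _ x)) (B-· _ (f x) z)) (B-· _ x z)) ⟩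
    - 1# * B (f x) z - - 1# * B x z ≡⟨ linear₁ (- 1#) (trans (sym (B-⊕ (f x) v z)) (cong (λ w → B w z) e))
         (solve 3 (λ a b c → :- κ 1 :* a :- :- κ 1 :* b :+ :- κ 1 :* b := c :+ :- κ 1 :* (a :+ c)) refl (B (f x) z) (B x z) (B v z)) ⟩
    B v z ∎)

  AU-count : ∀ {m} → IsSpace m whole → ∑[ A ∈ Funs ] ∑[ v ∈ Vˢ ] 𝟙 (InG? whole A) ≡ groupOrder m *′ pw Q m
  AU-count {m} sp = begin
    ∑[ A ∈ Funs ] ∑[ v ∈ Vˢ ] 𝟙 (InG? whole A) ≡⟨ ∑-cong Funs (λ A → trans (∑-cong Vˢ (λ v → sym (ℚO.*-identityʳ _))) (∑-*ˡ Vˢ (𝟙 (InG? whole A)) (λ _ → 1ℚ))) ⟩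
    ∑[ A ∈ Funs ] (𝟙 (InG? whole A) *′ size whole) ≡⟨ ∑-*ʳ Funs _ _ ⟩
    order whole *′ size whole ≡⟨ cong₂ _*′_ (group-order m sp) (dimension sp) ⟩
    groupOrder m *′ pw Q m ∎

  derangement? : ∀ m A v → Dec ((InG whole A × Unipotent m A) × v ≡ v × ¬ Coboundary whole A v)
  derangement? m A v = inU? m whole A ×-dec (yes refl ×-dec ¬? (coboundary? whole A v))

  derangement-count : ∀ {m} → IsSpace m whole → ∑[ A ∈ Funs ] ∑[ v ∈ Vˢ ] 𝟙 (derangement? m A v) ≡ pw Q m *′ (groupOrder m *′ formula q m)
  derangement-count {m} sp = trans
    (∑-cong Funs (λ A → trans (∑-cong Vˢ (λ v → 𝟙-× (inU? m whole A) (yes refl ×-dec ¬? (coboundary? whole A v)))) (∑-*ˡ Vˢ (𝟙 (inU? m whole A)) _)))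
    (derangement-sum sp)

-- Transfer to the given field, form and matrices

lookup-All : ∀ {a p} {A : Set a} {P : A → Set p} {xs : List A} → All P xs → ∀ i → P (lookup xs i)
lookup-All (p ∷ ps) Fin.zero = p
lookup-All (p ∷ ps) (Fin.suc i) = lookup-All ps i

lookup-injective : ∀ {a r} {A : Set a} {_~_ : A → A → Set r} → (∀ {x y} → x ~ y → y ~ x) → (xs : List A) →
  AllPairs (λ x y → ¬ (x ~ y)) xs → ∀ i j → lookup xs i ~ lookup xs j → i ≡ j
lookup-injective s (x ∷ xs) (n ∷ ns) Fin.zero Fin.zero e = refl
lookup-injective s (x ∷ xs) (n ∷ ns) Fin.zero (Fin.suc j) e = ⊥-elim (lookup-All n j e)
lookup-injective s (x ∷ xs) (n ∷ ns) (Fin.suc i) Fin.zero e = ⊥-elim (lookup-All n i (s e))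
lookup-injective s (x ∷ xs) (n ∷ ns) (Fin.suc i) (Fin.suc j) e = cong Fin.suc (lookup-injective s xs ns i j e)

-- Replace the elements of a finite field by their positions in the given listing, so that equality becomes propositional.
module Transfer {c ℓ} (p q e n : ℕ) (i₀ : Fin n) (pr : Prime p) (1≤e : 1 ℕ.≤ e) (q≡pᵉ : q ≡ p ℕ.^ e)
  (F : CommutativeRing c ℓ) (F-field : IsField F) (LF : List (CommutativeRing.Carrier F)) (LF-length : length LF ≡ q ℕ.^ 2)
  (LF-complete : ∀ x → Any (CommutativeRing._≈_ F x) LF) (LF-distinct : AllPairs (λ x y → ¬ (CommutativeRing._≈_ F x y)) LF)
  (Bᶠ : Unitary.Form F q n) (B-form : Unitary.IsNondegHermitian F q Bᶠ) where

  module C = CommutativeRing F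
  open C using (Carrier; _≈_) renaming (_+_ to infixl 6 _+ᶠ_; _*_ to infixl 7 _*ᶠ_; -_ to infix 8 -ᶠ_)
  module ≈R = Relation.Binary.Reasoning.Setoid C.setoid

  F′ : Set
  F′ = Fin (length LF)

  el : F′ → Carrier
  el = lookup LF

  opaque
    idx : Carrier → F′
    idx x = Any.index (LF-complete x)

    el-idx : ∀ x → el (idx x) ≈ x
    el-idx x = C.sym (AnyP.lookup-index (LF-complete x))

  el-injective : ∀ {i j} → el i ≈ el j → i ≡ j
  el-injective {i} {j} = lookup-injective C.sym LF LF-distinct i j

  idx-cong : ∀ {x y} → x ≈ y → idx x ≡ idx y
  idx-cong e = el-injective (C.trans (el-idx _) (C.trans e (C.sym (el-idx _))))

  raw′ : RawRing 0ℓ 0ℓ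
  raw′ = record { Carrier = F′ ; _≈_ = _≡_ ; _+_ = λ i j → idx (el i +ᶠ el j) ; _*_ = λ i j → idx (el i *ᶠ el j)
                ; -_ = λ i → idx (-ᶠ el i) ; 0# = idx C.0# ; 1# = idx C.1# }

  open RawRing raw′ using () renaming (_+_ to add; _*_ to mul; -_ to neg; 0# to 0′; 1# to 1′)

  -- The operations on positions are pulled back along the injection `el`, so the ring laws are
  -- inherited from the given field.
  el-monomorphism : IsRingMonomorphism raw′ C.rawRing el
  el-monomorphism = record
    { isRingHomomorphism = record
      { isSemiringHomomorphism = record
        { isNearSemiringHomomorphism = record
          { +-isMonoidHomomorphism = record
            { isMagmaHomomorphism = record { isRelHomomorphism = record { cong = λ { refl → C.refl } } ; homo = λ _ _ → el-idx _ }
            ; ε-homo = el-idx _ }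
          ; *-homo = λ _ _ → el-idx _ }
        ; 1#-homo = el-idx _ }
      ; -‿homo = λ _ → el-idx _ }
    ; injective = el-injective }

  isCR′ : IsCommutativeRing _≡_ add mul neg 0′ 1′
  isCR′ = RingMono.isCommutativeRing el-monomorphism C.isCommutativeRing

  1≢0 : ¬ (1′ ≡ 0′)
  1≢0 eq = proj₁ F-field (C.trans (C.sym (el-idx C.1#)) (C.trans (C.reflexive (cong el eq)) (el-idx C.0#)))

  inverse : ∀ x → ¬ (x ≡ 0′) → ∃ λ y → mul x y ≡ 1′
  inverse x x≢0 = let y , e = proj₂ F-field (el x) (λ x≈0 → x≢0 (el-injective (C.trans x≈0 (C.sym (el-idx _))))) in
    idx y , idx-cong (C.trans (C.*-congˡ (el-idx y)) e)

  module FF = FiniteField p q e pr 1≤e q≡pᵉ add mul neg 0′ 1′ isCR′ FinP._≟_ (allFin (length LF)) ∈-allFin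
    (UniqueP.allFin⁺ (length LF)) (trans (ListP.length-tabulate _) LF-length) 1≢0 inverse

  open FF using (σ; Fˢ)

  el-pow : ∀ i k → el (FF.power i k) ≈ pow F (el i) k
  el-pow i zero = el-idx _
  el-pow i (suc k) = C.trans (el-idx _) (C.*-congʳ (el-pow i k))

  V′ : Set
  V′ = Vec F′ n

  elⱽ : ∀ {k} → Vec F′ k → Vec' F k
  elⱽ v i = el (Vec.lookup v i)

  opaque
    idxⱽ : ∀ {k} → Vec' F k → Vec F′ k
    idxⱽ u = Vec.tabulate (λ i → idx (u i))

    elⱽ-idxⱽ : ∀ {k} (u : Vec' F k) i → elⱽ (idxⱽ u) i ≈ u i
    elⱽ-idxⱽ u i = C.trans (C.reflexive (cong el (VecP.lookup∘tabulate _ i))) (el-idx (u i))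

  elⱽ-injective : ∀ {k} {v w : Vec F′ k} → (∀ i → elⱽ v i ≈ elⱽ w i) → v ≡ w
  elⱽ-injective {v = v} {w} h = trans (sym (VecP.tabulate∘lookup v)) (trans (VecP.tabulate-cong (λ i → el-injective (h i))) (VecP.tabulate∘lookup w))

  idxⱽ-elⱽ : ∀ {k} (v : Vec F′ k) → idxⱽ (elⱽ v) ≡ v
  idxⱽ-elⱽ v = elⱽ-injective (elⱽ-idxⱽ (elⱽ v))

  idxⱽ-cong : ∀ {k} {u w : Vec' F k} → (∀ i → u i ≈ w i) → idxⱽ u ≡ idxⱽ w
  idxⱽ-cong {u = u} {w} h = elⱽ-injective (λ i → C.trans (elⱽ-idxⱽ u i) (C.trans (h i) (C.sym (elⱽ-idxⱽ w i))))

  vectors : ∀ k → FinSet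
  vectors k = mkFinSet (Vec F′ k) _≡_ ≡.isEquivalence (VecP.≡-dec FinP._≟_)
    (map Vec.tabulate (allFunctions FinP._≟_ (allFin k) 0′ (allFin (length LF))))
    (λ v → AnyP.map⁺ (Any.map (λ a → trans (sym (VecP.tabulate∘lookup v)) (VecP.tabulate-cong (λ i → All.lookup a (∈-allFin i))))
      (allFunctions-complete FinP._≟_ (allFin k) 0′ (allFin (length LF)) ∈-allFin (Vec.lookup v))))

  q² : ℚ
  q² = ι q *′ ι q

  field-size : ∑[ x ∈ Fˢ ] 1ℚ ≡ q²
  field-size = trans (∑-1 Fˢ) (trans (cong ι (trans (ListP.length-tabulate {n = length LF} (λ i → i)) (trans LF-length (cong (q ℕ.*_) (ℕP.*-identityʳ q))))) (ι-* q q))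

  vectors-size : ∀ k → ∑[ v ∈ vectors k ] 1ℚ ≡ pw q² k
  vectors-size zero = trans (∑-cong (vectors 0) (λ v → sym (𝟙-yes (v Vec0≟ Vec.[]) (unique v))))
    (∑-𝟙-unique (vectors 0) (λ v → v Vec0≟ Vec.[]) (λ { refl h → h }) (Vec.[] , refl) (λ e f → trans e (sym f)))
    where
    _Vec0≟_ = VecP.≡-dec {n = 0} (FinP._≟_ {length LF})
    unique : ∀ (v : Vec F′ 0) → v ≡ Vec.[]
    unique Vec.[] = refl
  vectors-size (suc k) = begin
    ∑[ v ∈ vectors (suc k) ] 1ℚ ≡⟨ ∑-fibre (vectors (suc k)) Fˢ Vec.head (λ _ → 1ℚ) ⟩
    ∑[ a ∈ Fˢ ] ∑[ v ∈ vectors (suc k) ] (𝟙 (a FinP.≟ Vec.head v) *′ 1ℚ) ≡⟨ ∑-cong Fˢ (λ a → trans (fibre a) (∑-cong (vectors k) (λ _ → Rat.*-identityʳ 1ℚ))) ⟩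
    ∑[ a ∈ Fˢ ] ∑[ w ∈ vectors k ] 1ℚ ≡⟨ ∑-cong Fˢ (λ a → trans (vectors-size k) (sym (Rat.*-identityˡ _))) ⟩
    ∑[ a ∈ Fˢ ] (1ℚ *′ pw q² k) ≡⟨ trans (∑-*ʳ Fˢ _ _) (trans (cong (_*′ pw q² k) field-size) (Rat.*-comm _ _)) ⟩
    pw q² (suc k) ∎
    where
    open ≡-Reasoning
    cons-head : ∀ {a} {v : Vec F′ (suc k)} → a ≡ Vec.head v → a Vec.∷ Vec.tail v ≡ v
    cons-head {v = x Vec.∷ v} refl = refl
    fibre : ∀ a → ∑[ v ∈ vectors (suc k) ] (𝟙 (a FinP.≟ Vec.head v) *′ 1ℚ) ≡ ∑[ w ∈ vectors k ] (𝟙 (yes (refl {x = w})) *′ 1ℚ)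
    fibre a = ∑-bij (vectors (suc k)) (vectors k) (λ v → a FinP.≟ Vec.head v) (λ w → yes (refl {x = w})) (λ _ → 1ℚ) (λ _ → 1ℚ)
      Vec.tail (a Vec.∷_) (λ { refl h → h }) (λ { refl h → refl }) (cong Vec.tail) (cong (a Vec.∷_)) (λ _ → refl) (λ _ → refl) cons-head (λ _ → refl) (λ _ → refl) (λ _ → refl)

  open Unitary F q hiding (σ)

  Vˢ : FinSet
  Vˢ = vectors n

  _⊕_ : V′ → V′ → V′
  v ⊕ w = idxⱽ (λ i → elⱽ v i +ᶠ elⱽ w i)

  _·_ : F′ → V′ → V′
  a · v = idxⱽ (λ i → el a *ᶠ elⱽ v i)

  𝟎 : V′
  𝟎 = idxⱽ (zeroV F)

  B′ : V′ → V′ → F′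
  B′ v w = idx (Bᶠ (elⱽ v) (elⱽ w))

  Bᶠ-+ = proj₁ B-form
  Bᶠ-* = proj₁ (proj₂ B-form)
  Bᶠ-herm = proj₁ (proj₂ (proj₂ B-form))
  Bᶠ-cong = proj₁ (proj₂ (proj₂ (proj₂ B-form)))
  Bᶠ-nondegenerate = proj₂ (proj₂ (proj₂ (proj₂ B-form)))

  Bᶠ-congˡ : ∀ {u u′ v : Vec' F n} → (∀ i → u i ≈ u′ i) → Bᶠ u v ≈ Bᶠ u′ v
  Bᶠ-congˡ h = Bᶠ-cong _ _ _ _ h (λ _ → C.refl)

  B′-⊕ : ∀ x y z → B′ (x ⊕ y) z ≡ add (B′ x z) (B′ y z)
  B′-⊕ x y z = idx-cong (C.trans (Bᶠ-congˡ (elⱽ-idxⱽ _)) (C.trans (Bᶠ-+ _ _ _) (C.sym (C.+-cong (el-idx _) (el-idx _)))))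

  B′-· : ∀ a x z → B′ (a · x) z ≡ mul a (B′ x z)
  B′-· a x z = idx-cong (C.trans (Bᶠ-congˡ (elⱽ-idxⱽ _)) (C.trans (Bᶠ-* _ _ _) (C.*-congˡ (C.sym (el-idx _)))))

  B′-𝟎 : ∀ z → B′ 𝟎 z ≡ 0′
  B′-𝟎 z = idx-cong (C.trans (Bᶠ-congˡ (λ i → C.trans (elⱽ-idxⱽ _ i) (C.sym (C.zeroˡ (elⱽ z i))))) (C.trans (Bᶠ-* C.0# (elⱽ z) (elⱽ z)) (C.zeroˡ _)))

  B′-herm : ∀ x y → B′ y x ≡ σ (B′ x y)
  B′-herm x y = el-injective (C.trans (el-idx _) (C.trans (Bᶠ-herm (elⱽ x) (elⱽ y)) (C.trans (pow-cong q (C.sym (el-idx _))) (C.sym (el-pow _ q)))))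
    where
    pow-cong : ∀ k {a b} → a ≈ b → pow F a k ≈ pow F b k
    pow-cong zero h = C.refl
    pow-cong (suc k) h = C.*-cong (pow-cong k h) h

  -- Nondegeneracy of the given form is applied to the difference of the represented vectors. The
  -- hypothesis speaks only of coded vectors z, and `on` passes from an arbitrary vector to its
  -- code.
  B′-separates : ∀ {x y} → (∀ z → B′ x z ≡ B′ y z) → x ≡ y
  B′-separates {x} {y} h = elⱽ-injective λ i → let open ≈R in begin
    elⱽ x i ≈⟨ C.sym (C.+-identityʳ _) ⟩
    elⱽ x i +ᶠ C.0# ≈⟨ C.+-congˡ (C.sym (C.trans (C.+-congʳ (negate (elⱽ y i))) (C.-‿inverseˡ _))) ⟩
    elⱽ x i +ᶠ (-ᶠ C.1# *ᶠ elⱽ y i +ᶠ elⱽ y i) ≈⟨ C.sym (C.+-assoc _ _ _) ⟩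
    d i +ᶠ elⱽ y i ≈⟨ C.+-congʳ (Bᶠ-nondegenerate d d⊥ i) ⟩
    C.0# +ᶠ elⱽ y i ≈⟨ C.+-identityˡ _ ⟩
    elⱽ y i ∎
    where
    negate : ∀ a → -ᶠ C.1# *ᶠ a ≈ -ᶠ a
    negate = Algebra.Properties.Ring.-1*x≈-x C.ring
    d : Vec' F n
    d i = elⱽ x i +ᶠ -ᶠ C.1# *ᶠ elⱽ y i
    d⊥ : ∀ v → Bᶠ d v ≈ C.0#
    d⊥ v = let open ≈R in begin
      Bᶠ d v ≈⟨ Bᶠ-+ _ _ v ⟩
      Bᶠ (elⱽ x) v +ᶠ Bᶠ (λ i → -ᶠ C.1# *ᶠ elⱽ y i) v ≈⟨ C.+-cong same (C.trans (Bᶠ-* _ _ v) (negate _)) ⟩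
      Bᶠ (elⱽ y) v +ᶠ -ᶠ Bᶠ (elⱽ y) v ≈⟨ C.-‿inverseʳ _ ⟩
      C.0# ∎
      where
      on : ∀ u → Bᶠ u v ≈ Bᶠ u (elⱽ (idxⱽ v))
      on u = Bᶠ-cong _ _ _ _ (λ _ → C.refl) (λ i → C.sym (elⱽ-idxⱽ v i))
      same : Bᶠ (elⱽ x) v ≈ Bᶠ (elⱽ y) v
      same = C.trans (on _) (C.trans (C.trans (C.sym (el-idx _)) (C.trans (C.reflexive (cong el (h (idxⱽ v)))) (el-idx _))) (C.sym (on _)))

  basis : ∀ {k} → Fin k → Vec' F k
  basis i = idM F i

  idM-diagonal : ∀ {k} (i : Fin k) → basis i i ≈ C.1#
  idM-diagonal i with i Fin.≟ i
  ... | yes _ = C.refl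
  ... | no i≢i = ⊥-elim (i≢i refl)

  e₀ : Vec' F n
  e₀ = basis i₀

  -- The rank is positive, so the basis vector `e₀` is nonzero and cannot be orthogonal to
  -- everything. Its multiples then realise every scalar as a value of the form.
  pairing : ∃ λ z → ¬ (B′ (idxⱽ e₀) z ≡ 0′)
  pairing with Any.any? (λ z → ¬? (B′ (idxⱽ e₀) z FinP.≟ 0′)) (FinSet.elems Vˢ)
  ... | yes a = Any.satisfied a
  ... | no ¬a = ⊥-elim (proj₁ F-field (C.trans (C.sym (idM-diagonal {n} i₀)) (C.trans (C.sym (elⱽ-idxⱽ e₀ i₀))
        (C.trans (C.reflexive (cong (λ v → elⱽ v i₀) zero-vector)) (elⱽ-idxⱽ {n} (zeroV F) i₀)))))
    where
    zero-vector : idxⱽ e₀ ≡ 𝟎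
    zero-vector = B′-separates {idxⱽ e₀} {𝟎} λ z → trans (decidable-stable (B′ (idxⱽ e₀) z FinP.≟ 0′) (λ ne → ¬a (Any.map (λ { refl → ne }) (FinSet.complete Vˢ z)))) (sym (B′-𝟎 z))

  -- Every scalar is a value of the form, and σ² fixes those.
  σσ : ∀ x → σ (σ x) ≡ x
  σσ x = let z , nz = pairing
             i , inv-i = inverse _ nz
             v = mul x i · idxⱽ e₀
             value : B′ v z ≡ x
             value = trans (B′-· (mul x i) (idxⱽ e₀) z) (trans (*-assoc x i _) (trans (cong (mul x) (trans (*-comm i _) inv-i)) (*-identityʳ x)))
         in trans (cong (λ y → σ (σ y)) (sym value)) (trans (sym (trans (B′-herm z v) (cong σ (B′-herm v z)))) value)
    where
    open IsCommutativeRing isCR′ using (*-assoc; *-comm; *-identityʳ)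

  module Fib = FF.Fibres σσ

  K : UnitaryField
  K = record
    { p = p ; q = q ; prime = pr ; F = F′ ; add = add ; mul = mul ; neg = neg ; 0# = 0′ ; 1# = 1′ ; isCR = isCR′
    ; _≟_ = FinP._≟_ ; elems = allFin (length LF) ; complete = ∈-allFin ; distinct = UniqueP.allFin⁺ (length LF)
    ; 1≢0 = 1≢0 ; inverse = inverse ; characteristic = FF.p×1≡0 ; σ = σ ; σ-+ = FF.σ-+ ; σ-* = FF.σ-* ; σσ = σσ
    ; 2≤q = FF.1<q ; total = Fib.total ; trace-count = Fib.trace-count ; norm-count = Fib.norm-count ; nonzero-count = Fib.nonzero-count }

  H : HermitianSpace K
  H = record
    { V = V′ ; _≟ⱽ_ = FinSet._~?_ Vˢ ; elemsⱽ = FinSet.elems Vˢ ; completeⱽ = FinSet.complete Vˢ ; distinctⱽ = FinSet.distinct Vˢ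
    ; _⊕_ = _⊕_ ; _·_ = _·_ ; 𝟎 = 𝟎 ; B = B′ ; B-⊕ = B′-⊕ ; B-· = B′-· ; B-𝟎 = B′-𝟎 ; B-herm = B′-herm ; B-separates = B′-separates }

  module G = Geometry K H

  sumF-cong : ∀ {k} {f g : Fin k → Carrier} → (∀ i → f i ≈ g i) → sumF F f ≈ sumF F g
  sumF-cong {zero} h = C.refl
  sumF-cong {suc k} h = C.+-cong (h Fin.zero) (sumF-cong (λ i → h (Fin.suc i)))

  sumF-zero : ∀ {k} → sumF F {k} (λ _ → C.0#) ≈ C.0#
  sumF-zero {zero} = C.refl
  sumF-zero {suc k} = C.trans (C.+-identityˡ _) (sumF-zero {k})

  +-interchange : ∀ a b x y → (a +ᶠ b) +ᶠ (x +ᶠ y) ≈ (a +ᶠ x) +ᶠ (b +ᶠ y)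
  +-interchange a b x y = C.trans (C.+-assoc a b _) (C.trans (C.+-congˡ (C.trans (C.sym (C.+-assoc b x y)) (C.trans (C.+-congʳ (C.+-comm b x)) (C.+-assoc x b y)))) (C.sym (C.+-assoc a x _)))

  sumF-+ : ∀ {k} (f g : Fin k → Carrier) → sumF F (λ i → f i +ᶠ g i) ≈ sumF F f +ᶠ sumF F g
  sumF-+ {zero} f g = C.sym (C.+-identityˡ _)
  sumF-+ {suc k} f g = C.trans (C.+-congˡ (sumF-+ (λ i → f (Fin.suc i)) (λ i → g (Fin.suc i)))) (+-interchange _ _ _ _)

  sumF-*ˡ : ∀ {k} a (f : Fin k → Carrier) → sumF F (λ i → a *ᶠ f i) ≈ a *ᶠ sumF F f
  sumF-*ˡ {zero} a f = C.sym (C.zeroʳ a)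
  sumF-*ˡ {suc k} a f = C.trans (C.+-congˡ (sumF-*ˡ a (λ i → f (Fin.suc i)))) (C.sym (C.distribˡ a _ _))

  sumF-*ʳ : ∀ {k} (f : Fin k → Carrier) a → sumF F (λ i → f i *ᶠ a) ≈ sumF F f *ᶠ a
  sumF-*ʳ f a = C.trans (sumF-cong (λ i → C.*-comm (f i) a)) (C.trans (sumF-*ˡ a f) (C.*-comm a _))

  sumF-swap : ∀ {k l} (f : Fin k → Fin l → Carrier) → sumF F (λ i → sumF F (λ j → f i j)) ≈ sumF F (λ j → sumF F (λ i → f i j))
  sumF-swap {zero} {l} f = C.sym (sumF-zero {l})
  sumF-swap {suc k} f = C.trans (C.+-congˡ (sumF-swap (λ i → f (Fin.suc i)))) (C.sym (sumF-+ (f Fin.zero) (λ j → sumF F (λ i → f (Fin.suc i) j))))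

  infixl 7 _·ᴹ_
  _·ᴹ_ : Vec' F n → Mat F n → Vec' F n
  _·ᴹ_ = _·M_ F

  ·M-cong : ∀ {u w : Vec' F n} {A A′ : Mat F n} → (∀ i → u i ≈ w i) → (∀ i j → A i j ≈ A′ i j) → ∀ j → (u ·ᴹ A) j ≈ (w ·ᴹ A′) j
  ·M-cong h k j = sumF-cong (λ i → C.*-cong (h i) (k i j))

  ·M-+ : ∀ u w (A : Mat F n) j → (_+V_ F u w ·ᴹ A) j ≈ (u ·ᴹ A) j +ᶠ (w ·ᴹ A) j
  ·M-+ u w A j = C.trans (sumF-cong (λ i → C.distribʳ (A i j) (u i) (w i))) (sumF-+ (λ i → u i *ᶠ A i j) (λ i → w i *ᶠ A i j))

  ·M-* : ∀ a u (A : Mat F n) j → ((λ i → a *ᶠ u i) ·ᴹ A) j ≈ a *ᶠ (u ·ᴹ A) j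
  ·M-* a u A j = C.trans (sumF-cong (λ i → C.*-assoc a (u i) (A i j))) (sumF-*ˡ a (λ i → u i *ᶠ A i j))

  ·M-assoc : ∀ u (A A′ : Mat F n) k → ((u ·ᴹ A) ·ᴹ A′) k ≈ (u ·ᴹ _*M_ F A A′) k
  ·M-assoc u A A′ k = C.trans (sumF-cong (λ j → C.sym (sumF-*ʳ (λ i → u i *ᶠ A i j) (A′ j k))))
    (C.trans (sumF-swap (λ j i → u i *ᶠ A i j *ᶠ A′ j k))
      (sumF-cong (λ i → C.trans (sumF-cong (λ j → C.*-assoc (u i) (A i j) (A′ j k))) (sumF-*ˡ (u i) (λ j → A i j *ᶠ A′ j k)))))

  idM-suc : ∀ {k} (i j : Fin k) → idM F (Fin.suc i) (Fin.suc j) ≈ idM F i j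
  idM-suc i j with i Fin.≟ j
  ... | yes _ = C.refl
  ... | no _ = C.refl

  cons : ∀ {k} → Carrier → Vec' F k → Vec' F (suc k)
  cons a u Fin.zero = a
  cons a u (Fin.suc i) = u i

  -- Stated for an abstract linear functional, so that it applies both to the coordinates of a
  -- vector and to the coordinates of the image of a vector under an isometry.
  linear-expansion : ∀ {k} (ℓ : Vec' F k → Carrier) → (∀ {u w} → (∀ i → u i ≈ w i) → ℓ u ≈ ℓ w) →
    (∀ u w → ℓ (_+V_ F u w) ≈ ℓ u +ᶠ ℓ w) → (∀ a u → ℓ (λ i → a *ᶠ u i) ≈ a *ᶠ ℓ u) →
    ∀ u → ℓ u ≈ sumF F (λ i → u i *ᶠ ℓ (basis i))
  linear-expansion {zero} ℓ ℓ-cong ℓ-+ ℓ-* u = C.trans (ℓ-cong (λ ())) (C.trans (ℓ-* C.0# u) (C.zeroˡ _))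
  linear-expansion {suc k} ℓ ℓ-cong ℓ-+ ℓ-* u = C.trans (ℓ-cong split) (C.trans (ℓ-+ _ _) (C.+-cong (ℓ-* _ _)
    (C.trans (linear-expansion (λ w → ℓ (cons C.0# w)) (λ h → ℓ-cong (cons-cong h))
        (λ w w′ → C.trans (ℓ-cong (λ { Fin.zero → C.sym (C.+-identityˡ _) ; (Fin.suc i) → C.refl })) (ℓ-+ _ _))
        (λ a w → C.trans (ℓ-cong (λ { Fin.zero → C.sym (C.zeroʳ a) ; (Fin.suc i) → C.refl })) (ℓ-* a _)) (λ i → u (Fin.suc i)))
      (sumF-cong (λ i → C.*-congˡ (ℓ-cong (λ { Fin.zero → C.refl ; (Fin.suc j) → C.sym (idM-suc i j) })))))))
    where
    cons-cong : ∀ {w w′ : Vec' F k} → (∀ i → w i ≈ w′ i) → ∀ i → cons C.0# w i ≈ cons C.0# w′ i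
    cons-cong h Fin.zero = C.refl
    cons-cong h (Fin.suc i) = h i
    split : ∀ i → u i ≈ u Fin.zero *ᶠ basis Fin.zero i +ᶠ cons C.0# (λ i → u (Fin.suc i)) i
    split Fin.zero = C.sym (C.trans (C.+-identityʳ _) (C.*-identityʳ _))
    split (Fin.suc i) = C.sym (C.trans (C.+-congʳ (C.zeroʳ _)) (C.+-identityˡ _))

  ·M-idM : ∀ (u : Vec' F n) j → (u ·ᴹ idM F) j ≈ u j
  ·M-idM u j = C.sym (linear-expansion (λ w → w j) (λ h → h j) (λ _ _ → C.refl) (λ _ _ → C.refl) u)

  basis-·M : ∀ i (A : Mat F n) j → (basis i ·ᴹ A) j ≈ A i j
  basis-·M i A j = row i (λ k → A k j)
    where
    row : ∀ {k} (i : Fin k) (f : Fin k → Carrier) → sumF F (λ l → basis i l *ᶠ f l) ≈ f i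
    row {suc k} Fin.zero f = C.trans (C.+-cong (C.*-identityˡ _) (C.trans (sumF-cong (λ l → C.zeroˡ (f (Fin.suc l)))) (sumF-zero {k}))) (C.+-identityʳ _)
    row {suc k} (Fin.suc i) f = C.trans (C.+-cong (C.zeroˡ _) (C.trans (sumF-cong (λ l → C.*-congʳ (idM-suc i l))) (row i (λ l → f (Fin.suc l))))) (C.+-identityˡ _)

  toMap : Mat F n → V′ → V′
  toMap A x = idxⱽ (elⱽ x ·ᴹ A)

  toMat : (V′ → V′) → Mat F n
  toMat f i j = elⱽ (f (idxⱽ (basis i))) j

  toMap-idxⱽ : ∀ A (u : Vec' F n) → toMap A (idxⱽ u) ≡ idxⱽ (u ·ᴹ A)
  toMap-idxⱽ A u = idxⱽ-cong (·M-cong {A = A} {A} (elⱽ-idxⱽ u) (λ _ _ → C.refl))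

  el-toMap : ∀ A x j → elⱽ (toMap A x) j ≈ (elⱽ x ·ᴹ A) j
  el-toMap A x = elⱽ-idxⱽ _

  toMat-toMap : ∀ {f} → G.InG G.whole f → ∀ u j → (u ·ᴹ toMat f) j ≈ elⱽ (f (idxⱽ u)) j
  toMat-toMap {f} h u j = C.sym (linear-expansion (λ w → elⱽ (f (idxⱽ w)) j)
    (λ e → C.reflexive (cong (λ v → elⱽ (f v) j) (idxⱽ-cong e)))
    (λ w w′ → C.trans (C.reflexive (cong (λ v → elⱽ v j) (trans (cong f (idxⱽ-cong (λ i → C.sym (C.+-cong (elⱽ-idxⱽ w i) (elⱽ-idxⱽ w′ i))))) (additive (idxⱽ w) (idxⱽ w′))))) (elⱽ-idxⱽ _ j))
    (λ a w → C.trans (C.reflexive (cong (λ v → elⱽ v j) (trans (cong f (idxⱽ-cong (λ i → C.sym (C.*-cong (el-idx a) (elⱽ-idxⱽ w i))))) (homogeneous (idx a) (idxⱽ w)))))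
      (C.trans (elⱽ-idxⱽ _ j) (C.*-congʳ (el-idx a)))) u)
    where
    open G.InG h

  map-of-mat : ∀ {f} → G.InG G.whole f → ∀ x → f x ≡ toMap (toMat f) x
  map-of-mat {f} h x = trans (cong f (sym (idxⱽ-elⱽ x))) (trans (sym (idxⱽ-elⱽ _)) (idxⱽ-cong (λ j → C.sym (toMat-toMap h (elⱽ x) j))))

  unitary⇒InG : ∀ {A} → IsUnitary Bᶠ A → G.InG G.whole (toMap A)
  unitary⇒InG {A} (_ , preserves) = record
    { additive = λ x y → trans (toMap-idxⱽ A _) (idxⱽ-cong (λ j → C.trans (·M-+ _ _ A j) (C.sym (C.+-cong (el-toMap A x j) (el-toMap A y j)))))
    ; homogeneous = λ a x → trans (toMap-idxⱽ A _) (idxⱽ-cong (λ j → C.trans (·M-* _ _ A j) (C.sym (C.*-congˡ (el-toMap A x j)))))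
    ; isometric = λ x y → idx-cong (C.trans (Bᶠ-cong _ _ _ _ (el-toMap A x) (el-toMap A y)) (preserves (elⱽ x) (elⱽ y)))
    ; support = λ _ → refl }

  -- The inverse matrix is the matrix of the inverse isometry.
  InG⇒unitary : ∀ {f} → G.InG G.whole f → IsUnitary Bᶠ (toMat f)
  InG⇒unitary {f} h = let g , gG , fg , gf = G.inverse-InG h in
      (toMat g , product gG h gf , product h gG fg) , preserves
    where
    product : ∀ {f g} → G.InG G.whole f → G.InG G.whole g → (∀ x → f (g x) ≡ x) → ∀ i j → _*M_ F (toMat g) (toMat f) i j ≈ idM F i j
    product {f} {g} fG gG fg i j = let open ≈R in begin
      _*M_ F (toMat g) (toMat f) i j ≈⟨ C.sym (basis-·M i (_*M_ F (toMat g) (toMat f)) j) ⟩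
      (basis i ·ᴹ _*M_ F (toMat g) (toMat f)) j ≈⟨ C.sym (·M-assoc (basis i) (toMat g) (toMat f) j) ⟩
      ((basis i ·ᴹ toMat g) ·ᴹ toMat f) j ≈⟨ ·M-cong {A = toMat f} {toMat f} (toMat-toMap gG (basis i)) (λ _ _ → C.refl) j ⟩
      (elⱽ (g (idxⱽ (basis i))) ·ᴹ toMat f) j ≈⟨ toMat-toMap fG _ j ⟩
      elⱽ (f (idxⱽ (elⱽ (g (idxⱽ (basis i)))))) j ≈⟨ C.reflexive (cong (λ v → elⱽ v j) (trans (cong f (idxⱽ-elⱽ _)) (fg _))) ⟩
      elⱽ (idxⱽ (basis i)) j ≈⟨ elⱽ-idxⱽ (basis i) j ⟩
      basis i j ∎
    preserves : ∀ u v → Bᶠ (u ·ᴹ toMat f) (v ·ᴹ toMat f) ≈ Bᶠ u v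
    preserves u v = let open ≈R in begin
      Bᶠ (u ·ᴹ toMat f) (v ·ᴹ toMat f) ≈⟨ Bᶠ-cong _ _ _ _ (toMat-toMap h u) (toMat-toMap h v) ⟩
      Bᶠ (elⱽ (f (idxⱽ u))) (elⱽ (f (idxⱽ v))) ≈⟨ C.sym (el-idx _) ⟩
      el (B′ (f (idxⱽ u)) (f (idxⱽ v))) ≈⟨ C.reflexive (cong el (G.InG.isometric h (idxⱽ u) (idxⱽ v))) ⟩
      el (B′ (idxⱽ u) (idxⱽ v)) ≈⟨ el-idx _ ⟩
      Bᶠ (elⱽ (idxⱽ u)) (elⱽ (idxⱽ v)) ≈⟨ Bᶠ-cong _ _ _ _ (elⱽ-idxⱽ u) (elⱽ-idxⱽ v) ⟩
      Bᶠ u v ∎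

  affineMap : AffElt n → V′ → V′
  affineMap (A , v) = G.affine (toMap A) (idxⱽ v)

  affineMap-act : ∀ g x → affineMap g x ≡ idxⱽ (act g (elⱽ x))
  affineMap-act (A , v) x = idxⱽ-cong (λ j → C.+-cong (el-toMap A x j) (elⱽ-idxⱽ v j))

  act-cong : ∀ g {u w} → (∀ i → u i ≈ w i) → ∀ i → act g u i ≈ act g w i
  act-cong (A , v) h i = C.+-congʳ (·M-cong {A = A} {A} h (λ _ _ → C.refl) i)

  act-∘ : ∀ g h u i → act (g ∘A h) u i ≈ act h (act g u) i
  act-∘ (A , v) (A′ , v′) u i = C.trans (C.+-congʳ (C.sym (·M-assoc u A A′ i))) (C.trans (C.sym (C.+-assoc _ _ _)) (C.+-congʳ (C.sym (·M-+ _ _ A′ i))))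

  act-id : ∀ u i → act idA u i ≈ u i
  act-id u i = C.trans (C.+-identityʳ _) (·M-idM u i)

  iterate-act : ∀ g k x → iterate (affineMap g) k x ≡ idxⱽ (act (powA g k) (elⱽ x))
  iterate-act g zero x = trans (sym (idxⱽ-elⱽ x)) (idxⱽ-cong (λ i → C.sym (act-id (elⱽ x) i)))
  iterate-act g (suc k) x = trans (affineMap-act g (iterate (affineMap g) k x)) (idxⱽ-cong (λ i →
    C.trans (act-cong g (λ j → C.trans (C.reflexive (cong (λ v → elⱽ v j) (iterate-act g k x))) (elⱽ-idxⱽ _ j)) i)
      (C.sym (act-∘ (powA g k) g (elⱽ x) i))))

  ppower⇒ : ∀ g → HasPPowerOrder p g → G.PPower (affineMap g)
  ppower⇒ g (k , (Ak , vk)) = k , λ x → trans (iterate-act g (p ℕ.^ k) x) (trans (idxⱽ-cong (λ i →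
    C.trans (C.+-cong (·M-cong (λ _ → C.refl) Ak i) (vk i)) (act-id (elⱽ x) i))) (idxⱽ-elⱽ x))

  -- Evaluation at 0 shows that the translation part vanishes; evaluation at the basis vectors then
  -- gives the rows of the matrix.
  ppower⇐ : ∀ g → G.PPower (affineMap g) → HasPPowerOrder p g
  ppower⇐ g (k , e) = k , (λ i j → C.trans (C.sym (basis-·M i A j)) (linear (basis i) j)) , v≈0
    where
    A = proj₁ (powA g (p ℕ.^ k))
    v = proj₂ (powA g (p ℕ.^ k))
    fixed : ∀ u i → act (powA g (p ℕ.^ k)) u i ≈ u i
    fixed u i = C.trans (act-cong (powA g (p ℕ.^ k)) (λ j → C.sym (elⱽ-idxⱽ u j)) i) (C.trans (C.sym (elⱽ-idxⱽ _ i))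
      (C.trans (C.reflexive (cong (λ v → elⱽ v i) (trans (sym (iterate-act g (p ℕ.^ k) (idxⱽ u))) (e (idxⱽ u))))) (elⱽ-idxⱽ u i)))
    v≈0 : ∀ i → v i ≈ C.0#
    v≈0 i = C.trans (C.sym (C.trans (C.+-congʳ (C.trans (sumF-cong (λ l → C.zeroˡ (A l i))) (sumF-zero {n}))) (C.+-identityˡ _))) (fixed (zeroV F) i)
    linear : ∀ u i → (u ·ᴹ A) i ≈ u i
    linear u i = C.trans (C.sym (C.trans (C.+-congˡ (v≈0 i)) (C.+-identityʳ _))) (fixed u i)

  dimension : G.IsSpace n G.whole
  dimension = record { dimension = vectors-size n ; nondegenerate = G.whole-nondegenerate }

  Derangement : AffElt n → Set _
  Derangement g = InAU Bᶠ g × IsDerangement g × HasPPowerOrder p g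

  toMap-cong : ∀ {g h} → g ≈A h → (∀ x → toMap (proj₁ g) x ≡ toMap (proj₁ h) x) × idxⱽ (proj₂ g) ≡ idxⱽ (proj₂ h)
  toMap-cong (hA , hv) = (λ x → idxⱽ-cong (·M-cong (λ _ → C.refl) hA)) , idxⱽ-cong hv

  toMap-injective : ∀ {g h} → (∀ x → toMap (proj₁ g) x ≡ toMap (proj₁ h) x) → idxⱽ (proj₂ g) ≡ idxⱽ (proj₂ h) → g ≈A h
  toMap-injective {A , v} {A′ , v′} eA ev =
    (λ i j → C.trans (C.sym (basis-·M i A j)) (C.trans (via (trans (sym (toMap-idxⱽ A (basis i))) (trans (eA (idxⱽ (basis i))) (toMap-idxⱽ A′ (basis i)))) j) (basis-·M i A′ j))) , via ev
    where
    via : ∀ {u w : Vec' F n} → idxⱽ u ≡ idxⱽ w → ∀ j → u j ≈ w j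
    via {u} {w} eq j = C.trans (C.sym (elⱽ-idxⱽ u j)) (C.trans (C.reflexive (cong (λ v → elⱽ v j) eq)) (elⱽ-idxⱽ w j))

  AU-size : ∀ {N} → HasCard (AffElt n) _≈A_ (InAU Bᶠ) N → ι N ≡ G.groupOrder n *′ pw q² n
  AU-size (L , refl , LP , LC , LD) = trans
    (card-pairs G.Funs Vˢ L LP LC LD (λ f v → G.InG? G.whole f) (λ g → toMap (proj₁ g)) (λ g → idxⱽ (proj₂ g)) (λ f v → toMat f , elⱽ v)
      (λ ga e _ → G.InG-resp (λ x → sym (e x)) (unitary⇒InG ga)) toMap-cong (λ _ _ → toMap-injective)
      (λ h → InG⇒unitary h , map-of-mat h , sym (idxⱽ-elⱽ _)))
    (G.AU-count dimension)

  -- The identity belongs to the group, so the total division in the proportion is a genuine one.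
  AU-size≢0 : ∀ {N} → HasCard (AffElt n) _≈A_ (InAU Bᶠ) N → ι N ≢ 0ℚ
  AU-size≢0 (L , refl , LP , LC , LD) = nonempty (LC (toMat (λ x → x) , zeroV F) (InG⇒unitary G.id-InG))
    where
    nonempty : ∀ {L} {P : AffElt n → Set ℓ} → Any P L → ι (length L) ≢ 0ℚ
    nonempty {x ∷ L} _ = 1≤⇒≢0 (Rat.1≤ι-suc (length L))

  derangement⇒ : ∀ {g} → Derangement g → (G.InG G.whole (toMap (proj₁ g)) × G.Unipotent n (toMap (proj₁ g))) × idxⱽ (proj₂ g) ≡ idxⱽ (proj₂ g) × ¬ G.Coboundary G.whole (toMap (proj₁ g)) (idxⱽ (proj₂ g))
  derangement⇒ {g} (gU , der , pp) = (hG , G.affine-ppower⇒ {v = idxⱽ (proj₂ g)} dimension hG (ppower⇒ g pp)) , refl , λ c →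
    let x , e = G.Coboundary⇒fixed {G.whole} {toMap (proj₁ g)} {idxⱽ (proj₂ g)} hG c in
    der (elⱽ x) (λ i → C.trans (C.sym (elⱽ-idxⱽ (act g (elⱽ x)) i)) (C.reflexive (cong (λ v → elⱽ v i) (trans (sym (affineMap-act g x)) e))))
    where hG = unitary⇒InG gU

  derangement⇐ : ∀ {f v} → (G.InG G.whole f × G.Unipotent n f) × v ≡ v × ¬ G.Coboundary G.whole f v → Derangement (toMat f , elⱽ v)
  derangement⇐ {f} {v} ((hG , hU) , _ , ¬c) = InG⇒unitary hG ,
      (λ u eq → ¬c (G.fixed⇒Coboundary {G.whole} {x = idxⱽ u} hG (trans (sym (same (idxⱽ u))) (trans (affineMap-act g (idxⱽ u))
        (idxⱽ-cong (λ i → C.trans (act-cong g (elⱽ-idxⱽ u) i) (eq i))))))) ,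
      ppower⇐ g (let k , e = G.affine-ppower⇐ {n} v hG hU in k , λ x → trans (iterate-cong same (p ℕ.^ k) x) (e x))
    where
    g : AffElt n
    g = toMat f , elⱽ v
    same : ∀ x → affineMap g x ≡ G.affine f v x
    same x = cong₂ _⊕_ (sym (map-of-mat hG x)) (idxⱽ-elⱽ v)

  derangements-size : ∀ {M} → HasCard (AffElt n) _≈A_ Derangement M → ι M ≡ pw q² n *′ (G.groupOrder n *′ formula q n)
  derangements-size (L , refl , LP , LC , LD) = trans
    (card-pairs G.Funs Vˢ L LP LC LD (G.derangement? n) (λ g → toMap (proj₁ g)) (λ g → idxⱽ (proj₂ g)) (λ f v → toMat f , elⱽ v)
      (λ {g} ga e₁ e₂ → respects e₁ e₂ (derangement⇒ {g} ga)) toMap-cong (λ _ _ → toMap-injective)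
      (λ r → derangement⇐ r , map-of-mat (proj₁ (proj₁ r)) , sym (idxⱽ-elⱽ _)))
    (G.derangement-count dimension)
    where
    respects : ∀ {f f′ v v′} → (∀ x → f x ≡ f′ x) → v ≡ v′ → (G.InG G.whole f′ × G.Unipotent n f′) × v′ ≡ v′ × ¬ G.Coboundary G.whole f′ v′ →
      (G.InG G.whole f × G.Unipotent n f) × v ≡ v × ¬ G.Coboundary G.whole f v
    respects e refl ((hG , hU) , _ , ¬c) = (G.InG-resp (λ x → sym (e x)) hG , G.unipotent-resp {n} (λ x → sym (e x)) hU) , refl ,
      λ c → ¬c (Any.map (λ {y} (wy , δ) → wy , trans (cong (λ z → G._⊖_ z y) (sym (e y))) δ) c)

  proportion : ∀ {N M} → HasCard (AffElt n) _≈A_ (InAU Bᶠ) N → HasCard (AffElt n) _≈A_ Derangement M →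
    fromℕ M ÷' fromℕ N ≡ formula q n
  proportion {N} {M} hN hM = begin
    fromℕ M ÷' fromℕ N ≡⟨ cong₂ _÷'_ (ι-unfold M) (ι-unfold N) ⟩
    ι M ÷' ι N ≡⟨ Rat.÷'-inv (ι M) (AU-size≢0 hN) ⟩
    ι M *′ inv (ι N) ≡⟨ cong (_*′ inv (ι N)) (trans (derangements-size hM) (trans (sym (Rat.*-assoc _ _ _)) (cong (_*′ formula q n) (trans (Rat.*-comm _ _) (sym (AU-size hN)))))) ⟩
    ι N *′ formula q n *′ inv (ι N) ≡⟨ trans (cong (_*′ inv (ι N)) (Rat.*-comm _ _)) (Rat.*-assoc _ _ _) ⟩
    formula q n *′ (ι N *′ inv (ι N)) ≡⟨ trans (cong (formula q n *′_) (inv-inverseʳ (AU-size≢0 hN))) (Rat.*-identityʳ _) ⟩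
    formula q n ∎
    where
    open ≡-Reasoning

theorem1p2 : ∀ {c ℓ} (p q m : ℕ) → Prime p → IsPowerOf q p → 1 ℕ.≤ m →
    (F : CommutativeRing c ℓ) → IsFiniteFieldOfSize F (q ℕ.^ 2) →
    (B : Unitary.Form F q m) → Unitary.IsNondegHermitian F q B →
    (N M : ℕ) →
    HasCard (Unitary.AffElt F q m) (Unitary._≈A_ F q) (Unitary.InAU F q B) N →
    HasCard (Unitary.AffElt F q m) (Unitary._≈A_ F q)
    (λ g → Unitary.InAU F q B g × Unitary.IsDerangement F q g × Unitary.HasPPowerOrder F q p g) M →
    (fromℕ M ÷' fromℕ N) ≡ formula q m
-- Positivity of the rank supplies the coordinate `Fin.zero`, from which `pairing` and the
-- involutivity of σ are obtained.
theorem1p2 p q (suc m) pr (e , 1≤e , q≡pᵉ) _ F (F-field , LF , LF-length , _ , LF-complete , LF-distinct) B B-form N M hN hM =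
  Transfer.proportion p q e (suc m) Fin.zero pr 1≤e q≡pᵉ F F-field LF LF-length (λ x → LF-complete x tt) LF-distinct B B-form hN hM
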